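{- Let $n\ge 1$ and let $p(x)=\sum_{a\in\mathcal A}c_a x^a$ be a homogeneous posynomial in $n$ variables of degree $d>0$. Suppose that $p$ is $\Gamma_1$-stable, i.e. the principal branch of $p$ has no zero $z=(z_1,\dots,z_n)\in\mathbb C^n$ with $\operatorname{Re} z_i>0$ for all $i$. Then the function $x\mapsto p(x)^{1/d}$ is concave on $\mathbb R_{>0}^n$. In particular, $\log p$ is concave on $\mathbb R_{>0}^n$.
   Context: A posynomial in $n$ variables is a finite sum $p(x)=\sum_{a\in\mathcal A}c_a x^a=\sum_{a\in\mathcal A}c_a\prod_{i=1}^n x_i^{a_i}$, where $\mathcal A\subset\mathbb R_{\ge 0}^n$ is finite and $c_a>0$ for every $a\in\mathcal A$ (exponents are arbitrary nonnegative reals). It is homogeneous of degree $d$ if $\sum_i a_i=d$ for every $a\in\mathcal A$. On $\mathbb C\setminus(-\infty,0]$ real powers are defined using the principal logarithm, $z^{s}=\exp(s\operatorname{Log} z)$ with $\operatorname{Im}\operatorname{Log} z\in(-\pi,\pi)$; this defines a holomorphic function $p$ (the principal branch) on $(\mathbb C\setminus(-\infty,0])^n$. For $0<\alpha\le 1$, $\Gamma_\alpha=\{re^{i\theta}: r>0,\ |\theta|<\alpha\pi/2\}$; in particular $\Gamma_1$ is the open right half-plane. The posynomial $p$ is $\Gamma_\alpha$-stable if its principal branch has no zero on $\Gamma_\alpha^n$. -}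

module Defs where

open import Data.Fin.Base using (Fin)
open import Data.Integer.Base as ℤ using (+_)
import Data.Integer.Properties as ℤ
open import Data.Nat.Base as ℕ using (ℕ; zero; suc)
import Data.Nat.Properties as ℕ
open import Data.Product.Base using (∃; _×_; _,_; proj₁; proj₂)
open import Data.Rational.Base as ℚ using (ℚ; 0ℚ; 1ℚ; ½; ∣_∣; toℚᵘ)
import Data.Rational.Properties as ℚ
open import Data.Rational.Solver using (module +-*-Solver)
import Data.Rational.Unnormalised.Base as ℚᵘ
import Data.Rational.Unnormalised.Properties as ℚᵘ
open import Data.Vec.Functional using (foldr)
open import Function.Base using (_∘_)
open import Relation.Binary.PropositionalEquality
open import Relation.Nullary using (¬_)

infix 4 _<ℚ_ _≤ℚ_
_<ℚ_ _≤ℚ_ : ℚ → ℚ → Set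
_<ℚ_ = ℚ._<_
_≤ℚ_ = ℚ._≤_

module _ where
  open import Data.Rational.Base using (_+_; _*_; _-_; -_)
  open +-*-Solver

  ⅓ : ℚ
  ⅓ = + 1 ℚ./ 3

  *-mono-≤ : ∀ {a b c d} → 0ℚ ≤ℚ a → 0ℚ ≤ℚ d → a ≤ℚ b → c ≤ℚ d → a * c ≤ℚ b * d
  *-mono-≤ {a} {b} {c} {d} 0≤a 0≤d a≤b c≤d = ℚ.≤-trans
    (ℚ.*-monoˡ-≤-nonNeg a {{ℚ.nonNegative 0≤a}} c≤d)
    (ℚ.*-monoʳ-≤-nonNeg d {{ℚ.nonNegative 0≤d}} a≤b)

  *-pos : ∀ {a b} → 0ℚ <ℚ a → 0ℚ <ℚ b → 0ℚ <ℚ a * b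
  *-pos {a} {b} 0<a 0<b = ℚ.positive⁻¹ (a * b)
    {{ℚ.pos*pos⇒pos a {{ℚ.positive 0<a}} b {{ℚ.positive 0<b}}}}

  *-nonNeg : ∀ {a b} → 0ℚ ≤ℚ a → 0ℚ ≤ℚ b → 0ℚ ≤ℚ a * b
  *-nonNeg {a} {b} 0≤a 0≤b = ℚ.nonNegative⁻¹ (a * b)
    {{ℚ.nonNeg*nonNeg⇒nonNeg a {{ℚ.nonNegative 0≤a}} b {{ℚ.nonNegative 0≤b}}}}

  half-pos : ∀ {ε} → 0ℚ <ℚ ε → 0ℚ <ℚ ½ * ε
  half-pos = *-pos (ℚ.positive⁻¹ ½)

  third-pos : ∀ {ε} → 0ℚ <ℚ ε → 0ℚ <ℚ ⅓ * ε
  third-pos = *-pos (ℚ.positive⁻¹ ⅓)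

  identity01 : ∀ i j a → i * j * a ≡ i * a * j
  identity01 = solve 3 (λ i j a → i :* j :* a := i :* a :* j) refl

  identity02 : ∀ a b c → (a - b) + (b - c) ≡ a - c
  identity02 = solve 3 (λ a b c → (a :- b) :+ (b :- c) := a :- c) refl

  identity03 : ∀ a b → a - b ≡ - (b - a)
  identity03 = solve 2 (λ a b → a :- b := :- (b :- a)) refl

  identity04 : ∀ a b c d → (a - b) + (c - d) ≡ (a + c) - (b + d)
  identity04 = solve 4 (λ a b c d → (a :- b) :+ (c :- d) := (a :+ c) :- (b :+ d)) refl

  identity05 : ∀ a b → - (a - b) ≡ (- a) - (- b)
  identity05 = solve 2 (λ a b → :- (a :- b) := (:- a) :- (:- b)) refl

  identity06 : ∀ a b → (a - b) + b ≡ a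
  identity06 = solve 2 (λ a b → (a :- b) :+ b := a) refl

  identity07 : ∀ i e c → i * e * c ≡ i * c * e
  identity07 = solve 3 (λ i e c → i :* e :* c := i :* c :* e) refl

  identity08 : ∀ a b c d → (a - b) * c + (c - d) * b ≡ a * c - b * d
  identity08 = solve 4 (λ a b c d → (a :- b) :* c :+ (c :- d) :* b := a :* c :- b :* d) refl

  identity09 : ∀ p q a b → (p * q) * (b - a) ≡ p * (q * b) - q * (p * a)
  identity09 = solve 4 (λ p q a b → (p :* q) :* (b :- a) := p :* (q :* b) :- q :* (p :* a)) refl

  identity10 : ∀ i e d → (i * i) * (e * e * d) ≡ (i * e) * ((i * e) * d)
  identity10 = solve 3 (λ i e d → (i :* i) :* (e :* e :* d) := (i :* e) :* ((i :* e) :* d)) refl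

  identity11 : ∀ a b c d → (a + c) + (b + d) ≡ (a + b) + (c + d)
  identity11 = solve 4 (λ a b c d → (a :+ c) :+ (b :+ d) := (a :+ b) :+ (c :+ d)) refl

  identity12 : ∀ x y u v → (x * u + y * v) + (x * v + y * u) ≡ (x + y) * (u + v)
  identity12 = solve 4 (λ x y u v → (x :* u :+ y :* v) :+ (x :* v :+ y :* u) := (x :+ y) :* (u :+ v)) refl

  identity13 : ∀ c m t → c * (m + m) * t ≡ c * (m * t) + c * (m * t)
  identity13 = solve 3 (λ c m t → c :* (m :+ m) :* t := c :* (m :* t) :+ c :* (m :* t)) refl

  identity14 : ∀ a t → a * (t + t) ≡ (a + a) * t
  identity14 = solve 2 (λ a t → a :* (t :+ t) := (a :+ a) :* t) refl

  identity15 : ∀ a t → a * t + a * t ≡ a * (t + t)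
  identity15 = solve 2 (λ a t → a :* t :+ a :* t := a :* (t :+ t)) refl

  identity16 : ∀ i e t → i * t * e ≡ i * e * t
  identity16 = solve 3 (λ i e t → i :* t :* e := i :* e :* t) refl

  identity17 : ∀ a u a₀ → (a - a₀) + u ≡ (a + u) - a₀
  identity17 = solve 3 (λ a u a₀ → (a :- a₀) :+ u := (a :+ u) :- a₀) refl

  halves : ∀ ε → ½ * ε + ½ * ε ≡ ε
  halves = solve 1 (λ e → con ½ :* e :+ con ½ :* e := e) refl

  thirds : ∀ ε → ⅓ * ε + ⅓ * ε + ⅓ * ε ≡ ε
  thirds = solve 1 (λ e → con ⅓ :* e :+ con ⅓ :* e :+ con ⅓ :* e := e) refl

  inv : ∀ {b} → 0ℚ <ℚ b → ℚ
  inv {b} 0<b = (ℚ.1/ b) {{ℚ.pos⇒nonZero b {{ℚ.positive 0<b}}}}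

  inv-pos : ∀ {b} (0<b : 0ℚ <ℚ b) → 0ℚ <ℚ inv 0<b
  inv-pos {b} 0<b = ℚ.positive⁻¹ (inv 0<b) {{ℚ.1/pos⇒pos b {{ℚ.positive 0<b}}}}

  inv-cancel : ∀ {b} (0<b : 0ℚ <ℚ b) → inv 0<b * b ≡ 1ℚ
  inv-cancel {b} 0<b = ℚ.*-inverseˡ b {{ℚ.pos⇒nonZero b {{ℚ.positive 0<b}}}}

  inv-antitone : ∀ {a b} (0<a : 0ℚ <ℚ a) (0<b : 0ℚ <ℚ b) → a ≤ℚ b → inv 0<b ≤ℚ inv 0<a
  inv-antitone {a} {b} 0<a 0<b a≤b = subst₂ _≤ℚ_ eq₁ eq₂
    (ℚ.*-monoˡ-≤-nonNeg (i * j) {{ℚ.nonNegative (ℚ.<⇒≤ (*-pos (inv-pos 0<a) (inv-pos 0<b)))}} a≤b)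
    where
    i = inv 0<a
    j = inv 0<b
    eq₁ : i * j * a ≡ j
    eq₁ = trans (identity01 i j a)
                (trans (cong (_* j) (inv-cancel 0<a)) (ℚ.*-identityˡ j))
    eq₂ : i * j * b ≡ i
    eq₂ = trans (ℚ.*-assoc i j b) (trans (cong (i *_) (inv-cancel 0<b)) (ℚ.*-identityʳ i))

  triangle : ∀ a b c → ∣ a - c ∣ ≤ℚ ∣ a - b ∣ + ∣ b - c ∣
  triangle a b c = subst (λ t → ∣ t ∣ ≤ℚ ∣ a - b ∣ + ∣ b - c ∣)
    (identity02 a b c)
    (ℚ.∣p+q∣≤∣p∣+∣q∣ (a - b) (b - c))

  ∣-∣-swap : ∀ a b → ∣ a - b ∣ ≡ ∣ b - a ∣
  ∣-∣-swap a b = trans (cong ∣_∣ (identity03 a b))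
                       (ℚ.∣-p∣≡∣p∣ (b - a))

-- Propositional equality on ℝ is finer than equality of real numbers, which is _≈_.

Cauchy : (ℕ → ℚ) → Set
Cauchy s = ∀ ε → 0ℚ <ℚ ε →
  ∃ λ N → ∀ m n → N ℕ.≤ m → N ℕ.≤ n → ∣ s m ℚ.- s n ∣ <ℚ ε

record ℝ : Set where
  constructor mkℝ
  field
    seq    : ℕ → ℚ
    cauchy : Cauchy seq
open ℝ public

infix 4 _≈_ _<_ _≤_

_≈_ : ℝ → ℝ → Set
x ≈ y = ∀ ε → 0ℚ <ℚ ε → ∃ λ N → ∀ k → N ℕ.≤ k → ∣ seq x k ℚ.- seq y k ∣ <ℚ ε

_<_ : ℝ → ℝ → Set
x < y = ∃ λ ε → 0ℚ <ℚ ε × ∃ λ N → ∀ k → N ℕ.≤ k → ε ≤ℚ seq y k ℚ.- seq x k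

_≤_ : ℝ → ℝ → Set
x ≤ y = ¬ (y < x)

module _ where
  open import Data.Rational.Base using (_+_; _*_; _-_; -_)
  open +-*-Solver

  const-cauchy : ∀ q → Cauchy (λ _ → q)
  const-cauchy q ε 0<ε = 0 , λ _ _ _ _ →
    subst (_<ℚ ε) (sym (cong ∣_∣ (ℚ.+-inverseʳ q))) 0<ε

  +-cauchy : ∀ s t → Cauchy s → Cauchy t → Cauchy (λ k → s k + t k)
  +-cauchy s t cs ct ε 0<ε with cs (½ * ε) (half-pos 0<ε) | ct (½ * ε) (half-pos 0<ε)
  ... | N , hs | M , ht = N ℕ.⊔ M , λ m n hm hn →
    let le = subst (λ u → ∣ u ∣ ≤ℚ ∣ s m - s n ∣ + ∣ t m - t n ∣)
               (identity04
                 (s m) (s n) (t m) (t n))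
               (ℚ.∣p+q∣≤∣p∣+∣q∣ (s m - s n) (t m - t n))
        lt = ℚ.+-mono-< (hs m n (ℕ.≤-trans (ℕ.m≤m⊔n N M) hm) (ℕ.≤-trans (ℕ.m≤m⊔n N M) hn))
                        (ht m n (ℕ.≤-trans (ℕ.m≤n⊔m N M) hm) (ℕ.≤-trans (ℕ.m≤n⊔m N M) hn))
    in subst (∣ (s m + t m) - (s n + t n) ∣ <ℚ_) (halves ε) (ℚ.≤-<-trans le lt)

  neg-cauchy : ∀ s → Cauchy s → Cauchy (λ k → - s k)
  neg-cauchy s cs ε 0<ε with cs ε 0<ε
  ... | N , hs = N , λ m n hm hn → subst (_<ℚ ε)
    (trans (sym (ℚ.∣-p∣≡∣p∣ (s m - s n)))
           (cong ∣_∣ (identity05 (s m) (s n))))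
    (hs m n hm hn)

  tail-bound : ∀ s → Cauchy s → ∃ λ B → 0ℚ <ℚ B × ∃ λ N → ∀ k → N ℕ.≤ k → ∣ s k ∣ ≤ℚ B
  tail-bound s cs with cs 1ℚ (ℚ.positive⁻¹ 1ℚ)
  ... | N , h = 1ℚ + ∣ s N ∣ , ℚ.+-mono-<-≤ (ℚ.positive⁻¹ 1ℚ) (ℚ.0≤∣p∣ (s N)) , N , λ k hk →
    ℚ.≤-trans
      (subst (λ u → ∣ u ∣ ≤ℚ ∣ s k - s N ∣ + ∣ s N ∣)
        (identity06 (s k) (s N))
        (ℚ.∣p+q∣≤∣p∣+∣q∣ (s k - s N) (s N)))
      (ℚ.+-monoˡ-≤ ∣ s N ∣ (ℚ.<⇒≤ (h k N hk ℕ.≤-refl)))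

  scaled : ∀ x y {C e} (0<C : 0ℚ <ℚ C) → ∣ y ∣ ≤ℚ C → ∣ x ∣ <ℚ inv 0<C * e → ∣ x ∣ * ∣ y ∣ <ℚ e
  scaled x y {C} {e} 0<C hy hx = ℚ.≤-<-trans {j = ∣ x ∣ * C}
    (ℚ.*-monoˡ-≤-nonNeg ∣ x ∣ {{ℚ.∣-∣-nonNeg x}} hy)
    (subst (∣ x ∣ * C <ℚ_) cancel (ℚ.*-monoˡ-<-pos C {{ℚ.positive 0<C}} hx))
    where
    cancel : inv 0<C * e * C ≡ e
    cancel = trans (identity07 (inv 0<C) e C)
                   (trans (cong (_* e) (inv-cancel 0<C)) (ℚ.*-identityˡ e))

  split : ∀ a b c d → ∣ a * c - b * d ∣ ≤ℚ ∣ a - b ∣ * ∣ c ∣ + ∣ c - d ∣ * ∣ b ∣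
  split a b c d = ℚ.≤-trans
    (ℚ.≤-reflexive (cong ∣_∣ (sym (identity08 a b c d))))
    (ℚ.≤-trans (ℚ.∣p+q∣≤∣p∣+∣q∣ ((a - b) * c) ((c - d) * b))
      (ℚ.≤-reflexive (cong₂ _+_ (ℚ.∣p*q∣≡∣p∣*∣q∣ (a - b) c) (ℚ.∣p*q∣≡∣p∣*∣q∣ (c - d) b))))

  *-cauchy : ∀ s t → Cauchy s → Cauchy t → Cauchy (λ k → s k * t k)
  *-cauchy s t cs ct ε 0<ε = N , bound
    where
    A = proj₁ (tail-bound s cs)
    0<A = proj₁ (proj₂ (tail-bound s cs))
    N₁ = proj₁ (proj₂ (proj₂ (tail-bound s cs)))
    B = proj₁ (tail-bound t ct)
    0<B = proj₁ (proj₂ (tail-bound t ct))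
    N₂ = proj₁ (proj₂ (proj₂ (tail-bound t ct)))
    ds = cs (inv 0<B * (½ * ε)) (*-pos (inv-pos 0<B) (half-pos 0<ε))
    dt = ct (inv 0<A * (½ * ε)) (*-pos (inv-pos 0<A) (half-pos 0<ε))
    N₃ = proj₁ ds
    N₄ = proj₁ dt
    L = N₁ ℕ.⊔ N₂
    R = N₃ ℕ.⊔ N₄
    N = L ℕ.⊔ R
    up₁ : ∀ {k} → N ℕ.≤ k → N₁ ℕ.≤ k
    up₁ h = ℕ.≤-trans (ℕ.m≤m⊔n N₁ N₂) (ℕ.≤-trans (ℕ.m≤m⊔n L R) h)
    up₂ : ∀ {k} → N ℕ.≤ k → N₂ ℕ.≤ k
    up₂ h = ℕ.≤-trans (ℕ.m≤n⊔m N₁ N₂) (ℕ.≤-trans (ℕ.m≤m⊔n L R) h)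
    up₃ : ∀ {k} → N ℕ.≤ k → N₃ ℕ.≤ k
    up₃ h = ℕ.≤-trans (ℕ.m≤m⊔n N₃ N₄) (ℕ.≤-trans (ℕ.m≤n⊔m L R) h)
    up₄ : ∀ {k} → N ℕ.≤ k → N₄ ℕ.≤ k
    up₄ h = ℕ.≤-trans (ℕ.m≤n⊔m N₃ N₄) (ℕ.≤-trans (ℕ.m≤n⊔m L R) h)
    bound : ∀ m n → N ℕ.≤ m → N ℕ.≤ n → ∣ s m * t m - s n * t n ∣ <ℚ ε
    bound m n hm hn = subst (∣ s m * t m - s n * t n ∣ <ℚ_) (halves ε)
      (ℚ.≤-<-trans (split (s m) (s n) (t m) (t n))
        (ℚ.+-mono-<
          (scaled (s m - s n) (t m) 0<B
            (proj₂ (proj₂ (proj₂ (tail-bound t ct))) m (up₂ hm)) (proj₂ ds m n (up₃ hm) (up₃ hn)))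
          (scaled (t m - t n) (s n) 0<A
            (proj₂ (proj₂ (proj₂ (tail-bound s cs))) n (up₁ hn)) (proj₂ dt m n (up₄ hm) (up₄ hn)))))

infixl 6 _+ℝ_ _-ℝ_
infixl 7 _*ℝ_
infix  8 -ℝ_

fromℚ : ℚ → ℝ
fromℚ q = mkℝ (λ _ → q) (const-cauchy q)

0ℝ 1ℝ : ℝ
0ℝ = fromℚ 0ℚ
1ℝ = fromℚ 1ℚ

_+ℝ_ : ℝ → ℝ → ℝ
x +ℝ y = mkℝ (λ k → seq x k ℚ.+ seq y k) (+-cauchy (seq x) (seq y) (cauchy x) (cauchy y))

-ℝ_ : ℝ → ℝ
-ℝ x = mkℝ (λ k → ℚ.- seq x k) (neg-cauchy (seq x) (cauchy x))

_-ℝ_ : ℝ → ℝ → ℝ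
x -ℝ y = x +ℝ -ℝ y

_*ℝ_ : ℝ → ℝ → ℝ
x *ℝ y = mkℝ (λ k → seq x k ℚ.* seq y k) (*-cauchy (seq x) (seq y) (cauchy x) (cauchy y))

-- The join with a positive lower bound ε of a tail of x alters only finitely
-- many terms and keeps every denominator positive.

module _ (x : ℝ) (ε : ℚ) (0<ε : 0ℚ <ℚ ε) where
  open import Data.Rational.Base using (_⊔_)
  open +-*-Solver

  ⊔-pos : ∀ k → 0ℚ <ℚ seq x k ⊔ ε
  ⊔-pos k = ℚ.<-≤-trans 0<ε (ℚ.p≤q⊔p (seq x k) ε)

  recipSeq : ℕ → ℚ
  recipSeq k = inv (⊔-pos k)

  recip-cauchy : (∃ λ N → ∀ k → N ℕ.≤ k → ε ≤ℚ seq x k ℚ.- 0ℚ) → Cauchy recipSeq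
  recip-cauchy (N , hx) δ 0<δ with cauchy x (ε ℚ.* ε ℚ.* δ) (*-pos (*-pos 0<ε 0<ε) 0<δ)
  ... | M , hc = N ℕ.⊔ M , bound
    where
    open import Data.Rational.Base using () renaming (_*_ to _·_)
    i = inv 0<ε
    bound : ∀ m n → N ℕ.⊔ M ℕ.≤ m → N ℕ.⊔ M ℕ.≤ n → ∣ recipSeq m ℚ.- recipSeq n ∣ <ℚ δ
    bound m n hm hn = ℚ.≤-<-trans le lt
      where
      a = seq x m ⊔ ε
      b = seq x n ⊔ ε
      ia = recipSeq m
      ib = recipSeq n
      tail : ∀ k → N ℕ.⊔ M ℕ.≤ k → seq x k ⊔ ε ≡ seq x k
      tail k hk = ℚ.p≥q⇒p⊔q≡p (subst (ε ≤ℚ_) (ℚ.+-identityʳ (seq x k))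
        (hx k (ℕ.≤-trans (ℕ.m≤m⊔n N M) hk)))
      close : ∣ b ℚ.- a ∣ <ℚ ε · ε · δ
      close = subst₂ (λ u v → ∣ u ℚ.- v ∣ <ℚ ε · ε · δ) (sym (tail n hn)) (sym (tail m hm))
        (hc n m (ℕ.≤-trans (ℕ.m≤n⊔m N M) hn) (ℕ.≤-trans (ℕ.m≤n⊔m N M) hm))
      diff : (ia · ib) · (b ℚ.- a) ≡ ia ℚ.- ib
      diff = trans
        (identity09 ia ib a b)
        (cong₂ ℚ._-_ (trans (cong (ia ·_) (inv-cancel (⊔-pos n))) (ℚ.*-identityʳ ia))
                     (trans (cong (ib ·_) (inv-cancel (⊔-pos m))) (ℚ.*-identityʳ ib)))
      0≤ia = ℚ.<⇒≤ (inv-pos (⊔-pos m))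
      0≤ib = ℚ.<⇒≤ (inv-pos (⊔-pos n))
      0≤i  = ℚ.<⇒≤ (inv-pos 0<ε)
      le : ∣ ia ℚ.- ib ∣ ≤ℚ (i · i) · ∣ b ℚ.- a ∣
      le = subst (_≤ℚ (i · i) · ∣ b ℚ.- a ∣)
        (trans (cong (_· ∣ b ℚ.- a ∣) (sym (ℚ.0≤p⇒∣p∣≡p (*-nonNeg 0≤ia 0≤ib))))
               (trans (sym (ℚ.∣p*q∣≡∣p∣*∣q∣ (ia · ib) (b ℚ.- a))) (cong ∣_∣ diff)))
        (*-mono-≤ (*-nonNeg 0≤ia 0≤ib) (ℚ.0≤∣p∣ (b ℚ.- a))
          (*-mono-≤ 0≤ia 0≤i (inv-antitone 0<ε (⊔-pos m) (ℚ.p≤q⊔p (seq x m) ε))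
                             (inv-antitone 0<ε (⊔-pos n) (ℚ.p≤q⊔p (seq x n) ε)))
          ℚ.≤-refl)
      cancel : (i · i) · (ε · ε · δ) ≡ δ
      cancel = trans
        (identity10 i ε δ)
        (trans (cong₂ (λ u v → u · (v · δ)) (inv-cancel 0<ε) (inv-cancel 0<ε))
               (trans (ℚ.*-identityˡ (1ℚ · δ)) (ℚ.*-identityˡ δ)))
      lt : (i · i) · ∣ b ℚ.- a ∣ <ℚ δ
      lt = subst ((i · i) · ∣ b ℚ.- a ∣ <ℚ_) cancel
        (ℚ.*-monoʳ-<-pos (i · i) {{ℚ.positive (*-pos (inv-pos 0<ε) (inv-pos 0<ε))}} close)

recip : (x : ℝ) → 0ℝ < x → ℝ
recip x (ε , 0<ε , tail) = mkℝ (recipSeq x ε 0<ε) (recip-cauchy x ε 0<ε tail)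

infixl 6 _+ℂ_
infixl 7 _*ℂ_
infixr 7 _•_
infix  4 _≈ℂ_

record ℂ : Set where
  constructor _+i_
  field
    re im : ℝ
open ℂ public

_≈ℂ_ : ℂ → ℂ → Set
z ≈ℂ w = re z ≈ re w × im z ≈ im w

ofℝ : ℝ → ℂ
ofℝ x = x +i 0ℝ

0ℂ 1ℂ : ℂ
0ℂ = ofℝ 0ℝ
1ℂ = ofℝ 1ℝ

_+ℂ_ _*ℂ_ : ℂ → ℂ → ℂ
z +ℂ w = (re z +ℝ re w) +i (im z +ℝ im w)
z *ℂ w = (re z *ℝ re w -ℝ im z *ℝ im w) +i (re z *ℝ im w +ℝ im z *ℝ re w)

_•_ : ℝ → ℂ → ℂ
s • z = (s *ℝ re z) +i (s *ℝ im z)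

expTerm : ℕ → ℂ → ℂ
expTerm zero    z = 1ℂ
expTerm (suc k) z = fromℚ (+ 1 ℚ./ suc k) • (z *ℂ expTerm k z)

expSum : ℕ → ℂ → ℂ
expSum zero    z = 0ℂ
expSum (suc k) z = expSum k z +ℂ expTerm k z

-- Convergence of the diagonal: terms of the series are dominated by M^k/k!,
-- which eventually at least halves at each step.

module _ where
  open import Data.Rational.Base using (_+_; _*_; _-_; -_)
  open +-*-Solver

  ι : ℕ → ℚ
  ι zero    = 0ℚ
  ι (suc k) = 1ℚ + ι k

  ι≡ : ∀ k → toℚᵘ (ι k) ℚᵘ.≃ (+ k) ℚᵘ./ 1
  ι≡ zero    = ℚᵘ.≃-refl
  ι≡ (suc k) = ℚᵘ.≃-trans (ℚ.toℚᵘ-homo-+ 1ℚ (ι k))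
    (ℚᵘ.≃-trans (ℚᵘ.+-congʳ (toℚᵘ 1ℚ) (ι≡ k))
      (ℚᵘ.*≡* (cong (λ j → ((+ 1) ℤ.+ j) ℤ.* (+ 1)) (ℤ.*-identityʳ (+ k)))))

  ι-nonNeg : ∀ k → 0ℚ ≤ℚ ι k
  ι-nonNeg zero    = ℚ.≤-refl
  ι-nonNeg (suc k) = ℚ.+-mono-≤ (ℚ.nonNegative⁻¹ 1ℚ) (ι-nonNeg k)

  ι-mono : ∀ {j k} → j ℕ.≤ k → ι j ≤ℚ ι k
  ι-mono {k = k} ℕ.z≤n = ι-nonNeg k
  ι-mono (ℕ.s≤s h)     = ℚ.+-monoʳ-≤ 1ℚ (ι-mono h)

  1/suc : ℕ → ℚ
  1/suc k = + 1 ℚ./ suc k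

  1/suc-nonNeg : ∀ k → 0ℚ ≤ℚ 1/suc k
  1/suc-nonNeg k = ℚ.nonNegative⁻¹ (1/suc k) {{ℚ.normalize-nonNeg 1 (suc k)}}

  1/suc-cancel : ∀ k → 1/suc k * ι (suc k) ≡ 1ℚ
  1/suc-cancel k = ℚ.toℚᵘ-injective
    (ℚᵘ.≃-trans (ℚ.toℚᵘ-homo-* (1/suc k) (ι (suc k)))
      (ℚᵘ.≃-trans (ℚᵘ.*-cong (ℚ.toℚᵘ-fromℚᵘ (ℚᵘ.mkℚᵘ (+ 1) k)) (ι≡ (suc k)))
        (ℚᵘ.*≡* (cong +_ (lemma k)))))
    where
    lemma : ∀ k → (suc k ℕ.+ 0) ℕ.* 1 ≡ suc k ℕ.* 1 ℕ.+ 0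
    lemma k = trans (ℕ.*-identityʳ _) (cong (ℕ._+ 0) (sym (ℕ.*-identityʳ (suc k))))

  archimedean : ∀ q → ∃ λ K → q ≤ℚ ι K
  archimedean q@(ℚ.mkℚ n d _) = ℤ.∣ n ∣ , ℚ.toℚᵘ-cancel-≤
    (ℚᵘ.≤-respʳ-≃ (ℚᵘ.≃-sym (ι≡ ℤ.∣ n ∣)) (ℚᵘ.*≤* le))
    where
    n≤∣n∣ : ∀ n → n ℤ.≤ + ℤ.∣ n ∣
    n≤∣n∣ (+ m)          = ℤ.≤-refl
    n≤∣n∣ (ℤ.-[1+ m ])   = ℤ.-≤+
    le : n ℤ.* (+ 1) ℤ.≤ (+ ℤ.∣ n ∣) ℤ.* (+ suc d)
    le = subst (ℤ._≤ (+ ℤ.∣ n ∣) ℤ.* (+ suc d)) (sym (ℤ.*-identityʳ n))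
      (ℤ.≤-trans (n≤∣n∣ n)
        (subst ((+ ℤ.∣ n ∣) ℤ.≤_) (ℤ.pos-* ℤ.∣ n ∣ (suc d))
          (ℤ.+≤+ (ℕ.m≤m*n ℤ.∣ n ∣ (suc d)))))

  ‖_,_‖ : ℚ → ℚ → ℚ
  ‖ a , b ‖ = ∣ a ∣ + ∣ b ∣

  ‖‖-nonNeg : ∀ a b → 0ℚ ≤ℚ ‖ a , b ‖
  ‖‖-nonNeg a b = ℚ.+-mono-≤ (ℚ.0≤∣p∣ a) (ℚ.0≤∣p∣ b)

  ‖‖-triangle : ∀ a b c d → ‖ a + c , b + d ‖ ≤ℚ ‖ a , b ‖ + ‖ c , d ‖
  ‖‖-triangle a b c d = subst (‖ a + c , b + d ‖ ≤ℚ_)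
    (identity11
      (∣ a ∣) (∣ b ∣) (∣ c ∣) (∣ d ∣))
    (ℚ.+-mono-≤ (ℚ.∣p+q∣≤∣p∣+∣q∣ a c) (ℚ.∣p+q∣≤∣p∣+∣q∣ b d))

  ‖‖-mult : ∀ x y u v → ‖ x * u + - (y * v) , x * v + y * u ‖ ≤ℚ ‖ x , y ‖ * ‖ u , v ‖
  ‖‖-mult x y u v = ℚ.≤-trans
    (ℚ.+-mono-≤ (ℚ.∣p-q∣≤∣p∣+∣q∣ (x * u) (y * v)) (ℚ.∣p+q∣≤∣p∣+∣q∣ (x * v) (y * u)))
    (ℚ.≤-reflexive (trans
      (cong₂ _+_ (cong₂ _+_ (ℚ.∣p*q∣≡∣p∣*∣q∣ x u) (ℚ.∣p*q∣≡∣p∣*∣q∣ y v))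
                 (cong₂ _+_ (ℚ.∣p*q∣≡∣p∣*∣q∣ x v) (ℚ.∣p*q∣≡∣p∣*∣q∣ y u)))
      (identity12
        (∣ x ∣) (∣ y ∣) (∣ u ∣) (∣ v ∣))))

  module _ (M : ℚ) (0≤M : 0ℚ ≤ℚ M) where

    majorant : ℕ → ℚ
    majorant zero    = 1ℚ
    majorant (suc k) = 1/suc k * (M * majorant k)

    majorant-nonNeg : ∀ k → 0ℚ ≤ℚ majorant k
    majorant-nonNeg zero    = ℚ.nonNegative⁻¹ 1ℚ
    majorant-nonNeg (suc k) = *-nonNeg (1/suc-nonNeg k) (*-nonNeg 0≤M (majorant-nonNeg k))

    term-bound : ∀ z i → ‖ seq (re z) i , seq (im z) i ‖ ≤ℚ M → ∀ k →
      ‖ seq (re (expTerm k z)) i , seq (im (expTerm k z)) i ‖ ≤ℚ majorant k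
    term-bound z i h zero    = ℚ.≤-refl
    term-bound z i h (suc k) = ℚ.≤-trans (ℚ.≤-reflexive eq)
      (ℚ.*-monoˡ-≤-nonNeg c {{ℚ.nonNegative (1/suc-nonNeg k)}}
        (ℚ.≤-trans (‖‖-mult x y u v)
          (*-mono-≤ (‖‖-nonNeg x y) (majorant-nonNeg k) h (term-bound z i h k))))
      where
      c = 1/suc k
      x = seq (re z) i
      y = seq (im z) i
      u = seq (re (expTerm k z)) i
      v = seq (im (expTerm k z)) i
      p = x * u + - (y * v)
      q = x * v + y * u
      pull : ∀ p → ∣ c * p ∣ ≡ c * ∣ p ∣
      pull p = trans (ℚ.∣p*q∣≡∣p∣*∣q∣ c p) (cong (_* ∣ p ∣) (ℚ.0≤p⇒∣p∣≡p (1/suc-nonNeg k)))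
      eq : ‖ c * p , c * q ‖ ≡ c * ‖ p , q ‖
      eq = trans (cong₂ _+_ (pull p) (pull q)) (sym (ℚ.*-distribˡ-+ c (∣ p ∣) (∣ q ∣)))

    module _ (K : ℕ) (hK : M + M ≤ℚ ι K) where

      halving : ∀ k → K ℕ.≤ k → majorant (suc k) + majorant (suc k) ≤ℚ majorant k
      halving k hk = subst₂ _≤ℚ_
        (identity13
          (1/suc k) M (majorant k))
        (ℚ.*-identityˡ (majorant k))
        (ℚ.*-monoʳ-≤-nonNeg (majorant k) {{ℚ.nonNegative (majorant-nonNeg k)}}
          (subst (1/suc k * (M + M) ≤ℚ_) (1/suc-cancel k)
            (ℚ.*-monoˡ-≤-nonNeg (1/suc k) {{ℚ.nonNegative (1/suc-nonNeg k)}}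
              (ℚ.≤-trans hK (ι-mono (ℕ.m≤n⇒m≤1+n hk))))))

      decay : ∀ j → ι (suc j) * majorant (j ℕ.+ K) ≤ℚ majorant K
      decay zero    = ℚ.≤-reflexive (ℚ.*-identityˡ (majorant K))
      decay (suc j) = ℚ.≤-trans step (decay j)
        where
        t = majorant (suc j ℕ.+ K)
        step : ι (suc (suc j)) * t ≤ℚ ι (suc j) * majorant (j ℕ.+ K)
        step = ℚ.≤-trans
          (ℚ.*-monoʳ-≤-nonNeg t {{ℚ.nonNegative (majorant-nonNeg (suc j ℕ.+ K))}}
            (ℚ.+-monoˡ-≤ (ι (suc j)) (ι-mono {1} {suc j} (ℕ.s≤s ℕ.z≤n))))
          (subst (_≤ℚ ι (suc j) * majorant (j ℕ.+ K))
            (identity14 (ι (suc j)) t)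
            (ℚ.*-monoˡ-≤-nonNeg (ι (suc j)) {{ℚ.nonNegative (ι-nonNeg (suc j))}}
              (halving (j ℕ.+ K) (ℕ.m≤n+m K j))))

      majorant-small : ∀ ε → 0ℚ <ℚ ε → ∃ λ m → K ℕ.≤ m × majorant m + majorant m <ℚ ε
      majorant-small ε 0<ε with archimedean (inv 0<ε * (majorant K + majorant K))
      ... | J , hJ = J ℕ.+ K , ℕ.m≤n+m K J ,
        ℚ.*-cancelˡ-<-nonNeg (ι (suc J)) {{ℚ.nonNegative (ι-nonNeg (suc J))}}
          (ℚ.≤-<-trans le lt)
        where
        T = majorant K
        t = majorant (J ℕ.+ K)
        le : ι (suc J) * (t + t) ≤ℚ T + T
        le = subst (_≤ℚ T + T)
          (identity15 (ι (suc J)) t)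
          (ℚ.+-mono-≤ (decay J) (decay J))
        J<sucJ : ι J <ℚ ι (suc J)
        J<sucJ = subst (_<ℚ ι (suc J)) (ℚ.+-identityˡ (ι J)) (ℚ.+-monoˡ-< (ι J) (ℚ.positive⁻¹ 1ℚ))
        lt : T + T <ℚ ι (suc J) * ε
        lt = subst (_<ℚ ι (suc J) * ε)
          (trans (identity16 (inv 0<ε) ε (T + T))
                 (trans (cong (_* (T + T)) (inv-cancel 0<ε)) (ℚ.*-identityˡ (T + T))))
          (ℚ.*-monoˡ-<-pos ε {{ℚ.positive 0<ε}} (ℚ.≤-<-trans hJ J<sucJ))

      tail-sum : ∀ z i → ‖ seq (re z) i , seq (im z) i ‖ ≤ℚ M → ∀ m → K ℕ.≤ m → ∀ j →
        ‖ seq (re (expSum (j ℕ.+ m) z)) i - seq (re (expSum m z)) i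
        , seq (im (expSum (j ℕ.+ m) z)) i - seq (im (expSum m z)) i ‖
          + (majorant (j ℕ.+ m) + majorant (j ℕ.+ m)) ≤ℚ majorant m + majorant m
      tail-sum z i h m hm zero = ℚ.≤-reflexive
        (trans (cong₂ (λ p q → ‖ p , q ‖ + (majorant m + majorant m))
                 (ℚ.+-inverseʳ (seq (re (expSum m z)) i))
                 (ℚ.+-inverseʳ (seq (im (expSum m z)) i)))
               (ℚ.+-identityˡ (majorant m + majorant m)))
      tail-sum z i h m hm (suc j) = ℚ.≤-trans step (tail-sum z i h m hm j)
        where
        n = j ℕ.+ m
        a = seq (re (expSum n z)) i
        b = seq (im (expSum n z)) i
        a₀ = seq (re (expSum m z)) i
        b₀ = seq (im (expSum m z)) i
        u = seq (re (expTerm n z)) i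
        v = seq (im (expTerm n z)) i
        t = majorant n
        t′ = majorant (suc n)
        shift : ∀ a u a₀ → (a - a₀) + u ≡ (a + u) - a₀
        shift = identity17
        le : ‖ (a + u) - a₀ , (b + v) - b₀ ‖ ≤ℚ ‖ a - a₀ , b - b₀ ‖ + t
        le = subst₂ (λ p q → ‖ p , q ‖ ≤ℚ ‖ a - a₀ , b - b₀ ‖ + t) (shift a u a₀) (shift b v b₀)
          (ℚ.≤-trans (‖‖-triangle (a - a₀) (b - b₀) u v)
            (ℚ.+-monoʳ-≤ ‖ a - a₀ , b - b₀ ‖ (term-bound z i h n)))
        step : ‖ (a + u) - a₀ , (b + v) - b₀ ‖ + (t′ + t′) ≤ℚ ‖ a - a₀ , b - b₀ ‖ + (t + t)
        step = subst (‖ (a + u) - a₀ , (b + v) - b₀ ‖ + (t′ + t′) ≤ℚ_)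
          (ℚ.+-assoc ‖ a - a₀ , b - b₀ ‖ t t)
          (ℚ.+-mono-≤ le (halving n (ℕ.≤-trans hm (ℕ.m≤n+m m j))))

  gap : ℂ → ℕ → ℕ → ℕ → ℚ
  gap z n m i = ‖ seq (re (expSum n z)) i - seq (re (expSum m z)) i
                , seq (im (expSum n z)) i - seq (im (expSum m z)) i ‖

  uniform-tail : ∀ z ε → 0ℚ <ℚ ε → ∃ λ m → ∃ λ N → ∀ n i → m ℕ.≤ n → N ℕ.≤ i → gap z n m i <ℚ ε
  uniform-tail z ε 0<ε = m , N , bound
    where
    boundʳ = tail-bound (seq (re z)) (cauchy (re z))
    boundⁱ = tail-bound (seq (im z)) (cauchy (im z))
    M = proj₁ boundʳ + proj₁ boundⁱ
    0≤M : 0ℚ ≤ℚ M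
    0≤M = ℚ.<⇒≤ (ℚ.+-mono-< (proj₁ (proj₂ boundʳ)) (proj₁ (proj₂ boundⁱ)))
    Nʳ = proj₁ (proj₂ (proj₂ boundʳ))
    Nⁱ = proj₁ (proj₂ (proj₂ boundⁱ))
    N = Nʳ ℕ.⊔ Nⁱ
    arch = archimedean (M + M)
    K = proj₁ arch
    small = majorant-small M 0≤M K (proj₂ arch) ε 0<ε
    m = proj₁ small
    z≤M : ∀ i → N ℕ.≤ i → ‖ seq (re z) i , seq (im z) i ‖ ≤ℚ M
    z≤M i hi = ℚ.+-mono-≤
      (proj₂ (proj₂ (proj₂ boundʳ)) i (ℕ.≤-trans (ℕ.m≤m⊔n Nʳ Nⁱ) hi))
      (proj₂ (proj₂ (proj₂ boundⁱ)) i (ℕ.≤-trans (ℕ.m≤n⊔m Nʳ Nⁱ) hi))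
    drop-tail : ∀ p t {q} → 0ℚ ≤ℚ t → p + (t + t) ≤ℚ q → p ≤ℚ q
    drop-tail p t 0≤t = ℚ.≤-trans
      (ℚ.≤-trans (ℚ.≤-reflexive (sym (ℚ.+-identityʳ p))) (ℚ.+-monoʳ-≤ p (ℚ.+-mono-≤ 0≤t 0≤t)))
    bound′ : ∀ j i → N ℕ.≤ i → gap z (j ℕ.+ m) m i <ℚ ε
    bound′ j i hi = ℚ.≤-<-trans
      (drop-tail (gap z (j ℕ.+ m) m i) (majorant M 0≤M (j ℕ.+ m))
        (majorant-nonNeg M 0≤M (j ℕ.+ m))
        (tail-sum M 0≤M K (proj₂ arch) z i (z≤M i hi) m (proj₁ (proj₂ small)) j))
      (proj₂ (proj₂ small))
    bound : ∀ n i → m ℕ.≤ n → N ℕ.≤ i → gap z n m i <ℚ ε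
    bound n i hn hi = subst (λ n → gap z n m i <ℚ ε) (ℕ.m∸n+n≡m hn) (bound′ (n ℕ.∸ m) i hi)

  diagonal-cauchy : (X : ℕ → ℝ) →
    (∀ ε → 0ℚ <ℚ ε → ∃ λ m → ∃ λ N → ∀ n i → m ℕ.≤ n → N ℕ.≤ i →
      ∣ seq (X n) i - seq (X m) i ∣ <ℚ ε) →
    Cauchy (λ k → seq (X k) k)
  diagonal-cauchy X h ε 0<ε with h (⅓ * ε) (third-pos 0<ε)
  ... | m , N , near with cauchy (X m) (⅓ * ε) (third-pos 0<ε)
  ... | L , hL = (m ℕ.⊔ N) ℕ.⊔ L , bound
    where
    bound : ∀ j k → (m ℕ.⊔ N) ℕ.⊔ L ℕ.≤ j → (m ℕ.⊔ N) ℕ.⊔ L ℕ.≤ k →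
            ∣ seq (X j) j - seq (X k) k ∣ <ℚ ε
    bound j k hj hk = subst (∣ seq (X j) j - seq (X k) k ∣ <ℚ_) (thirds ε)
      (ℚ.≤-<-trans
        (ℚ.≤-trans (triangle (seq (X j) j) (seq (X m) k) (seq (X k) k))
          (ℚ.+-monoˡ-≤ _ (triangle (seq (X j) j) (seq (X m) j) (seq (X m) k))))
        (ℚ.+-mono-<
          (ℚ.+-mono-< (near j j (up₁ hj) (up₂ hj)) (hL j k (up₃ hj) (up₃ hk)))
          (subst (_<ℚ ⅓ * ε) (∣-∣-swap (seq (X k) k) (seq (X m) k)) (near k k (up₁ hk) (up₂ hk)))))
      where
      up₁ : ∀ {i} → (m ℕ.⊔ N) ℕ.⊔ L ℕ.≤ i → m ℕ.≤ i
      up₁ hi = ℕ.≤-trans (ℕ.m≤m⊔n m N) (ℕ.≤-trans (ℕ.m≤m⊔n (m ℕ.⊔ N) L) hi)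
      up₂ : ∀ {i} → (m ℕ.⊔ N) ℕ.⊔ L ℕ.≤ i → N ℕ.≤ i
      up₂ hi = ℕ.≤-trans (ℕ.m≤n⊔m m N) (ℕ.≤-trans (ℕ.m≤m⊔n (m ℕ.⊔ N) L) hi)
      up₃ : ∀ {i} → (m ℕ.⊔ N) ℕ.⊔ L ℕ.≤ i → L ℕ.≤ i
      up₃ hi = ℕ.≤-trans (ℕ.m≤n⊔m (m ℕ.⊔ N) L) hi

  ∣re∣≤‖‖ : ∀ a b → ∣ a ∣ ≤ℚ ‖ a , b ‖
  ∣re∣≤‖‖ a b = subst (_≤ℚ ‖ a , b ‖) (ℚ.+-identityʳ ∣ a ∣) (ℚ.+-monoʳ-≤ ∣ a ∣ (ℚ.0≤∣p∣ b))

  ∣im∣≤‖‖ : ∀ a b → ∣ b ∣ ≤ℚ ‖ a , b ‖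
  ∣im∣≤‖‖ a b = subst (_≤ℚ ‖ a , b ‖) (ℚ.+-identityˡ ∣ b ∣) (ℚ.+-monoˡ-≤ ∣ b ∣ (ℚ.0≤∣p∣ a))

  exp-re-cauchy : ∀ z → Cauchy (λ k → seq (re (expSum k z)) k)
  exp-re-cauchy z = diagonal-cauchy (λ k → re (expSum k z)) λ ε 0<ε →
    let m , N , h = uniform-tail z ε 0<ε
    in m , N , λ n i hn hi → ℚ.≤-<-trans (∣re∣≤‖‖ _ _) (h n i hn hi)

  exp-im-cauchy : ∀ z → Cauchy (λ k → seq (im (expSum k z)) k)
  exp-im-cauchy z = diagonal-cauchy (λ k → im (expSum k z)) λ ε 0<ε →
    let m , N , h = uniform-tail z ε 0<ε
    in m , N , λ n i hn hi → ℚ.≤-<-trans (∣im∣≤‖‖ (seq (re (expSum n z)) i - seq (re (expSum m z)) i) _) (h n i hn hi)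

-- Σ zᵏ/k!, as the diagonal of its partial sums.

exp : ℂ → ℂ
exp z = mkℝ (λ k → seq (re (expSum k z)) k) (exp-re-cauchy z)
     +i mkℝ (λ k → seq (im (expSum k z)) k) (exp-im-cauchy z)

sin : ℝ → ℝ
sin x = im (exp (0ℝ +i x))

-- π is the least positive zero of the sine.

IsPi : ℝ → Set
IsPi π = 0ℝ < π × sin π ≈ 0ℝ × (∀ t → 0ℝ < t → t < π → ¬ (sin t ≈ 0ℝ))

-- Functions defined only on part of their ambient space (Log, real powers, the
-- branch p, and p^s and log p on the positive orthant) are given by their graphs.
-- Here w is Log z.

PrincipalLog : ℂ → ℂ → Set
PrincipalLog z w = exp w ≈ℂ z × ∃ λ π → IsPi π × -ℝ π < im w × im w < π

PrincipalPower : ℝ → ℂ → ℂ → Set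
PrincipalPower s z v = ∃ λ w → PrincipalLog z w × exp (s • w) ≈ℂ v

Pointℝ Pointℂ : ℕ → Set
Pointℝ n = Fin n → ℝ
Pointℂ n = Fin n → ℂ

Positive : ∀ {n} → Pointℝ n → Set
Positive x = ∀ i → 0ℝ < x i

record Posynomial (n : ℕ) : Set where
  field
    size         : ℕ
    exponent     : Fin size → Fin n → ℝ
    coeff        : Fin size → ℝ
    exponent≥0   : ∀ j i → 0ℝ ≤ exponent j i
    coeff>0      : ∀ j → 0ℝ < coeff j
    exponent-inj : ∀ j k → (∀ i → exponent j i ≈ exponent k i) → j ≡ k
open Posynomial public

Homogeneous : ∀ {n} → Posynomial n → ℝ → Set
Homogeneous p d = ∀ j → foldr _+ℝ_ 0ℝ (exponent p j) ≈ d

-- w i is the logarithm of the i-th coordinate, so that zᵢ^a is exp (a • w i).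

evalLog : ∀ {n} → Posynomial n → Pointℂ n → ℂ
evalLog p w = foldr _+ℂ_ 0ℂ λ j →
  coeff p j • foldr _*ℂ_ 1ℂ (λ i → exp (exponent p j i • w i))

Value : ∀ {n} → Posynomial n → Pointℂ n → ℂ → Set
Value p z v = ∃ λ w → (∀ i → PrincipalLog (z i) (w i)) × evalLog p w ≈ℂ v

Γ₁-Stable : ∀ {n} → Posynomial n → Set
Γ₁-Stable p = ∀ z → (∀ i → 0ℝ < re (z i)) → ¬ Value p z 0ℂ

PowerOf : ∀ {n} → Posynomial n → ℝ → Pointℝ n → ℝ → Set
PowerOf p s x y = ∃ λ u → Value p (ofℝ ∘ x) (ofℝ u) × PrincipalPower s (ofℝ u) (ofℝ y)

LogOf : ∀ {n} → Posynomial n → Pointℝ n → ℝ → Set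
LogOf p x y = ∃ λ u → Value p (ofℝ ∘ x) (ofℝ u) × PrincipalLog (ofℝ u) (ofℝ y)

-- Totality of the graph F is required so that the inequality cannot hold vacuously.

ConcaveOnPositive : ∀ {n} → (Pointℝ n → ℝ → Set) → Set
ConcaveOnPositive F =
  (∀ x → Positive x → ∃ λ a → F x a) ×
  (∀ x y t → Positive x → Positive y → 0ℝ ≤ t → t ≤ 1ℝ →
   ∀ a b c → F x a → F y b → F (λ i → (1ℝ -ℝ t) *ℝ x i +ℝ t *ℝ y i) c →
   (1ℝ -ℝ t) *ℝ a +ℝ t *ℝ b ≤ c)

module Submission where

-- In logarithmic coordinates z = exp ω the posynomial becomes P ω = Σ c_j exp (a_j · ω), which
-- has no zero on the tube |Im ω_i| < π/2.  Lifting P through exp along vertical segments issuing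
-- from real points gives a branch ℓ of log P on the tube.
--
-- First, |Im ℓ| ≤ d π/2.  Otherwise β < Im ℓ ω for some β > d π/2, say at ω = ρ + i φ.  Along
-- t ↦ ω + t φ with t ≤ 0, Im (e^{-iβ} P) = Σ A_j e^{m_j t} sin (m_j - β), where m_j = a_j · φ, and
-- Im ℓ tends to the least m_j as t → -∞, so that Im (ℓ - β) passes a number of multiples of π.
-- Homogeneity gives |m_j| ≤ d π/2 < β, and Descartes' rule of signs allows fewer sign changes.
--
-- Hence q = P^{1/d} has Re q ≥ 0.  For positive X and Y put
--   V w = Re (q (X e^{-w} + Y e^w) - q X e^{-w} - q Y e^w),    |Im w| < π/2.
-- V tends to 0 as |Re w| → ∞, and the terms other than the first tend to 0 as |Im w| → π/2.  The
-- minimum principle gives V 0 ≥ 0, that is q (X + Y) ≥ q X + q Y.  Superadditivity and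
-- homogeneity make q concave, and convexity of exp yields the statement for log p.

open import Algebra.Bundles using (CommutativeRing; RawRing)
import Algebra.Solver.Ring
import Algebra.Solver.Ring.AlmostCommutativeRing as ACR
open import Algebra.Structures using (IsCommutativeRing)
open import Axiom.ExcludedMiddle using (ExcludedMiddle)
open import Data.Bool.Base as Bool using (Bool; true; false; not)
open import Data.Empty using (⊥; ⊥-elim)
open import Data.Fin.Base using (Fin; zero; suc)
open import Data.Maybe using (Maybe; just; nothing; is-just; to-witness-T)
open import Data.Nat.Base as ℕ using (ℕ; zero; suc; z≤n; s≤s)
import Data.Nat.Properties as ℕ
open import Data.Product.Base using (∃; _×_; _,_; proj₁; proj₂)
open import Data.Rational.Base as ℚ using (ℚ; 0ℚ; 1ℚ; ½)
import Data.Rational.Properties as ℚ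
open import Data.Rational.Solver using (module +-*-Solver)
open import Data.Sum.Base as ⊎ using (_⊎_; inj₁; inj₂; [_,_]′)
open import Data.Unit.Base using (tt)
open import Data.Vec.Functional using (foldr)
open import Data.Vec.N-ary using (N-ary; Eq; curryⁿ; curryⁿ-cong)
open import Defs using (ι; 1/suc; 1/suc-cancel)
open import Function.Base using (_∘_)
open import Level using (0ℓ)
open import Relation.Binary.Bundles using (Setoid)
open import Relation.Binary.PropositionalEquality as ≡ using (_≡_)
import Relation.Binary.Reasoning.Setoid
import Relation.Binary.Reflection
open import Relation.Nullary using (¬_; Dec; yes; no)

-- Working with an abstract structure keeps the Cauchy sequences behind ℝ from being unfolded.
record Reals : Set₁ where
  infix 4 _≈_ _<_
  infixl 6 _+_
  infixl 7 _*_
  infix 8 -_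
  field
    R : Set
    _≈_ _<_ : R → R → Set
    _+_ _*_ : R → R → R
    -_ : R → R
    fromℚ : ℚ → R
    isCommutativeRing : IsCommutativeRing _≈_ _+_ _*_ -_ (fromℚ 0ℚ) (fromℚ 1ℚ)
    fromℚ-+ : ∀ p q → fromℚ (p ℚ.+ q) ≈ fromℚ p + fromℚ q
    fromℚ-* : ∀ p q → fromℚ (p ℚ.* q) ≈ fromℚ p * fromℚ q
    fromℚ-neg : ∀ p → fromℚ (ℚ.- p) ≈ - fromℚ p
    fromℚ-pos : ∀ p → 0ℚ ℚ.< p → fromℚ 0ℚ < fromℚ p
    <-resp₂ : ∀ {x x′ y y′} → x ≈ x′ → y ≈ y′ → x < y → x′ < y′
    <-irrefl : ∀ {x} → ¬ (x < x)
    <-trans : ∀ {x y z} → x < y → y < z → x < z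
    compare : ∀ x y → x < y ⊎ x ≈ y ⊎ y < x
    +-monoˡ-< : ∀ z {x y} → x < y → x + z < y + z
    *-pos : ∀ {x y} → fromℚ 0ℚ < x → fromℚ 0ℚ < y → fromℚ 0ℚ < x * y
    reciprocal : ∀ x → fromℚ 0ℚ < x → ∃ λ y → x * y ≈ fromℚ 1ℚ
    archimedean : ∀ x → ∃ λ k → x < fromℚ (ι k)
    -- The Cauchy condition can be one-sided because m and n range over the same tail; no absolute
    -- value is available yet.
    complete : (s : ℕ → R) →
      (∀ ε → fromℚ 0ℚ < ε → ∃ λ N → ∀ m n → N ℕ.≤ m → N ℕ.≤ n → s m < s n + ε) →
      ∃ λ l → ∀ ε → fromℚ 0ℚ < ε → ∃ λ N → ∀ n → N ℕ.≤ n → s n < l + ε × l < s n + ε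
    lem : ∀ {P : Set} → Dec P

-- Order and field arithmetic over the abstract reals

module Analysis (𝓡 : Reals) where

  open Reals 𝓡 public
  open IsCommutativeRing isCommutativeRing public using
    ( refl; sym; trans; +-cong; *-cong; -‿cong; isEquivalence; +-identityˡ; +-identityʳ
    ; *-identityˡ; *-identityʳ; -‿inverseˡ; -‿inverseʳ; +-comm; *-comm; +-assoc; *-assoc
    ; distribˡ; distribʳ; zeroˡ; zeroʳ; +-congˡ; +-congʳ; *-congˡ; *-congʳ; reflexive)

  0# 1# 2# : R
  0# = fromℚ 0ℚ
  1# = fromℚ 1ℚ
  2# = 1# + 1#

  infixl 6 _-_
  _-_ : R → R → R
  x - y = x + - y

  R-commutativeRing : CommutativeRing 0ℓ 0ℓ
  R-commutativeRing = record { isCommutativeRing = isCommutativeRing }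

  R-almostCommutativeRing : ACR.AlmostCommutativeRing 0ℓ 0ℓ
  R-almostCommutativeRing = ACR.fromCommutativeRing R-commutativeRing

  ℚ-rawRing : RawRing 0ℓ 0ℓ
  ℚ-rawRing = CommutativeRing.rawRing ℚ.+-*-commutativeRing

  fromℚ-morphism : ℚ-rawRing ACR.-Raw-AlmostCommutative⟶ R-almostCommutativeRing
  fromℚ-morphism = record
    { ⟦_⟧ = fromℚ ; +-homo = fromℚ-+ ; *-homo = fromℚ-* ; -‿homo = fromℚ-neg
    ; 0-homo = refl ; 1-homo = refl }

  fromℚ-≟ : ∀ p q → Maybe (fromℚ p ≈ fromℚ q)
  fromℚ-≟ p q with p ℚ.≟ q
  ... | yes ≡.refl = just refl
  ... | no _ = nothing

  -- Comparing normal forms as data, instead of proving their values equal by refl, keeps the values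
  -- out of the proof terms.
  module RationalSolver (A : ACR.AlmostCommutativeRing 0ℓ 0ℓ) (h : ℚ-rawRing ACR.-Raw-AlmostCommutative⟶ A)
    (h-≟ : ∀ p q → Maybe (ACR.AlmostCommutativeRing._≈_ A (ACR._-Raw-AlmostCommutative⟶_.⟦_⟧ h p) (ACR._-Raw-AlmostCommutative⟶_.⟦_⟧ h q))) where

    open ACR.AlmostCommutativeRing A using (setoid) renaming (_≈_ to _≈ᴬ_)
    open Algebra.Solver.Ring ℚ-rawRing A h h-≟ public
    open Relation.Binary.Reflection setoid var ⟦_⟧ ⟦_⟧↓ correct using (close)

    solve-by-≟ : ∀ n (f : N-ary n (Polynomial n) (Polynomial n × Polynomial n)) →
      Bool.T (is-just (normalise (proj₁ (close n f)) ≟N normalise (proj₂ (close n f)))) →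
      Eq n _≈ᴬ_ (curryⁿ ⟦ proj₁ (close n f) ⟧) (curryⁿ ⟦ proj₂ (close n f) ⟧)
    solve-by-≟ n f same = curryⁿ-cong _≈ᴬ_ ⟦ proj₁ (close n f) ⟧ ⟦ proj₂ (close n f) ⟧ λ ρ →
      prove ρ (proj₁ (close n f)) (proj₂ (close n f)) (⟦ to-witness-T _ same ⟧N-cong ρ)

  module R-Solver = RationalSolver R-almostCommutativeRing fromℚ-morphism fromℚ-≟
  open R-Solver public using (_:+_; _:*_; _:-_; :-_; _:=_; con) renaming (solve-by-≟ to solve)

  infix 4 _≤_
  _≤_ : R → R → Set
  x ≤ y = ¬ (y < x)

  ≈-dec : ∀ x y → x ≈ y ⊎ ¬ (x ≈ y)
  ≈-dec x y with lem {x ≈ y}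
  ... | yes p = inj₁ p
  ... | no ¬p = inj₂ ¬p

  ≤-or-> : ∀ x y → x ≤ y ⊎ y < x
  ≤-or-> x y with lem {y < x}
  ... | yes p = inj₂ p
  ... | no ¬p = inj₁ ¬p

  <⇒≤ : ∀ {x y} → x < y → x ≤ y
  <⇒≤ p q = <-irrefl (<-trans p q)

  ≤-split : ∀ {x y} → x ≤ y → x < y ⊎ x ≈ y
  ≤-split {x} {y} p with compare x y
  ... | inj₁ q = inj₁ q
  ... | inj₂ (inj₁ q) = inj₂ q
  ... | inj₂ (inj₂ q) = ⊥-elim (p q)

  <-≤-trans : ∀ {x y z} → x < y → y ≤ z → x < z
  <-≤-trans p q with ≤-split q
  ... | inj₁ r = <-trans p r
  ... | inj₂ r = <-resp₂ refl r p

  ≤-<-trans : ∀ {x y z} → x ≤ y → y < z → x < z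
  ≤-<-trans p q with ≤-split p
  ... | inj₁ r = <-trans r q
  ... | inj₂ r = <-resp₂ (sym r) refl q

  ≤-reflexive : ∀ {x y} → x ≈ y → x ≤ y
  ≤-reflexive p q = <-irrefl (<-resp₂ refl p q)

  ≤-refl : ∀ {x} → x ≤ x
  ≤-refl = <-irrefl

  ≤-trans : ∀ {x y z} → x ≤ y → y ≤ z → x ≤ z
  ≤-trans p q r = q (<-≤-trans r p)

  ≤-antisym : ∀ {x y} → x ≤ y → y ≤ x → x ≈ y
  ≤-antisym p q with ≤-split p
  ... | inj₁ r = ⊥-elim (q r)
  ... | inj₂ r = r

  <⇒≉ : ∀ {x y} → x < y → ¬ (x ≈ y)
  <⇒≉ p q = <-irrefl (<-resp₂ q refl p)

  ≤-resp₂ : ∀ {x x′ y y′} → x ≈ x′ → y ≈ y′ → x ≤ y → x′ ≤ y′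
  ≤-resp₂ p q r = ≤-trans (≤-reflexive (sym p)) (≤-trans r (≤-reflexive q))

  -- Only the difference of the two sides of an inequality matters. With `<-by` and `≤-by` every
  -- rearrangement of an inequality becomes a polynomial identity for the ring solver.
  <-by : ∀ {a b x y} → a < b → b - a ≈ y - x → x < y
  <-by {a} {b} {x} {y} p e = <-resp₂
    (solve 2 (λ a x → a :+ (x :- a) := x) tt a x)
    (trans (solve 3 (λ a b x → b :+ (x :- a) := (b :- a) :+ x) tt a b x)
           (trans (+-congʳ e) (solve 2 (λ x y → (y :- x) :+ x := y) tt x y)))
    (+-monoˡ-< (x - a) p)

  ≤-by : ∀ {a b x y} → a ≤ b → b - a ≈ y - x → x ≤ y
  ≤-by {a} {b} {x} {y} p e q = p (<-by q (trans (solve 2 (λ x y → x :- y := :- (y :- x)) tt x y)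
    (trans (-‿cong (sym e)) (solve 2 (λ a b → :- (b :- a) := a :- b) tt a b))))

  0<1 : 0# < 1#
  0<1 = fromℚ-pos 1ℚ (ℚ.positive⁻¹ 1ℚ)

  +-mono-< : ∀ {a b c d} → a < b → c < d → a + c < b + d
  +-mono-< {a} {b} {c} {d} p q = <-trans (+-monoˡ-< c p)
    (<-by q (solve 3 (λ b c d → d :- c := (b :+ d) :- (b :+ c)) tt b c d))

  +-mono-≤ : ∀ {a b c d} → a ≤ b → c ≤ d → a + c ≤ b + d
  +-mono-≤ {a} {b} {c} {d} p q = ≤-trans (≤-by p (solve 3 (λ a b c → b :- a := (b :+ c) :- (a :+ c)) tt a b c))
    (≤-by q (solve 3 (λ b c d → d :- c := (b :+ d) :- (b :+ c)) tt b c d))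

  +-mono-<-≤ : ∀ {a b c d} → a < b → c ≤ d → a + c < b + d
  +-mono-<-≤ {a} {b} {c} {d} p q = <-≤-trans (+-monoˡ-< c p)
    (≤-by q (solve 3 (λ b c d → d :- c := (b :+ d) :- (b :+ c)) tt b c d))

  +-mono-≤-< : ∀ {a b c d} → a ≤ b → c < d → a + c < b + d
  +-mono-≤-< {a} {b} {c} {d} p q = ≤-<-trans (≤-by p (solve 3 (λ a b c → b :- a := (b :+ c) :- (a :+ c)) tt a b c))
    (<-by q (solve 3 (λ b c d → d :- c := (b :+ d) :- (b :+ c)) tt b c d))

  0<2 : 0# < 2#
  0<2 = <-resp₂ (+-identityˡ 0#) refl (+-mono-< 0<1 0<1)

  neg-mono-≤ : ∀ {a b} → a ≤ b → - b ≤ - a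
  neg-mono-≤ {a} {b} p = ≤-by p (solve 2 (λ a b → b :- a := (:- a) :- (:- b)) tt a b)

  neg-mono-< : ∀ {a b} → a < b → - b < - a
  neg-mono-< {a} {b} p = <-by p (solve 2 (λ a b → b :- a := (:- a) :- (:- b)) tt a b)

  neg-pos : ∀ {a} → a < 0# → 0# < - a
  neg-pos {a} p = <-by p (solve 1 (λ a → con 0ℚ :- a := (:- a) :- con 0ℚ) tt a)

  neg-nonpos : ∀ {a} → 0# ≤ a → - a ≤ 0#
  neg-nonpos {a} p = ≤-by p (solve 1 (λ a → a :- con 0ℚ := con 0ℚ :- (:- a)) tt a)

  ≤⇒0≤ : ∀ {a b} → a ≤ b → 0# ≤ b - a
  ≤⇒0≤ {a} {b} p = ≤-by p (solve 2 (λ a b → b :- a := (b :- a) :- con 0ℚ) tt a b)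

  <⇒0< : ∀ {a b} → a < b → 0# < b - a
  <⇒0< {a} {b} p = <-by p (solve 2 (λ a b → b :- a := (b :- a) :- con 0ℚ) tt a b)

  +-nonneg : ∀ {a b} → 0# ≤ a → 0# ≤ b → 0# ≤ a + b
  +-nonneg p q = ≤-resp₂ (+-identityˡ 0#) refl (+-mono-≤ p q)

  +-pos : ∀ {a b} → 0# < a → 0# ≤ b → 0# < a + b
  +-pos p q = <-resp₂ (+-identityˡ 0#) refl (+-mono-<-≤ p q)

  *-nonneg : ∀ {a b} → 0# ≤ a → 0# ≤ b → 0# ≤ a * b
  *-nonneg {a} {b} p q with ≤-split p | ≤-split q
  ... | inj₁ r | inj₁ s = <⇒≤ (*-pos r s)
  ... | inj₁ r | inj₂ s = ≤-reflexive (trans (sym (zeroʳ a)) (*-congˡ s))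
  ... | inj₂ r | _ = ≤-reflexive (trans (sym (zeroˡ b)) (*-congʳ r))

  *-monoˡ-≤ : ∀ {c a b} → 0# ≤ c → a ≤ b → c * a ≤ c * b
  *-monoˡ-≤ {c} {a} {b} p q = ≤-by (*-nonneg p (≤⇒0≤ q)) (solve 3
    (λ a b c → c :* (b :- a) :- con 0ℚ := c :* b :- c :* a) tt a b c)

  *-monoʳ-≤ : ∀ {c a b} → 0# ≤ c → a ≤ b → a * c ≤ b * c
  *-monoʳ-≤ {c} {a} {b} p q = ≤-resp₂ (*-comm c a) (*-comm c b) (*-monoˡ-≤ p q)

  *-monoˡ-< : ∀ {c a b} → 0# < c → a < b → c * a < c * b
  *-monoˡ-< {c} {a} {b} p q = <-by (*-pos p (<⇒0< q)) (solve 3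
    (λ a b c → c :* (b :- a) :- con 0ℚ := c :* b :- c :* a) tt a b c)

  *-monoʳ-< : ∀ {c a b} → 0# < c → a < b → a * c < b * c
  *-monoʳ-< {c} {a} {b} p q = <-resp₂ (*-comm c a) (*-comm c b) (*-monoˡ-< p q)

  *-mono-≤ : ∀ {a b c d} → 0# ≤ a → 0# ≤ d → a ≤ b → c ≤ d → a * c ≤ b * d
  *-mono-≤ 0≤a 0≤d p q = ≤-trans (*-monoˡ-≤ 0≤a q) (*-monoʳ-≤ 0≤d p)

  *-cancelˡ-≤ : ∀ {c a b} → 0# < c → c * a ≤ c * b → a ≤ b
  *-cancelˡ-≤ p q r = q (*-monoˡ-< p r)

  *-cancelˡ-< : ∀ {c a b} → 0# < c → c * a < c * b → a < b
  *-cancelˡ-< {c} {a} {b} p q with ≤-or-> b a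
  ... | inj₁ r = ⊥-elim (*-monoˡ-≤ (<⇒≤ p) r q)
  ... | inj₂ r = r

  square-nonneg : ∀ a → 0# ≤ a * a
  square-nonneg a with ≤-or-> 0# a
  ... | inj₁ p = *-nonneg p p
  ... | inj₂ p = ≤-resp₂ refl (solve 1 (λ a → (:- a) :* (:- a) := a :* a) tt a)
    (*-nonneg (<⇒≤ (neg-pos p)) (<⇒≤ (neg-pos p)))

  ≈⇒-≈0 : ∀ {a b} → a ≈ b → a - b ≈ 0#
  ≈⇒-≈0 {a} {b} p = trans (+-congʳ p) (-‿inverseʳ b)

  pos-or-neg : ∀ {x} → ¬ (x ≈ 0#) → 0# < x ⊎ x < 0#
  pos-or-neg {x} p with compare 0# x
  ... | inj₁ q = inj₁ q
  ... | inj₂ (inj₁ q) = ⊥-elim (p (sym q))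
  ... | inj₂ (inj₂ q) = inj₂ q

  -- The inverse of 0# is 0#.

  opaque
    inverse : ∀ x → ∃ λ y → ¬ (x ≈ 0#) → x * y ≈ 1#
    inverse x with compare 0# x
    ... | inj₁ p = proj₁ (reciprocal x p) , λ _ → proj₂ (reciprocal x p)
    ... | inj₂ (inj₁ p) = 0# , λ q → ⊥-elim (q (sym p))
    ... | inj₂ (inj₂ p) = - proj₁ r , λ _ → trans (move x (proj₁ r)) (proj₂ r)
      where
      r : ∃ λ y → (- x) * y ≈ 1#
      r = reciprocal (- x) (neg-pos p)
      move : ∀ x y → x * (- y) ≈ (- x) * y
      move = solve 2 (λ x y → x :* (:- y) := (:- x) :* y) tt

  infix 9 _⁻¹
  _⁻¹ : R → R
  x ⁻¹ = proj₁ (inverse x)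

  *-inverseʳ : ∀ {x} → ¬ (x ≈ 0#) → x * x ⁻¹ ≈ 1#
  *-inverseʳ {x} = proj₂ (inverse x)

  *-inverseˡ : ∀ {x} → ¬ (x ≈ 0#) → x ⁻¹ * x ≈ 1#
  *-inverseˡ {x} p = trans (*-comm (x ⁻¹) x) (*-inverseʳ p)

  pos⇒≉0 : ∀ {x} → 0# < x → ¬ (x ≈ 0#)
  pos⇒≉0 p q = <⇒≉ p (sym q)

  *-cancelˡ-≈ : ∀ {c a b} → ¬ (c ≈ 0#) → c * a ≈ c * b → a ≈ b
  *-cancelˡ-≈ {c} {a} {b} p q = trans (divide a) (trans (*-congˡ q) (sym (divide b)))
    where
    divide : ∀ a → a ≈ c ⁻¹ * (c * a)
    divide a = trans (sym (*-identityˡ a)) (trans (*-congʳ (sym (*-inverseˡ p))) (*-assoc (c ⁻¹) c a))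

  ⁻¹-pos : ∀ {x} → 0# < x → 0# < x ⁻¹
  ⁻¹-pos {x} p = *-cancelˡ-< p (<-resp₂ (sym (zeroʳ x)) (sym (*-inverseʳ (pos⇒≉0 p))) 0<1)

  ⁻¹-unique : ∀ {x y} → x * y ≈ 1# → ¬ (x ≈ 0#) → y ≈ x ⁻¹
  ⁻¹-unique p q = *-cancelˡ-≈ q (trans p (sym (*-inverseʳ q)))

  infixl 7 _/_
  _/_ : R → R → R
  x / y = x * y ⁻¹

  *-/-cancel : ∀ {x y} → ¬ (y ≈ 0#) → y * (x / y) ≈ x
  *-/-cancel {x} {y} p = trans (solve 3 (λ x y z → y :* (x :* z) := (y :* z) :* x) tt x y (y ⁻¹))
    (trans (*-congʳ (*-inverseʳ p)) (*-identityˡ x))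

  /-pos : ∀ {x y} → 0# < x → 0# < y → 0# < x / y
  /-pos p q = *-pos p (⁻¹-pos q)

  ≤-/ : ∀ {x y z} → 0# < y → y * x ≤ z → x ≤ z / y
  ≤-/ p q = *-cancelˡ-≤ p (≤-trans q (≤-reflexive (sym (*-/-cancel (pos⇒≉0 p)))))

  ½# : R
  ½# = fromℚ ½

  0<½ : 0# < ½#
  0<½ = fromℚ-pos ½ (ℚ.positive⁻¹ ½)

  half-pos : ∀ {ε} → 0# < ε → 0# < ½# * ε
  half-pos = *-pos 0<½

  halves : ∀ ε → ½# * ε + ½# * ε ≈ ε
  halves = solve 1 (λ e → con ½ :* e :+ con ½ :* e := e) tt

  half-< : ∀ {ε} → 0# < ε → ½# * ε < ε
  half-< {ε} p = <-by (half-pos p) (solve 1 (λ e → con ½ :* e :- con 0ℚ := e :- con ½ :* e) tt ε)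

  ≤-from-ε : ∀ {x y} → (∀ ε → 0# < ε → x ≤ y + ε) → x ≤ y
  ≤-from-ε {x} {y} h p = h (½# * (x - y)) (half-pos (<⇒0< p))
    (<-by (half-< (<⇒0< p)) (solve 2 (λ x y → (x :- y) :- con ½ :* (x :- y) := x :- (y :+ con ½ :* (x :- y))) tt x
      y))

  ≤0-from-ε : ∀ {x} → (∀ ε → 0# < ε → x ≤ ε) → x ≤ 0#
  ≤0-from-ε h = ≤-from-ε λ ε p → ≤-trans (h ε p) (≤-reflexive (sym (+-identityˡ ε)))

  opaque
    -- The absolute value is opaque and reached only through these properties, so that the case
    -- distinction behind it is never unfolded; maximum and minimum follow the same pattern.
    abs-spec : ∀ x → ∃ λ y → 0# ≤ y × x ≤ y × - x ≤ y × (y ≈ x ⊎ y ≈ - x)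
    abs-spec x with ≤-or-> 0# x
    ... | inj₁ p = x , p , ≤-refl , ≤-trans (neg-nonpos p) p , inj₁ refl
    ... | inj₂ p = - x , <⇒≤ (neg-pos p) , <⇒≤ (<-trans p (neg-pos p)) , ≤-refl , inj₂ refl

  ∣_∣ : R → R
  ∣ x ∣ = proj₁ (abs-spec x)

  ∣∣-nonneg : ∀ x → 0# ≤ ∣ x ∣
  ∣∣-nonneg x = proj₁ (proj₂ (abs-spec x))

  x≤∣x∣ : ∀ x → x ≤ ∣ x ∣
  x≤∣x∣ x = proj₁ (proj₂ (proj₂ (abs-spec x)))

  -x≤∣x∣ : ∀ x → - x ≤ ∣ x ∣
  -x≤∣x∣ x = proj₁ (proj₂ (proj₂ (proj₂ (abs-spec x))))

  ∣∣-cases : ∀ x → ∣ x ∣ ≈ x ⊎ ∣ x ∣ ≈ - x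
  ∣∣-cases x = proj₂ (proj₂ (proj₂ (proj₂ (abs-spec x))))

  ∣∣-lub : ∀ {x y} → x ≤ y → - x ≤ y → ∣ x ∣ ≤ y
  ∣∣-lub {x} p q with ∣∣-cases x
  ... | inj₁ e = ≤-trans (≤-reflexive e) p
  ... | inj₂ e = ≤-trans (≤-reflexive e) q

  ∣∣-cong : ∀ {x y} → x ≈ y → ∣ x ∣ ≈ ∣ y ∣
  ∣∣-cong {x} {y} p = ≤-antisym
    (∣∣-lub (≤-trans (≤-reflexive p) (x≤∣x∣ y)) (≤-trans (≤-reflexive (-‿cong p)) (-x≤∣x∣ y)))
    (∣∣-lub (≤-trans (≤-reflexive (sym p)) (x≤∣x∣ x)) (≤-trans (≤-reflexive (-‿cong (sym p))) (-x≤∣x∣ x)))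

  nonneg⇒∣∣ : ∀ {x} → 0# ≤ x → ∣ x ∣ ≈ x
  nonneg⇒∣∣ {x} p = ≤-antisym (∣∣-lub ≤-refl (≤-trans (neg-nonpos p) p)) (x≤∣x∣ x)

  ∣∣-neg : ∀ x → ∣ - x ∣ ≈ ∣ x ∣
  ∣∣-neg x = ≤-antisym
    (∣∣-lub (-x≤∣x∣ x) (≤-trans (≤-reflexive (solve 1 (λ x → :- (:- x) := x) tt x)) (x≤∣x∣ x)))
    (∣∣-lub (≤-trans (≤-reflexive (solve 1 (λ x → x := :- (:- x)) tt x)) (-x≤∣x∣ (- x))) (x≤∣x∣ (- x)))

  ∣∣-triangle : ∀ x y → ∣ x + y ∣ ≤ ∣ x ∣ + ∣ y ∣
  ∣∣-triangle x y = ∣∣-lub (+-mono-≤ (x≤∣x∣ x) (x≤∣x∣ y))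
    (≤-trans (≤-reflexive (solve 2 (λ x y → :- (x :+ y) := :- x :+ :- y) tt x y)) (+-mono-≤ (-x≤∣x∣ x) (-x≤∣x∣ y)))

  ∣∣-* : ∀ x y → ∣ x * y ∣ ≈ ∣ x ∣ * ∣ y ∣
  ∣∣-* x y = ≤-antisym (∣∣-lub upper lower) (sign (∣∣-cases x) (∣∣-cases y))
    where
    a = ∣ x ∣
    b = ∣ y ∣
    -- The two nonnegative products add up to 2 (a b - x y), and those of `mm` to 2 (a b + x y), so
    -- the upper bounds need no case distinction on signs.
    pp : 0# ≤ (a - x) * (b + y) + (a + x) * (b - y)
    pp = +-nonneg (*-nonneg (≤⇒0≤ (x≤∣x∣ x)) (≤-by (-x≤∣x∣ y)
      (solve 2 (λ b y → b :- (:- y) := (b :+ y) :- con 0ℚ) tt b y)))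
                  (*-nonneg (≤-by (-x≤∣x∣ x) (solve 2 (λ a x → a :- (:- x) := (a :+ x) :- con 0ℚ) tt a x))
                    (≤⇒0≤ (x≤∣x∣ y)))
    mm : 0# ≤ (a - x) * (b - y) + (a + x) * (b + y)
    mm = +-nonneg (*-nonneg (≤⇒0≤ (x≤∣x∣ x)) (≤⇒0≤ (x≤∣x∣ y)))
      (*-nonneg (≤-by (-x≤∣x∣ x) (solve 2 (λ a x → a :- (:- x) := (a :+ x) :- con 0ℚ) tt a x))
                (≤-by (-x≤∣x∣ y) (solve 2 (λ b y → b :- (:- y) := (b :+ y) :- con 0ℚ) tt b y)))
    upper : x * y ≤ a * b
    upper = *-cancelˡ-≤ 0<2 (≤-by pp (solve 4 (λ a b x y → ((a :- x) :* (b :+ y) :+ (a :+ x) :* (b :- y)) :- con 0ℚ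
      := (con 1ℚ :+ con 1ℚ) :* (a :* b) :- (con 1ℚ :+ con 1ℚ) :* (x :* y)) tt a b x y))
    lower : - (x * y) ≤ a * b
    lower = *-cancelˡ-≤ 0<2 (≤-by mm (solve 4 (λ a b x y → ((a :- x) :* (b :- y) :+ (a :+ x) :* (b :+ y)) :- con 0ℚ
      := (con 1ℚ :+ con 1ℚ) :* (a :* b) :- (con 1ℚ :+ con 1ℚ) :* (:- (x :* y))) tt a b x y))
    sign : (a ≈ x ⊎ a ≈ - x) → (b ≈ y ⊎ b ≈ - y) → a * b ≤ ∣ x * y ∣
    sign (inj₁ p) (inj₁ q) = ≤-trans (≤-reflexive (*-cong p q)) (x≤∣x∣ (x * y))
    sign (inj₁ p) (inj₂ q) = ≤-trans (≤-reflexive (trans (*-cong p q)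
      (solve 2 (λ x y → x :* :- y := :- (x :* y)) tt x y))) (-x≤∣x∣ (x * y))
    sign (inj₂ p) (inj₁ q) = ≤-trans (≤-reflexive (trans (*-cong p q)
      (solve 2 (λ x y → (:- x) :* y := :- (x :* y)) tt x y))) (-x≤∣x∣ (x * y))
    sign (inj₂ p) (inj₂ q) = ≤-trans (≤-reflexive (trans (*-cong p q)
      (solve 2 (λ x y → (:- x) :* (:- y) := x :* y) tt x y))) (x≤∣x∣ (x * y))

  ∣∣≤0⇒≈0 : ∀ {x} → ∣ x ∣ ≤ 0# → x ≈ 0#
  ∣∣≤0⇒≈0 {x} p = ≤-antisym (≤-trans (x≤∣x∣ x) p)
    (≤-by (≤-trans (-x≤∣x∣ x) p) (solve 1 (λ x → con 0ℚ :- (:- x) := x :- con 0ℚ) tt x))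

  opaque
    max-spec : ∀ x y → ∃ λ z → x ≤ z × y ≤ z × (∀ {P : R → Set} → P x → P y → P z)
    max-spec x y with ≤-or-> x y
    ... | inj₁ p = y , p , ≤-refl , λ _ q → q
    ... | inj₂ p = x , ≤-refl , <⇒≤ p , λ q _ → q

  infixl 6 _⊔_ _⊓_
  _⊔_ : R → R → R
  x ⊔ y = proj₁ (max-spec x y)

  opaque
    min-spec : ∀ x y → ∃ λ z → z ≤ x × z ≤ y × (∀ {P : R → Set} → P x → P y → P z)
    min-spec x y with ≤-or-> x y
    ... | inj₁ p = x , ≤-refl , p , λ q _ → q
    ... | inj₂ p = y , <⇒≤ p , ≤-refl , λ _ q → q

  _⊓_ : R → R → R
  x ⊓ y = proj₁ (min-spec x y)

  x⊓y≤x : ∀ x y → x ⊓ y ≤ x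
  x⊓y≤x x y = proj₁ (proj₂ (min-spec x y))

  x⊓y≤y : ∀ x y → x ⊓ y ≤ y
  x⊓y≤y x y = proj₁ (proj₂ (proj₂ (min-spec x y)))

  ⊓-pos : ∀ {x y} → 0# < x → 0# < y → 0# < x ⊓ y
  ⊓-pos {x} {y} p q = proj₂ (proj₂ (proj₂ (min-spec x y))) {λ z → 0# < z} p q

  opaque
    nat : ℕ → R
    nat k = fromℚ (ι k)

    nat-suc : ∀ k → nat (suc k) ≈ 1# + nat k
    nat-suc k = fromℚ-+ 1ℚ (ι k)

    nat-zero : nat 0 ≈ 0#
    nat-zero = refl

    nat-archimedean : ∀ x → ∃ λ k → x < nat k
    nat-archimedean = archimedean

  nat-nonneg : ∀ k → 0# ≤ nat k
  nat-nonneg zero = ≤-reflexive (sym nat-zero)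
  nat-nonneg (suc k) = ≤-trans (+-nonneg (<⇒≤ 0<1) (nat-nonneg k)) (≤-reflexive (sym (nat-suc k)))

  nat-pos : ∀ k → 0# < nat (suc k)
  nat-pos k = <-resp₂ refl (sym (nat-suc k)) (+-pos 0<1 (nat-nonneg k))

  nat-mono : ∀ {j k} → j ℕ.≤ k → nat j ≤ nat k
  nat-mono {k = k} z≤n = ≤-trans (≤-reflexive nat-zero) (nat-nonneg k)
  nat-mono {suc j} {suc k} (s≤s p) = ≤-resp₂ (sym (nat-suc j)) (sym (nat-suc k)) (+-mono-≤ ≤-refl (nat-mono p))

  opaque
    unfolding nat
    -- This is 1/(k + 1), with the index shift of the exponential series: it is the factor leading
    -- from the term of degree k to that of degree k + 1.
    unit : ℕ → R
    unit k = fromℚ (1/suc k)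

    unit≈ : ∀ k → unit k ≈ fromℚ (1/suc k)
    unit≈ k = refl

    unit-cancel : ∀ k → unit k * nat (suc k) ≈ 1#
    unit-cancel k = trans (sym (fromℚ-* (1/suc k) (ι (suc k)))) (reflexive (≡.cong fromℚ (1/suc-cancel k)))

  unit-pos : ∀ k → 0# < unit k
  unit-pos k = *-cancelˡ-< (nat-pos k) (<-resp₂ (sym (zeroʳ _)) (sym (trans (*-comm _ _) (unit-cancel k))) 0<1)

  unit-anti : ∀ {j k} → j ℕ.≤ k → unit k ≤ unit j
  unit-anti {j} {k} p = *-cancelˡ-≤ (nat-pos k) (≤-trans
    (≤-reflexive (trans (*-comm _ _) (trans (unit-cancel k) (sym (unit-cancel j)))))
    (≤-trans (*-monoˡ-≤ (<⇒≤ (unit-pos j)) (nat-mono (s≤s p))) (≤-reflexive (*-comm _ _))))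

  archimedean-small : ∀ C {ε} → 0# < ε → ∃ λ N → ∀ n → N ℕ.≤ n → C * unit n < ε
  archimedean-small C {ε} p with nat-archimedean (C / ε)
  ... | N , q = N , λ n le → *-cancelˡ-< (nat-pos n) (<-resp₂
        (trans (trans (sym (*-identityʳ C)) (*-congˡ (sym (unit-cancel n))))
          (solve 3 (λ C u n → C :* (u :* n) := n :* (C :* u)) tt C (unit n) (nat (suc n))))
        (*-comm ε (nat (suc n)))
        (≤-<-trans (≤-reflexive (sym (*-/-cancel (pos⇒≉0 p))))
          (*-monoˡ-< p (<-≤-trans q (nat-mono (ℕ.m≤n⇒m≤1+n le))))))

  ≤0-from-unit : ∀ {x} C → (∀ n → x ≤ C * unit n) → x ≤ 0#
  ≤0-from-unit C h = ≤0-from-ε λ ε p → let N , q = archimedean-small C p in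
    ≤-trans (h N) (<⇒≤ (q N ℕ.≤-refl))

  -- Complex numbers

  record C : Set where
    constructor mkC
    field
      re im : R
  open C public

  infix 4 _≈ᶜ_ _,ᶜ_
  -- A record, so that unification does not see through it to the real and imaginary parts.
  record _≈ᶜ_ (z w : C) : Set where
    constructor _,ᶜ_
    field
      re-cong : re z ≈ re w
      im-cong : im z ≈ im w
  open _≈ᶜ_ public

  ofR : R → C
  ofR x = mkC x 0#

  0ᶜ 1ᶜ 𝕚 : C
  0ᶜ = ofR 0#
  1ᶜ = ofR 1#
  𝕚 = mkC 0# 1#

  infixl 6 _+ᶜ_ _-ᶜ_
  infixl 7 _*ᶜ_
  infix 8 -ᶜ_

  -- Opaque, so that the ring solver does not expand products into real and imaginary parts.

  opaque
    _+ᶜ_ _*ᶜ_ : C → C → C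
    z +ᶜ w = mkC (re z + re w) (im z + im w)
    z *ᶜ w = mkC (re z * re w - im z * im w) (re z * im w + im z * re w)

    -ᶜ_ conj : C → C
    -ᶜ z = mkC (- re z) (- im z)
    conj z = mkC (re z) (- im z)

    re-+ : ∀ z w → re (z +ᶜ w) ≈ re z + re w
    re-+ _ _ = refl

    im-+ : ∀ z w → im (z +ᶜ w) ≈ im z + im w
    im-+ _ _ = refl

    re-* : ∀ z w → re (z *ᶜ w) ≈ re z * re w - im z * im w
    re-* _ _ = refl

    im-* : ∀ z w → im (z *ᶜ w) ≈ re z * im w + im z * re w
    im-* _ _ = refl

    re-neg : ∀ z → re (-ᶜ z) ≈ - re z
    re-neg _ = refl

    im-neg : ∀ z → im (-ᶜ z) ≈ - im z
    im-neg _ = refl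

    re-conj : ∀ z → re (conj z) ≈ re z
    re-conj _ = refl

    im-conj : ∀ z → im (conj z) ≈ - im z
    im-conj _ = refl

  _-ᶜ_ : C → C → C
  z -ᶜ w = z +ᶜ -ᶜ w

  opaque
    unfolding _+ᶜ_
    C-isCommutativeRing : IsCommutativeRing _≈ᶜ_ _+ᶜ_ _*ᶜ_ -ᶜ_ 0ᶜ 1ᶜ
    C-isCommutativeRing = record
      { isRing = record
        { +-isAbelianGroup = record
          { isGroup = record
            { isMonoid = record
              { isSemigroup = record
                { isMagma = record
                  { isEquivalence = record
                    { refl = refl ,ᶜ refl
                    ; sym = λ p → sym (re-cong p) ,ᶜ sym (im-cong p)
                    ; trans = λ p q → trans (re-cong p) (re-cong q) ,ᶜ trans (im-cong p) (im-cong q) }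
                  ; ∙-cong = λ p q → +-cong (re-cong p) (re-cong q) ,ᶜ +-cong (im-cong p) (im-cong q) }
                ; assoc = λ z w v → +-assoc _ _ _ ,ᶜ +-assoc _ _ _ }
              ; identity = (λ z → +-identityˡ _ ,ᶜ +-identityˡ _) , (λ z → +-identityʳ _ ,ᶜ +-identityʳ _) }
            ; inverse = (λ z → -‿inverseˡ _ ,ᶜ -‿inverseˡ _) , (λ z → -‿inverseʳ _ ,ᶜ -‿inverseʳ _)
            ; ⁻¹-cong = λ p → -‿cong (re-cong p) ,ᶜ -‿cong (im-cong p) }
          ; comm = λ z w → +-comm _ _ ,ᶜ +-comm _ _ }
        ; *-cong = λ p q →
            +-cong (*-cong (re-cong p) (re-cong q)) (-‿cong (*-cong (im-cong p) (im-cong q))) ,ᶜ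
            +-cong (*-cong (re-cong p) (im-cong q)) (*-cong (im-cong p) (re-cong q))
        ; *-assoc = λ z w v →
            solve 6 (λ a b c d e f → (a :* c :- b :* d) :* e :- (a :* d :+ b :* c) :* f := a :*
              (c :* e :- d :* f) :- b :* (c :* f :+ d :* e)) tt (re z) (im z) (re w) (im w) (re v) (im v) ,ᶜ
            solve 6 (λ a b c d e f → (a :* c :- b :* d) :* f :+ (a :* d :+ b :* c) :* e := a :*
              (c :* f :+ d :* e) :+ b :* (c :* e :- d :* f)) tt (re z) (im z) (re w) (im w) (re v) (im v)
        ; *-identity =
            (λ z → solve 2 (λ a b → con 1ℚ :* a :- con 0ℚ :* b := a) tt (re z) (im z) ,ᶜ solve 2
              (λ a b → con 1ℚ :* b :+ con 0ℚ :* a := b) tt (re z) (im z)) ,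
            (λ z → solve 2 (λ a b → a :* con 1ℚ :- b :* con 0ℚ := a) tt (re z) (im z) ,ᶜ solve 2
              (λ a b → a :* con 0ℚ :+ b :* con 1ℚ := b) tt (re z) (im z))
        ; distrib =
            (λ z w v →
              solve 6 (λ a b c d e f → a :* (c :+ e) :- b :* (d :+ f) := (a :* c :- b :* d) :+ (a :* e :- b :* f))
                tt (re z) (im z) (re w) (im w) (re v) (im v) ,ᶜ
              solve 6 (λ a b c d e f → a :* (d :+ f) :+ b :* (c :+ e) := (a :* d :+ b :* c) :+ (a :* f :+ b :* e))
                tt (re z) (im z) (re w) (im w) (re v) (im v)) ,
            (λ z w v →
              solve 6 (λ a b c d e f → (c :+ e) :* a :- (d :+ f) :* b := (c :* a :- d :* b) :+ (e :* a :- f :* b))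
                tt (re z) (im z) (re w) (im w) (re v) (im v) ,ᶜ
              solve 6 (λ a b c d e f → (c :+ e) :* b :+ (d :+ f) :* a := (c :* b :+ d :* a) :+ (e :* b :+ f :* a))
                tt (re z) (im z) (re w) (im w) (re v) (im v)) }
      ; *-comm = λ z w →
          solve 4 (λ a b c d → a :* c :- b :* d := c :* a :- d :* b) tt (re z) (im z) (re w) (im w) ,ᶜ
          solve 4 (λ a b c d → a :* d :+ b :* c := c :* b :+ d :* a) tt (re z) (im z) (re w) (im w) }

  open IsCommutativeRing C-isCommutativeRing public using () renaming
    ( refl to crefl; sym to csym; trans to ctrans; +-cong to +ᶜ-cong; *-cong to *ᶜ-cong
    ; -‿cong to -ᶜ-cong; isEquivalence to ≈ᶜ-isEquivalence; +-identityˡ to +ᶜ-identityˡ; +-identityʳ to +ᶜ-identityʳ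
    ; *-identityˡ to *ᶜ-identityˡ; *-identityʳ to *ᶜ-identityʳ; -‿inverseʳ to -ᶜ-inverseʳ
    ; +-comm to +ᶜ-comm; *-comm to *ᶜ-comm; *-assoc to *ᶜ-assoc
    ; zeroˡ to *ᶜ-zeroˡ; +-congˡ to +ᶜ-congˡ; +-congʳ to +ᶜ-congʳ
    ; *-congˡ to *ᶜ-congˡ; *-congʳ to *ᶜ-congʳ)

  C-almostCommutativeRing : ACR.AlmostCommutativeRing 0ℓ 0ℓ
  C-almostCommutativeRing = ACR.fromCommutativeRing (record { isCommutativeRing = C-isCommutativeRing })

  opaque
    unfolding _+ᶜ_
    ofR-+ : ∀ x y → ofR (x + y) ≈ᶜ ofR x +ᶜ ofR y
    ofR-+ x y = refl ,ᶜ sym (+-identityˡ 0#)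

    ofR-* : ∀ x y → ofR (x * y) ≈ᶜ ofR x *ᶜ ofR y
    ofR-* x y = solve 2 (λ x y → x :* y := x :* y :- con 0ℚ :* con 0ℚ) tt x y ,ᶜ solve 2
      (λ x y → con 0ℚ := x :* con 0ℚ :+ con 0ℚ :* y) tt x y

    ofR-neg : ∀ x → ofR (- x) ≈ᶜ -ᶜ ofR x
    ofR-neg x = refl ,ᶜ solve 0 (con 0ℚ := :- con 0ℚ) tt

  ofR-cong : ∀ {x y} → x ≈ y → ofR x ≈ᶜ ofR y
  ofR-cong p = p ,ᶜ refl

  ofR-- : ∀ x y → ofR (x - y) ≈ᶜ ofR x -ᶜ ofR y
  ofR-- x y = ctrans (ofR-+ x (- y)) (+ᶜ-congˡ (ofR-neg y))

  ofRℚ-morphism : ℚ-rawRing ACR.-Raw-AlmostCommutative⟶ C-almostCommutativeRing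
  ofRℚ-morphism = record
    { ⟦_⟧ = ofR ∘ fromℚ
    ; +-homo = λ p q → ctrans (ofR-cong (fromℚ-+ p q)) (ofR-+ _ _)
    ; *-homo = λ p q → ctrans (ofR-cong (fromℚ-* p q)) (ofR-* _ _)
    ; -‿homo = λ p → ctrans (ofR-cong (fromℚ-neg p)) (ofR-neg _)
    ; 0-homo = crefl ; 1-homo = crefl }

  ofRℚ-≟ : ∀ p q → Maybe (ofR (fromℚ p) ≈ᶜ ofR (fromℚ q))
  ofRℚ-≟ p q with p ℚ.≟ q
  ... | yes ≡.refl = just crefl
  ... | no _ = nothing

  module C-Solver = RationalSolver C-almostCommutativeRing ofRℚ-morphism ofRℚ-≟
  open C-Solver public using () renaming
    (solve-by-≟ to csolve; _:+_ to _⊕_; _:*_ to _⊗_; _:-_ to _⊖_; :-_ to ⊝_; _:=_ to _⊜_; con to ccon)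

  ≈ᶜ-setoid : Setoid 0ℓ 0ℓ
  ≈ᶜ-setoid = record { isEquivalence = ≈ᶜ-isEquivalence }

  module C-Reasoning = Relation.Binary.Reasoning.Setoid ≈ᶜ-setoid

  opaque
    unfolding _+ᶜ_
    conj-cong : ∀ {z w} → z ≈ᶜ w → conj z ≈ᶜ conj w
    conj-cong (p ,ᶜ q) = p ,ᶜ -‿cong q

    conj-+ : ∀ z w → conj (z +ᶜ w) ≈ᶜ conj z +ᶜ conj w
    conj-+ z w = refl ,ᶜ solve 2 (λ a b → :- (a :+ b) := :- a :+ :- b) tt (im z) (im w)

    conj-neg : ∀ z → conj (-ᶜ z) ≈ᶜ -ᶜ conj z
    conj-neg z = refl ,ᶜ refl

    conj-* : ∀ z w → conj (z *ᶜ w) ≈ᶜ conj z *ᶜ conj w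
    conj-* z w = solve 4 (λ a b c d → a :* c :- b :* d := a :* c :- (:- b) :* (:- d)) tt (re z) (im z) (re w)
      (im w) ,ᶜ
      solve 4 (λ a b c d → :- (a :* d :+ b :* c) := a :* (:- d) :+ (:- b) :* c) tt (re z) (im z) (re w) (im w)

    conj-ofR : ∀ x → conj (ofR x) ≈ᶜ ofR x
    conj-ofR x = refl ,ᶜ solve 0 (:- con 0ℚ := con 0ℚ) tt

    re-ofR-* : ∀ r z → re (ofR r *ᶜ z) ≈ r * re z
    re-ofR-* r z = solve 3 (λ r a b → r :* a :- con 0ℚ :* b := r :* a) tt r (re z) (im z)

    im-ofR-* : ∀ r z → im (ofR r *ᶜ z) ≈ r * im z
    im-ofR-* r z = solve 3 (λ r a b → r :* b :+ con 0ℚ :* a := r :* b) tt r (re z) (im z)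

    𝕚*𝕚 : 𝕚 *ᶜ 𝕚 ≈ᶜ -ᶜ 1ᶜ
    𝕚*𝕚 = solve 0 (con 0ℚ :* con 0ℚ :- con 1ℚ :* con 1ℚ := :- con 1ℚ) tt ,ᶜ solve 0
      (con 0ℚ :* con 1ℚ :+ con 1ℚ :* con 0ℚ := :- con 0ℚ) tt

  -ᶜ≈0⇒≈ᶜ : ∀ {a b} → a -ᶜ b ≈ᶜ 0ᶜ → a ≈ᶜ b
  -ᶜ≈0⇒≈ᶜ {a} {b} p = ctrans (csolve 2 (λ a b → a ⊜ (a ⊖ b) ⊕ b) tt a b) (ctrans (+ᶜ-congʳ p) (+ᶜ-identityˡ b))

  ≈ᶜ⇒-ᶜ≈0 : ∀ {a b} → a ≈ᶜ b → a -ᶜ b ≈ᶜ 0ᶜ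
  ≈ᶜ⇒-ᶜ≈0 {a} {b} p = ctrans (+ᶜ-congʳ p) (-ᶜ-inverseʳ b)

  -- The 1-norm is submultiplicative and needs no square root.

  ‖_‖ : C → R
  ‖ z ‖ = ∣ re z ∣ + ∣ im z ∣

  ‖‖-nonneg : ∀ z → 0# ≤ ‖ z ‖
  ‖‖-nonneg z = +-nonneg (∣∣-nonneg (re z)) (∣∣-nonneg (im z))

  ‖‖-cong : ∀ {z w} → z ≈ᶜ w → ‖ z ‖ ≈ ‖ w ‖
  ‖‖-cong (p ,ᶜ q) = +-cong (∣∣-cong p) (∣∣-cong q)

  ∣re∣≤‖‖ : ∀ z → ∣ re z ∣ ≤ ‖ z ‖
  ∣re∣≤‖‖ z = ≤-by (∣∣-nonneg (im z)) (solve 2 (λ a b → b :- con 0ℚ := (a :+ b) :- a) tt (∣ re z ∣) (∣ im z ∣))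

  ∣im∣≤‖‖ : ∀ z → ∣ im z ∣ ≤ ‖ z ‖
  ∣im∣≤‖‖ z = ≤-by (∣∣-nonneg (re z)) (solve 2 (λ a b → a :- con 0ℚ := (a :+ b) :- b) tt (∣ re z ∣) (∣ im z ∣))

  ‖‖-triangle : ∀ z w → ‖ z +ᶜ w ‖ ≤ ‖ z ‖ + ‖ w ‖
  ‖‖-triangle z w = ≤-trans
    (≤-reflexive (+-cong (∣∣-cong (re-+ z w)) (∣∣-cong (im-+ z w))))
    (≤-trans (+-mono-≤ (∣∣-triangle (re z) (re w)) (∣∣-triangle (im z) (im w)))
      (≤-reflexive (solve 4 (λ a b c d → (a :+ b) :+ (c :+ d) := (a :+ c) :+ (b :+ d)) tt (∣ re z ∣) (∣ re w ∣)
        (∣ im z ∣) (∣ im w ∣))))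

  ‖‖-neg : ∀ z → ‖ -ᶜ z ‖ ≈ ‖ z ‖
  ‖‖-neg z = +-cong (trans (∣∣-cong (re-neg z)) (∣∣-neg (re z))) (trans (∣∣-cong (im-neg z)) (∣∣-neg (im z)))

  ‖‖-conj : ∀ z → ‖ conj z ‖ ≈ ‖ z ‖
  ‖‖-conj z = +-cong (∣∣-cong (re-conj z)) (trans (∣∣-cong (im-conj z)) (∣∣-neg (im z)))

  ‖‖-swap : ∀ z w → ‖ z -ᶜ w ‖ ≈ ‖ w -ᶜ z ‖
  ‖‖-swap z w = trans (‖‖-cong (csolve 2 (λ z w → z ⊖ w ⊜ ⊝ (w ⊖ z)) tt z w)) (‖‖-neg (w -ᶜ z))

  ‖‖-triangle-- : ∀ z w → ‖ z -ᶜ w ‖ ≤ ‖ z ‖ + ‖ w ‖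
  ‖‖-triangle-- z w = ≤-trans (‖‖-triangle z (-ᶜ w)) (+-mono-≤ ≤-refl (≤-reflexive (‖‖-neg w)))

  ‖‖-mult : ∀ z w → ‖ z *ᶜ w ‖ ≤ ‖ z ‖ * ‖ w ‖
  ‖‖-mult z w = ≤-trans
    (+-mono-≤
      (≤-trans (≤-reflexive (∣∣-cong (re-* z w))) (≤-trans (∣∣-triangle _ _)
        (+-mono-≤ (≤-reflexive (∣∣-* _ _)) (≤-reflexive (trans (∣∣-neg _) (∣∣-* _ _))))))
      (≤-trans (≤-reflexive (∣∣-cong (im-* z w))) (≤-trans (∣∣-triangle _ _)
        (+-mono-≤ (≤-reflexive (∣∣-* _ _)) (≤-reflexive (∣∣-* _ _))))))
    (≤-reflexive (solve 4 (λ a b c d → (a :* c :+ b :* d) :+ (a :* d :+ b :* c) := (a :+ b) :* (c :+ d)) tt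
      (∣ re z ∣) (∣ im z ∣) (∣ re w ∣) (∣ im w ∣)))

  ‖‖-mult-≤ : ∀ {z w a b} → ‖ z ‖ ≤ a → ‖ w ‖ ≤ b → ‖ z *ᶜ w ‖ ≤ a * b
  ‖‖-mult-≤ {z} {w} p q = ≤-trans (‖‖-mult z w) (*-mono-≤ (‖‖-nonneg z) (≤-trans (‖‖-nonneg w) q) p q)

  ‖‖-+-≤ : ∀ {z w a b} → ‖ z ‖ ≤ a → ‖ w ‖ ≤ b → ‖ z +ᶜ w ‖ ≤ a + b
  ‖‖-+-≤ p q = ≤-trans (‖‖-triangle _ _) (+-mono-≤ p q)

  ‖ofR‖ : ∀ r → ‖ ofR r ‖ ≈ ∣ r ∣
  ‖ofR‖ r = trans (+-congˡ (nonneg⇒∣∣ ≤-refl)) (+-identityʳ ∣ r ∣)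

  ‖ofR*‖ : ∀ r z → ‖ ofR r *ᶜ z ‖ ≈ ∣ r ∣ * ‖ z ‖
  ‖ofR*‖ r z = trans
    (+-cong (trans (∣∣-cong (re-ofR-* r z)) (∣∣-* r (re z))) (trans (∣∣-cong (im-ofR-* r z)) (∣∣-* r (im z))))
    (solve 3 (λ r a b → r :* a :+ r :* b := r :* (a :+ b)) tt ∣ r ∣ (∣ re z ∣) (∣ im z ∣))

  ‖0‖ : ‖ 0ᶜ ‖ ≈ 0#
  ‖0‖ = trans (‖ofR‖ 0#) (nonneg⇒∣∣ ≤-refl)

  ‖1‖ : ‖ 1ᶜ ‖ ≈ 1#
  ‖1‖ = trans (‖ofR‖ 1#) (nonneg⇒∣∣ (<⇒≤ 0<1))

  ‖‖≤0⇒≈0 : ∀ {z} → ‖ z ‖ ≤ 0# → z ≈ᶜ 0ᶜ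
  ‖‖≤0⇒≈0 {z} p = ∣∣≤0⇒≈0 (≤-trans (∣re∣≤‖‖ z) p) ,ᶜ ∣∣≤0⇒≈0 (≤-trans (∣im∣≤‖‖ z) p)

  ‖-‖≤0⇒≈ : ∀ {z w} → ‖ z -ᶜ w ‖ ≤ 0# → z ≈ᶜ w
  ‖-‖≤0⇒≈ p = -ᶜ≈0⇒≈ᶜ (‖‖≤0⇒≈0 p)

  ≈⇒‖-‖≤0 : ∀ {z w} → z ≈ᶜ w → ‖ z -ᶜ w ‖ ≤ 0#
  ≈⇒‖-‖≤0 p = ≤-reflexive (trans (‖‖-cong (≈ᶜ⇒-ᶜ≈0 p)) ‖0‖)

  ‖‖-reverse : ∀ z w → ‖ z ‖ ≤ ‖ w ‖ + ‖ z -ᶜ w ‖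
  ‖‖-reverse z w = ≤-trans (≤-reflexive (‖‖-cong (csolve 2 (λ z w → z ⊜ w ⊕ (z ⊖ w)) tt z w)))
    (‖‖-triangle w (z -ᶜ w))

  ‖‖-through : ∀ x y z → ‖ x -ᶜ z ‖ ≤ ‖ x -ᶜ y ‖ + ‖ y -ᶜ z ‖
  ‖‖-through x y z = ≤-trans (≤-reflexive (‖‖-cong (csolve 3 (λ x y z → x ⊖ z ⊜ (x ⊖ y) ⊕ (y ⊖ z)) tt x y z)))
    (‖‖-triangle (x -ᶜ y) (y -ᶜ z))

  ∣re-re∣≤ : ∀ z w → ∣ re z - re w ∣ ≤ ‖ z -ᶜ w ‖
  ∣re-re∣≤ z w = ≤-trans (≤-reflexive (∣∣-cong (sym (trans (re-+ z _) (+-congˡ (re-neg w)))))) (∣re∣≤‖‖ (z -ᶜ w))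

  ∣im-im∣≤ : ∀ z w → ∣ im z - im w ∣ ≤ ‖ z -ᶜ w ‖
  ∣im-im∣≤ z w = ≤-trans (≤-reflexive (∣∣-cong (sym (trans (im-+ z _) (+-congˡ (im-neg w)))))) (∣im∣≤‖‖ (z -ᶜ w))

  sqnorm : C → R
  sqnorm z = re z * re z + im z * im z

  opaque
    unfolding _+ᶜ_
    *-conj : ∀ z → z *ᶜ conj z ≈ᶜ ofR (sqnorm z)
    *-conj z = solve 2 (λ a b → a :* a :- b :* (:- b) := a :* a :+ b :* b) tt (re z) (im z) ,ᶜ solve 2
      (λ a b → a :* (:- b) :+ b :* a := con 0ℚ) tt (re z) (im z)

  square-pos : ∀ {x} → ¬ (x ≈ 0#) → 0# < x * x
  square-pos {x} p with pos-or-neg p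
  ... | inj₁ q = *-pos q q
  ... | inj₂ q = <-resp₂ refl (solve 1 (λ x → (:- x) :* (:- x) := x :* x) tt x) (*-pos (neg-pos q) (neg-pos q))

  sqnorm-pos : ∀ {z} → ¬ (z ≈ᶜ 0ᶜ) → 0# < sqnorm z
  sqnorm-pos {z} p with ≈-dec (re z) 0# | ≈-dec (im z) 0#
  ... | inj₁ q | inj₁ r = ⊥-elim (p (q ,ᶜ r))
  ... | inj₁ q | inj₂ r = <-resp₂ refl (+-comm _ _) (+-pos (square-pos r) (square-nonneg (re z)))
  ... | inj₂ q | _ = +-pos (square-pos q) (square-nonneg (im z))

  ‖‖²≤2sqnorm : ∀ z → ‖ z ‖ * ‖ z ‖ ≤ 2# * sqnorm z
  ‖‖²≤2sqnorm z = ≤-by (square-nonneg (a - b))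
    (trans (solve 2 (λ a b → (a :- b) :* (a :- b) :- con 0ℚ := (con 1ℚ :+ con 1ℚ) :* (a :* a :+ b :* b) :-
      (a :+ b) :* (a :+ b)) tt a b)
           (+-congʳ (*-congˡ (+-cong (sq (re z)) (sq (im z))))))
    where
    a = ∣ re z ∣
    b = ∣ im z ∣
    sq : ∀ x → ∣ x ∣ * ∣ x ∣ ≈ x * x
    sq x = trans (sym (∣∣-* x x)) (nonneg⇒∣∣ (square-nonneg x))

  -- The inverse of 0ᶜ is 0ᶜ.

  infix 9 _⁻¹ᶜ
  _⁻¹ᶜ : C → C
  z ⁻¹ᶜ = ofR (sqnorm z ⁻¹) *ᶜ conj z

  *ᶜ-inverseʳ : ∀ {z} → ¬ (z ≈ᶜ 0ᶜ) → z *ᶜ z ⁻¹ᶜ ≈ᶜ 1ᶜ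
  *ᶜ-inverseʳ {z} p = ctrans (csolve 3 (λ z n w → z ⊗ (n ⊗ w) ⊜ n ⊗ (z ⊗ w)) tt z (ofR (sqnorm z ⁻¹)) (conj z))
    (ctrans (*ᶜ-congˡ (*-conj z)) (ctrans (csym (ofR-* _ _)) (ofR-cong (*-inverseˡ (pos⇒≉0 (sqnorm-pos p))))))

  *ᶜ-inverseˡ : ∀ {z} → ¬ (z ≈ᶜ 0ᶜ) → z ⁻¹ᶜ *ᶜ z ≈ᶜ 1ᶜ
  *ᶜ-inverseˡ {z} p = ctrans (*ᶜ-comm _ _) (*ᶜ-inverseʳ p)

  -- The 1-norm is only submultiplicative, so the product need not be 1; the comparison of its
  -- square with twice the square of the Euclidean norm costs the factor 2.
  ⁻¹ᶜ-norm : ∀ {z} → ¬ (z ≈ᶜ 0ᶜ) → ‖ z ⁻¹ᶜ ‖ * ‖ z ‖ ≤ 2#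
  ⁻¹ᶜ-norm {z} p = ≤-trans (≤-reflexive (trans (*-congʳ eq) (*-assoc _ _ _)))
    (≤-trans (*-monoˡ-≤ (<⇒≤ (⁻¹-pos N>0)) (‖‖²≤2sqnorm z))
      (≤-reflexive (trans (solve 2 (λ i n → i :* ((con 1ℚ :+ con 1ℚ) :* n) := (con 1ℚ :+ con 1ℚ) :* (i :* n)) tt
        (sqnorm z ⁻¹) (sqnorm z))
        (trans (*-congˡ (*-inverseˡ (pos⇒≉0 N>0))) (*-identityʳ 2#)))))
    where
    N>0 = sqnorm-pos p
    eq : ‖ z ⁻¹ᶜ ‖ ≈ sqnorm z ⁻¹ * ‖ z ‖
    eq = trans (‖ofR*‖ _ _) (*-cong (nonneg⇒∣∣ (<⇒≤ (⁻¹-pos N>0))) (‖‖-conj z))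

  ⁻¹ᶜ-norm-≤ : ∀ {z c} → 0# < c → c ≤ ‖ z ‖ → ‖ z ⁻¹ᶜ ‖ ≤ 2# / c
  ⁻¹ᶜ-norm-≤ {z} {c} p q = ≤-/ p (≤-trans (≤-reflexive (*-comm c _))
    (≤-trans (*-monoˡ-≤ (‖‖-nonneg (z ⁻¹ᶜ)) q)
      (⁻¹ᶜ-norm λ e → <-irrefl (<-≤-trans p (≤-trans q (≤-reflexive (trans (‖‖-cong e) ‖0‖)))))))

  *ᶜ-cancelˡ : ∀ {c a b} → ¬ (c ≈ᶜ 0ᶜ) → c *ᶜ a ≈ᶜ c *ᶜ b → a ≈ᶜ b
  *ᶜ-cancelˡ {c} {a} {b} p q = ctrans (divide a) (ctrans (*ᶜ-congˡ q) (csym (divide b)))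
    where
    divide : ∀ a → a ≈ᶜ c ⁻¹ᶜ *ᶜ (c *ᶜ a)
    divide a = ctrans (csym (*ᶜ-identityˡ a)) (ctrans (*ᶜ-congʳ (csym (*ᶜ-inverseˡ p))) (*ᶜ-assoc (c ⁻¹ᶜ) c a))

  1≉0 : ¬ (1ᶜ ≈ᶜ 0ᶜ)
  1≉0 (p ,ᶜ _) = <⇒≉ 0<1 (sym p)

  *ᶜ≈1⇒≉0 : ∀ {z w} → z *ᶜ w ≈ᶜ 1ᶜ → ¬ (z ≈ᶜ 0ᶜ)
  *ᶜ≈1⇒≉0 {z} {w} p q = 1≉0 (ctrans (csym p) (ctrans (*ᶜ-congʳ q) (*ᶜ-zeroˡ w)))

  -- The exponential series

  Tᶜ Sᶜ : ℕ → C → C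
  Tᶜ zero z = 1ᶜ
  Tᶜ (suc k) z = ofR (unit k) *ᶜ (z *ᶜ Tᶜ k z)
  Sᶜ zero z = 0ᶜ
  Sᶜ (suc k) z = Sᶜ k z +ᶜ Tᶜ k z

  record Exponential : Set where
    field
      exp : C → C
      exp-limit : ∀ z ε → 0# < ε → ∃ λ m → ∀ n → m ℕ.≤ n → ‖ exp z -ᶜ Sᶜ n z ‖ ≤ ε

  -- The concrete series enters through the real and imaginary parts of its terms (`u`, `v`) and
  -- partial sums (`A`, `B`), known only by their recursions. Nothing here can unfold the sequences
  -- of rationals behind them.
  module Series (exp : C → C) (u v A B : C → ℕ → R)
    (u-zero : ∀ z → u z 0 ≈ 1#) (v-zero : ∀ z → v z 0 ≈ 0#)
    (u-suc : ∀ z k → u z (suc k) ≈ fromℚ (1/suc k) * (re z * u z k - im z * v z k))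
    (v-suc : ∀ z k → v z (suc k) ≈ fromℚ (1/suc k) * (re z * v z k + im z * u z k))
    (A-zero : ∀ z → A z 0 ≈ 0#) (B-zero : ∀ z → B z 0 ≈ 0#)
    (A-suc : ∀ z k → A z (suc k) ≈ A z k + u z k) (B-suc : ∀ z k → B z (suc k) ≈ B z k + v z k)
    (A-limit : ∀ z ε → 0# < ε → ∃ λ m → ∀ n → m ℕ.≤ n → re (exp z) ≤ A z n + ε × A z n ≤ re (exp z) + ε)
    (B-limit : ∀ z ε → 0# < ε → ∃ λ m → ∀ n → m ℕ.≤ n → im (exp z) ≤ B z n + ε × B z n ≤ im (exp z) + ε) where

    term : ∀ k z → mkC (u z k) (v z k) ≈ᶜ Tᶜ k z
    term zero z = u-zero z ,ᶜ v-zero z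
    term (suc k) z = csym (ctrans (*ᶜ-congˡ (*ᶜ-congˡ (csym (term k z))))
      (trans (re-ofR-* _ _) (trans (*-cong (unit≈ k) (re-* _ _)) (sym (u-suc z k))) ,ᶜ
       trans (im-ofR-* _ _) (trans (*-cong (unit≈ k) (im-* _ _)) (sym (v-suc z k)))))

    partial-sum : ∀ k z → mkC (A z k) (B z k) ≈ᶜ Sᶜ k z
    partial-sum zero z = A-zero z ,ᶜ B-zero z
    partial-sum (suc k) z = ctrans (trans (A-suc z k) (sym (re-+ _ _)) ,ᶜ trans (B-suc z k) (sym (im-+ _ _)))
      (+ᶜ-cong (partial-sum k z) (term k z))

    within : ∀ {x y ε} → x ≤ y + ε × y ≤ x + ε → ∣ x - y ∣ ≤ ε
    within {x} {y} {ε} (p , q) = ∣∣-lub (≤-by p (solve 3 (λ x y e → (y :+ e) :- x := e :- (x :- y)) tt x y ε))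
      (≤-by q (solve 3 (λ x y e → (x :+ e) :- y := e :- :- (x :- y)) tt x y ε))

    exponential : Exponential
    exponential = record { exp = exp ; exp-limit = λ z ε ε>0 →
      let m , f = A-limit z (½# * ε) (half-pos ε>0) ; m′ , g = B-limit z (½# * ε) (half-pos ε>0) in
      m ℕ.⊔ m′ , λ n le → ≤-trans (+-mono-≤
          (≤-trans (≤-reflexive (∣∣-cong (trans (re-+ _ _) (+-congˡ
            (trans (re-neg _) (-‿cong (re-cong (csym (partial-sum n z)))))))))
            (within (f n (ℕ.≤-trans (ℕ.m≤m⊔n m m′) le))))
          (≤-trans (≤-reflexive (∣∣-cong (trans (im-+ _ _) (+-congˡ
            (trans (im-neg _) (-‿cong (im-cong (csym (partial-sum n z)))))))))
            (within (g n (ℕ.≤-trans (ℕ.m≤n⊔m m m′) le)))))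
        (≤-reflexive (halves ε)) }

-- Estimates and the functional equation of the exponential

module Theory (𝓡 : Reals) (𝓔 : Analysis.Exponential 𝓡) where
  open Analysis 𝓡
  open Exponential 𝓔

  ≤-from-*ε : ∀ {x y} c → 0# < c → (∀ ε → 0# < ε → x ≤ y + c * ε) → x ≤ y
  ≤-from-*ε {x} {y} c c>0 h = ≤-from-ε λ ε p →
    ≤-trans (h (ε / c) (/-pos p c>0)) (≤-reflexive (+-congˡ (*-/-cancel (pos⇒≉0 c>0))))

  T⁺ S⁺ : ℕ → R → R
  T⁺ zero r = 1#
  T⁺ (suc k) r = unit k * (r * T⁺ k r)
  S⁺ zero r = 0#
  S⁺ (suc k) r = S⁺ k r + T⁺ k r

  T⁺-nonneg : ∀ k {r} → 0# ≤ r → 0# ≤ T⁺ k r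
  T⁺-nonneg zero p = <⇒≤ 0<1
  T⁺-nonneg (suc k) p = *-nonneg (<⇒≤ (unit-pos k)) (*-nonneg p (T⁺-nonneg k p))

  ∣unit∣ : ∀ k → ∣ unit k ∣ ≈ unit k
  ∣unit∣ k = nonneg⇒∣∣ (<⇒≤ (unit-pos k))

  T-suc-norm : ∀ k z → ‖ Tᶜ (suc k) z ‖ ≤ unit k * (‖ z ‖ * ‖ Tᶜ k z ‖)
  T-suc-norm k z = ≤-trans (≤-reflexive (trans (‖ofR*‖ _ _) (*-congʳ (∣unit∣ k))))
    (*-monoˡ-≤ (<⇒≤ (unit-pos k)) (‖‖-mult z (Tᶜ k z)))

  T-bound : ∀ k {z r} → ‖ z ‖ ≤ r → ‖ Tᶜ k z ‖ ≤ T⁺ k r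
  T-bound zero p = ≤-reflexive ‖1‖
  T-bound (suc k) {z} {r} p = ≤-trans (T-suc-norm k z)
    (*-monoˡ-≤ (<⇒≤ (unit-pos k)) (*-mono-≤ (‖‖-nonneg z) (T⁺-nonneg k (≤-trans (‖‖-nonneg z) p)) p (T-bound k p)))

  S⁺-step : ∀ k {r} → 0# ≤ r → S⁺ k r ≤ S⁺ (suc k) r
  S⁺-step k {r} p = ≤-by (T⁺-nonneg k p) (solve 2 (λ a b → b :- con 0ℚ := (a :+ b) :- a) tt (S⁺ k r) (T⁺ k r))

  S⁺-mono : ∀ {j k r} → 0# ≤ r → j ℕ.≤′ k → S⁺ j r ≤ S⁺ k r
  S⁺-mono p ℕ.≤′-refl = ≤-refl
  S⁺-mono {k = suc k} p (ℕ.≤′-step q) = ≤-trans (S⁺-mono p q) (S⁺-step k p)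

  T-ofR : ∀ k r → Tᶜ k (ofR r) ≈ᶜ ofR (T⁺ k r)
  T-ofR zero r = crefl
  T-ofR (suc k) r = ctrans (*ᶜ-congˡ (ctrans (*ᶜ-congˡ (T-ofR k r)) (csym (ofR-* _ _)))) (csym (ofR-* _ _))

  S-ofR : ∀ k r → Sᶜ k (ofR r) ≈ᶜ ofR (S⁺ k r)
  S-ofR zero r = crefl
  S-ofR (suc k) r = ctrans (+ᶜ-cong (S-ofR k r) (T-ofR k r)) (csym (ofR-+ _ _))

  expR : R → R
  expR x = re (exp (ofR x))

  -- For r ≥ 0 the partial sums increase to their limit. This makes `expR r` the common bound in all
  -- estimates obtained termwise from the majorants r^k / k!.
  S⁺≤expR : ∀ k {r} → 0# ≤ r → S⁺ k r ≤ expR r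
  S⁺≤expR k {r} p = ≤-from-ε λ ε ε>0 → let m , h = exp-limit (ofR r) ε ε>0 ; n = k ℕ.⊔ m in
    ≤-trans (S⁺-mono p (ℕ.≤⇒≤′ (ℕ.m≤m⊔n k m)))
      (≤-trans (≤-reflexive (sym (re-cong (S-ofR n r))))
        (≤-by (≤-trans (-x≤∣x∣ _) (≤-trans (∣re-re∣≤ (exp (ofR r)) (Sᶜ n (ofR r))) (h n (ℕ.m≤n⊔m k m))))
          (solve 3 (λ e x y → e :- (:- (x :- y)) := (x :+ e) :- y) tt ε (expR r) (re (Sᶜ n (ofR r))))))

  S-bound : ∀ k {z r} → ‖ z ‖ ≤ r → ‖ Sᶜ k z ‖ ≤ S⁺ k r
  S-bound zero p = ≤-reflexive ‖0‖
  S-bound (suc k) p = ‖‖-+-≤ (S-bound k p) (T-bound k p)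

  exp-bound : ∀ {z r} → ‖ z ‖ ≤ r → ‖ exp z ‖ ≤ expR r
  exp-bound {z} {r} p = ≤-from-ε λ ε ε>0 → let m , h = exp-limit z ε ε>0 in
    ≤-trans (‖‖-reverse (exp z) (Sᶜ m z))
      (+-mono-≤ (≤-trans (S-bound m p) (S⁺≤expR m (≤-trans (‖‖-nonneg z) p))) (h m ℕ.≤-refl))

  T-cong : ∀ k {z w} → z ≈ᶜ w → Tᶜ k z ≈ᶜ Tᶜ k w
  T-cong zero p = crefl
  T-cong (suc k) p = *ᶜ-congˡ (*ᶜ-cong p (T-cong k p))

  S-cong : ∀ k {z w} → z ≈ᶜ w → Sᶜ k z ≈ᶜ Sᶜ k w
  S-cong zero p = crefl
  S-cong (suc k) p = +ᶜ-cong (S-cong k p) (T-cong k p)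

  T-conj : ∀ k z → Tᶜ k (conj z) ≈ᶜ conj (Tᶜ k z)
  T-conj zero z = csym (conj-ofR 1#)
  T-conj (suc k) z = ctrans (*ᶜ-cong (csym (conj-ofR (unit k)))
    (ctrans (*ᶜ-congˡ (T-conj k z)) (csym (conj-* z _)))) (csym (conj-* _ _))

  S-conj : ∀ k z → Sᶜ k (conj z) ≈ᶜ conj (Sᶜ k z)
  S-conj zero z = csym (conj-ofR 0#)
  S-conj (suc k) z = ctrans (+ᶜ-cong (S-conj k z) (T-conj k z)) (csym (conj-+ _ _))

  -- `exp` is an arbitrary function with prescribed limits, so even its compatibility with `_≈ᶜ_`
  -- has to come from the partial sums.
  exp-cong : ∀ {z w} → z ≈ᶜ w → exp z ≈ᶜ exp w
  exp-cong {z} {w} p = ‖-‖≤0⇒≈ (≤-from-*ε 2# 0<2 λ ε ε>0 →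
    let m , h = exp-limit z ε ε>0 ; m′ , h′ = exp-limit w ε ε>0 ; n = m ℕ.⊔ m′ in
    ≤-trans (≤-reflexive (‖‖-cong (ctrans (csolve 4 (λ x y a b → x ⊖ y ⊜ (x ⊖ a) ⊕ (a ⊖ y)) tt (exp z) (exp w)
      (Sᶜ n z) 0ᶜ)
        (+ᶜ-congˡ (+ᶜ-congʳ (S-cong n p))))))
      (≤-trans (‖‖-+-≤ (h n (ℕ.m≤m⊔n m m′)) (≤-trans (≤-reflexive (‖‖-swap _ _)) (h′ n (ℕ.m≤n⊔m m m′))))
        (≤-reflexive (solve 1 (λ e → e :+ e := con 0ℚ :+ (con 1ℚ :+ con 1ℚ) :* e) tt ε))))

  exp-conj : ∀ z → exp (conj z) ≈ᶜ conj (exp z)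
  exp-conj z = ‖-‖≤0⇒≈ (≤-from-*ε 2# 0<2 λ ε ε>0 →
    let m , h = exp-limit (conj z) ε ε>0 ; m′ , h′ = exp-limit z ε ε>0 ; n = m ℕ.⊔ m′ in
    ≤-trans (≤-reflexive (‖‖-cong (ctrans (csolve 3 (λ x y a → x ⊖ y ⊜ (x ⊖ a) ⊕ (a ⊖ y)) tt (exp (conj z))
      (conj (exp z)) (Sᶜ n (conj z)))
        (+ᶜ-congˡ (+ᶜ-congʳ (S-conj n z))))))
      (≤-trans (‖‖-+-≤ (h n (ℕ.m≤m⊔n m m′))
          (≤-trans (≤-reflexive (trans (‖‖-swap _ _) (trans (‖‖-cong
            (ctrans (+ᶜ-congˡ (csym (conj-neg _))) (csym (conj-+ _ _)))) (‖‖-conj _)))) (h′ n (ℕ.m≤n⊔m m m′))))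
        (≤-reflexive (solve 1 (λ e → e :+ e := con 0ℚ :+ (con 1ℚ :+ con 1ℚ) :* e) tt ε))))

  -- The derivative of the term of degree k + 1 is the term of degree k. So `D k` is the first order
  -- Taylor remainder of one term, `F k` that of a partial sum, and |h|² times the majorant series
  -- bounds them.
  module FirstOrder (z h : C) (r : R) (z≤r : ‖ z ‖ ≤ r) (zh≤r : ‖ z +ᶜ h ‖ ≤ r) where
    private
      w = z +ᶜ h
      H = ‖ h ‖ * ‖ h ‖

      r≥0 : 0# ≤ r
      r≥0 = ≤-trans (‖‖-nonneg z) z≤r

      H≥0 : 0# ≤ H
      H≥0 = square-nonneg ‖ h ‖

    D F : ℕ → C
    D k = Tᶜ (suc k) w -ᶜ Tᶜ (suc k) z -ᶜ h *ᶜ Tᶜ k z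
    F k = Sᶜ (suc (suc k)) w -ᶜ Sᶜ (suc (suc k)) z -ᶜ h *ᶜ Sᶜ (suc k) z

    unit-cancelᶜ : ∀ k → ofR (unit k) *ᶜ ofR (nat (suc k)) ≈ᶜ 1ᶜ
    unit-cancelᶜ k = ctrans (csym (ofR-* _ _)) (ofR-cong (unit-cancel k))

    nat-T : ∀ k → ofR (nat (suc k)) *ᶜ Tᶜ (suc k) z ≈ᶜ z *ᶜ Tᶜ k z
    nat-T k = ctrans (csolve 3 (λ n u v → n ⊗ (u ⊗ v) ⊜ (u ⊗ n) ⊗ v) tt (ofR (nat (suc k))) (ofR (unit k))
      (z *ᶜ Tᶜ k z))
      (ctrans (*ᶜ-congʳ (unit-cancelᶜ k)) (*ᶜ-identityˡ _))

    D-zero : D 0 ≈ᶜ 0ᶜ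
    D-zero = ctrans (csolve 3 (λ u z h → u ⊗ ((z ⊕ h) ⊗ ccon 1ℚ) ⊖ u ⊗ (z ⊗ ccon 1ℚ) ⊖ h ⊗ ccon 1ℚ ⊜
      (u ⊗ ccon 1ℚ ⊖ ccon 1ℚ) ⊗ h) tt (ofR (unit 0)) z h)
      (ctrans (*ᶜ-congʳ (ctrans (+ᶜ-congʳ (ctrans (*ᶜ-congˡ (ofR-cong (sym nat-one))) (unit-cancelᶜ 0)))
        (-ᶜ-inverseʳ 1ᶜ))) (*ᶜ-zeroˡ h))
      where
      nat-one : nat 1 ≈ 1#
      nat-one = trans (nat-suc 0) (trans (+-congˡ nat-zero) (+-identityʳ 1#))

    -- Since z T_k = (k + 1) T_{k+1}, the contributions linear in h add up to (k + 2) h T_{k+1}. The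
    -- factor 1/(k + 2) turns this into the h T_{k+1} that is subtracted, and only `Q` remains.
    D-suc : ∀ k → D (suc k) ≈ᶜ ofR (unit (suc k)) *ᶜ (h *ᶜ h *ᶜ Tᶜ k z +ᶜ w *ᶜ D k)
    D-suc k = begin
      D (suc k)
        ≈⟨ csolve 6 (λ u z h A B P → u ⊗ ((z ⊕ h) ⊗ A) ⊖ u ⊗ (z ⊗ B) ⊖ h ⊗ B ⊜ u ⊗
          (h ⊗ (z ⊗ P) ⊕ h ⊗ B ⊕ (h ⊗ h ⊗ P ⊕ (z ⊕ h) ⊗ (A ⊖ B ⊖ h ⊗ P))) ⊖ h ⊗ B) tt
             u z h (Tᶜ (suc k) w) (Tᶜ (suc k) z) (Tᶜ k z) ⟩
      u *ᶜ (h *ᶜ (z *ᶜ Tᶜ k z) +ᶜ h *ᶜ Tᶜ (suc k) z +ᶜ Q) -ᶜ h *ᶜ Tᶜ (suc k) z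
        ≈⟨ +ᶜ-congʳ (*ᶜ-congˡ (+ᶜ-congʳ (+ᶜ-congʳ (*ᶜ-congˡ (csym (nat-T k)))))) ⟩
      u *ᶜ (h *ᶜ (N *ᶜ Tᶜ (suc k) z) +ᶜ h *ᶜ Tᶜ (suc k) z +ᶜ Q) -ᶜ h *ᶜ Tᶜ (suc k) z
        ≈⟨ csolve 5 (λ u h N B Q → u ⊗ (h ⊗ (N ⊗ B) ⊕ h ⊗ B ⊕ Q) ⊖ h ⊗ B ⊜ (u ⊗ (ccon 1ℚ ⊕ N) ⊖ ccon 1ℚ) ⊗
          (h ⊗ B) ⊕ u ⊗ Q) tt u h N (Tᶜ (suc k) z) Q ⟩
      (u *ᶜ (1ᶜ +ᶜ N) -ᶜ 1ᶜ) *ᶜ (h *ᶜ Tᶜ (suc k) z) +ᶜ u *ᶜ Q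
        ≈⟨ +ᶜ-congʳ (ctrans (*ᶜ-congʳ (ctrans (+ᶜ-congʳ (ctrans
          (*ᶜ-congˡ (ctrans (csym (ofR-+ _ _)) (ofR-cong (sym (nat-suc (suc k)))))) (unit-cancelᶜ (suc k))))
          (-ᶜ-inverseʳ 1ᶜ))) (*ᶜ-zeroˡ _)) ⟩
      0ᶜ +ᶜ u *ᶜ Q
        ≈⟨ +ᶜ-identityˡ _ ⟩
      u *ᶜ Q ∎
      where
      open C-Reasoning
      u = ofR (unit (suc k))
      N = ofR (nat (suc k))
      Q = h *ᶜ h *ᶜ Tᶜ k z +ᶜ w *ᶜ D k

    r*t : ∀ k → r * T⁺ k r ≈ nat (suc k) * T⁺ (suc k) r
    r*t k = sym (trans (solve 3 (λ n u v → n :* (u :* v) := (u :* n) :* v) tt (nat (suc k)) (unit k) (r * T⁺ k r))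
      (trans (*-congʳ (unit-cancel k)) (*-identityˡ _)))

    D-step : ∀ k {b} → ‖ D k ‖ ≤ b → ‖ D (suc k) ‖ ≤ unit (suc k) * (H * T⁺ k r + r * b)
    D-step k {b} p = ≤-trans (≤-reflexive (trans (‖‖-cong (D-suc k))
      (trans (‖ofR*‖ _ _) (*-congʳ (∣unit∣ (suc k))))))
      (*-monoˡ-≤ (<⇒≤ (unit-pos (suc k))) (‖‖-+-≤ (‖‖-mult-≤ (‖‖-mult h h) (T-bound k z≤r)) (‖‖-mult-≤ zh≤r p)))

    unit*nat≤1 : ∀ k → unit (suc k) * nat (suc k) ≤ 1#
    unit*nat≤1 k = ≤-trans (*-monoˡ-≤ (<⇒≤ (unit-pos (suc k))) (nat-mono (ℕ.n≤1+n (suc k))))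
      (≤-reflexive (unit-cancel (suc k)))

    D-bound : ∀ k → ‖ D (suc k) ‖ ≤ H * T⁺ k r
    D-bound zero = ≤-trans (D-step 0 (≤-reflexive (trans (‖‖-cong D-zero) ‖0‖)))
      (≤-trans (≤-reflexive (solve 3 (λ u H r → u :* (H :* con 1ℚ :+ r :* con 0ℚ) := H :* (u :* con 1ℚ)) tt
        (unit 1) H r))
        (*-monoˡ-≤ H≥0 (≤-trans (*-monoˡ-≤ (<⇒≤ (unit-pos 1)) (≤-reflexive (sym nat-one))) (unit*nat≤1 0))))
      where
      nat-one : nat 1 ≈ 1#
      nat-one = trans (nat-suc 0) (trans (+-congˡ nat-zero) (+-identityʳ 1#))
    D-bound (suc k) = ≤-trans (D-step (suc k) (D-bound k))
      (≤-trans (≤-reflexive (trans (*-congˡ (+-congˡ (trans (solve 3 (λ r H q → r :* (H :* q) := H :* (r :* q)) tt r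
        H (T⁺ k r)) (*-congˡ (r*t k)))))
          (trans (solve 4 (λ u H q n → u :* (H :* q :+ H :* (n :* q)) := (u :* (con 1ℚ :+ n)) :* (H :* q)) tt
            (unit (suc (suc k))) H (T⁺ (suc k) r) (nat (suc k)))
            (*-congʳ (*-congˡ (sym (nat-suc (suc k))))))))
        (≤-trans (*-monoʳ-≤ (*-nonneg H≥0 (T⁺-nonneg (suc k) r≥0)) (unit*nat≤1 (suc k)))
          (≤-reflexive (*-identityˡ _))))

    F-bound : ∀ k → ‖ F k ‖ ≤ H * S⁺ k r
    F-bound zero = ≤-reflexive (trans (‖‖-cong (ctrans
      (csolve 3 (λ a b h → ((ccon 0ℚ ⊕ ccon 1ℚ) ⊕ a) ⊖ ((ccon 0ℚ ⊕ ccon 1ℚ) ⊕ b) ⊖ h ⊗ (ccon 0ℚ ⊕ ccon 1ℚ) ⊜ a ⊖ b ⊖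
        h ⊗ ccon 1ℚ) tt (Tᶜ 1 w) (Tᶜ 1 z) h) D-zero)) (trans ‖0‖ (sym (zeroʳ H))))
    F-bound (suc k) = ≤-trans (≤-reflexive (‖‖-cong
        (csolve 7 (λ a b c d e f h → (a ⊕ b) ⊖ (c ⊕ d) ⊖ h ⊗ (e ⊕ f) ⊜ (a ⊖ c ⊖ h ⊗ e) ⊕ (b ⊖ d ⊖ h ⊗ f)) tt
          (Sᶜ (suc (suc k)) w) (Tᶜ (suc (suc k)) w) (Sᶜ (suc (suc k)) z) (Tᶜ (suc (suc k)) z) (Sᶜ (suc k) z)
            (Tᶜ (suc k) z) h)))
      (≤-trans (‖‖-+-≤ (F-bound k) (D-bound k)) (≤-reflexive (sym (distribˡ H _ _))))

    exp-first-order : ‖ exp (z +ᶜ h) -ᶜ exp z -ᶜ h *ᶜ exp z ‖ ≤ H * expR r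
    exp-first-order = ≤-from-*ε (2# + ‖ h ‖) (+-pos 0<2 (‖‖-nonneg h)) λ ε ε>0 →
      let m , f = exp-limit w ε ε>0 ; m′ , f′ = exp-limit z ε ε>0 ; n = m ℕ.⊔ m′
          le = ℕ.≤-trans (ℕ.m≤m⊔n m m′) (ℕ.≤-trans (ℕ.n≤1+n n) (ℕ.n≤1+n (suc n)))
          le′ = ℕ.≤-trans (ℕ.m≤n⊔m m m′) (ℕ.n≤1+n n)
      in ≤-trans (≤-reflexive (‖‖-cong (csolve 6 (λ x y h a b c → x ⊖ y ⊖ h ⊗ y ⊜ (a ⊖ b ⊖ h ⊗ c) ⊕ ((x ⊖ a) ⊖ (y ⊖ b) ⊖ h ⊗ (y ⊖ c))) tt
             (exp w) (exp z) h (Sᶜ (suc (suc n)) w) (Sᶜ (suc (suc n)) z) (Sᶜ (suc n) z))))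
           (≤-trans (‖‖-+-≤ (≤-trans (F-bound n) (*-monoˡ-≤ H≥0 (S⁺≤expR n r≥0)))
               (≤-trans (‖‖-triangle-- _ _) (+-mono-≤ (≤-trans (‖‖-triangle-- _ _)
                 (+-mono-≤ (f _ le) (f′ _ (ℕ.≤-trans le′ (ℕ.n≤1+n (suc n)))))) (‖‖-mult-≤ ≤-refl (f′ _ le′)))))
             (≤-reflexive (solve 3 (λ k e h → k :+ ((e :+ e) :+ h :* e) := k :+ ((con 1ℚ :+ con 1ℚ) :+ h) :* e) tt
               (H * expR r) ε ‖ h ‖)))

  open FirstOrder public using (exp-first-order)

  unit≤1 : ∀ k → unit k ≤ 1#
  unit≤1 k = ≤-trans (unit-anti {0} {k} z≤n) (≤-reflexive (trans (sym (*-identityʳ _))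
    (trans (*-congˡ (sym (trans (nat-suc 0) (trans (+-congˡ nat-zero) (+-identityʳ 1#))))) (unit-cancel 0))))

  T-suc-norm′ : ∀ k z {b} → ‖ Tᶜ k z ‖ ≤ b → ‖ Tᶜ (suc k) z ‖ ≤ ‖ z ‖ * b
  T-suc-norm′ k z {b} p = ≤-trans (T-suc-norm k z)
    (≤-trans (*-mono-≤ (<⇒≤ (unit-pos k)) (*-nonneg (‖‖-nonneg z) (≤-trans (‖‖-nonneg _) p)) (unit≤1 k)
      (*-monoˡ-≤ (‖‖-nonneg z) p))
      (≤-reflexive (*-identityˡ _)))

  quadratic : C → C
  quadratic h = 1ᶜ +ᶜ h +ᶜ ofR ½# *ᶜ (h *ᶜ h)

  -- The first three terms of the series are `quadratic h` exactly. From every later term a factor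
  -- |h|³ is taken out, at the cost of dropping three coefficients that are at most 1.
  S-third-order : ∀ k {h r} → ‖ h ‖ ≤ r → ‖ Sᶜ (3 ℕ.+ k) h -ᶜ quadratic h ‖ ≤ ‖ h ‖ * (‖ h ‖ * (‖ h ‖ * S⁺ k r))
  S-third-order zero {h} {r} p = ≤-trans (≈⇒‖-‖≤0
    (ctrans (csolve 3 (λ u v h → ((ccon 0ℚ ⊕ ccon 1ℚ) ⊕ u ⊗ (h ⊗ ccon 1ℚ)) ⊕ v ⊗ (h ⊗ (u ⊗ (h ⊗ ccon 1ℚ))) ⊜ ccon 1ℚ
      ⊕ u ⊗ h ⊕ (v ⊗ u) ⊗ (h ⊗ h)) tt (ofR (unit 0)) (ofR (unit 1)) h)
      (+ᶜ-cong (+ᶜ-congˡ (ctrans (*ᶜ-congʳ (ofR-cong u0)) (*ᶜ-identityˡ h)))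
        (*ᶜ-congʳ (ctrans (csym (ofR-* _ _)) (ofR-cong (trans (*-cong u1 u0) (*-identityʳ _))))))))
    (≤-reflexive (solve 1 (λ h → con 0ℚ := h :* (h :* (h :* con 0ℚ))) tt ‖ h ‖))
    where
    nat-one : nat 1 ≈ 1#
    nat-one = trans (nat-suc 0) (trans (+-congˡ nat-zero) (+-identityʳ 1#))
    u0 : unit 0 ≈ 1#
    u0 = trans (sym (*-identityʳ _)) (trans (*-congˡ (sym nat-one)) (unit-cancel 0))
    u1 : unit 1 ≈ ½#
    u1 = trans (solve 1 (λ u → u := (u :* (con 1ℚ :+ con 1ℚ)) :* con ½) tt (unit 1))
      (trans (*-congʳ (trans (*-congˡ (sym (trans (nat-suc 1) (+-congˡ nat-one)))) (unit-cancel 1)))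
      (*-identityˡ _))
  S-third-order (suc k) {h} {r} p = ≤-trans (≤-reflexive (‖‖-cong (csolve 3 (λ a b q → (a ⊕ b) ⊖ q ⊜ (a ⊖ q) ⊕ b) tt
    (Sᶜ (3 ℕ.+ k) h) (Tᶜ (3 ℕ.+ k) h) (quadratic h))))
    (≤-trans (‖‖-+-≤ (S-third-order k p) (T-suc-norm′ (2 ℕ.+ k) h
      (T-suc-norm′ (1 ℕ.+ k) h (T-suc-norm′ k h (T-bound k p)))))
      (≤-reflexive (solve 3 (λ h a b → h :* (h :* (h :* a)) :+ h :* (h :* (h :* b)) := h :* (h :* (h :* (a :+ b))))
        tt ‖ h ‖ (S⁺ k r) (T⁺ k r))))

  exp-third-order : ∀ {h r} → ‖ h ‖ ≤ r → ‖ exp h -ᶜ quadratic h ‖ ≤ ‖ h ‖ * (‖ h ‖ * (‖ h ‖ * expR r))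
  exp-third-order {h} {r} p = ≤-from-ε λ ε ε>0 → let m , f = exp-limit h ε ε>0 in
    ≤-trans (‖‖-through (exp h) (Sᶜ (3 ℕ.+ m) h) (quadratic h))
      (≤-trans (+-mono-≤ (f _ (ℕ.m≤n+m m 3)) (≤-trans (S-third-order m p)
          (*-monoˡ-≤ (‖‖-nonneg h) (*-monoˡ-≤ (‖‖-nonneg h) (*-monoˡ-≤ (‖‖-nonneg h)
            (S⁺≤expR m (≤-trans (‖‖-nonneg h) p)))))))
        (≤-reflexive (+-comm _ _)))

  exp-zero : exp 0ᶜ ≈ᶜ 1ᶜ
  exp-zero = ‖-‖≤0⇒≈ (≤-trans (≤-reflexive (‖‖-cong (+ᶜ-congˡ
    (-ᶜ-cong (csolve 0 (ccon 1ℚ ⊜ ccon 1ℚ ⊕ ccon 0ℚ ⊕ ccon ½ ⊗ (ccon 0ℚ ⊗ ccon 0ℚ)) tt)))))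
    (≤-trans (exp-third-order ≤-refl) (≤-reflexive (trans (*-congʳ ‖0‖) (zeroˡ _)))))

  -- x ↦ exp (z + x w) exp (w - x w) is constant on [0, 1], because over a step of length δ it moves by O(δ²).

  module Addition (z w : C) where
    private
      W = ‖ w ‖
      r = ‖ z ‖ + (W + W)
      β = expR r

      β≥0 : 0# ≤ β
      β≥0 = ≤-trans (‖‖-nonneg (exp z)) (exp-bound (≤-by (+-nonneg (‖‖-nonneg w) (‖‖-nonneg w))
        (solve 2 (λ a b → (b :+ b) :- con 0ℚ := (a :+ (b :+ b)) :- a) tt ‖ z ‖ W)))

      K : R
      K = W * W * (β * (β * (2# + 1# + W)))

      A B : R → C
      A x = z +ᶜ ofR x *ᶜ w
      B x = w -ᶜ ofR x *ᶜ w

      A-bound : ∀ {x} → 0# ≤ x → x ≤ 1# → ‖ A x ‖ ≤ r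
      A-bound {x} p q = ≤-trans (‖‖-+-≤ ≤-refl (≤-trans (≤-reflexive (trans (‖ofR*‖ x w) (*-congʳ (nonneg⇒∣∣ p))))
        (*-monoʳ-≤ (‖‖-nonneg w) q)))
        (≤-by (‖‖-nonneg w) (solve 2 (λ a b → b :- con 0ℚ := (a :+ (b :+ b)) :- (a :+ con 1ℚ :* b)) tt ‖ z ‖ W))

      B-bound : ∀ {x} → 0# ≤ x → x ≤ 1# → ‖ B x ‖ ≤ r
      B-bound {x} p q = ≤-trans (‖‖-triangle-- _ _) (≤-trans (+-mono-≤ ≤-refl
        (≤-trans (≤-reflexive (trans (‖ofR*‖ x w) (*-congʳ (nonneg⇒∣∣ p)))) (*-monoʳ-≤ (‖‖-nonneg w) q)))
        (≤-by (‖‖-nonneg z) (solve 2 (λ a b → a :- con 0ℚ := (a :+ (b :+ b)) :- (b :+ con 1ℚ :* b)) tt ‖ z ‖ W)))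

      product : R → C
      product x = exp (A x) *ᶜ exp (B x)

      step : ∀ x δ → 0# ≤ x → 0# ≤ δ → x + δ ≤ 1# → ‖ product (x + δ) -ᶜ product x ‖ ≤ δ * δ * K
      step x δ x≥0 δ≥0 x+δ≤1 = ≤-trans (≤-reflexive (‖‖-cong eq))
        (≤-trans (‖‖-+-≤ (‖‖-+-≤ (‖‖-mult-≤ (≤-reflexive (‖‖-neg _)) (‖‖-mult-≤ a≤ b≤))
              (‖‖-mult-≤ (≤-trans (‖‖-mult-≤ (‖‖-+-≤ (≤-reflexive ‖1‖) h≤) a≤) ≤-refl) e₂≤)) (‖‖-mult-≤ e₁≤ b′≤))
          (≤-trans (+-mono-≤ (+-mono-≤ (*-monoʳ-≤ (*-nonneg β≥0 β≥0) hh≤) ≤-refl) ≤-refl) fin))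
        where
        x≤1 : x ≤ 1#
        x≤1 = ≤-trans (≤-by δ≥0 (solve 2 (λ x d → d :- con 0ℚ := (x :+ d) :- x) tt x δ)) x+δ≤1
        δ≤1 : δ ≤ 1#
        δ≤1 = ≤-trans (≤-by x≥0 (solve 2 (λ x d → x :- con 0ℚ := (x :+ d) :- d) tt x δ)) x+δ≤1
        h = ofR δ *ᶜ w
        a = exp (A x)
        b = exp (B x)
        e₁ = exp (A x +ᶜ h) -ᶜ a -ᶜ h *ᶜ a
        e₂ = exp (B x +ᶜ -ᶜ h) -ᶜ b -ᶜ (-ᶜ h) *ᶜ b
        A+ : A (x + δ) ≈ᶜ A x +ᶜ h
        A+ = ctrans (+ᶜ-congˡ (*ᶜ-congʳ (ofR-+ x δ))) (csolve 4 (λ z x d w → z ⊕ (x ⊕ d) ⊗ w ⊜ z ⊕ x ⊗ w ⊕ d ⊗ w) tt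
          z (ofR x) (ofR δ) w)
        B+ : B (x + δ) ≈ᶜ B x +ᶜ -ᶜ h
        B+ = ctrans (+ᶜ-congˡ (-ᶜ-cong (*ᶜ-congʳ (ofR-+ x δ))))
          (csolve 3 (λ x d w → w ⊖ (x ⊕ d) ⊗ w ⊜ (w ⊖ x ⊗ w) ⊕ ⊝ (d ⊗ w)) tt (ofR x) (ofR δ) w)
        -- With exp (A + h) = a + h a + e₁ and exp (B - h) = b - h b + e₂ the terms linear in h
        -- cancel, so every remaining summand is of second order in δ.
        eq : product (x + δ) -ᶜ product x ≈ᶜ
          (-ᶜ (h *ᶜ h)) *ᶜ (a *ᶜ b) +ᶜ ((1ᶜ +ᶜ h) *ᶜ a) *ᶜ e₂ +ᶜ e₁ *ᶜ exp (B x +ᶜ -ᶜ h)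
        eq = ctrans (+ᶜ-congʳ (*ᶜ-cong (exp-cong A+) (exp-cong B+)))
          (csolve 5 (λ a b h p q → p ⊗ q ⊖ a ⊗ b ⊜ (⊝ (h ⊗ h)) ⊗ (a ⊗ b) ⊕ ((ccon 1ℚ ⊕ h) ⊗ a) ⊗
            (q ⊖ b ⊖ (⊝ h) ⊗ b) ⊕ (p ⊖ a ⊖ h ⊗ a) ⊗ q) tt
            a b h (exp (A x +ᶜ h)) (exp (B x +ᶜ -ᶜ h)))
        0≤x+δ = +-nonneg x≥0 δ≥0
        Ax≤ = A-bound x≥0 x≤1
        Bx≤ = B-bound x≥0 x≤1
        Ah≤ = ≤-trans (≤-reflexive (‖‖-cong (csym A+))) (A-bound 0≤x+δ x+δ≤1)
        Bh≤ = ≤-trans (≤-reflexive (‖‖-cong (csym B+))) (B-bound 0≤x+δ x+δ≤1)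
        a≤ = exp-bound Ax≤
        b≤ = exp-bound Bx≤
        b′≤ = exp-bound Bh≤
        ‖h‖ : ‖ h ‖ ≈ δ * W
        ‖h‖ = trans (‖ofR*‖ δ w) (*-congʳ (nonneg⇒∣∣ δ≥0))
        h≤ : ‖ h ‖ ≤ W
        h≤ = ≤-trans (≤-reflexive ‖h‖) (≤-trans (*-monoʳ-≤ (‖‖-nonneg w) δ≤1) (≤-reflexive (*-identityˡ W)))
        hh≤ : ‖ h *ᶜ h ‖ ≤ δ * W * (δ * W)
        hh≤ = ‖‖-mult-≤ (≤-reflexive ‖h‖) (≤-reflexive ‖h‖)
        e₁≤ : ‖ e₁ ‖ ≤ δ * W * (δ * W) * β
        e₁≤ = ≤-trans (exp-first-order (A x) h r Ax≤ Ah≤) (≤-reflexive (*-congʳ (*-cong ‖h‖ ‖h‖)))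
        e₂≤ : ‖ e₂ ‖ ≤ δ * W * (δ * W) * β
        e₂≤ = ≤-trans (exp-first-order (B x) (-ᶜ h) r Bx≤ Bh≤)
          (≤-reflexive (*-congʳ (*-cong (trans (‖‖-neg h) ‖h‖) (trans (‖‖-neg h) ‖h‖))))
        fin : δ * W * (δ * W) * (β * β) + (1# + W) * β * (δ * W * (δ * W) * β) + δ * W * (δ * W) * β * β ≤ δ * δ * K
        fin = ≤-reflexive (solve 3 (λ d W b → d :* W :* (d :* W) :* (b :* b) :+ (con 1ℚ :+ W) :* b :*
          (d :* W :* (d :* W) :* b) :+ d :* W :* (d :* W) :* b :* b := d :* d :*
          (W :* W :* (b :* (b :* ((con 1ℚ :+ con 1ℚ) :+ con 1ℚ :+ W))))) tt δ W β)

      steps : ∀ n k → k ℕ.≤ suc n → ‖ product (nat k * unit n) -ᶜ product 0# ‖ ≤ nat k * (unit n * unit n * K)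
      steps n zero _ = ≤-trans (≈⇒‖-‖≤0 (*ᶜ-cong (exp-cong (+ᶜ-congˡ (*ᶜ-congʳ (ofR-cong e))))
        (exp-cong (+ᶜ-congˡ (-ᶜ-cong (*ᶜ-congʳ (ofR-cong e)))))))
        (≤-reflexive (trans (sym (zeroˡ _)) (*-congʳ (sym nat-zero))))
        where
        e : nat 0 * unit n ≈ 0#
        e = trans (*-congʳ nat-zero) (zeroˡ _)
      steps n (suc k) le = ≤-trans (‖‖-through _ (product (nat k * unit n)) _)
        (≤-trans (+-mono-≤ (≤-trans (≤-reflexive (‖‖-cong (+ᶜ-congʳ product-cong))) (step (nat k * unit n) (unit n)
            (*-nonneg (nat-nonneg k) (<⇒≤ (unit-pos n))) (<⇒≤ (unit-pos n))
            (≤-trans (≤-reflexive (sym e)) (≤-trans (*-monoʳ-≤ (<⇒≤ (unit-pos n)) (nat-mono le))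
              (≤-reflexive (trans (*-comm _ _) (unit-cancel n)))))))
            (steps n k (ℕ.≤-trans (ℕ.n≤1+n k) le)))
          (≤-reflexive (trans (solve 2 (λ n q → q :+ n :* q := (con 1ℚ :+ n) :* q) tt (nat k) (unit n * unit n * K))
            (*-congʳ (sym (nat-suc k))))))
        where
        e : nat (suc k) * unit n ≈ nat k * unit n + unit n
        e = trans (*-congʳ (nat-suc k)) (solve 2 (λ n u → (con 1ℚ :+ n) :* u := n :* u :+ u) tt (nat k) (unit n))
        product-cong : product (nat (suc k) * unit n) ≈ᶜ product (nat k * unit n + unit n)
        product-cong = *ᶜ-cong (exp-cong (+ᶜ-congˡ (*ᶜ-congʳ (ofR-cong e))))
          (exp-cong (+ᶜ-congˡ (-ᶜ-cong (*ᶜ-congʳ (ofR-cong e)))))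

      total : ∀ n → ‖ product 1# -ᶜ product 0# ‖ ≤ K * unit n
      total n = ≤-trans (≤-reflexive (‖‖-cong (+ᶜ-congʳ (*ᶜ-cong (exp-cong (+ᶜ-congˡ (*ᶜ-congʳ (ofR-cong e))))
        (exp-cong (+ᶜ-congˡ (-ᶜ-cong (*ᶜ-congʳ (ofR-cong e)))))))))
        (≤-trans (steps n (suc n) ℕ.≤-refl) (≤-reflexive (trans
          (solve 3 (λ n u k → n :* (u :* u :* k) := (u :* n) :* (k :* u)) tt (nat (suc n)) (unit n) K)
          (trans (*-congʳ (unit-cancel n)) (*-identityˡ _)))))
        where
        e : 1# ≈ nat (suc n) * unit n
        e = trans (sym (unit-cancel n)) (*-comm _ _)

    exp-+ : exp (z +ᶜ w) ≈ᶜ exp z *ᶜ exp w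
    exp-+ = begin
      exp (z +ᶜ w) ≈⟨ csolve 1 (λ x → x ⊜ x ⊗ ccon 1ℚ) tt (exp (z +ᶜ w)) ⟩
      exp (z +ᶜ w) *ᶜ 1ᶜ ≈⟨ *ᶜ-cong (exp-cong (csolve 2 (λ z w → z ⊕ w ⊜ z ⊕ ccon 1ℚ ⊗ w) tt z w))
        (csym (ctrans (exp-cong (csolve 1 (λ w → w ⊖ ccon 1ℚ ⊗ w ⊜ ccon 0ℚ) tt w)) exp-zero)) ⟩
      product 1# ≈⟨ ‖-‖≤0⇒≈ (≤0-from-unit K total) ⟩
      product 0# ≈⟨ *ᶜ-cong (exp-cong (csolve 2 (λ z w → z ⊕ ccon 0ℚ ⊗ w ⊜ z) tt z w))
        (exp-cong (csolve 1 (λ w → w ⊖ ccon 0ℚ ⊗ w ⊜ w) tt w)) ⟩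
      exp z *ᶜ exp w ∎
      where open C-Reasoning

  open Addition public using (exp-+)

  exp-neg : ∀ z → exp z *ᶜ exp (-ᶜ z) ≈ᶜ 1ᶜ
  exp-neg z = ctrans (csym (exp-+ z (-ᶜ z))) (ctrans (exp-cong (-ᶜ-inverseʳ z)) exp-zero)

  exp≉0 : ∀ z → ¬ (exp z ≈ᶜ 0ᶜ)
  exp≉0 z = *ᶜ≈1⇒≉0 (exp-neg z)

  exp-ofR : ∀ x → exp (ofR x) ≈ᶜ ofR (expR x)
  exp-ofR x = refl ,ᶜ trans (solve 1 (λ y → y := con ½ :* (y :- :- y)) tt y)
    (trans (*-congˡ (trans (+-congˡ (-‿cong e)) (-‿inverseʳ y))) (zeroʳ ½#))
    where
    y = im (exp (ofR x))
    e : - y ≈ y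
    e = trans (sym (im-conj _)) (trans (im-cong (csym (exp-conj (ofR x)))) (im-cong (exp-cong (conj-ofR x))))

  expR-cong : ∀ {x y} → x ≈ y → expR x ≈ expR y
  expR-cong p = re-cong (exp-cong (ofR-cong p))

  expR-+ : ∀ x y → expR (x + y) ≈ expR x * expR y
  expR-+ x y = re-cong (ctrans (exp-cong (ofR-+ x y)) (ctrans (exp-+ (ofR x) (ofR y))
    (ctrans (*ᶜ-cong (exp-ofR x) (exp-ofR y)) (csym (ofR-* _ _)))))

  expR-zero : expR 0# ≈ 1#
  expR-zero = re-cong exp-zero

  expR-pos : ∀ x → 0# < expR x
  expR-pos x = <-resp₂ refl (trans (sym (expR-+ (½# * x) (½# * x))) (expR-cong (halves x)))
    (square-pos λ e → exp≉0 (ofR (½# * x)) (ctrans (exp-ofR _) (ofR-cong e)))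

  expR-neg : ∀ x → expR x * expR (- x) ≈ 1#
  expR-neg x = trans (sym (expR-+ x (- x))) (trans (expR-cong (-‿inverseʳ x)) expR-zero)

  1+x≤expR : ∀ {x} → 0# ≤ x → 1# + x ≤ expR x
  1+x≤expR {x} p = ≤-trans (≤-reflexive (trans (+-congˡ (sym (trans (*-congʳ u0)
    (solve 1 (λ x → con 1ℚ :* (x :* con 1ℚ) := x) tt x)))) (solve 2 (λ a b → a :+ b := (con 0ℚ :+ a) :+ b) tt 1#
    (unit 0 * (x * 1#)))))
    (S⁺≤expR 2 p)
    where
    u0 : unit 0 ≈ 1#
    u0 = trans (sym (*-identityʳ _)) (trans (*-congˡ (sym (trans (nat-suc 0)
      (trans (+-congˡ nat-zero) (+-identityʳ 1#))))) (unit-cancel 0))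

  expR-mono-< : ∀ {x y} → x < y → expR x < expR y
  expR-mono-< {x} {y} p = <-resp₂ (*-identityʳ _) (trans (sym (expR-+ x (y - x)))
    (expR-cong (solve 2 (λ x y → x :+ (y :- x) := y) tt x y)))
    (*-monoˡ-< (expR-pos x) (<-≤-trans (<-by (<⇒0< p) (solve 1 (λ d → d :- con 0ℚ := (con 1ℚ :+ d) :- con 1ℚ) tt
      (y - x))) (1+x≤expR (<⇒≤ (<⇒0< p)))))

  expR-mono-≤ : ∀ {x y} → x ≤ y → expR x ≤ expR y
  expR-mono-≤ p with ≤-split p
  ... | inj₁ q = <⇒≤ (expR-mono-< q)
  ... | inj₂ q = ≤-reflexive (expR-cong q)

  expR-cancel-≤ : ∀ {x y} → expR x ≤ expR y → x ≤ y
  expR-cancel-≤ p q = p (expR-mono-< q)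

  expR-injective : ∀ {x y} → expR x ≈ expR y → x ≈ y
  expR-injective p = ≤-antisym (expR-cancel-≤ (≤-reflexive p)) (expR-cancel-≤ (≤-reflexive (sym p)))

  -- Limits and bisection

  hp : ℕ → R
  hp zero = 1#
  hp (suc n) = ½# * hp n

  hp-pos : ∀ n → 0# < hp n
  hp-pos zero = 0<1
  hp-pos (suc n) = half-pos (hp-pos n)

  hp*nat≤1 : ∀ n → nat (suc n) * hp n ≤ 1#
  hp*nat≤1 zero = ≤-reflexive (trans (*-identityʳ _) (trans (nat-suc 0)
    (trans (+-congˡ nat-zero) (+-identityʳ 1#))))
  hp*nat≤1 (suc n) = ≤-trans
    (≤-by (*-nonneg (nat-nonneg n) (<⇒≤ (half-pos (hp-pos n))))
      (trans (solve 2 (λ n h → n :* (con ½ :* h) :- con 0ℚ := (con 1ℚ :+ n) :* h :- (con 1ℚ :+ (con 1ℚ :+ n)) :*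
        (con ½ :* h)) tt (nat n) (hp n))
        (+-cong (*-congʳ (sym (nat-suc n))) (-‿cong (*-congʳ (sym
          (trans (nat-suc (suc n)) (+-congˡ (nat-suc n)))))))))
    (hp*nat≤1 n)

  hp≤unit : ∀ n → hp n ≤ unit n
  hp≤unit n = *-cancelˡ-≤ (nat-pos n) (≤-trans (hp*nat≤1 n) (≤-reflexive
    (trans (sym (unit-cancel n)) (*-comm _ _))))

  hp-small : ∀ {c} → 0# ≤ c → ∀ {ε} → 0# < ε → ∃ λ N → c * hp N < ε
  hp-small {c} c≥0 ε>0 = let N , h = archimedean-small c ε>0 in
    N , ≤-<-trans (*-monoˡ-≤ c≥0 (hp≤unit N)) (h N ℕ.≤-refl)

  ≤-from-hp : ∀ {x y} c → 0# ≤ c → (∀ n → x ≤ y + c * hp n) → x ≤ y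
  ≤-from-hp c c≥0 h = ≤-from-ε λ ε ε>0 → let N , q = hp-small c≥0 ε>0 in
    ≤-trans (h N) (+-mono-≤ ≤-refl (<⇒≤ q))

  -- the telescoped form of the geometric estimate makes the induction go through
  geometric-drift : ∀ (x : ℕ → R) c → (∀ n → ∣ x (suc n) - x n ∣ ≤ c * hp n) →
    ∀ n k → ∣ x (k ℕ.+ n) - x n ∣ ≤ 2# * c * (hp n - hp (k ℕ.+ n))
  geometric-drift x c h n zero = ≤-reflexive (trans (∣∣-cong (-‿inverseʳ _)) (trans (nonneg⇒∣∣ ≤-refl)
    (solve 2 (λ c a → con 0ℚ := (con 1ℚ :+ con 1ℚ) :* c :* (a :- a)) tt c (hp n))))
  geometric-drift x c h n (suc k) = ≤-trans
    (≤-trans (≤-reflexive (∣∣-cong (solve 3 (λ a b d → a :- d := (a :- b) :+ (b :- d)) tt (x (suc k ℕ.+ n))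
      (x (k ℕ.+ n)) (x n)))) (∣∣-triangle _ _))
    (≤-trans (+-mono-≤ (h (k ℕ.+ n)) (geometric-drift x c h n k))
      (≤-reflexive (solve 3 (λ c a b → c :* b :+ (con 1ℚ :+ con 1ℚ) :* c :* (a :- b) := (con 1ℚ :+ con 1ℚ) :* c :*
        (a :- con ½ :* b)) tt c (hp n) (hp (k ℕ.+ n)))))

  geometric-bound : ∀ (x : ℕ → R) c → 0# ≤ c → (∀ n → ∣ x (suc n) - x n ∣ ≤ c * hp n) →
    ∀ m n → n ℕ.≤ m → ∣ x m - x n ∣ ≤ 2# * c * hp n
  geometric-bound x c c≥0 h m n n≤m = ≡.subst (λ m → ∣ x m - x n ∣ ≤ 2# * c * hp n) (ℕ.m∸n+n≡m n≤m)
    (≤-trans (geometric-drift x c h n (m ℕ.∸ n))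
      (≤-by (*-nonneg (*-nonneg (<⇒≤ 0<2) c≥0) (<⇒≤ (hp-pos ((m ℕ.∸ n) ℕ.+ n))))
        (solve 3 (λ c a b → (con 1ℚ :+ con 1ℚ) :* c :* b :- con 0ℚ := (con 1ℚ :+ con 1ℚ) :* c :* a :-
          (con 1ℚ :+ con 1ℚ) :* c :* (a :- b)) tt c (hp n) (hp ((m ℕ.∸ n) ℕ.+ n)))))

  ∣-∣-swap : ∀ x y → ∣ x - y ∣ ≈ ∣ y - x ∣
  ∣-∣-swap x y = trans (∣∣-cong (solve 2 (λ x y → x :- y := :- (y :- x)) tt x y)) (∣∣-neg (y - x))

  ∣-∣-through : ∀ x y z → ∣ x - z ∣ ≤ ∣ x - y ∣ + ∣ y - z ∣
  ∣-∣-through x y z = ≤-trans (≤-reflexive (∣∣-cong (solve 3 (λ x y z → x :- z := (x :- y) :+ (y :- z)) tt x y z)))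
    (∣∣-triangle _ _)

  ∣-∣≤⇒≤ : ∀ {x y c} → ∣ x - y ∣ ≤ c → x ≤ y + c
  ∣-∣≤⇒≤ {x} {y} {c} p = ≤-by (≤-trans (x≤∣x∣ _) p) (solve 3 (λ x y c → c :- (x :- y) := (y :+ c) :- x) tt x y c)

  ≤⇒∣-∣≤ : ∀ {x y c} → x ≤ y + c → y ≤ x + c → ∣ x - y ∣ ≤ c
  ≤⇒∣-∣≤ {x} {y} {c} p q = ∣∣-lub (≤-by p (solve 3 (λ x y c → (y :+ c) :- x := c :- (x :- y)) tt x y c))
    (≤-by q (solve 3 (λ x y c → (x :+ c) :- y := c :- :- (x :- y)) tt x y c))

  opaque
    geometric-limit : ∀ (x : ℕ → R) c → 0# ≤ c → (∀ n → ∣ x (suc n) - x n ∣ ≤ c * hp n) →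
      ∃ λ l → ∀ n → ∣ l - x n ∣ ≤ 2# * c * hp n
    geometric-limit x c c≥0 h = l , bound
      where
      4c≥0 : 0# ≤ 2# * (2# * c)
      4c≥0 = *-nonneg (<⇒≤ 0<2) (*-nonneg (<⇒≤ 0<2) c≥0)
      cauchy : ∀ ε → 0# < ε → ∃ λ N → ∀ m n → N ℕ.≤ m → N ℕ.≤ n → x m < x n + ε
      cauchy ε ε>0 = let N , q = hp-small 4c≥0 ε>0 in N , λ m n m≥N n≥N →
        <-by (≤-<-trans (≤-trans (x≤∣x∣ _) (≤-trans (∣-∣-through (x m) (x N) (x n))
          (+-mono-≤ (geometric-bound x c c≥0 h m N m≥N) (≤-trans (≤-reflexive (∣-∣-swap _ _))
            (geometric-bound x c c≥0 h n N n≥N)))))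
          (≤-<-trans (≤-reflexive (solve 2 (λ c a → (con 1ℚ :+ con 1ℚ) :* c :* a :+ (con 1ℚ :+ con 1ℚ) :* c :* a :=
            (con 1ℚ :+ con 1ℚ) :* ((con 1ℚ :+ con 1ℚ) :* c) :* a) tt c (hp N))) q))
          (solve 3 (λ a b e → e :- (a :- b) := (b :+ e) :- a) tt (x m) (x n) ε)
      l : R
      l = proj₁ (complete x cauchy)
      bound : ∀ n → ∣ l - x n ∣ ≤ 2# * c * hp n
      bound n = ≤-from-ε λ ε ε>0 → let N , f = proj₂ (complete x cauchy) ε ε>0 ; m = N ℕ.⊔ n in
        ≤-trans (∣-∣-through l (x m) (x n)) (≤-trans (+-mono-≤
          (≤⇒∣-∣≤ (<⇒≤ (proj₂ (f m (ℕ.m≤m⊔n N n)))) (<⇒≤ (proj₁ (f m (ℕ.m≤m⊔n N n)))))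
          (geometric-bound x c c≥0 h m n (ℕ.m≤n⊔m N n)))
          (≤-reflexive (+-comm _ _)))

  opaque
    geometric-limitᶜ : ∀ (x : ℕ → C) c → 0# ≤ c → (∀ n → ‖ x (suc n) -ᶜ x n ‖ ≤ c * hp n) →
      ∃ λ l → ∀ n → ‖ l -ᶜ x n ‖ ≤ 2# * (2# * c) * hp n
    geometric-limitᶜ x c c≥0 h = mkC (proj₁ a) (proj₁ b) , λ n → ≤-trans
      (+-mono-≤ (≤-trans (≤-reflexive (∣∣-cong (trans (re-+ _ _) (+-congˡ (re-neg _))))) (proj₂ a n))
                (≤-trans (≤-reflexive (∣∣-cong (trans (im-+ _ _) (+-congˡ (im-neg _))))) (proj₂ b n)))
      (≤-reflexive (solve 2 (λ c h → (con 1ℚ :+ con 1ℚ) :* c :* h :+ (con 1ℚ :+ con 1ℚ) :* c :* h :=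
        (con 1ℚ :+ con 1ℚ) :* ((con 1ℚ :+ con 1ℚ) :* c) :* h) tt c (hp n)))
      where
      a : ∃ λ l → ∀ n → ∣ l - re (x n) ∣ ≤ 2# * c * hp n
      a = geometric-limit (re ∘ x) c c≥0 λ n → ≤-trans (∣re-re∣≤ (x (suc n)) (x n)) (h n)
      b : ∃ λ l → ∀ n → ∣ l - im (x n) ∣ ≤ 2# * c * hp n
      b = geometric-limit (im ∘ x) c c≥0 λ n → ≤-trans (∣im-im∣≤ (x (suc n)) (x n)) (h n)

  opaque
    nested-limit : ∀ (a : ℕ → R) A → 0# ≤ A → (∀ n → a n ≤ a (suc n)) → (∀ n → a (suc n) ≤ a n + A * hp (suc n)) →
      ∃ λ c → ∀ n → a n ≤ c × c ≤ a n + A * hp n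
    nested-limit a A A≥0 up step = c , λ n →
      (≤-from-hp A A≥0 λ k → ≤-trans (mono n k) (≤-trans (∣-∣≤⇒≤
        (≤-trans (≤-reflexive (∣-∣-swap _ _)) (near (k ℕ.+ n))))
         (+-mono-≤ ≤-refl (≤-trans (≤-reflexive (eq (k ℕ.+ n))) (*-monoˡ-≤ A≥0 (hp-anti n k)))))) ,
      ≤-trans (∣-∣≤⇒≤ (near n)) (+-mono-≤ ≤-refl (≤-reflexive (eq n)))
      where
      lim : ∃ λ l → ∀ n → ∣ l - a n ∣ ≤ 2# * (½# * A) * hp n
      lim = geometric-limit a (½# * A) (*-nonneg (<⇒≤ 0<½) A≥0) λ n →
        ≤⇒∣-∣≤ (≤-trans (step n) (≤-reflexive (solve 3 (λ a A h → a :+ A :* (con ½ :* h) := a :+ con ½ :* A :* h) tt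
          (a n) A (hp n))))
               (≤-trans (up n) (≤-by (*-nonneg (*-nonneg (<⇒≤ 0<½) A≥0) (<⇒≤ (hp-pos n)))
                 (solve 2 (λ a q → q :- con 0ℚ := (a :+ q) :- a) tt (a (suc n)) (½# * A * hp n))))
      c : R
      c = proj₁ lim
      near : ∀ n → ∣ c - a n ∣ ≤ 2# * (½# * A) * hp n
      near = proj₂ lim
      eq : ∀ n → 2# * (½# * A) * hp n ≈ A * hp n
      eq n = solve 2 (λ A h → (con 1ℚ :+ con 1ℚ) :* (con ½ :* A) :* h := A :* h) tt A (hp n)
      mono : ∀ n k → a n ≤ a (k ℕ.+ n)
      mono n zero = ≤-refl
      mono n (suc k) = ≤-trans (mono n k) (up (k ℕ.+ n))
      hp-anti : ∀ n k → hp (k ℕ.+ n) ≤ hp k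
      hp-anti n zero = hp≤1 n
        where
        hp≤1 : ∀ n → hp n ≤ 1#
        hp≤1 zero = ≤-refl
        hp≤1 (suc n) = ≤-trans (<⇒≤ (half-< (hp-pos n))) (hp≤1 n)
      hp-anti n (suc k) = *-monoˡ-≤ (<⇒≤ 0<½) (hp-anti n k)

  -- Subrectangles with sides A hp n and B hp n are given by their lower left corners.

  module Bisection (A B : R) (A≥0 : 0# ≤ A) (B≥0 : 0# ≤ B) (Good : R → R → ℕ → Set)
    (refine : ∀ a b n → Good a b n → ∃ λ a′ → ∃ λ b′ →
      (a ≤ a′ × a′ ≤ a + A * hp (suc n)) × (b ≤ b′ × b′ ≤ b + B * hp (suc n)) × Good a′ b′ (suc n))
    (a₀ b₀ : R) (good₀ : Good a₀ b₀ 0) where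
    private
      State : ℕ → Set
      State n = ∃ λ a → ∃ λ b → Good a b n

      state : ∀ n → State n
      next : ∀ {n} (σ : State n) → ∃ λ a′ → ∃ λ b′ →
        (proj₁ σ ≤ a′ × a′ ≤ proj₁ σ + A * hp (suc n)) × (proj₁ (proj₂ σ) ≤ b′ × b′ ≤ proj₁ (proj₂ σ) + B * hp
          (suc n)) × Good a′ b′ (suc n)
      next {n} (a , b , g) = refine a b n g
      state zero = a₀ , b₀ , good₀
      state (suc n) = proj₁ (next (state n)) , proj₁ (proj₂ (next (state n))) , proj₂
        (proj₂ (proj₂ (proj₂ (next (state n)))))

      a b : ℕ → R
      a n = proj₁ (state n)
      b n = proj₁ (proj₂ (state n))

      step : ∀ n → (a n ≤ a (suc n) × a (suc n) ≤ a n + A * hp (suc n)) ×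
        (b n ≤ b (suc n) × b (suc n) ≤ b n + B * hp (suc n))
      step n = proj₁ (proj₂ (proj₂ (next (state n)))) , proj₁ (proj₂ (proj₂ (proj₂ (next (state n)))))

      lim-a = nested-limit a A A≥0 (λ n → proj₁ (proj₁ (step n))) (λ n → proj₂ (proj₁ (step n)))
      lim-b = nested-limit b B B≥0 (λ n → proj₁ (proj₂ (step n))) (λ n → proj₂ (proj₂ (step n)))

    opaque
      limit : ∃ λ x → ∃ λ y → (a₀ ≤ x × x ≤ a₀ + A) × (b₀ ≤ y × y ≤ b₀ + B) ×
        (∀ n → ∃ λ a → ∃ λ b → Good a b n × (a ≤ x × x ≤ a + A * hp n) × (b ≤ y × y ≤ b + B * hp n))
      limit = proj₁ lim-a , proj₁ lim-b , widen (proj₂ lim-a 0) , widen (proj₂ lim-b 0) ,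
        λ n → a n , b n , proj₂ (proj₂ (state n)) , proj₂ lim-a n , proj₂ lim-b n
        where
        widen : ∀ {u x D} → u ≤ x × x ≤ u + D * 1# → u ≤ x × x ≤ u + D
        widen (p , q) = p , ≤-trans q (≤-reflexive (+-congˡ (*-identityʳ _)))

  -- A local logarithm: near 0 the map l ↦ exp l - 1 - l is a ½-contraction.

  opaque
    -- `β` is e. The denominator of `ρ` is the one for which the Lipschitz constant of `exp-error`
    -- on the ball of radius `ρ`, as computed in `exp-error-contraction`, is exactly ½. `r₀` is half
    -- of `ρ` because |log (1 + x)| ≤ 2 |x|.
    β ρ r₀ : R
    β = expR 1#
    ρ = ½# / (2# * (β * β) + 1# + β)
    r₀ = ½# * ρ

    β>0 : 0# < β
    β>0 = expR-pos 1#

    ρ-denominator : 0# < 2# * (β * β) + 1# + β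
    ρ-denominator = +-pos (+-pos (*-pos 0<2 (*-pos β>0 β>0)) (<⇒≤ 0<1)) (<⇒≤ β>0)

    ρ>0 : 0# < ρ
    ρ>0 = /-pos 0<½ ρ-denominator

    r₀>0 : 0# < r₀
    r₀>0 = half-pos ρ>0

    ρ-eq : (2# * (β * β) + 1# + β) * ρ ≈ ½#
    ρ-eq = *-/-cancel (pos⇒≉0 ρ-denominator)

    r₀≈½ρ : r₀ ≈ ½# * ρ
    r₀≈½ρ = refl

    β≈expR1 : β ≈ expR 1#
    β≈expR1 = refl

  2r₀≈ρ : 2# * r₀ ≈ ρ
  2r₀≈ρ = trans (*-congˡ r₀≈½ρ) (solve 1 (λ p → (con 1ℚ :+ con 1ℚ) :* (con ½ :* p) := p) tt ρ)

  2ρ≤1 : ρ + ρ ≤ 1#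
  2ρ≤1 = ≤-trans (≤-by (*-nonneg (+-nonneg (*-nonneg (<⇒≤ 0<2) (*-nonneg (<⇒≤ β>0) (<⇒≤ β>0))) (<⇒≤ β>0)) (<⇒≤ ρ>0))
      (solve 2 (λ b p → ((con 1ℚ :+ con 1ℚ) :* (b :* b) :+ b) :* p :- con 0ℚ :=
        ((con 1ℚ :+ con 1ℚ) :* (b :* b) :+ con 1ℚ :+ b) :* p :- p) tt β ρ) ⟨+⟩ ≤-by
        (*-nonneg (+-nonneg (*-nonneg (<⇒≤ 0<2) (*-nonneg (<⇒≤ β>0) (<⇒≤ β>0))) (<⇒≤ β>0)) (<⇒≤ ρ>0))
      (solve 2 (λ b p → ((con 1ℚ :+ con 1ℚ) :* (b :* b) :+ b) :* p :- con 0ℚ :=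
        ((con 1ℚ :+ con 1ℚ) :* (b :* b) :+ con 1ℚ :+ b) :* p :- p) tt β ρ))
    (≤-reflexive (trans (+-cong ρ-eq ρ-eq) (solve 0 (con ½ :+ con ½ := con 1ℚ) tt)))
    where
    _⟨+⟩_ : ∀ {a b c d} → a ≤ b → c ≤ d → a + c ≤ b + d
    _⟨+⟩_ = +-mono-≤

  ρ≤1 : ρ ≤ 1#
  ρ≤1 = ≤-trans (≤-by (<⇒≤ ρ>0) (solve 1 (λ p → p :- con 0ℚ := (p :+ p) :- p) tt ρ)) 2ρ≤1

  exp-error : C → C
  exp-error l = exp l -ᶜ 1ᶜ -ᶜ l

  exp-error-bound : ∀ {h} → ‖ h ‖ ≤ 1# → ‖ exp-error h ‖ ≤ ‖ h ‖ * ‖ h ‖ * β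
  exp-error-bound {h} p = ≤-trans
    (≤-reflexive (‖‖-cong (ctrans (csolve 2 (λ e h → e ⊖ ccon 1ℚ ⊖ h ⊜ e ⊖ ccon 1ℚ ⊖ h ⊗ ccon 1ℚ) tt (exp h) h)
      (+ᶜ-cong (+ᶜ-cong (exp-cong (csym (+ᶜ-identityˡ h))) (-ᶜ-cong (csym exp-zero)))
        (-ᶜ-cong (*ᶜ-congˡ (csym exp-zero)))))))
    (≤-trans (exp-first-order 0ᶜ h 1# (≤-trans (≤-reflexive ‖0‖) (<⇒≤ 0<1))
      (≤-trans (≤-reflexive (‖‖-cong (+ᶜ-identityˡ h))) p))
      (≤-reflexive (*-congˡ (sym β≈expR1))))

  -- By the functional equation the difference is exp l′ · `exp-error` k + (exp l′ - 1) k with k = l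
  -- - l′: a quantity quadratic in the small k plus a small multiple of k.
  exp-error-contraction : ∀ {l l′} → ‖ l ‖ ≤ ρ → ‖ l′ ‖ ≤ ρ → ‖ exp-error l -ᶜ exp-error l′ ‖ ≤ ½# * ‖ l -ᶜ l′ ‖
  exp-error-contraction {l} {l′} p q = ≤-trans (≤-reflexive (‖‖-cong eq))
    (≤-trans (‖‖-+-≤ (‖‖-mult-≤ (≤-trans (exp-bound (≤-trans q ρ≤1)) (≤-reflexive (sym β≈expR1))) e≤)
      (‖‖-mult-≤ e′≤ ≤-refl))
      (≤-reflexive (trans (solve 3 (λ b p k → b :* (k :* (p :+ p) :* b) :+ (p :+ p :* con 1ℚ :* b) :* k :=
        (((con 1ℚ :+ con 1ℚ) :* (b :* b) :+ con 1ℚ :+ b) :* p) :* k) tt β ρ ‖ k ‖) (*-congʳ ρ-eq))))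
    where
    k = l -ᶜ l′
    eq : exp-error l -ᶜ exp-error l′ ≈ᶜ exp l′ *ᶜ exp-error k +ᶜ (exp l′ -ᶜ 1ᶜ) *ᶜ k
    eq = ctrans (+ᶜ-congʳ (+ᶜ-congʳ (+ᶜ-congʳ (ctrans (exp-cong (csolve 2 (λ a b → a ⊜ b ⊕ (a ⊖ b)) tt l l′))
      (exp-+ l′ k)))))
      (csolve 4 (λ e f a b → (e ⊗ f ⊖ ccon 1ℚ ⊖ a) ⊖ (e ⊖ ccon 1ℚ ⊖ b) ⊜ e ⊗ (f ⊖ ccon 1ℚ ⊖ (a ⊖ b)) ⊕
        (e ⊖ ccon 1ℚ) ⊗ (a ⊖ b)) tt (exp l′) (exp k) l l′)
    k≤ : ‖ k ‖ ≤ ρ + ρ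
    k≤ = ≤-trans (‖‖-triangle-- l l′) (+-mono-≤ p q)
    e≤ : ‖ exp-error k ‖ ≤ ‖ k ‖ * (ρ + ρ) * β
    e≤ = ≤-trans (exp-error-bound (≤-trans k≤ 2ρ≤1)) (*-monoʳ-≤ (<⇒≤ β>0) (*-monoˡ-≤ (‖‖-nonneg k) k≤))
    e′≤ : ‖ exp l′ -ᶜ 1ᶜ ‖ ≤ ρ + ρ * 1# * β
    e′≤ = ≤-trans (≤-reflexive (‖‖-cong (csolve 2 (λ e l → e ⊖ ccon 1ℚ ⊜ l ⊕ (e ⊖ ccon 1ℚ ⊖ l)) tt (exp l′) l′)))
      (‖‖-+-≤ q (≤-trans (exp-error-bound (≤-trans q ρ≤1))
        (*-monoʳ-≤ (<⇒≤ β>0) (*-mono-≤ (‖‖-nonneg l′) (<⇒≤ 0<1) q (≤-trans q ρ≤1)))))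

  -- Up to a constant, exp is the identity plus a ½-contraction, so it shrinks distances at most by
  -- the factor ½; injectivity near 0 follows.
  exp-lower-lipschitz : ∀ {l l′} → ‖ l ‖ ≤ ρ → ‖ l′ ‖ ≤ ρ → ‖ l -ᶜ l′ ‖ ≤ 2# * ‖ exp l -ᶜ exp l′ ‖
  exp-lower-lipschitz {l} {l′} p q = *-cancelˡ-≤ 0<½
    (≤-by (≤-trans (≤-reflexive (‖‖-cong (csolve 4 (λ e f a b → a ⊖ b ⊜ (e ⊖ f) ⊖
      ((e ⊖ ccon 1ℚ ⊖ a) ⊖ (f ⊖ ccon 1ℚ ⊖ b))) tt (exp l) (exp l′) l l′)))
        (≤-trans (‖‖-triangle-- _ _) (+-mono-≤ ≤-refl (exp-error-contraction p q))))
      (solve 2 (λ d k → (d :+ con ½ :* k) :- k := con ½ :* ((con 1ℚ :+ con 1ℚ) :* d) :- con ½ :* k) tt ‖ exp l -ᶜ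
        exp l′ ‖ ‖ l -ᶜ l′ ‖))

  exp-injective-near : ∀ {l l′} → ‖ l ‖ ≤ ρ → ‖ l′ ‖ ≤ ρ → exp l ≈ᶜ exp l′ → l ≈ᶜ l′
  exp-injective-near p q e = ‖-‖≤0⇒≈ (≤-trans (exp-lower-lipschitz p q)
    (≤-trans (*-monoˡ-≤ (<⇒≤ 0<2) (≈⇒‖-‖≤0 e)) (≤-reflexive (zeroʳ 2#))))

  exp-error-zero : exp-error 0ᶜ ≈ᶜ 0ᶜ
  exp-error-zero = ctrans (+ᶜ-congʳ (+ᶜ-congʳ exp-zero)) (csolve 0 (ccon 1ℚ ⊖ ccon 1ℚ ⊖ ccon 0ℚ ⊜ ccon 0ℚ) tt)

  -- Banach iteration of l ↦ x - `exp-error` l, whose fixed points are the solutions of exp l = 1 +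
  -- x.
  module Log1p (x : C) (x≤r₀ : ‖ x ‖ ≤ r₀) where
    private
      l : ℕ → C
      l zero = 0ᶜ
      l (suc n) = x -ᶜ exp-error (l n)

      2x≤ρ : 2# * ‖ x ‖ ≤ ρ
      2x≤ρ = ≤-trans (*-monoˡ-≤ (<⇒≤ 0<2) x≤r₀) (≤-reflexive 2r₀≈ρ)

      near-zero : ∀ {y} → ‖ y ‖ ≤ ρ → ‖ exp-error y ‖ ≤ ½# * ‖ y ‖
      near-zero {y} p = ≤-trans (≤-reflexive (‖‖-cong (ctrans (csolve 1 (λ y → y ⊜ y ⊖ ccon 0ℚ) tt (exp-error y))
        (+ᶜ-congˡ (-ᶜ-cong (csym exp-error-zero))))))
        (≤-trans (exp-error-contraction p (≤-trans (≤-reflexive ‖0‖) (<⇒≤ ρ>0)))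
          (≤-reflexive (*-congˡ (‖‖-cong (csolve 1 (λ y → y ⊖ ccon 0ℚ ⊜ y) tt y)))))

      l-bound : ∀ n → ‖ l n ‖ ≤ 2# * ‖ x ‖
      l-bound zero = ≤-trans (≤-reflexive ‖0‖) (*-nonneg (<⇒≤ 0<2) (‖‖-nonneg x))
      l-bound (suc n) = ≤-trans (‖‖-triangle-- x _) (≤-trans
        (+-mono-≤ ≤-refl (≤-trans (near-zero (≤-trans (l-bound n) 2x≤ρ)) (*-monoˡ-≤ (<⇒≤ 0<½) (l-bound n))))
        (≤-reflexive (solve 1 (λ x → x :+ con ½ :* ((con 1ℚ :+ con 1ℚ) :* x) := (con 1ℚ :+ con 1ℚ) :* x) tt ‖ x ‖)))

      l≤ρ : ∀ n → ‖ l n ‖ ≤ ρ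
      l≤ρ n = ≤-trans (l-bound n) 2x≤ρ

      l-step : ∀ n → ‖ l (suc n) -ᶜ l n ‖ ≤ ‖ x ‖ * hp n
      l-step zero = ≤-reflexive (trans (‖‖-cong (ctrans (+ᶜ-congʳ (+ᶜ-congˡ (-ᶜ-cong exp-error-zero)))
        (csolve 1 (λ x → (x ⊖ ccon 0ℚ) ⊖ ccon 0ℚ ⊜ x) tt x))) (sym (*-identityʳ _)))
      l-step (suc n) = ≤-trans (≤-reflexive (trans (‖‖-cong (csolve 3 (λ x a b → (x ⊖ a) ⊖ (x ⊖ b) ⊜ b ⊖ a) tt x
        (exp-error (l (suc n))) (exp-error (l n)))) (‖‖-swap _ _)))
        (≤-trans (exp-error-contraction (l≤ρ (suc n)) (l≤ρ n)) (≤-trans (*-monoˡ-≤ (<⇒≤ 0<½) (l-step n))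
          (≤-reflexive (solve 2 (λ x h → con ½ :* (x :* h) := x :* (con ½ :* h)) tt ‖ x ‖ (hp n)))))

      K : R
      K = 2# * (2# * ‖ x ‖)

      K≥0 : 0# ≤ K
      K≥0 = *-nonneg (<⇒≤ 0<2) (*-nonneg (<⇒≤ 0<2) (‖‖-nonneg x))

    opaque
      log : C
      log = proj₁ (geometric-limitᶜ l ‖ x ‖ (‖‖-nonneg x) l-step)

      l→log : ∀ n → ‖ log -ᶜ l n ‖ ≤ K * hp n
      l→log = proj₂ (geometric-limitᶜ l ‖ x ‖ (‖‖-nonneg x) l-step)

    log-bound : ‖ log ‖ ≤ 2# * ‖ x ‖
    log-bound = ≤-from-hp K K≥0 λ n → ≤-trans (‖‖-reverse log (l n)) (+-mono-≤ (l-bound n) (l→log n))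

    exp-log : exp log ≈ᶜ 1ᶜ +ᶜ x
    exp-log = ctrans (csolve 3 (λ e l x → e ⊜ ccon 1ℚ ⊕ x ⊕ (l ⊖ (x ⊖ (e ⊖ ccon 1ℚ ⊖ l)))) tt (exp log) log x)
      (ctrans (+ᶜ-congˡ (≈ᶜ⇒-ᶜ≈0 fixed)) (+ᶜ-identityʳ _))
      where
      shrink : ∀ n → ‖ l (suc n) -ᶜ (x -ᶜ exp-error log) ‖ ≤ ½# * (K * hp n)
      shrink n = ≤-trans (≤-reflexive (‖‖-cong (csolve 3 (λ x a b → (x ⊖ a) ⊖ (x ⊖ b) ⊜ b ⊖ a) tt x
        (exp-error (l n)) (exp-error log))))
        (≤-trans (exp-error-contraction (≤-trans log-bound 2x≤ρ) (l≤ρ n)) (*-monoˡ-≤ (<⇒≤ 0<½) (l→log n)))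
      total : ∀ n → ‖ log -ᶜ (x -ᶜ exp-error log) ‖ ≤ 0# + K * hp n
      total n = ≤-trans (‖‖-through log (l (suc n)) (x -ᶜ exp-error log))
        (≤-trans (+-mono-≤ (l→log (suc n)) (shrink n))
          (≤-reflexive (solve 2 (λ k h → k :* (con ½ :* h) :+ con ½ :* (k :* h) := con 0ℚ :+ k :* h) tt K (hp n))))
      fixed : log ≈ᶜ x -ᶜ exp-error log
      fixed = ‖-‖≤0⇒≈ (≤-from-hp K K≥0 total)

  opaque
    -- Total, with value 0 outside the ball, so that the term `log1p x` contains no proof of
    -- smallness. `Log` and `ℓ` are made total in the same way.
    log1p-spec : ∀ x → ∃ λ l → ‖ x ‖ ≤ r₀ → exp l ≈ᶜ 1ᶜ +ᶜ x × ‖ l ‖ ≤ 2# * ‖ x ‖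
    log1p-spec x with lem {‖ x ‖ ≤ r₀}
    ... | yes p = Log1p.log x p , λ _ → Log1p.exp-log x p , Log1p.log-bound x p
    ... | no ¬p = 0ᶜ , λ p → ⊥-elim (¬p p)

  log1p : C → C
  log1p x = proj₁ (log1p-spec x)

  exp-log1p : ∀ {x} → ‖ x ‖ ≤ r₀ → exp (log1p x) ≈ᶜ 1ᶜ +ᶜ x
  exp-log1p {x} p = proj₁ (proj₂ (log1p-spec x) p)

  log1p-bound : ∀ {x} → ‖ x ‖ ≤ r₀ → ‖ log1p x ‖ ≤ 2# * ‖ x ‖
  log1p-bound {x} p = proj₂ (proj₂ (log1p-spec x) p)

  log1p≤ρ : ∀ {x} → ‖ x ‖ ≤ r₀ → ‖ log1p x ‖ ≤ ρ
  log1p≤ρ p = ≤-trans (log1p-bound p) (≤-trans (*-monoˡ-≤ (<⇒≤ 0<2) p) (≤-reflexive 2r₀≈ρ))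

  log1p-unique : ∀ {x l} → ‖ x ‖ ≤ r₀ → ‖ l ‖ ≤ ρ → exp l ≈ᶜ 1ᶜ +ᶜ x → l ≈ᶜ log1p x
  log1p-unique p q e = exp-injective-near q (log1p≤ρ p) (ctrans e (csym (exp-log1p p)))

  log1p-lipschitz : ∀ {x y} → ‖ x ‖ ≤ r₀ → ‖ y ‖ ≤ r₀ → ‖ log1p x -ᶜ log1p y ‖ ≤ 2# * ‖ x -ᶜ y ‖
  log1p-lipschitz {x} {y} p q = ≤-trans (exp-lower-lipschitz (log1p≤ρ p) (log1p≤ρ q))
    (*-monoˡ-≤ (<⇒≤ 0<2) (≤-reflexive (‖‖-cong (ctrans (+ᶜ-cong (exp-log1p p) (-ᶜ-cong (exp-log1p q)))
      (csolve 2 (λ x y → (ccon 1ℚ ⊕ x) ⊖ (ccon 1ℚ ⊕ y) ⊜ x ⊖ y) tt x y)))))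

  log1p-cong : ∀ {x y} → ‖ x ‖ ≤ r₀ → x ≈ᶜ y → log1p x ≈ᶜ log1p y
  log1p-cong p e = log1p-unique (≤-trans (≤-reflexive (‖‖-cong (csym e))) p) (log1p≤ρ p)
    (ctrans (exp-log1p p) (+ᶜ-congˡ e))

  log1p-conj : ∀ {x} → ‖ x ‖ ≤ r₀ → log1p (conj x) ≈ᶜ conj (log1p x)
  log1p-conj {x} p = csym (log1p-unique (≤-trans (≤-reflexive (‖‖-conj x)) p)
    (≤-trans (≤-reflexive (‖‖-conj _)) (log1p≤ρ p))
    (ctrans (exp-conj _) (ctrans (conj-cong (exp-log1p p)) (ctrans (conj-+ _ _) (+ᶜ-congʳ (conj-ofR 1#))))))

  ≈-neg⇒≈0 : ∀ {y} → - y ≈ y → y ≈ 0#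
  ≈-neg⇒≈0 {y} e = trans (solve 1 (λ y → y := con ½ :* (y :- :- y)) tt y)
    (trans (*-congˡ (trans (+-congˡ (-‿cong e)) (-‿inverseʳ y))) (zeroʳ ½#))

  log1p-real : ∀ {x} → ‖ ofR x ‖ ≤ r₀ → im (log1p (ofR x)) ≈ 0#
  log1p-real {x} p = ≈-neg⇒≈0 (trans (sym (im-conj _)) (im-cong
    (ctrans (csym (log1p-conj p)) (csym (log1p-cong p (csym (conj-ofR x)))))))

  -- Lower semicontinuous functions attain their minimum on a rectangle

  ¬∀⇒∃¬ : ∀ {A : Set} {P : A → Set} → ¬ (∀ x → P x) → ∃ λ x → ¬ P x
  ¬∀⇒∃¬ {A} {P} h with lem {∃ λ x → ¬ P x}
  ... | yes p = p
  ... | no q = ⊥-elim (h λ x → ¬¬-elim λ np → q (x , np))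
    where
    ¬¬-elim : ∀ {B : Set} → ¬ ¬ B → B
    ¬¬-elim {B} nn with lem {B}
    ... | yes b = b
    ... | no nb = ⊥-elim (nn nb)

  Between : R → R → R → Set
  Between a b x = a ≤ x × x ≤ b

  halve : ∀ {a A x} → Between a (a + (½# * A + ½# * A)) x → Between a (a + ½# * A) x ⊎ Between (a + ½# * A)
    (a + ½# * A + ½# * A) x
  halve {a} {A} {x} (p , q) with ≤-or-> x (a + ½# * A)
  ... | inj₁ r = inj₁ (p , r)
  ... | inj₂ r = inj₂ (<⇒≤ r , ≤-trans q (≤-reflexive (sym (+-assoc _ _ _))))

  module Minimum (f : R → R → R) (a₀ A b₀ B : R) (A≥0 : 0# ≤ A) (B≥0 : 0# ≤ B) where

    Rectangle : R → R → Set
    Rectangle x y = Between a₀ (a₀ + A) x × Between b₀ (b₀ + B) y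

    LowerSemicontinuous : Set
    LowerSemicontinuous = ∀ x y → Rectangle x y → ∀ ε → 0# < ε → ∃ λ δ → 0# < δ ×
      (∀ x′ y′ → Rectangle x′ y′ → ∣ x′ - x ∣ ≤ δ → ∣ y′ - y ∣ ≤ δ → f x y ≤ f x′ y′ + ε)

    -- Replaces "the infimum is approached in U". Formulated in this way it needs neither an infimum
    -- nor boundedness from below, and it survives bisection.
    Dominates : (R → R → Set) → Set
    Dominates U = ∀ x y → Rectangle x y → ∃ λ x′ → ∃ λ y′ → U x′ y′ × f x′ y′ ≤ f x y

    -- If U₁ fails, some point (x₁, y₁) has a smaller value than every point of U₁. Whatever
    -- dominates the better of (x, y) and (x₁, y₁) then cannot lie in U₁, so it lies in U₂.
    dominates-split : ∀ {U U₁ U₂ : R → R → Set} → (∀ {x y} → U x y → Rectangle x y) →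
      (∀ {x y} → U x y → U₁ x y ⊎ U₂ x y) → Dominates U → Dominates U₁ ⊎ Dominates U₂
    dominates-split {U} {U₁} {U₂} inside cover dom with lem {Dominates U₁}
    ... | yes d = inj₁ d
    ... | no ¬d = inj₂ other
      where
      bad : ∃ λ x₁ → ∃ λ y₁ → Rectangle x₁ y₁ × (∀ x y → U₁ x y → ¬ (f x y ≤ f x₁ y₁))
      bad = let x₁ , p = ¬∀⇒∃¬ ¬d ; y₁ , q = ¬∀⇒∃¬ p ; r , s = ¬∀⇒∃¬ {A = Rectangle x₁ y₁} q in
        x₁ , y₁ , r , λ x y u le → s (x , y , u , le)
      other : Dominates U₂
      other x y r with bad
      ... | x₁ , y₁ , r₁ , worse with ≤-or-> (f x y) (f x₁ y₁)
      ...   | inj₁ le = choose (dom x y r)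
        where
        choose : (∃ λ x′ → ∃ λ y′ → U x′ y′ × f x′ y′ ≤ f x y) → ∃ λ x′ → ∃ λ y′ → U₂ x′ y′ × f x′ y′ ≤ f x y
        choose (x′ , y′ , u , le′) with cover u
        ... | inj₁ u₁ = ⊥-elim (worse x′ y′ u₁ (≤-trans le′ le))
        ... | inj₂ u₂ = x′ , y′ , u₂ , le′
      ...   | inj₂ gt = choose (dom x₁ y₁ r₁)
        where
        choose : (∃ λ x′ → ∃ λ y′ → U x′ y′ × f x′ y′ ≤ f x₁ y₁) → ∃ λ x′ → ∃ λ y′ → U₂ x′ y′ × f x′ y′ ≤ f x y
        choose (x′ , y′ , u , le′) with cover u
        ... | inj₁ u₁ = ⊥-elim (worse x′ y′ u₁ le′)
        ... | inj₂ u₂ = x′ , y′ , u₂ , ≤-trans le′ (<⇒≤ gt)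

    Within : R → R → R → R → R → R → Set
    Within a b s t x y = Between a (a + s) x × Between b (b + t) y

    Good : R → R → ℕ → Set
    Good a b n = (a₀ ≤ a × a + A * hp n ≤ a₀ + A) × (b₀ ≤ b × b + B * hp n ≤ b₀ + B) × Dominates
      (Within a b (A * hp n) (B * hp n))

    private
      shrink : ∀ a C n → a + C * hp n ≈ a + (½# * (C * hp n) + ½# * (C * hp n))
      shrink a C n = solve 3 (λ a c h → a :+ c :* h := a :+ (con ½ :* (c :* h) :+ con ½ :* (c :* h))) tt a C (hp n)

      half-eq : ∀ C n → ½# * (C * hp n) ≈ C * hp (suc n)
      half-eq C n = solve 2 (λ c h → con ½ :* (c :* h) := c :* (con ½ :* h)) tt C (hp n)

      Corner : R → R → R → ℕ → R → Set
      Corner c₀ c C n c′ = (c ≤ c′ × c′ ≤ c + C * hp (suc n)) × (c₀ ≤ c′ × c′ + C * hp (suc n) ≤ c₀ + C)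

      lower-corner : ∀ {c₀ c C} n → 0# ≤ C → c₀ ≤ c → c + C * hp n ≤ c₀ + C → Corner c₀ c C n c
      lower-corner {c₀} {c} {C} n C≥0 p q = (≤-refl , le) , p ,
        ≤-trans (≤-trans (≤-by h≥0 (solve 3 (λ c C h → con ½ :* (C :* h) :- con 0ℚ := (c :+ C :* h) :-
          (c :+ C :* (con ½ :* h))) tt c C (hp n))) ≤-refl) q
        where
        h≥0 : 0# ≤ ½# * (C * hp n)
        h≥0 = *-nonneg (<⇒≤ 0<½) (*-nonneg C≥0 (<⇒≤ (hp-pos n)))
        le : c ≤ c + C * hp (suc n)
        le = ≤-by h≥0 (solve 3 (λ c C h → con ½ :* (C :* h) :- con 0ℚ := (c :+ C :* (con ½ :* h)) :- c) tt c C
          (hp n))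

      upper-corner : ∀ {c₀ c C} n → 0# ≤ C → c₀ ≤ c → c + C * hp n ≤ c₀ + C → Corner c₀ c C n (c + ½# * (C * hp n))
      upper-corner {c₀} {c} {C} n C≥0 p q = (le , ≤-reflexive (+-congˡ (half-eq C n))) , ≤-trans p le ,
        ≤-trans (≤-reflexive (solve 3 (λ c C h → c :+ con ½ :* (C :* h) :+ C :* (con ½ :* h) := c :+ C :* h) tt c C
          (hp n))) q
        where
        le : c ≤ c + ½# * (C * hp n)
        le = ≤-by (*-nonneg (<⇒≤ 0<½) (*-nonneg C≥0 (<⇒≤ (hp-pos n))))
          (solve 2 (λ c h → h :- con 0ℚ := (c :+ h) :- c) tt c (½# * (C * hp n)))

      between-cong : ∀ {a b b′ x} → b ≈ b′ → Between a b x → Between a b′ x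
      between-cong e (p , q) = p , ≤-trans q (≤-reflexive e)

      half₁ : ∀ {a C n x} → Between a (a + C * hp n) x → Between a (a + C * hp (suc n)) x ⊎ Between
        (a + ½# * (C * hp n)) (a + ½# * (C * hp n) + C * hp (suc n)) x
      half₁ {a} {C} {n} {x} p = ⊎.map
        (between-cong {a} {a + ½# * (C * hp n)} {a + C * hp (suc n)} {x} (+-congˡ (half-eq C n)))
        (between-cong {a + ½# * (C * hp n)} {a + ½# * (C * hp n) + ½# * (C * hp n)} {a + ½# * (C * hp n) + C * hp
          (suc n)} {x} (+-congˡ (half-eq C n)))
        (halve {a} {C * hp n} {x} (between-cong {a} {a + C * hp n} {a + (½# * (C * hp n) + ½# * (C * hp n))} {x}
          (shrink a C n) p))

      refine-x : ∀ {a b n} → Good a b n → ∃ λ a′ → Corner a₀ a A n a′ × Dominates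
        (Within a′ b (A * hp (suc n)) (B * hp n))
      refine-x {a} {b} {n} ((p , q) , (p′ , q′) , dom) with dominates-split
        {U₁ = Within a b (A * hp (suc n)) (B * hp n)} {U₂ = Within (a + ½# * (A * hp n)) b (A * hp (suc n))
          (B * hp n)}
        (λ { ((u , v) , (u′ , v′)) → (≤-trans p u , ≤-trans v q) , (≤-trans p′ u′ , ≤-trans v′ q′) })
        (λ { (u , v) → ⊎.map (_, v) (_, v) (half₁ {n = n} u) }) dom
      ... | inj₁ d = a , lower-corner n A≥0 p q , d
      ... | inj₂ d = a + ½# * (A * hp n) , upper-corner n A≥0 p q , d

      refine-y : ∀ {a b n} → (a₀ ≤ a × a + A * hp (suc n) ≤ a₀ + A) → (b₀ ≤ b × b + B * hp n ≤ b₀ + B) →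
        Dominates (Within a b (A * hp (suc n)) (B * hp n)) → ∃ λ b′ → Corner b₀ b B n b′ × Dominates
          (Within a b′ (A * hp (suc n)) (B * hp (suc n)))
      refine-y {a} {b} {n} (p , q) (p′ , q′) dom with dominates-split
        {U₁ = Within a b (A * hp (suc n)) (B * hp (suc n))} {U₂ = Within a (b + ½# * (B * hp n)) (A * hp (suc n))
          (B * hp (suc n))}
        (λ { ((u , v) , (u′ , v′)) → (≤-trans p u , ≤-trans v q) , (≤-trans p′ u′ , ≤-trans v′ q′) })
        (λ { (u , v) → ⊎.map (u ,_) (u ,_) (half₁ {n = n} v) }) dom
      ... | inj₁ d = b , lower-corner n B≥0 p′ q′ , d
      ... | inj₂ d = b + ½# * (B * hp n) , upper-corner n B≥0 p′ q′ , d

      refine : ∀ a b n → Good a b n → ∃ λ a′ → ∃ λ b′ →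
        (a ≤ a′ × a′ ≤ a + A * hp (suc n)) × (b ≤ b′ × b′ ≤ b + B * hp (suc n)) × Good a′ b′ (suc n)
      refine a b n g@(_ , gb , _) = let a′ , (ca , ca′) , d = refine-x {a} {b} {n} g ; b′ , (cb , cb′) , d′ = refine-y {a′} {b} {n} ca′ gb d in
        a′ , b′ , ca , cb , ca′ , cb′ , d′

      widen : ∀ {u x D} → Between u (u + D) x → Between u (u + D * 1#) x
      widen = between-cong (+-congˡ (sym (*-identityʳ _)))

      good₀ : Good a₀ b₀ 0
      good₀ = (≤-refl , ≤-reflexive (+-congˡ (*-identityʳ A))) , (≤-refl , ≤-reflexive (+-congˡ (*-identityʳ B))) ,
        λ x y r → x , y , (widen (proj₁ r) , widen (proj₂ r)) , ≤-refl

      near : ∀ {a C n x x′ δ} → C * hp n ≤ δ → Between a (a + C * hp n) x → Between a (a + C * hp n) x′ → ∣ x′ - x ∣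
        ≤ δ
      near {a} {C} {n} {x} {x′} {δ} le (p , q) (p′ , q′) = ≤-trans
        (≤⇒∣-∣≤ (≤-trans q′ (+-mono-≤ p ≤-refl)) (≤-trans q (+-mono-≤ p′ ≤-refl))) le

    private
      Limit : R → R → Set
      Limit x y = ∀ n → ∃ λ a → ∃ λ b → Good a b n × Between a (a + A * hp n) x × Between b (b + B * hp n) y

      limit : ∃ λ x → ∃ λ y → Between a₀ (a₀ + A) x × Between b₀ (b₀ + B) y × Limit x y
      limit = Bisection.limit A B A≥0 B≥0 Good refine a₀ b₀ good₀

      -- Each point of the rectangle is dominated from within arbitrarily small rectangles around
      -- the limit point, and there lower semicontinuity applies.
      limit-minimal : LowerSemicontinuous → ∀ {x y} → Rectangle x y → Limit x y → ∀ x′ y′ → Rectangle x′ y′ →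
        ∀ ε → 0# < ε → f x y ≤ f x′ y′ + ε
      limit-minimal lsc {x} {y} r approx x′ y′ r′ ε ε>0 =
        let δ , δ>0 , close = lsc x y r ε ε>0
            n , hn = hp-small (+-nonneg A≥0 B≥0) δ>0
            a , b , ((p , q) , (p′ , q′) , dom) , bx , by = approx n
            x″ , y″ , (wx , wy) , le = dom x′ y′ r′
            A≤ : A * hp n ≤ δ
            A≤ = ≤-trans (*-monoʳ-≤ (<⇒≤ (hp-pos n)) (≤-by B≥0
              (solve 2 (λ a b → b :- con 0ℚ := (a :+ b) :- a) tt A B))) (<⇒≤ hn)
            B≤ : B * hp n ≤ δ
            B≤ = ≤-trans (*-monoʳ-≤ (<⇒≤ (hp-pos n)) (≤-by A≥0
              (solve 2 (λ a b → a :- con 0ℚ := (a :+ b) :- b) tt A B))) (<⇒≤ hn)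
        in ≤-trans
          (close x″ y″ ((≤-trans p (proj₁ wx) , ≤-trans (proj₂ wx) q) ,
            (≤-trans p′ (proj₁ wy) , ≤-trans (proj₂ wy) q′))
            (near {a} {A} {n} {x} {x″} {δ} A≤ bx wx) (near {b} {B} {n} {y} {y″} {δ} B≤ by wy))
          (+-mono-≤ le ≤-refl)

    opaque
      attained : LowerSemicontinuous → ∃ λ x → ∃ λ y → Rectangle x y × (∀ x′ y′ → Rectangle x′ y′ → f x y ≤ f x′ y′)
      attained lsc = let x , y , rx , ry , approx = limit in
        x , y , (rx , ry) , λ x′ y′ r → ≤-from-ε (limit-minimal lsc {x} {y} (rx , ry) approx x′ y′ r)

  opaque
    modulus : ∀ K → 0# ≤ K → ∀ {ε} → 0# < ε → ∃ λ δ → 0# < δ × K * (δ + δ) ≤ ε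
    modulus K K≥0 {ε} ε>0 = δ , δ>0 , ≤-trans (≤-by (<⇒≤ δ>0)
      (solve 2 (λ k d → d :- con 0ℚ := (con 1ℚ :+ (con 1ℚ :+ con 1ℚ) :* k) :* d :- k :* (d :+ d)) tt K δ))
      (≤-reflexive (*-/-cancel (pos⇒≉0 D>0)))
      where
      D>0 : 0# < 1# + 2# * K
      D>0 = +-pos 0<1 (*-nonneg (<⇒≤ 0<2) K≥0)
      δ : R
      δ = ε / (1# + 2# * K)
      δ>0 : 0# < δ
      δ>0 = /-pos ε>0 D>0

  ‖‖-pos : ∀ {z} → ¬ (z ≈ᶜ 0ᶜ) → 0# < ‖ z ‖
  ‖‖-pos {z} z≉0 = [ (λ p → p) , (λ e → ⊥-elim (z≉0 (‖‖≤0⇒≈0 (≤-reflexive (sym e))))) ]′ (≤-split (‖‖-nonneg z))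

  opaque
    -- The norm attains its minimum, which is not 0. This bound, uniform over the whole rectangle,
    -- is what fixes the mesh in the later subdivision arguments.
    norm-bounded-below : ∀ (F : R → R → C) a₀ A b₀ B → 0# ≤ A → 0# ≤ B → ∀ K → 0# ≤ K →
      (∀ x y x′ y′ → Between a₀ (a₀ + A) x × Between b₀ (b₀ + B) y → Between a₀ (a₀ + A) x′ × Between b₀
        (b₀ + B) y′ →
        ‖ F x y -ᶜ F x′ y′ ‖ ≤ K * (∣ x′ - x ∣ + ∣ y′ - y ∣)) →
      (∀ x y → Between a₀ (a₀ + A) x × Between b₀ (b₀ + B) y → ¬ (F x y ≈ᶜ 0ᶜ)) →
      ∃ λ c → 0# < c × (∀ x y → Between a₀ (a₀ + A) x × Between b₀ (b₀ + B) y → c ≤ ‖ F x y ‖)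
    norm-bounded-below F a₀ A b₀ B A≥0 B≥0 K K≥0 lip F≉0 =
      let x , y , r , least = Minimum.attained (λ x y → ‖ F x y ‖) a₀ A b₀ B A≥0 B≥0 lsc
      in ‖ F x y ‖ , ‖‖-pos (F≉0 x y r) , least
      where
      lsc : Minimum.LowerSemicontinuous (λ x y → ‖ F x y ‖) a₀ A b₀ B A≥0 B≥0
      lsc x y r ε ε>0 = let δ , δ>0 , small = modulus K K≥0 ε>0 in
        δ , δ>0 , λ x′ y′ r′ p q → ≤-trans (‖‖-reverse (F x y) (F x′ y′))
          (+-mono-≤ ≤-refl (≤-trans (lip x y x′ y′ r r′) (≤-trans (*-monoˡ-≤ K≥0 (+-mono-≤ p q)) small)))

  -- Lifts of paths [0, 1] → ℂ ∖ {0} through exp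

  𝕀 : R → Set
  𝕀 = Between 0# 1#

  0∈𝕀 : 𝕀 0#
  0∈𝕀 = ≤-refl , <⇒≤ 0<1

  1∈𝕀 : 𝕀 1#
  1∈𝕀 = <⇒≤ 0<1 , ≤-refl

  Lipschitz : R → (R → C) → Set
  Lipschitz K f = ∀ τ σ → 𝕀 τ → 𝕀 σ → ‖ f τ -ᶜ f σ ‖ ≤ K * ∣ τ - σ ∣

  lipschitz-cong : ∀ {K f τ σ} → Lipschitz K f → 𝕀 τ → 𝕀 σ → τ ≈ σ → f τ ≈ᶜ f σ
  lipschitz-cong {K} lip p q e = ‖-‖≤0⇒≈ (≤-trans (lip _ _ p q)
    (≤-reflexive (trans (*-congˡ (trans (∣∣-cong (≈⇒-≈0 e)) (nonneg⇒∣∣ ≤-refl))) (zeroʳ K))))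

  -- Lipschitz rather than merely continuous, so that a uniform mesh on [0, 1] comes directly from
  -- the archimedean property.
  record Lift (f L : R → C) : Set where
    field
      constant : R
      constant≥0 : 0# ≤ constant
      lipschitz : Lipschitz constant L
      exp-lift : ∀ τ → 𝕀 τ → exp (L τ) ≈ᶜ f τ
  open Lift

  grid∈𝕀 : ∀ N k → k ℕ.≤ suc N → 𝕀 (nat k * unit N)
  grid∈𝕀 N k le = *-nonneg (nat-nonneg k) (<⇒≤ (unit-pos N)) ,
    ≤-trans (*-monoʳ-≤ (<⇒≤ (unit-pos N)) (nat-mono le)) (≤-reflexive (trans (*-comm _ _) (unit-cancel N)))

  grid-step : ∀ N k → nat (suc k) * unit N - nat k * unit N ≈ unit N
  grid-step N k = trans (+-congʳ (*-congʳ (nat-suc k))) (solve 2 (λ n u → (con 1ℚ :+ n) :* u :- n :* u := u) tt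
    (nat k) (unit N))

  grid-zero : ∀ N → nat 0 * unit N ≈ 0#
  grid-zero N = trans (*-congʳ nat-zero) (zeroˡ _)

  grid-one : ∀ N → nat (suc N) * unit N ≈ 1#
  grid-one N = trans (*-comm _ _) (unit-cancel N)

  -- Half of `r₀`: for |x| ≤ r₁ the logarithm of 1 + x stays within r₀, which leaves room for one
  -- more move of size r₀ inside the ball of radius ρ = 2 r₀ on which exp is injective.
  r₁ : R
  r₁ = ½# * r₀

  r₁>0 : 0# < r₁
  r₁>0 = half-pos r₀>0

  r₁≤r₀ : r₁ ≤ r₀
  r₁≤r₀ = <⇒≤ (half-< r₀>0)

  log1p≤r₀ : ∀ {x} → ‖ x ‖ ≤ r₁ → ‖ log1p x ‖ ≤ r₀
  log1p≤r₀ p = ≤-trans (log1p-bound (≤-trans p r₁≤r₀)) (≤-trans (*-monoˡ-≤ (<⇒≤ 0<2) p)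
    (≤-reflexive (solve 1 (λ r → (con 1ℚ :+ con 1ℚ) :* (con ½ :* r) := r) tt r₀)))

  log1p-zero : log1p 0ᶜ ≈ᶜ 0ᶜ
  log1p-zero = csym (log1p-unique (≤-trans (≤-reflexive ‖0‖) (<⇒≤ r₀>0)) (≤-trans (≤-reflexive ‖0‖) (<⇒≤ ρ>0))
    (ctrans exp-zero (csolve 0 (ccon 1ℚ ⊜ ccon 1ℚ ⊕ ccon 0ℚ) tt)))

  -- The difference of the two lifts cannot leave the ball on which exp is injective.
  lift-compare : ∀ {f g L M} (x : R → C) → Lift f L → Lift g M →
    (∀ τ → 𝕀 τ → ‖ x τ ‖ ≤ r₁ × g τ ≈ᶜ f τ *ᶜ (1ᶜ +ᶜ x τ)) →
    M 0# ≈ᶜ L 0# +ᶜ log1p (x 0#) → M 1# ≈ᶜ L 1# +ᶜ log1p (x 1#)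
  lift-compare {f} {g} {L} {M} x lf lg rel start = finish
    where
    K : R
    K = constant lg + constant lf
    D : R → C
    D τ = M τ -ᶜ L τ
    D-lip : Lipschitz K D
    D-lip τ σ p q = ≤-trans (≤-reflexive (‖‖-cong (csolve 4 (λ a b c d → (a ⊖ b) ⊖ (c ⊖ d) ⊜ (a ⊖ c) ⊖ (b ⊖ d)) tt
      (M τ) (L τ) (M σ) (L σ))))
      (≤-trans (‖‖-triangle-- _ _) (≤-trans (+-mono-≤ (lipschitz lg τ σ p q) (lipschitz lf τ σ p q))
        (≤-reflexive (sym (distribʳ _ _ _)))))
    exp-D : ∀ τ → 𝕀 τ → exp (D τ) ≈ᶜ 1ᶜ +ᶜ x τ
    exp-D τ p = *ᶜ-cancelˡ (exp≉0 (L τ)) (ctrans (csym (exp-+ (L τ) (D τ)))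
      (ctrans (exp-cong (csolve 2 (λ a b → b ⊕ (a ⊖ b) ⊜ a) tt (M τ) (L τ)))
        (ctrans (exp-lift lg τ p) (ctrans (proj₂ (rel τ p)) (*ᶜ-congʳ (csym (exp-lift lf τ p)))))))
    small : ∃ λ N → ∀ n → N ℕ.≤ n → K * unit n < r₀
    small = archimedean-small K r₀>0
    N = proj₁ small
    x≤r₀ : ∀ τ → 𝕀 τ → ‖ x τ ‖ ≤ r₀
    x≤r₀ τ p = ≤-trans (proj₁ (rel τ p)) r₁≤r₀
    D-near : ∀ τ → 𝕀 τ → ‖ D τ ‖ ≤ r₀ → ∀ σ → 𝕀 σ → ∣ σ - τ ∣ ≤ unit N → D σ ≈ᶜ log1p (x σ) × ‖ D σ ‖ ≤ r₀
    D-near τ p b σ q le = e , ≤-trans (≤-reflexive (‖‖-cong e)) (log1p≤r₀ (proj₁ (rel σ q)))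
      where
      e : D σ ≈ᶜ log1p (x σ)
      e = log1p-unique (x≤r₀ σ q) (≤-trans (‖‖-reverse (D σ) (D τ)) (≤-trans (+-mono-≤ b
          (≤-trans (D-lip σ τ q p) (≤-trans (*-monoˡ-≤ (+-nonneg (constant≥0 lg) (constant≥0 lf)) le)
            (<⇒≤ (proj₂ small N ℕ.≤-refl)))))
          (≤-reflexive (trans (solve 1 (λ r → r :+ r := (con 1ℚ :+ con 1ℚ) :* r) tt r₀) 2r₀≈ρ)))) (exp-D σ q)
    D0 : D 0# ≈ᶜ log1p (x 0#)
    D0 = ctrans (+ᶜ-congʳ start) (csolve 2 (λ a b → (a ⊕ b) ⊖ a ⊜ b) tt (L 0#) (log1p (x 0#)))
    D0≤ : ‖ D 0# ‖ ≤ r₀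
    D0≤ = ≤-trans (≤-reflexive (‖‖-cong D0)) (log1p≤r₀ (proj₁ (rel 0# 0∈𝕀)))
    grid : ∀ k → k ℕ.≤ suc N → ‖ D (nat k * unit N) ‖ ≤ r₀
    grid zero le = ≤-trans (≤-reflexive (‖‖-cong (lipschitz-cong D-lip (grid∈𝕀 N 0 z≤n) 0∈𝕀 (grid-zero N)))) D0≤
    grid (suc k) le = proj₂ (D-near _ (grid∈𝕀 N k (ℕ.≤-trans (ℕ.n≤1+n k) le)) (grid k (ℕ.≤-trans (ℕ.n≤1+n k) le)) _
      (grid∈𝕀 N (suc k) le)
      (≤-reflexive (trans (∣∣-cong (grid-step N k)) (∣unit∣ N))))
    D1 : D 1# ≈ᶜ log1p (x 1#)
    D1 = proj₁ (D-near _ (grid∈𝕀 N (suc N) ℕ.≤-refl) (grid (suc N) ℕ.≤-refl) 1# 1∈𝕀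
      (≤-trans (≤-reflexive (trans (∣∣-cong (≈⇒-≈0 (sym (grid-one N)))) (nonneg⇒∣∣ ≤-refl))) (<⇒≤ (unit-pos N))))
    finish : M 1# ≈ᶜ L 1# +ᶜ log1p (x 1#)
    finish = ctrans (csolve 2 (λ a b → a ⊜ b ⊕ (a ⊖ b)) tt (M 1#) (L 1#)) (+ᶜ-congˡ D1)

  lift-unique : ∀ {f g L M} → Lift f L → Lift g M → (∀ τ → 𝕀 τ → g τ ≈ᶜ f τ) → M 0# ≈ᶜ L 0# → M 1# ≈ᶜ L 1#
  lift-unique {f} lf lg e start = ctrans
    (lift-compare (λ _ → 0ᶜ) lf lg (λ τ p → ≤-trans (≤-reflexive ‖0‖) (<⇒≤ r₁>0) , ctrans (e τ p)
      (csolve 1 (λ a → a ⊜ a ⊗ (ccon 1ℚ ⊕ ccon 0ℚ)) tt (f τ)))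
      (ctrans start (ctrans (csym (+ᶜ-identityʳ _)) (+ᶜ-congˡ (csym log1p-zero)))))
    (ctrans (+ᶜ-congˡ log1p-zero) (+ᶜ-identityʳ _))

  path-bounded-below : ∀ {f K} → 0# ≤ K → Lipschitz K f → (∀ τ → 𝕀 τ → ¬ (f τ ≈ᶜ 0ᶜ)) →
    ∃ λ c → 0# < c × (∀ τ → 𝕀 τ → c ≤ ‖ f τ ‖)
  path-bounded-below {f} {K} K≥0 lip f≉0 = proj₁ below , proj₁ (proj₂ below) ,
    λ { τ (p , q) → proj₂ (proj₂ below) τ 0# ((p , ≤-trans q (≤-reflexive (sym (+-identityˡ 1#)))) , ≤-refl ,
      ≤-reflexive (sym (+-identityˡ 0#))) }
    where
    in𝕀 : ∀ {x} → Between 0# (0# + 1#) x → 𝕀 x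
    in𝕀 (p , q) = p , ≤-trans q (≤-reflexive (+-identityˡ 1#))
    -- A path is treated as a function on a rectangle of height 0.
    below : ∃ λ c → 0# < c × (∀ x y → Between 0# (0# + 1#) x × Between 0# (0# + 0#) y → c ≤ ‖ f x ‖)
    below = norm-bounded-below (λ x _ → f x) 0# 1# 0# 0# (<⇒≤ 0<1) ≤-refl K K≥0
      (λ x y x′ y′ r r′ → ≤-trans (lip x x′ (in𝕀 (proj₁ r)) (in𝕀 (proj₁ r′)))
        (*-monoˡ-≤ K≥0 (≤-trans (≤-reflexive (∣-∣-swap x x′))
          (≤-by (∣∣-nonneg (y′ - y)) (solve 2 (λ a b → b :- con 0ℚ := (a :+ b) :- a) tt (∣ x′ - x ∣)
          (∣ y′ - y ∣))))))
      (λ x y r → f≉0 x (in𝕀 (proj₁ r)))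

  -- Local lifts are not glued. Instead f τ is f 0 times the telescoping product of the ratios of f
  -- at τ (k + 1)/(N + 1) and τ k/(N + 1), each near 1 and Lipschitz in τ. The sum of their local
  -- logarithms is a lift given by one formula on all of [0, 1].
  module LiftExists (f : R → C) (K : R) (K≥0 : 0# ≤ K) (lip : Lipschitz K f) (f≉0 : ∀ τ → 𝕀 τ → ¬ (f τ ≈ᶜ 0ᶜ))
    (L₀ : C) (start : exp L₀ ≈ᶜ f 0#) where
    private
      below : ∃ λ c → 0# < c × (∀ τ → 𝕀 τ → c ≤ ‖ f τ ‖)
      below = path-bounded-below K≥0 lip f≉0

      c : R
      c = proj₁ below

      c>0 : 0# < c
      c>0 = proj₁ (proj₂ below)

      c≤ : ∀ {τ} → 𝕀 τ → c ≤ ‖ f τ ‖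
      c≤ {τ} = proj₂ (proj₂ below) τ

      B P : R
      B = 2# / c
      P = ‖ f 0# ‖ + K

      B>0 : 0# < B
      B>0 = /-pos 0<2 c>0

      inv≤ : ∀ {τ} → 𝕀 τ → ‖ f τ ⁻¹ᶜ ‖ ≤ B
      inv≤ p = ⁻¹ᶜ-norm-≤ c>0 (c≤ p)

      f≤P : ∀ {τ} → 𝕀 τ → ‖ f τ ‖ ≤ P
      f≤P {τ} p = ≤-trans (‖‖-reverse (f τ) (f 0#)) (+-mono-≤ ≤-refl (≤-trans (lip τ 0# p 0∈𝕀)
        (≤-trans (*-monoˡ-≤ K≥0 (≤-trans (≤-reflexive (trans (∣∣-cong (solve 1 (λ t → t :- con 0ℚ := t) tt τ))
          (nonneg⇒∣∣ (proj₁ p)))) (proj₂ p))) (≤-reflexive (*-identityʳ K)))))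

      small : ∃ λ N → ∀ n → N ℕ.≤ n → K * B * unit n < r₁
      small = archimedean-small (K * B) r₁>0

      N : ℕ
      N = proj₁ small

      u : R
      u = unit N

      at : R → ℕ → R
      at τ k = τ * (nat k * u)

      at∈𝕀 : ∀ {τ k} → 𝕀 τ → k ℕ.≤ suc N → 𝕀 (at τ k)
      at∈𝕀 {τ} {k} p le = let g = grid∈𝕀 N k le in *-nonneg (proj₁ p) (proj₁ g) ,
        ≤-trans (*-mono-≤ (proj₁ p) (<⇒≤ 0<1) (proj₂ p) (proj₂ g)) (≤-reflexive (*-identityʳ 1#))

      y : ℕ → R → C
      y k τ = f (at τ (suc k)) *ᶜ f (at τ k) ⁻¹ᶜ -ᶜ 1ᶜ

      y-eq : ∀ {k τ} → 𝕀 τ → suc k ℕ.≤ suc N → f (at τ k) *ᶜ (1ᶜ +ᶜ y k τ) ≈ᶜ f (at τ (suc k))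
      y-eq {k} {τ} p le = ctrans (csolve 3 (λ a b i → a ⊗ (ccon 1ℚ ⊕ (b ⊗ i ⊖ ccon 1ℚ)) ⊜ b ⊗ (a ⊗ i)) tt
        (f (at τ k)) (f (at τ (suc k))) (f (at τ k) ⁻¹ᶜ))
        (ctrans (*ᶜ-congˡ (*ᶜ-inverseʳ (f≉0 _ (at∈𝕀 p (ℕ.≤-trans (ℕ.n≤1+n k) le))))) (*ᶜ-identityʳ _))

      y-small : ∀ {k τ} → 𝕀 τ → suc k ℕ.≤ suc N → ‖ y k τ ‖ ≤ r₁
      y-small {k} {τ} p le = ≤-trans (≤-reflexive (‖‖-cong eq))
        (≤-trans (‖‖-mult-≤ (≤-trans (lip _ _ (at∈𝕀 p le) p′) (*-monoˡ-≤ K≥0 dist)) (inv≤ p′))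
          (≤-trans (≤-reflexive (solve 3 (λ k u b → k :* u :* b := k :* b :* u) tt K u B))
            (<⇒≤ (proj₂ small N ℕ.≤-refl))))
        where
        p′ = at∈𝕀 {τ} {k} p (ℕ.≤-trans (ℕ.n≤1+n k) le)
        eq : y k τ ≈ᶜ (f (at τ (suc k)) -ᶜ f (at τ k)) *ᶜ f (at τ k) ⁻¹ᶜ
        eq = ctrans (+ᶜ-congˡ (-ᶜ-cong (csym (*ᶜ-inverseʳ (f≉0 _ p′)))))
          (csolve 3 (λ a b i → b ⊗ i ⊖ a ⊗ i ⊜ (b ⊖ a) ⊗ i) tt (f (at τ k)) (f (at τ (suc k))) (f (at τ k) ⁻¹ᶜ))
        dist : ∣ at τ (suc k) - at τ k ∣ ≤ u
        dist = ≤-trans (≤-reflexive (trans (∣∣-cong (trans (solve 3 (λ t a b → t :* a :- t :* b := t :* (a :- b)) tt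
          τ (nat (suc k) * u) (nat k * u)) (*-congˡ (grid-step N k))))
            (nonneg⇒∣∣ (*-nonneg (proj₁ p) (<⇒≤ (unit-pos N))))))
          (≤-trans (*-monoʳ-≤ (<⇒≤ (unit-pos N)) (proj₂ p)) (≤-reflexive (*-identityˡ u)))

      Y : R
      Y = K * B + P * (B * B * K)

      Y≥0 : 0# ≤ Y
      Y≥0 = +-nonneg (*-nonneg K≥0 (<⇒≤ B>0)) (*-nonneg (≤-trans (‖‖-nonneg (f 0#)) (f≤P 0∈𝕀))
        (*-nonneg (*-nonneg (<⇒≤ B>0) (<⇒≤ B>0)) K≥0))

      y-lip : ∀ k → suc k ℕ.≤ suc N → Lipschitz Y (y k)
      y-lip k le τ σ p q = ≤-trans (≤-reflexive (‖‖-cong eq))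
        (≤-trans (‖‖-+-≤ (‖‖-mult-≤ (moved (suc k) le) (inv≤ τk))
          (‖‖-mult-≤ (f≤P σk′) (‖‖-mult-≤ (‖‖-mult-≤ (inv≤ τk) (inv≤ σk))
            (≤-trans (≤-reflexive (‖‖-swap _ _)) (moved k (ℕ.≤-trans (ℕ.n≤1+n k) le))))))
          (≤-reflexive (solve 4 (λ k b p d → k :* d :* b :+ p :* (b :* b :* (k :* d)) :=
            (k :* b :+ p :* (b :* b :* k)) :* d) tt K B P (∣ τ - σ ∣))))
        where
        τk = at∈𝕀 {τ} {k} p (ℕ.≤-trans (ℕ.n≤1+n k) le)
        σk = at∈𝕀 {σ} {k} q (ℕ.≤-trans (ℕ.n≤1+n k) le)
        σk′ = at∈𝕀 {σ} {suc k} q le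
        moved : ∀ j → j ℕ.≤ suc N → ‖ f (at τ j) -ᶜ f (at σ j) ‖ ≤ K * ∣ τ - σ ∣
        moved j lj = ≤-trans (lip _ _ (at∈𝕀 p lj) (at∈𝕀 q lj)) (*-monoˡ-≤ K≥0
          (≤-trans (≤-reflexive (trans (∣∣-cong (solve 3 (λ t s a → t :* a :- s :* a := a :* (t :- s)) tt τ σ
            (nat j * u))) (trans (∣∣-* _ _) (*-congʳ (nonneg⇒∣∣ (proj₁ (grid∈𝕀 N j lj)))))))
            (≤-trans (*-monoʳ-≤ (∣∣-nonneg _) (proj₂ (grid∈𝕀 N j lj))) (≤-reflexive (*-identityˡ _)))))
        a = f (at τ (suc k))
        a′ = f (at σ (suc k))
        b = f (at τ k)
        b′ = f (at σ k)
        eq : y k τ -ᶜ y k σ ≈ᶜ (a -ᶜ a′) *ᶜ b ⁻¹ᶜ +ᶜ a′ *ᶜ (b ⁻¹ᶜ *ᶜ b′ ⁻¹ᶜ *ᶜ (b′ -ᶜ b))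
        eq = begin
          (a *ᶜ b ⁻¹ᶜ -ᶜ 1ᶜ) -ᶜ (a′ *ᶜ b′ ⁻¹ᶜ -ᶜ 1ᶜ)
            ≈⟨ csolve 4 (λ a a' i j → (a ⊗ i ⊖ ccon 1ℚ) ⊖ (a' ⊗ j ⊖ ccon 1ℚ) ⊜ (a ⊖ a') ⊗ i ⊕
              (a' ⊗ i ⊗ ccon 1ℚ ⊖ a' ⊗ j ⊗ ccon 1ℚ)) tt a a′ (b ⁻¹ᶜ) (b′ ⁻¹ᶜ) ⟩
          (a -ᶜ a′) *ᶜ b ⁻¹ᶜ +ᶜ (a′ *ᶜ b ⁻¹ᶜ *ᶜ 1ᶜ -ᶜ a′ *ᶜ b′ ⁻¹ᶜ *ᶜ 1ᶜ)
            ≈⟨ +ᶜ-congˡ (+ᶜ-cong (*ᶜ-congˡ (csym (*ᶜ-inverseʳ (f≉0 _ σk))))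
              (-ᶜ-cong (*ᶜ-congˡ (csym (*ᶜ-inverseʳ (f≉0 _ τk)))))) ⟩
          (a -ᶜ a′) *ᶜ b ⁻¹ᶜ +ᶜ (a′ *ᶜ b ⁻¹ᶜ *ᶜ (b′ *ᶜ b′ ⁻¹ᶜ) -ᶜ a′ *ᶜ b′ ⁻¹ᶜ *ᶜ (b *ᶜ b ⁻¹ᶜ))
            ≈⟨ csolve 6 (λ x a' i j b b' → x ⊕ (a' ⊗ i ⊗ (b' ⊗ j) ⊖ a' ⊗ j ⊗ (b ⊗ i)) ⊜ x ⊕ a' ⊗ (i ⊗ j ⊗ (b' ⊖ b)))
              tt ((a -ᶜ a′) *ᶜ b ⁻¹ᶜ) a′ (b ⁻¹ᶜ) (b′ ⁻¹ᶜ) b b′ ⟩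
          (a -ᶜ a′) *ᶜ b ⁻¹ᶜ +ᶜ a′ *ᶜ (b ⁻¹ᶜ *ᶜ b′ ⁻¹ᶜ *ᶜ (b′ -ᶜ b)) ∎
          where open C-Reasoning

      partial : ℕ → R → C
      partial zero τ = L₀
      partial (suc k) τ = partial k τ +ᶜ log1p (y k τ)

      partial-exp : ∀ k τ → 𝕀 τ → k ℕ.≤ suc N → exp (partial k τ) ≈ᶜ f (at τ k)
      partial-exp zero τ p le = ctrans start (lipschitz-cong lip 0∈𝕀 (at∈𝕀 p z≤n)
        (sym (trans (*-congˡ (grid-zero N)) (zeroʳ τ))))
      partial-exp (suc k) τ p le = ctrans (exp-+ _ _)
        (ctrans (*ᶜ-cong (partial-exp k τ p (ℕ.≤-trans (ℕ.n≤1+n k) le)) (exp-log1p (≤-trans (y-small p le) r₁≤r₀)))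
          (y-eq p le))

      partial-lip : ∀ k → k ℕ.≤ suc N → Lipschitz (nat k * (2# * Y)) (partial k)
      partial-lip zero le τ σ p q = ≤-trans (≈⇒‖-‖≤0 crefl) (*-nonneg
        (*-nonneg (nat-nonneg 0) (*-nonneg (<⇒≤ 0<2) Y≥0)) (∣∣-nonneg (τ - σ)))
      partial-lip (suc k) le τ σ p q = ≤-trans
        (≤-reflexive (‖‖-cong (csolve 4 (λ a b c d → (a ⊕ b) ⊖ (c ⊕ d) ⊜ (a ⊖ c) ⊕ (b ⊖ d)) tt (partial k τ)
          (log1p (y k τ)) (partial k σ) (log1p (y k σ)))))
        (≤-trans (‖‖-+-≤ (partial-lip k (ℕ.≤-trans (ℕ.n≤1+n k) le) τ σ p q)
            (≤-trans (log1p-lipschitz (≤-trans (y-small p le) r₁≤r₀) (≤-trans (y-small q le) r₁≤r₀))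
              (*-monoˡ-≤ (<⇒≤ 0<2) (y-lip k le τ σ p q))))
          (≤-reflexive (trans (solve 3 (λ n Y d → n :* ((con 1ℚ :+ con 1ℚ) :* Y) :* d :+ (con 1ℚ :+ con 1ℚ) :*
            (Y :* d) := (con 1ℚ :+ n) :* ((con 1ℚ :+ con 1ℚ) :* Y) :* d) tt (nat k) Y (∣ τ - σ ∣))
            (*-congʳ (*-congʳ (sym (nat-suc k)))))))

    lift-exists : ∃ λ L → Lift f L × L 0# ≈ᶜ L₀
    lift-exists = partial (suc N) , record
      { constant = nat (suc N) * (2# * Y)
      ; constant≥0 = *-nonneg (nat-nonneg (suc N)) (*-nonneg (<⇒≤ 0<2) Y≥0)
      ; lipschitz = partial-lip (suc N) ℕ.≤-refl
      ; exp-lift = λ τ p → ctrans (partial-exp (suc N) τ p ℕ.≤-refl)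
          (lipschitz-cong lip (at∈𝕀 p ℕ.≤-refl) p (trans (*-congˡ (grid-one N)) (*-identityʳ τ))) } ,
      at-zero (suc N) ℕ.≤-refl
      where
      at-zero : ∀ k → k ℕ.≤ suc N → partial k 0# ≈ᶜ L₀
      at-zero zero le = crefl
      at-zero (suc k) le = ctrans (+ᶜ-cong (at-zero k (ℕ.≤-trans (ℕ.n≤1+n k) le))
        (ctrans (log1p-cong (≤-trans (y-small 0∈𝕀 le) r₁≤r₀) y0) log1p-zero)) (+ᶜ-identityʳ _)
        where
        y0 : y k 0# ≈ᶜ 0ᶜ
        y0 = ctrans (+ᶜ-congʳ (ctrans (*ᶜ-congʳ (lipschitz-cong lip (at∈𝕀 0∈𝕀 le)
          (at∈𝕀 0∈𝕀 (ℕ.≤-trans (ℕ.n≤1+n k) le)) (trans (zeroˡ _) (sym (zeroˡ _)))))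
          (*ᶜ-inverseʳ (f≉0 _ (at∈𝕀 0∈𝕀 (ℕ.≤-trans (ℕ.n≤1+n k) le)))))) (-ᶜ-inverseʳ 1ᶜ)

  -- The principal logarithm on the right half-plane

  exp-lipschitz : ∀ {z w r} → ‖ z ‖ ≤ r → ‖ w ‖ ≤ r → ‖ exp z -ᶜ exp w ‖ ≤ expR r * (1# + 2# * r) * ‖ z -ᶜ w ‖
  exp-lipschitz {z} {w} {r} p q = ≤-trans
    (≤-reflexive (‖‖-cong (ctrans (+ᶜ-congʳ (exp-cong (csolve 2 (λ z w → z ⊜ w ⊕ (z ⊖ w)) tt z w)))
      (csolve 3 (λ a b h → a ⊖ b ⊜ (a ⊖ b ⊖ h ⊗ b) ⊕ h ⊗ b) tt (exp (w +ᶜ (z -ᶜ w))) (exp w) (z -ᶜ w)))))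
    (≤-trans (‖‖-+-≤ (≤-trans (exp-first-order w (z -ᶜ w) r q
      (≤-trans (≤-reflexive (‖‖-cong (csolve 2 (λ z w → w ⊕ (z ⊖ w) ⊜ z) tt z w))) p))
        (*-monoʳ-≤ (<⇒≤ (expR-pos r)) (*-monoʳ-≤ (‖‖-nonneg (z -ᶜ w))
          (≤-trans (‖‖-triangle-- z w) (+-mono-≤ p q)))))
      (‖‖-mult-≤ ≤-refl (exp-bound q)))
      (≤-reflexive (solve 3 (λ r d e → (r :+ r) :* d :* e :+ d :* e := e :* (con 1ℚ :+ (con 1ℚ :+ con 1ℚ) :* r) :*
        d) tt r (‖ z -ᶜ w ‖) (expR r))))

  ⁻¹ᶜ-cong : ∀ {z w} → ¬ (z ≈ᶜ 0ᶜ) → z ≈ᶜ w → z ⁻¹ᶜ ≈ᶜ w ⁻¹ᶜ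
  ⁻¹ᶜ-cong {z} {w} z≉0 e = *ᶜ-cancelˡ z≉0 (ctrans (*ᶜ-inverseʳ z≉0)
    (csym (ctrans (*ᶜ-congʳ e) (*ᶜ-inverseʳ λ w≈0 → z≉0 (ctrans e w≈0)))))

  segment : C → R → C
  segment z τ = 1ᶜ +ᶜ ofR τ *ᶜ (z -ᶜ 1ᶜ)

  re-segment : ∀ z τ → re (segment z τ) ≈ (1# - τ) + τ * re z
  re-segment z τ = trans (re-+ _ _) (trans (+-congˡ (trans (re-ofR-* τ _)
    (*-congˡ (trans (re-+ z _) (+-congˡ (re-neg _))))))
    (solve 2 (λ t a → con 1ℚ :+ t :* (a :- con 1ℚ) := (con 1ℚ :- t) :+ t :* a) tt τ (re z)))

  segment-below : ∀ {z τ m} → m ≤ 1# → m ≤ re z → 𝕀 τ → m ≤ re (segment z τ)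
  segment-below {z} {τ} {m} p q (τ≥0 , τ≤1) = ≤-trans (≤-reflexive
    (solve 2 (λ t m → m := (con 1ℚ :- t) :* m :+ t :* m) tt τ m))
    (≤-trans (+-mono-≤ (*-monoˡ-≤ (≤⇒0≤ τ≤1) p) (*-monoˡ-≤ τ≥0 q))
      (≤-reflexive (trans (+-congʳ (*-identityʳ _)) (sym (re-segment z τ)))))

  segment-norm-below : ∀ {z τ m} → m ≤ 1# → m ≤ re z → 𝕀 τ → m ≤ ‖ segment z τ ‖
  segment-norm-below p q r = ≤-trans (segment-below p q r) (≤-trans (x≤∣x∣ _) (∣re∣≤‖‖ _))

  re-segment-pos : ∀ {z τ} → 0# < re z → 𝕀 τ → 0# < re (segment z τ)
  re-segment-pos {z} p r = <-≤-trans (⊓-pos 0<1 p) (segment-below {m = 1# ⊓ re z} (x⊓y≤x 1# (re z))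
    (x⊓y≤y 1# (re z)) r)

  re-pos⇒≉0 : ∀ {z} → 0# < re z → ¬ (z ≈ᶜ 0ᶜ)
  re-pos⇒≉0 p e = <⇒≉ p (sym (re-cong e))

  segment≉0 : ∀ {z τ} → 0# < re z → 𝕀 τ → ¬ (segment z τ ≈ᶜ 0ᶜ)
  segment≉0 p r = re-pos⇒≉0 (re-segment-pos p r)

  segment-zero : ∀ z → segment z 0# ≈ᶜ 1ᶜ
  segment-zero z = csolve 1 (λ z → ccon 1ℚ ⊕ ccon 0ℚ ⊗ (z ⊖ ccon 1ℚ) ⊜ ccon 1ℚ) tt z

  segment-one : ∀ z → segment z 1# ≈ᶜ z
  segment-one z = csolve 1 (λ z → ccon 1ℚ ⊕ ccon 1ℚ ⊗ (z ⊖ ccon 1ℚ) ⊜ z) tt z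

  segment-lipschitz : ∀ z → Lipschitz (‖ z -ᶜ 1ᶜ ‖) (segment z)
  segment-lipschitz z τ σ _ _ = ≤-reflexive (trans (‖‖-cong (ctrans
    (csolve 3 (λ t s w → (ccon 1ℚ ⊕ t ⊗ w) ⊖ (ccon 1ℚ ⊕ s ⊗ w) ⊜ (t ⊖ s) ⊗ w) tt (ofR τ) (ofR σ) (z -ᶜ 1ᶜ))
    (*ᶜ-congʳ (csym (ofR-- τ σ)))))
    (trans (‖ofR*‖ _ _) (*-comm _ _)))

  opaque
    -- The value is the endpoint of a lift along the segment from 1 to z. The lift is kept with it,
    -- since two values of a branch can only be compared along their paths.
    Log-spec : ∀ z → ∃ λ l → 0# < re z → ∃ λ L → Lift (segment z) L × L 0# ≈ᶜ 0ᶜ × L 1# ≈ᶜ l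
    Log-spec z with lem {0# < re z}
    ... | yes p = proj₁ lifted 1# , λ _ → proj₁ lifted , proj₁ (proj₂ lifted) , proj₂ (proj₂ lifted) , crefl
      where
      lifted : ∃ λ L → Lift (segment z) L × L 0# ≈ᶜ 0ᶜ
      lifted = LiftExists.lift-exists (segment z) (‖ z -ᶜ 1ᶜ ‖) (‖‖-nonneg _) (segment-lipschitz z)
        (λ τ r → segment≉0 p r) 0ᶜ (ctrans exp-zero (csym (segment-zero z)))
    ... | no ¬p = 0ᶜ , λ p → ⊥-elim (¬p p)

  Log : C → C
  Log z = proj₁ (Log-spec z)

  exp-Log : ∀ {z} → 0# < re z → exp (Log z) ≈ᶜ z
  exp-Log {z} p = let L , lift , _ , e = proj₂ (Log-spec z) p in
    ctrans (exp-cong (csym e)) (ctrans (Lift.exp-lift lift 1# 1∈𝕀) (segment-one z))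

  -- On the segment to z the real part stays above min (1, Re z). Hence the ratio of the two
  -- segments is close to 1 uniformly in τ, and `lift-compare` carries the equation from τ = 0,
  -- where both logarithms vanish, to τ = 1.
  Log-local : ∀ {z} → 0# < re z → ∃ λ δ → 0# < δ × (∀ w → 0# < re w → ‖ w -ᶜ z ‖ ≤ δ →
    ‖ (w -ᶜ z) *ᶜ z ⁻¹ᶜ ‖ ≤ r₁ × Log w ≈ᶜ Log z +ᶜ log1p ((w -ᶜ z) *ᶜ z ⁻¹ᶜ))
  Log-local {z} p = δ , δ>0 , local
    where
    m : R
    m = 1# ⊓ re z
    m>0 : 0# < m
    m>0 = ⊓-pos 0<1 p
    B>0 : 0# < 2# / m
    B>0 = /-pos 0<2 m>0
    δ : R
    δ = r₁ / (2# / m)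
    δ>0 : 0# < δ
    δ>0 = /-pos r₁>0 B>0
    local : ∀ w → 0# < re w → ‖ w -ᶜ z ‖ ≤ δ → ‖ (w -ᶜ z) *ᶜ z ⁻¹ᶜ ‖ ≤ r₁ × Log w ≈ᶜ Log z +ᶜ log1p
      ((w -ᶜ z) *ᶜ z ⁻¹ᶜ)
    local w q near = ≤-trans (≤-reflexive (‖‖-cong (csym x1))) (small 1# 1∈𝕀) ,
      ctrans (csym eM) (ctrans (lift-compare x liftL liftM (λ τ r → small τ r , related τ r) start)
        (+ᶜ-cong eL (log1p-cong (≤-trans (small 1# 1∈𝕀) r₁≤r₀) x1)))
      where
      x : R → C
      x τ = ofR τ *ᶜ (w -ᶜ z) *ᶜ segment z τ ⁻¹ᶜ
      small : ∀ τ → 𝕀 τ → ‖ x τ ‖ ≤ r₁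
      small τ r = ≤-trans (‖‖-mult-≤ (≤-trans (≤-reflexive (trans (‖ofR*‖ τ (w -ᶜ z))
        (*-congʳ (nonneg⇒∣∣ (proj₁ r)))))
            (≤-trans (*-monoʳ-≤ (‖‖-nonneg _) (proj₂ r)) (≤-trans (≤-reflexive (*-identityˡ _)) near)))
          (⁻¹ᶜ-norm-≤ m>0 (segment-norm-below {z} (x⊓y≤x 1# (re z)) (x⊓y≤y 1# (re z)) r)))
        (≤-reflexive (trans (*-comm δ (2# / m)) (*-/-cancel (pos⇒≉0 B>0))))
      related : ∀ τ → 𝕀 τ → segment w τ ≈ᶜ segment z τ *ᶜ (1ᶜ +ᶜ x τ)
      related τ r = csym (ctrans (csolve 4 (λ f t d i → f ⊗ (ccon 1ℚ ⊕ t ⊗ d ⊗ i) ⊜ f ⊕ t ⊗ d ⊗ (f ⊗ i)) tt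
        (segment z τ) (ofR τ) (w -ᶜ z) (segment z τ ⁻¹ᶜ))
        (ctrans (+ᶜ-congˡ (*ᶜ-congˡ (*ᶜ-inverseʳ (segment≉0 p r))))
          (csolve 3 (λ t z w → ccon 1ℚ ⊕ t ⊗ (z ⊖ ccon 1ℚ) ⊕ t ⊗ (w ⊖ z) ⊗ ccon 1ℚ ⊜ ccon 1ℚ ⊕ t ⊗ (w ⊖ ccon 1ℚ)) tt
          (ofR τ) z w)))
      x1 : x 1# ≈ᶜ (w -ᶜ z) *ᶜ z ⁻¹ᶜ
      x1 = *ᶜ-cong (*ᶜ-identityˡ _) (⁻¹ᶜ-cong (segment≉0 p 1∈𝕀) (segment-one z))
      sL = proj₂ (Log-spec z) p
      sM = proj₂ (Log-spec w) q
      L = proj₁ sL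
      M = proj₁ sM
      liftL : Lift (segment z) L
      liftL = proj₁ (proj₂ sL)
      liftM : Lift (segment w) M
      liftM = proj₁ (proj₂ sM)
      eL : L 1# ≈ᶜ Log z
      eL = proj₂ (proj₂ (proj₂ sL))
      eM : M 1# ≈ᶜ Log w
      eM = proj₂ (proj₂ (proj₂ sM))
      start : M 0# ≈ᶜ L 0# +ᶜ log1p (x 0#)
      start = ctrans (proj₁ (proj₂ (proj₂ sM))) (csym (ctrans (+ᶜ-cong (proj₁ (proj₂ (proj₂ sL)))
        (ctrans (log1p-cong (≤-trans (small 0# 0∈𝕀) r₁≤r₀) (csolve 2 (λ d i → ccon 0ℚ ⊗ d ⊗ i ⊜ ccon 0ℚ) tt (w -ᶜ z)
          (segment z 0# ⁻¹ᶜ))) log1p-zero)) (+ᶜ-identityʳ 0ᶜ)))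

  Log-cong : ∀ {z w} → 0# < re z → z ≈ᶜ w → Log z ≈ᶜ Log w
  Log-cong {z} {w} p e = let δ , δ>0 , local = Log-local p
                             small , eq = local w (<-resp₂ refl (re-cong e) p) (≤-trans (≈⇒‖-‖≤0 (csym e)) (<⇒≤ δ>0)) in
    csym (ctrans eq (ctrans (+ᶜ-congˡ (ctrans (log1p-cong (≤-trans small r₁≤r₀)
      (ctrans (*ᶜ-congʳ (≈ᶜ⇒-ᶜ≈0 (csym e))) (*ᶜ-zeroˡ _))) log1p-zero)) (+ᶜ-identityʳ _)))

  lift-conj : ∀ {f L} → Lift f L → Lift (conj ∘ f) (conj ∘ L)
  lift-conj {f} {L} l = record
    { constant = Lift.constant l ; constant≥0 = Lift.constant≥0 l
    ; lipschitz = λ τ σ p q → ≤-trans (≤-reflexive (trans (‖‖-cong (csym (conj-- (L τ) (L σ)))) (‖‖-conj _)))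
      (Lift.lipschitz l τ σ p q)
    ; exp-lift = λ τ p → ctrans (exp-conj (L τ)) (conj-cong (Lift.exp-lift l τ p)) }
    where
    conj-- : ∀ z w → conj (z -ᶜ w) ≈ᶜ conj z -ᶜ conj w
    conj-- z w = ctrans (conj-+ z _) (+ᶜ-congˡ (conj-neg w))

  Log-conj : ∀ {z} → 0# < re z → Log (conj z) ≈ᶜ conj (Log z)
  Log-conj {z} p = ctrans (csym eM) (ctrans (lift-unique (lift-conj liftL) liftM related
      (ctrans (proj₁ (proj₂ (proj₂ sM))) (csym (ctrans (conj-cong (proj₁ (proj₂ (proj₂ sL)))) (conj-ofR 0#)))))
        (conj-cong eL))
    where
    sL = proj₂ (Log-spec z) p
    sM = proj₂ (Log-spec (conj z)) (<-resp₂ refl (sym (re-conj z)) p)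
    L = proj₁ sL
    M = proj₁ sM
    liftL : Lift (segment z) L
    liftL = proj₁ (proj₂ sL)
    liftM : Lift (segment (conj z)) M
    liftM = proj₁ (proj₂ sM)
    eL : L 1# ≈ᶜ Log z
    eL = proj₂ (proj₂ (proj₂ sL))
    eM : M 1# ≈ᶜ Log (conj z)
    eM = proj₂ (proj₂ (proj₂ sM))
    related : ∀ τ → 𝕀 τ → segment (conj z) τ ≈ᶜ conj (segment z τ)
    related τ _ = csym (ctrans (conj-+ _ _) (+ᶜ-cong (conj-ofR 1#) (ctrans (conj-* _ _) (*ᶜ-cong (conj-ofR τ)
      (ctrans (conj-+ z _) (+ᶜ-congˡ (ctrans (conj-cong (csym (ofR-neg 1#)))
        (ctrans (conj-ofR (- 1#)) (ofR-neg 1#)))))))))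

  ln : R → R
  ln x = re (Log (ofR x))

  Log-real : ∀ {x} → 0# < x → Log (ofR x) ≈ᶜ ofR (ln x)
  Log-real {x} p = refl ,ᶜ ≈-neg⇒≈0 (trans (sym (im-conj _)) (im-cong
    (ctrans (csym (Log-conj p)) (Log-cong (<-resp₂ refl (sym (re-conj (ofR x))) p) (conj-ofR x)))))

  expR-ln : ∀ {x} → 0# < x → expR (ln x) ≈ x
  expR-ln {x} p = re-cong (ctrans (exp-cong (csym (Log-real p))) (exp-Log p))

  ln-unique : ∀ {x y} → 0# < x → expR y ≈ x → y ≈ ln x
  ln-unique p e = expR-injective (trans e (sym (expR-ln p)))

  -- Trigonometry and π

  imag : R → C
  imag x = mkC 0# x

  sin cos : R → R
  sin x = im (exp (imag x))
  cos x = re (exp (imag x))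

  opaque
    unfolding _+ᶜ_
    imag-+ : ∀ x y → imag (x + y) ≈ᶜ imag x +ᶜ imag y
    imag-+ x y = sym (+-identityˡ 0#) ,ᶜ refl

    re+imag : ∀ z → z ≈ᶜ ofR (re z) +ᶜ imag (im z)
    re+imag z = sym (+-identityʳ _) ,ᶜ sym (+-identityˡ _)

    conj-imag : ∀ x → conj (imag x) ≈ᶜ imag (- x)
    conj-imag x = refl ,ᶜ refl

  ‖imag‖ : ∀ x → ‖ imag x ‖ ≈ ∣ x ∣
  ‖imag‖ x = trans (+-congʳ (nonneg⇒∣∣ ≤-refl)) (+-identityˡ _)

  imag-cong : ∀ {x y} → x ≈ y → imag x ≈ᶜ imag y
  imag-cong p = refl ,ᶜ p

  sin-cong : ∀ {x y} → x ≈ y → sin x ≈ sin y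
  sin-cong p = im-cong (exp-cong (imag-cong p))

  cos-cong : ∀ {x y} → x ≈ y → cos x ≈ cos y
  cos-cong p = re-cong (exp-cong (imag-cong p))

  sin-+ : ∀ x y → sin (x + y) ≈ cos x * sin y + sin x * cos y
  sin-+ x y = trans (im-cong (ctrans (exp-cong (imag-+ x y)) (exp-+ _ _))) (im-* _ _)

  cos-+ : ∀ x y → cos (x + y) ≈ cos x * cos y - sin x * sin y
  cos-+ x y = trans (re-cong (ctrans (exp-cong (imag-+ x y)) (exp-+ _ _))) (re-* _ _)

  exp-neg-imag : ∀ x → exp (imag (- x)) ≈ᶜ conj (exp (imag x))
  exp-neg-imag x = ctrans (exp-cong (csym (conj-imag x))) (exp-conj (imag x))

  sin-neg : ∀ x → sin (- x) ≈ - sin x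
  sin-neg x = trans (im-cong (exp-neg-imag x)) (im-conj _)

  cos-neg : ∀ x → cos (- x) ≈ cos x
  cos-neg x = trans (re-cong (exp-neg-imag x)) (re-conj _)

  sin-zero : sin 0# ≈ 0#
  sin-zero = im-cong exp-zero

  cos-zero : cos 0# ≈ 1#
  cos-zero = re-cong exp-zero

  cos²+sin² : ∀ x → cos x * cos x + sin x * sin x ≈ 1#
  cos²+sin² x = trans (solve 2 (λ c s → c :* c :+ s :* s := c :* c :- s :* (:- s)) tt (cos x) (sin x))
    (trans (+-cong (*-congˡ (sym (cos-neg x))) (-‿cong (*-congˡ (sym (sin-neg x)))))
      (trans (sym (cos-+ x (- x))) (trans (cos-cong (-‿inverseʳ x)) cos-zero)))

  exp-polar : ∀ z → exp z ≈ᶜ ofR (expR (re z)) *ᶜ exp (imag (im z))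
  exp-polar z = ctrans (exp-cong (re+imag z)) (ctrans (exp-+ _ _) (*ᶜ-congʳ (exp-ofR (re z))))

  re-exp : ∀ z → re (exp z) ≈ expR (re z) * cos (im z)
  re-exp z = trans (re-cong (exp-polar z)) (re-ofR-* _ _)

  im-exp : ∀ z → im (exp z) ≈ expR (re z) * sin (im z)
  im-exp z = trans (im-cong (exp-polar z)) (im-ofR-* _ _)

  sin-lipschitz : ∀ {x y r} → ∣ x ∣ ≤ r → ∣ y ∣ ≤ r → ∣ sin x - sin y ∣ ≤ expR r * (1# + 2# * r) * ∣ x - y ∣
  sin-lipschitz {x} {y} p q = ≤-trans (∣im-im∣≤ _ _)
    (≤-trans (exp-lipschitz (≤-trans (≤-reflexive (‖imag‖ x)) p) (≤-trans (≤-reflexive (‖imag‖ y)) q))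
      (≤-reflexive (*-congˡ (trans (‖‖-cong eq) (‖imag‖ _)))))
    where
    eq : imag x -ᶜ imag y ≈ᶜ imag (x - y)
    eq = trans (re-+ _ _) (trans (+-congˡ (re-neg _)) (-‿inverseʳ 0#)) ,ᶜ trans (im-+ _ _) (+-congˡ (im-neg _))

  -- The first order estimate |exp (it) - 1 - it| ≤ β t² gives sin t ≥ t (1 - β t).
  sin-pos-near-zero : ∀ {t} → 0# < t → t ≤ 1# → β * t < 1# → 0# < sin t
  sin-pos-near-zero {t} t>0 t≤1 βt<1 = <-≤-trans (*-pos t>0 (<⇒0< βt<1))
    (≤-by (≤-trans (≤-trans (-x≤∣x∣ _) (∣im∣≤‖‖ (exp-error (imag t))))
      (≤-trans (exp-error-bound (≤-trans (≤-reflexive norm) t≤1)) (≤-reflexive (*-congʳ (*-cong norm norm)))))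
      (trans (+-congˡ (-‿cong (-‿cong err))) (solve 3 (λ t b s → t :* t :* b :- :- (s :- con 0ℚ :- t) := s :- t :*
        (con 1ℚ :- b :* t)) tt t β (sin t))))
    where
    norm : ‖ imag t ‖ ≈ t
    norm = trans (‖imag‖ t) (nonneg⇒∣∣ (<⇒≤ t>0))
    err : im (exp-error (imag t)) ≈ sin t - 0# - t
    err = trans (im-+ _ _) (+-cong (trans (im-+ _ _) (+-congˡ (im-neg _))) (im-neg _))

  δ₀ : R
  δ₀ = ½# * (1# ⊓ β ⁻¹)

  δ₀>0 : 0# < δ₀
  δ₀>0 = half-pos (⊓-pos 0<1 (⁻¹-pos β>0))

  sin-pos-below-δ₀ : ∀ {t} → 0# < t → t ≤ δ₀ → 0# < sin t
  sin-pos-below-δ₀ {t} p q = sin-pos-near-zero p (≤-trans q (≤-trans (<⇒≤ half) (x⊓y≤x 1# (β ⁻¹))))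
    (<-resp₂ refl (*-inverseʳ (pos⇒≉0 β>0)) (*-monoˡ-< β>0 (≤-<-trans q (<-≤-trans half (x⊓y≤y 1# (β ⁻¹))))))
    where
    half : δ₀ < 1# ⊓ β ⁻¹
    half = half-< (⊓-pos 0<1 (⁻¹-pos β>0))

  -- exp (4 Log (1 + i)) = -4
  sin-has-zero : ∃ λ t → 0# < t × sin t ≈ 0#
  sin-has-zero = [ (λ p → b , p , sin-b) , (λ p → - b , neg-pos p , trans (sin-neg b)
    (trans (-‿cong sin-b) (solve 0 (:- con 0ℚ := con 0ℚ) tt))) ]′ (pos-or-neg b≉0)
    where
    z : C
    z = mkC 1# 1#
    l : C
    l = Log z
    l² : C
    l² = l +ᶜ l
    b : R
    b = im (l² +ᶜ l²)
    z≈ : z ≈ᶜ 1ᶜ +ᶜ 𝕚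
    z≈ = sym (trans (re-+ _ _) (+-identityʳ 1#)) ,ᶜ sym (trans (im-+ _ _) (+-identityˡ 1#))
    exp-l : exp l ≈ᶜ 1ᶜ +ᶜ 𝕚
    exp-l = ctrans (exp-Log 0<1) z≈
    exp-b : exp (l² +ᶜ l²) ≈ᶜ ofR (- (2# + 2#))
    exp-b = ctrans (exp-+ l² l²) (ctrans (*ᶜ-cong sq sq)
      (ctrans (csolve 1 (λ i → (ccon 1ℚ ⊕ i) ⊗ (ccon 1ℚ ⊕ i) ⊗ ((ccon 1ℚ ⊕ i) ⊗ (ccon 1ℚ ⊕ i)) ⊜ ccon 1ℚ ⊕
        ((ccon 1ℚ ⊕ ccon 1ℚ) ⊕ (ccon 1ℚ ⊕ ccon 1ℚ)) ⊗ i ⊕ ((ccon 1ℚ ⊕ ccon 1ℚ) ⊕ (ccon 1ℚ ⊕ ccon 1ℚ) ⊕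
        (ccon 1ℚ ⊕ ccon 1ℚ)) ⊗ (i ⊗ i) ⊕ ((ccon 1ℚ ⊕ ccon 1ℚ) ⊕ (ccon 1ℚ ⊕ ccon 1ℚ)) ⊗ (i ⊗ i) ⊗ i ⊕ (i ⊗ i) ⊗
        (i ⊗ i)) tt 𝕚)
        (ctrans (+ᶜ-cong (+ᶜ-cong (+ᶜ-congˡ (*ᶜ-congˡ 𝕚*𝕚)) (*ᶜ-congʳ (*ᶜ-congˡ 𝕚*𝕚))) (*ᶜ-cong 𝕚*𝕚 𝕚*𝕚))
          (ctrans (csolve 1 (λ i → ccon 1ℚ ⊕ ((ccon 1ℚ ⊕ ccon 1ℚ) ⊕ (ccon 1ℚ ⊕ ccon 1ℚ)) ⊗ i ⊕
            ((ccon 1ℚ ⊕ ccon 1ℚ) ⊕ (ccon 1ℚ ⊕ ccon 1ℚ) ⊕ (ccon 1ℚ ⊕ ccon 1ℚ)) ⊗ (⊝ ccon 1ℚ) ⊕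
            ((ccon 1ℚ ⊕ ccon 1ℚ) ⊕ (ccon 1ℚ ⊕ ccon 1ℚ)) ⊗ (⊝ ccon 1ℚ) ⊗ i ⊕ (⊝ ccon 1ℚ) ⊗ (⊝ ccon 1ℚ) ⊜ ⊝
            ((ccon 1ℚ ⊕ ccon 1ℚ) ⊕ (ccon 1ℚ ⊕ ccon 1ℚ))) tt 𝕚)
            (csym (ctrans (ofR-neg _) (-ᶜ-cong (ctrans (ofR-+ _ _) (+ᶜ-cong (ofR-+ _ _) (ofR-+ _ _))))))))))
      where
      sq : exp l² ≈ᶜ (1ᶜ +ᶜ 𝕚) *ᶜ (1ᶜ +ᶜ 𝕚)
      sq = ctrans (exp-+ l l) (*ᶜ-cong exp-l exp-l)
    sin-b : sin b ≈ 0#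
    sin-b = *-cancelˡ-≈ (pos⇒≉0 (expR-pos _)) (trans (sym (im-exp _)) (trans (im-cong exp-b) (sym (zeroʳ _))))
    b≉0 : ¬ (b ≈ 0#)
    b≉0 e = <-irrefl (<-trans (<-resp₂ refl (trans (sym (*-identityʳ _))
      (trans (*-congˡ (sym (trans (cos-cong e) cos-zero))) (trans (sym (re-exp _)) (re-cong exp-b))))
      (expR-pos (re (l² +ᶜ l²)))) (<-by (+-pos 0<2 (<⇒≤ 0<2))
        (solve 0 (((con 1ℚ :+ con 1ℚ) :+ (con 1ℚ :+ con 1ℚ)) :- con 0ℚ := con 0ℚ :- :-
        ((con 1ℚ :+ con 1ℚ) :+ (con 1ℚ :+ con 1ℚ))) tt)))

  private
    A : R
    A = proj₁ sin-has-zero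

    A≥0 : 0# ≤ A
    A≥0 = <⇒≤ (proj₁ (proj₂ sin-has-zero))

    PosBelow : R → Set
    PosBelow a = ∀ t → 0# < t → t < a → 0# < sin t

    -- Bisection for the least positive zero of the sine: no point of (0, a) has sin ≤ 0, but some
    -- point of the bracket does. The bisection is planar, so the second coordinate is a dummy with
    -- side 0.
    Bracket : R → R → ℕ → Set
    Bracket a b n = 0# ≤ a × PosBelow a × ∃ λ t → (a ≤ t × t ≤ a + A * hp n) × 0# < t × sin t ≤ 0#

    bracket-refine : ∀ a b n → Bracket a b n → ∃ λ a′ → ∃ λ b′ →
      (a ≤ a′ × a′ ≤ a + A * hp (suc n)) × (b ≤ b′ × b′ ≤ b + 0# * hp (suc n)) × Bracket a′ b′ (suc n)
    bracket-refine a b n (a≥0 , below , t , (a≤t , t≤) , t>0 , sin-t≤0) = choose (lem {PosBelow m})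
      where
      m : R
      m = a + A * hp (suc n)
      Ah≥0 : 0# ≤ A * hp (suc n)
      Ah≥0 = *-nonneg A≥0 (<⇒≤ (hp-pos (suc n)))
      a≤m : a ≤ m
      a≤m = ≤-by Ah≥0 (solve 2 (λ a h → h :- con 0ℚ := (a :+ h) :- a) tt a (A * hp (suc n)))
      b≤ : b ≤ b + 0# * hp (suc n)
      b≤ = ≤-reflexive (solve 2 (λ b h → b := b :+ con 0ℚ :* h) tt b (hp (suc n)))
      choose : Dec (PosBelow m) → ∃ λ a′ → ∃ λ b′ →
        (a ≤ a′ × a′ ≤ a + A * hp (suc n)) × (b ≤ b′ × b′ ≤ b + 0# * hp (suc n)) × Bracket a′ b′ (suc n)
      choose (yes p) = m , b , (a≤m , ≤-refl) , (≤-refl , b≤) , ≤-trans a≥0 a≤m , p , t ,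
        ((λ t<m → sin-t≤0 (p t t>0 t<m)) , ≤-trans t≤ (≤-reflexive
          (solve 3 (λ a A h → a :+ A :* h := a :+ A :* (con ½ :* h) :+ A :* (con ½ :* h)) tt a A (hp n)))) , t>0 ,
          sin-t≤0
      choose (no ¬p) = let s , q = ¬∀⇒∃¬ ¬p ; s>0 , q′ = ¬∀⇒∃¬ {A = 0# < s} q ; s<m , sin-s≤0 = ¬∀⇒∃¬ {A = s < m} q′ in
        a , b , (≤-refl , a≤m) , (≤-refl , b≤) , a≥0 , below , s , ((λ s<a → sin-s≤0 (below s s>0 s<a)) , <⇒≤ s<m) ,
          s>0 , sin-s≤0

    bracket₀ : Bracket 0# 0# 0
    bracket₀ = ≤-refl , (λ t p q → ⊥-elim (<-irrefl (<-trans p q))) , A ,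
      (A≥0 , ≤-reflexive (solve 1 (λ a → a := con 0ℚ :+ a :* con 1ℚ) tt A)) , proj₁
        (proj₂ sin-has-zero) , ≤-reflexive (proj₂ (proj₂ sin-has-zero))

  opaque
    π-spec : ∃ λ x → (0# ≤ x × x ≤ A) × (∀ n → ∃ λ a → ∃ λ b → Bracket a b n × (a ≤ x × x ≤ a + A * hp n))
    π-spec = let x , _ , (p , q) , _ , h = Bisection.limit A 0# A≥0 ≤-refl Bracket bracket-refine 0# 0# bracket₀ in
      x , (p , ≤-trans q (≤-reflexive (+-identityˡ A))) , λ n → let a , b , g , r , _ = h n in a , b , g , r

  π : R
  π = proj₁ π-spec

  private
    π≤A : π ≤ A
    π≤A = proj₂ (proj₁ (proj₂ π-spec))

    bracket : ∀ n → ∃ λ a → ∃ λ b → Bracket a b n × (a ≤ π × π ≤ a + A * hp n)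
    bracket = proj₂ (proj₂ π-spec)

  sin-pos : ∀ {t} → 0# < t → t < π → 0# < sin t
  sin-pos {t} p q = let n , hn = hp-small A≥0 (<⇒0< q) ; a , _ , (_ , below , _) , _ , π≤ = bracket n in
    below t p (≤-<-trans ≤-refl (<-by (+-mono-<-≤ hn π≤) (solve 4
      (λ h x t a → ((x :- t) :+ (a :+ h)) :- (h :+ x) := a :- t) tt (A * hp n) π t a)))

  π>0 : 0# < π
  π>0 = <-≤-trans δ₀>0 (≤-from-hp A A≥0 λ n → let a , _ , (_ , _ , t , (a≤t , t≤) , t>0 , s≤0) , a≤π , _ = bracket n in
    ≤-trans (<⇒≤ ([ (λ le → ⊥-elim (s≤0 (sin-pos-below-δ₀ t>0 le))) , (λ lt → lt) ]′ (≤-or-> t δ₀)))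
      (≤-trans t≤ (+-mono-≤ a≤π ≤-refl)))

  private
    Kπ : R
    Kπ = expR (2# * A) * (1# + 2# * (2# * A))

    Kπ≥0 : 0# ≤ Kπ
    Kπ≥0 = *-nonneg (<⇒≤ (expR-pos _)) (+-nonneg (<⇒≤ 0<1) (*-nonneg (<⇒≤ 0<2) (*-nonneg (<⇒≤ 0<2) A≥0)))

    A≤2A : A ≤ 2# * A
    A≤2A = ≤-by A≥0 (solve 1 (λ a → a :- con 0ℚ := (con 1ℚ :+ con 1ℚ) :* a :- a) tt A)

    sin-π≤0 : sin π ≤ 0#
    sin-π≤0 = ≤-from-hp (Kπ * A) (*-nonneg Kπ≥0 A≥0) λ n →
      let a , _ , (a≥0 , _ , t , (a≤t , t≤) , t>0 , s≤0) , a≤π , π≤ = bracket n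
          t≤2A : t ≤ 2# * A
          t≤2A = ≤-trans t≤ (≤-trans (+-mono-≤ (≤-trans a≤π π≤A)
            (≤-trans (*-monoˡ-≤ A≥0 (hp≤1 n)) (≤-reflexive (*-identityʳ A))))
            (≤-reflexive (solve 1 (λ a → a :+ a := (con 1ℚ :+ con 1ℚ) :* a) tt A)))
          d : ∣ π - t ∣ ≤ A * hp n
          d = ≤⇒∣-∣≤ (≤-trans π≤ (+-mono-≤ a≤t ≤-refl)) (≤-trans t≤ (+-mono-≤ a≤π ≤-refl))
      in ≤-trans (∣-∣≤⇒≤ (≤-trans (sin-lipschitz {π} {t} {2# * A}
            (≤-trans (≤-reflexive (nonneg⇒∣∣ (<⇒≤ π>0))) (≤-trans π≤A A≤2A))
              (≤-trans (≤-reflexive (nonneg⇒∣∣ (<⇒≤ t>0))) t≤2A)) (*-monoˡ-≤ Kπ≥0 d)))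
          (+-mono-≤ s≤0 (≤-reflexive (sym (*-assoc _ _ _))))
      where
      hp≤1 : ∀ n → hp n ≤ 1#
      hp≤1 zero = ≤-refl
      hp≤1 (suc n) = ≤-trans (<⇒≤ (half-< (hp-pos n))) (hp≤1 n)

    sin-π≥0 : 0# ≤ sin π
    sin-π≥0 = ≤-from-hp (Kπ * π) (*-nonneg Kπ≥0 (<⇒≤ π>0)) step
      where
      step : ∀ m → 0# ≤ sin π + Kπ * π * hp m
      step m = ≤-trans (<⇒≤ (sin-pos t>0 t<π))
        (≤-trans (∣-∣≤⇒≤ (≤-trans (sin-lipschitz {t} {π} {2# * A}
          (≤-trans (≤-reflexive (nonneg⇒∣∣ (<⇒≤ t>0))) (≤-trans (<⇒≤ t<π) (≤-trans π≤A A≤2A)))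
            (≤-trans (≤-reflexive (nonneg⇒∣∣ (<⇒≤ π>0))) (≤-trans π≤A A≤2A))) (*-monoˡ-≤ Kπ≥0 d)))
          (≤-reflexive (+-congˡ (sym (*-assoc _ _ _)))))
        where
        h≤½ : ∀ m → hp (suc m) ≤ ½#
        h≤½ zero = ≤-reflexive (*-identityʳ ½#)
        h≤½ (suc m) = ≤-trans (<⇒≤ (half-< (hp-pos (suc m)))) (h≤½ m)
        t : R
        t = π - π * hp (suc m)
        t>0 : 0# < t
        t>0 = <-≤-trans (half-pos π>0) (≤-by (*-monoˡ-≤ (<⇒≤ π>0) (h≤½ m))
          (solve 2 (λ p h → p :* con ½ :- p :* h := (p :- p :* h) :- con ½ :* p) tt π (hp (suc m))))
        t<π : t < π
        t<π = <-by (*-pos π>0 (hp-pos (suc m))) (solve 2 (λ p h → h :- con 0ℚ := p :- (p :- h)) tt π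
          (π * hp (suc m)))
        d : ∣ t - π ∣ ≤ π * hp m
        d = ≤-trans (≤-reflexive (trans (∣∣-cong (solve 2 (λ p h → (p :- h) :- p := :- h) tt π (π * hp (suc m))))
          (trans (∣∣-neg _) (nonneg⇒∣∣ (<⇒≤ (*-pos π>0 (hp-pos (suc m))))))))
          (*-monoˡ-≤ (<⇒≤ π>0) (<⇒≤ (half-< (hp-pos m))))

  sin-π : sin π ≈ 0#
  sin-π = ≤-antisym sin-π≤0 sin-π≥0

  π/2 : R
  π/2 = ½# * π

  π/2>0 : 0# < π/2
  π/2>0 = half-pos π>0

  π/2<π : π/2 < π
  π/2<π = half-< π>0

  sin-π/2-pos : 0# < sin π/2
  sin-π/2-pos = sin-pos π/2>0 π/2<π

  cos-π/2 : cos π/2 ≈ 0#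
  cos-π/2 = *-cancelˡ-≈ (pos⇒≉0 (*-pos 0<2 sin-π/2-pos)) (trans
    (solve 2 (λ c s → (con 1ℚ :+ con 1ℚ) :* s :* c := c :* s :+ s :* c) tt (cos π/2) (sin π/2))
    (trans (sym (sin-+ π/2 π/2)) (trans (sin-cong (halves π)) (trans sin-π (sym (zeroʳ _))))))

  sin-π/2 : sin π/2 ≈ 1#
  sin-π/2 = *-cancelˡ-≈ (pos⇒≉0 {1# + sin π/2} (+-pos 0<1 (<⇒≤ sin-π/2-pos)))
    (trans (solve 1 (λ s → (con 1ℚ :+ s) :* s := s :+ s :* s) tt (sin π/2))
    (trans (+-congˡ (trans (sym (+-identityˡ _)) (trans (+-congʳ (sym (trans (*-congʳ cos-π/2) (zeroˡ _))))
      (cos²+sin² π/2)))) (solve 1 (λ s → s :+ con 1ℚ := (con 1ℚ :+ s) :* con 1ℚ) tt (sin π/2))))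

  cos-π : cos π ≈ - 1#
  cos-π = trans (cos-cong (sym (halves π))) (trans (cos-+ π/2 π/2)
    (trans (+-cong (*-congʳ cos-π/2) (-‿cong (*-cong sin-π/2 sin-π/2)))
    (solve 1 (λ c → con 0ℚ :* c :- con 1ℚ :* con 1ℚ := :- con 1ℚ) tt (cos π/2))))

  sin-+π : ∀ x → sin (x + π) ≈ - sin x
  sin-+π x = trans (sin-+ x π) (trans (+-cong (*-congˡ sin-π) (*-congˡ cos-π))
    (solve 2 (λ c s → c :* con 0ℚ :+ s :* :- con 1ℚ := :- s) tt (cos x) (sin x)))

  sin-+π/2 : ∀ x → sin (x + π/2) ≈ cos x
  sin-+π/2 x = trans (sin-+ x π/2) (trans (+-cong (*-congˡ sin-π/2) (*-congˡ cos-π/2))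
    (solve 2 (λ c s → c :* con 1ℚ :+ s :* con 0ℚ := c) tt (cos x) (sin x)))

  sin-nonneg : ∀ {t} → 0# ≤ t → t ≤ π → 0# ≤ sin t
  sin-nonneg {t} p q = [ (λ p′ → [ (λ q′ → <⇒≤ (sin-pos p′ q′)) ,
    (λ e → ≤-reflexive (sym (trans (sin-cong e) sin-π))) ]′ (≤-split q)) ,
    (λ e → ≤-reflexive (sym (trans (sin-cong (sym e)) sin-zero))) ]′ (≤-split p)

  cos-pos : ∀ {x} → - π/2 < x → x < π/2 → 0# < cos x
  cos-pos {x} p q = <-resp₂ refl (sin-+π/2 x) (sin-pos
    (<-by p (solve 2 (λ x h → x :- :- h := (x :+ h) :- con 0ℚ) tt x π/2))
      (<-by q (solve 2 (λ x p → con ½ :* p :- x := p :- (x :+ con ½ :* p)) tt x π)))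

  cos-nonneg : ∀ {x} → - π/2 ≤ x → x ≤ π/2 → 0# ≤ cos x
  cos-nonneg {x} p q = ≤-resp₂ refl (sin-+π/2 x) (sin-nonneg
    (≤-by p (solve 2 (λ x h → x :- :- h := (x :+ h) :- con 0ℚ) tt x π/2))
      (≤-by q (solve 2 (λ x p → con ½ :* p :- x := p :- (x :+ con ½ :* p)) tt x π)))

  cos-nonpos : ∀ {x} → π/2 ≤ x → x ≤ π → cos x ≤ 0#
  cos-nonpos {x} p q = ≤-trans (≤-reflexive (trans (sym (sin-+π/2 x))
    (trans (sin-cong (solve 2 (λ x p → x :+ con ½ :* p := (x :- con ½ :* p) :+ p) tt x π)) (sin-+π _))))
    (neg-nonpos (sin-nonneg (≤⇒0≤ p) (≤-trans (≤-by (<⇒≤ π/2>0)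
      (solve 2 (λ x h → h :- con 0ℚ := x :- (x :- h)) tt x π/2)) q)))

  sin-neg-above-π : ∀ {x} → π < x → x < 2# * π → sin x < 0#
  sin-neg-above-π {x} p q = <-by (sin-pos (<⇒0< p) (<-by q (solve 2
    (λ x p → (con 1ℚ :+ con 1ℚ) :* p :- x := p :- (x :- p)) tt x π)))
    (trans (solve 1 (λ s → s :- con 0ℚ := con 0ℚ :- :- s) tt (sin (x - π)))
      (+-congˡ (-‿cong (trans (sym (sin-+π _)) (sin-cong (solve 2 (λ x p → (x :- p) :+ p := x) tt x π))))))

  exp-imag-injective : ∀ {x} → 0# < x → x < 2# * π → ¬ (exp (imag x) ≈ᶜ 1ᶜ)
  exp-imag-injective {x} p q e with compare x π
  ... | inj₁ lt = <⇒≉ (sin-pos p lt) (sym (im-cong e))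
  ... | inj₂ (inj₁ eq) = <⇒≉ (<-trans (<-by 0<1 (solve 0 (con 1ℚ :- con 0ℚ := con 0ℚ :- :- con 1ℚ) tt)) 0<1)
    (trans (sym cos-π) (trans (cos-cong (sym eq)) (re-cong e)))
  ... | inj₂ (inj₂ gt) = <⇒≉ (sin-neg-above-π gt q) (im-cong e)

  -- For d = u - v the sine of Im d vanishes and its cosine is positive, hence 1; below one full
  -- turn this leaves only Im d = 0.
  exp-injective-strip : ∀ {u v} → exp u ≈ᶜ exp v → ∣ im u - im v ∣ < 2# * π → u ≈ᶜ v
  exp-injective-strip {u} {v} e lt = -ᶜ≈0⇒≈ᶜ (re≈0 ,ᶜ im≈0)
    where
    d : C
    d = u -ᶜ v
    exp-d : exp d ≈ᶜ 1ᶜ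
    exp-d = ctrans (exp-+ u _) (ctrans (*ᶜ-congʳ e) (exp-neg v))
    y : R
    y = im d
    ∣y∣< : ∣ y ∣ < 2# * π
    ∣y∣< = <-resp₂ (∣∣-cong (sym (trans (im-+ u _) (+-congˡ (im-neg v))))) refl lt
    sin-y : sin y ≈ 0#
    sin-y = *-cancelˡ-≈ (pos⇒≉0 (expR-pos (re d))) (trans (sym (im-exp d)) (trans (im-cong exp-d) (sym (zeroʳ _))))
    expR-cos : expR (re d) * cos y ≈ 1#
    expR-cos = trans (sym (re-exp d)) (re-cong exp-d)
    cos-y>0 : 0# < cos y
    cos-y>0 = *-cancelˡ-< (expR-pos (re d)) (<-resp₂ (sym (zeroʳ _)) (sym expR-cos) 0<1)
    cos-y : cos y ≈ 1#
    cos-y = *-cancelˡ-≈ (pos⇒≉0 {1# + cos y} (+-pos 0<1 (<⇒≤ cos-y>0)))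
      (trans (solve 1 (λ c → (con 1ℚ :+ c) :* c := c :+ (c :* c :+ con 0ℚ :* con 0ℚ)) tt (cos y))
      (trans (+-congˡ (trans (+-congˡ (*-cong (sym sin-y) (sym sin-y))) (cos²+sin² y)))
        (solve 1 (λ c → c :+ con 1ℚ := (con 1ℚ :+ c) :* con 1ℚ) tt (cos y))))
    re≈0 : re d ≈ 0#
    re≈0 = expR-injective (trans (trans (sym (*-identityʳ _)) (trans (*-congˡ (sym cos-y)) expR-cos))
      (sym expR-zero))
    im≈0 : y ≈ 0#
    im≈0 with compare y 0#
    ... | inj₂ (inj₁ eq) = eq
    ... | inj₁ neg = ⊥-elim (exp-imag-injective (neg-pos neg) (≤-<-trans (-x≤∣x∣ y) ∣y∣<)
            (trans (cos-neg y) cos-y ,ᶜ trans (sin-neg y) (trans (-‿cong sin-y)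
              (solve 0 (:- con 0ℚ := con 0ℚ) tt))))
    ... | inj₂ (inj₂ pos) = ⊥-elim (exp-imag-injective pos (≤-<-trans (x≤∣x∣ y) ∣y∣<) (cos-y ,ᶜ sin-y))

  ∣∣<⇒ : ∀ {x y} → ∣ x ∣ < y → - y < x × x < y
  ∣∣<⇒ {x} {y} p = <-by (≤-<-trans (-x≤∣x∣ x) p) (solve 2 (λ x y → y :- :- x := x :- :- y) tt x y) , ≤-<-trans
    (x≤∣x∣ x) p

  -- Along the lift of a path in the right half-plane the cosine of the argument stays positive.
  lift-argument : ∀ {f L} → Lift f L → (∀ τ → 𝕀 τ → 0# < re (f τ)) → ∣ im (L 0#) ∣ < π/2 → ∣ im (L 1#) ∣ < π/2
  lift-argument {f} {L} l f>0 start = stay _ 1# (grid∈𝕀 N (suc N) ℕ.≤-refl) 1∈𝕀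
      (≤-trans (≤-reflexive (trans (∣∣-cong (≈⇒-≈0 (sym (grid-one N)))) (nonneg⇒∣∣ ≤-refl))) (<⇒≤ (unit-pos N)))
        (grid (suc N) ℕ.≤-refl)
    where
    K : R
    K = Lift.constant l
    -- Steps below π/2 keep the argument below π, so it cannot jump across the interval from π/2 to
    -- π, where the cosine is nonpositive.
    small : ∃ λ N → ∀ n → N ℕ.≤ n → K * unit n < π/2
    small = archimedean-small K π/2>0
    N : ℕ
    N = proj₁ small
    y : R → R
    y τ = im (L τ)
    stay : ∀ τ σ → 𝕀 τ → 𝕀 σ → ∣ σ - τ ∣ ≤ unit N → ∣ y τ ∣ < π/2 → ∣ y σ ∣ < π/2
    stay τ σ p q near lt = [ (λ ge → ⊥-elim (cos-nonpos ge y≤π cos>0)) , (λ r → r) ]′ (≤-or-> π/2 ∣ y σ ∣)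
      where
      y≤π : ∣ y σ ∣ ≤ π
      y≤π = ≤-trans (≤-reflexive (∣∣-cong (solve 2 (λ a b → a := b :+ (a :- b)) tt (y σ) (y τ))))
        (≤-trans (∣∣-triangle _ _)
        (≤-trans (+-mono-≤ (<⇒≤ lt) (≤-trans (∣im-im∣≤ _ _) (≤-trans (Lift.lipschitz l σ τ q p)
          (≤-trans (*-monoˡ-≤ (Lift.constant≥0 l) near) (<⇒≤ (proj₂ small N ℕ.≤-refl))))))
          (≤-reflexive (halves π))))
      cos>0 : 0# < cos ∣ y σ ∣
      cos>0 = *-cancelˡ-< (expR-pos (re (L σ))) (<-resp₂ (sym (zeroʳ _))
        (trans (re-cong (csym (Lift.exp-lift l σ q))) (trans (re-exp (L σ)) (*-congˡ
        ([ (λ e → cos-cong (sym e)) , (λ e → trans (sym (cos-neg _)) (cos-cong (sym e))) ]′ (∣∣-cases (y σ))))))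
          (f>0 σ q))
    grid : ∀ k → k ℕ.≤ suc N → ∣ y (nat k * unit N) ∣ < π/2
    grid zero le = stay 0# _ 0∈𝕀 (grid∈𝕀 N 0 le) (≤-trans (≤-reflexive
      (trans (∣∣-cong (≈⇒-≈0 (grid-zero N))) (nonneg⇒∣∣ ≤-refl))) (<⇒≤ (unit-pos N))) start
    grid (suc k) le = stay _ _ (grid∈𝕀 N k (ℕ.≤-trans (ℕ.n≤1+n k) le)) (grid∈𝕀 N (suc k) le)
      (≤-reflexive (trans (∣∣-cong (grid-step N k)) (∣unit∣ N))) (grid k (ℕ.≤-trans (ℕ.n≤1+n k) le))

  Log-argument : ∀ {z} → 0# < re z → ∣ im (Log z) ∣ < π/2
  Log-argument {z} p = let L , lift , start , e = proj₂ (Log-spec z) p in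
    <-resp₂ (∣∣-cong (im-cong e)) refl (lift-argument lift (λ τ r → re-segment-pos p r)
      (<-resp₂ (sym (trans (∣∣-cong (im-cong start)) (nonneg⇒∣∣ ≤-refl))) refl π/2>0))

  -- Posynomials in logarithmic coordinates: a point ω stands for z = exp ω.

  sum : ∀ {m} → (Fin m → R) → R
  sum {zero} f = 0#
  sum {suc m} f = f zero + sum (f ∘ suc)

  sumᶜ : ∀ {m} → (Fin m → C) → C
  sumᶜ {zero} f = 0ᶜ
  sumᶜ {suc m} f = f zero +ᶜ sumᶜ (f ∘ suc)

  sum-cong : ∀ {m} {f g : Fin m → R} → (∀ j → f j ≈ g j) → sum f ≈ sum g
  sum-cong {zero} h = refl
  sum-cong {suc m} h = +-cong (h zero) (sum-cong (h ∘ suc))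

  sumᶜ-cong : ∀ {m} {f g : Fin m → C} → (∀ j → f j ≈ᶜ g j) → sumᶜ f ≈ᶜ sumᶜ g
  sumᶜ-cong {zero} h = crefl
  sumᶜ-cong {suc m} h = +ᶜ-cong (h zero) (sumᶜ-cong (h ∘ suc))

  sum-mono-≤ : ∀ {m} {f g : Fin m → R} → (∀ j → f j ≤ g j) → sum f ≤ sum g
  sum-mono-≤ {zero} h = ≤-refl
  sum-mono-≤ {suc m} h = +-mono-≤ (h zero) (sum-mono-≤ (h ∘ suc))

  sum-nonneg : ∀ {m} {f : Fin m → R} → (∀ j → 0# ≤ f j) → 0# ≤ sum f
  sum-nonneg {zero} h = ≤-refl
  sum-nonneg {suc m} h = +-nonneg (h zero) (sum-nonneg (h ∘ suc))

  term≤sum : ∀ {m} {f : Fin m → R} → (∀ j → 0# ≤ f j) → ∀ j → f j ≤ sum f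
  term≤sum {suc m} {f} h zero = ≤-by (sum-nonneg (h ∘ suc)) (solve 2 (λ a b → b :- con 0ℚ := (a :+ b) :- a) tt
    (f zero) (sum (f ∘ suc)))
  term≤sum {suc m} {f} h (suc j) = ≤-trans (term≤sum (h ∘ suc) j)
    (≤-by (h zero) (solve 2 (λ a b → a :- con 0ℚ := (a :+ b) :- b) tt (f zero) (sum (f ∘ suc))))

  sum-*ʳ : ∀ {m} (f : Fin m → R) r → sum (λ j → f j * r) ≈ sum f * r
  sum-*ʳ {zero} f r = sym (zeroˡ r)
  sum-*ʳ {suc m} f r = trans (+-congˡ (sum-*ʳ (f ∘ suc) r)) (sym (distribʳ r _ _))

  sumᶜ-*ʳ : ∀ {m} (f : Fin m → C) z → sumᶜ (λ j → f j *ᶜ z) ≈ᶜ sumᶜ f *ᶜ z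
  sumᶜ-*ʳ {zero} f z = csym (*ᶜ-zeroˡ z)
  sumᶜ-*ʳ {suc m} f z = ctrans (+ᶜ-congˡ (sumᶜ-*ʳ (f ∘ suc) z)) (csolve 3 (λ a b z → a ⊗ z ⊕ b ⊗ z ⊜ (a ⊕ b) ⊗ z) tt
    (f zero) (sumᶜ (f ∘ suc)) z)

  sumᶜ-+ : ∀ {m} (f g : Fin m → C) → sumᶜ (λ j → f j +ᶜ g j) ≈ᶜ sumᶜ f +ᶜ sumᶜ g
  sumᶜ-+ {zero} f g = csym (+ᶜ-identityˡ 0ᶜ)
  sumᶜ-+ {suc m} f g = ctrans (+ᶜ-congˡ (sumᶜ-+ (f ∘ suc) (g ∘ suc)))
    (csolve 4 (λ a b c d → a ⊕ b ⊕ (c ⊕ d) ⊜ a ⊕ c ⊕ (b ⊕ d)) tt (f zero) (g zero) (sumᶜ (f ∘ suc))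
      (sumᶜ (g ∘ suc)))

  sumᶜ-neg : ∀ {m} (f : Fin m → C) → sumᶜ (λ j → -ᶜ f j) ≈ᶜ -ᶜ sumᶜ f
  sumᶜ-neg {zero} f = csolve 0 (ccon 0ℚ ⊜ ⊝ ccon 0ℚ) tt
  sumᶜ-neg {suc m} f = ctrans (+ᶜ-congˡ (sumᶜ-neg (f ∘ suc))) (csolve 2 (λ a b → ⊝ a ⊕ ⊝ b ⊜ ⊝ (a ⊕ b)) tt (f zero)
    (sumᶜ (f ∘ suc)))

  sumᶜ-norm : ∀ {m} (f : Fin m → C) → ‖ sumᶜ f ‖ ≤ sum (λ j → ‖ f j ‖)
  sumᶜ-norm {zero} f = ≤-reflexive ‖0‖
  sumᶜ-norm {suc m} f = ‖‖-+-≤ ≤-refl (sumᶜ-norm (f ∘ suc))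

  sumᶜ-ofR : ∀ {m} (f : Fin m → R) → sumᶜ (ofR ∘ f) ≈ᶜ ofR (sum f)
  sumᶜ-ofR {zero} f = crefl
  sumᶜ-ofR {suc m} f = ctrans (+ᶜ-congˡ (sumᶜ-ofR (f ∘ suc))) (csym (ofR-+ _ _))

  sumᶜ-conj : ∀ {m} (f : Fin m → C) → conj (sumᶜ f) ≈ᶜ sumᶜ (conj ∘ f)
  sumᶜ-conj {zero} f = conj-ofR 0#
  sumᶜ-conj {suc m} f = ctrans (conj-+ _ _) (+ᶜ-congˡ (sumᶜ-conj (f ∘ suc)))

  im-sumᶜ : ∀ {m} (f : Fin m → C) → im (sumᶜ f) ≈ sum (im ∘ f)
  im-sumᶜ {zero} f = refl
  im-sumᶜ {suc m} f = trans (im-+ _ _) (+-congˡ (im-sumᶜ (f ∘ suc)))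

  dot : ∀ {n} → (Fin n → R) → (Fin n → C) → C
  dot a ω = sumᶜ (λ i → ofR (a i) *ᶜ ω i)

  dotR : ∀ {n} → (Fin n → R) → (Fin n → R) → R
  dotR a ρ = sum (λ i → a i * ρ i)

  dot-cong : ∀ {n} (a : Fin n → R) {ω ω′} → (∀ i → ω i ≈ᶜ ω′ i) → dot a ω ≈ᶜ dot a ω′
  dot-cong {n} a h = sumᶜ-cong {n} λ i → *ᶜ-congˡ (h i)

  dot-ofR : ∀ {n} (a : Fin n → R) ρ → dot a (ofR ∘ ρ) ≈ᶜ ofR (dotR a ρ)
  dot-ofR {n} a ρ = ctrans (sumᶜ-cong {n} λ i → csym (ofR-* (a i) (ρ i))) (sumᶜ-ofR {n} _)

  dot-+ : ∀ {n} (a : Fin n → R) ω ω′ → dot a (λ i → ω i +ᶜ ω′ i) ≈ᶜ dot a ω +ᶜ dot a ω′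
  dot-+ {n} a ω ω′ = ctrans (sumᶜ-cong {n} λ i → csolve 3 (λ a z w → a ⊗ (z ⊕ w) ⊜ a ⊗ z ⊕ a ⊗ w) tt (ofR (a i))
    (ω i) (ω′ i)) (sumᶜ-+ {n} _ _)

  dot-- : ∀ {n} (a : Fin n → R) ω ω′ → dot a ω -ᶜ dot a ω′ ≈ᶜ dot a (λ i → ω i -ᶜ ω′ i)
  dot-- {n} a ω ω′ = csym (ctrans (dot-+ a ω (λ i → -ᶜ ω′ i))
    (+ᶜ-congˡ (ctrans (sumᶜ-cong {n} λ i → csolve 2 (λ a z → a ⊗ ⊝ z ⊜ ⊝ (a ⊗ z)) tt (ofR (a i)) (ω′ i))
    (sumᶜ-neg {n} _))))

  dot-*ʳ : ∀ {n} (a : Fin n → R) ω z → dot a (λ i → ω i *ᶜ z) ≈ᶜ dot a ω *ᶜ z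
  dot-*ʳ {n} a ω z = ctrans (sumᶜ-cong {n} λ i → csym (*ᶜ-assoc (ofR (a i)) (ω i) z)) (sumᶜ-*ʳ {n} _ z)

  dot-const : ∀ {n} (a : Fin n → R) z → dot a (λ _ → z) ≈ᶜ ofR (sum a) *ᶜ z
  dot-const {n} a z = ctrans (sumᶜ-*ʳ {n} (ofR ∘ a) z) (*ᶜ-congʳ (sumᶜ-ofR {n} a))

  dot-conj : ∀ {n} (a : Fin n → R) ω → dot a (conj ∘ ω) ≈ᶜ conj (dot a ω)
  dot-conj {n} a ω = csym (ctrans (sumᶜ-conj {n} _) (sumᶜ-cong {n} λ i → ctrans (conj-* _ _)
    (*ᶜ-congʳ (conj-ofR (a i)))))

  dot-norm : ∀ {n} {a : Fin n → R} {ω r} → (∀ i → 0# ≤ a i) → (∀ i → ‖ ω i ‖ ≤ r) → ‖ dot a ω ‖ ≤ sum a * r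
  dot-norm {n} {a} {ω} {r} a≥0 h = ≤-trans (sumᶜ-norm (λ i → ofR (a i) *ᶜ ω i)) (≤-trans
    (sum-mono-≤ λ i → ≤-trans (≤-reflexive (trans (‖ofR*‖ (a i) (ω i)) (*-congʳ (nonneg⇒∣∣ (a≥0 i)))))
      (*-monoˡ-≤ (a≥0 i) (h i)))
    (≤-reflexive (sum-*ʳ a r)))

  posynomial : ∀ {n m} → (Fin m → Fin n → R) → (Fin m → R) → (Fin n → C) → C
  posynomial a c ω = sumᶜ (λ j → ofR (c j) *ᶜ exp (dot (a j) ω))

  Tube : ∀ {n} → (Fin n → C) → Set
  Tube ω = ∀ i → ∣ im (ω i) ∣ < π/2

  record StablePosynomial (n m : ℕ) : Set where
    field
      a : Fin m → Fin n → R
      c : Fin m → R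
      d : R
      a≥0 : ∀ j i → 0# ≤ a j i
      c>0 : ∀ j → 0# < c j
      d>0 : 0# < d
      homogeneous : ∀ j → sum (a j) ≈ d
      stable : ∀ ω → Tube ω → ¬ (posynomial a c ω ≈ᶜ 0ᶜ)

  -- The branch ℓ of log P on the tube

  module Logarithm {n m : ℕ} (p : StablePosynomial n m) where
    open StablePosynomial p public

    Point : Set
    Point = Fin n → C

    P : Point → C
    P = posynomial a c

    PR : (Fin n → R) → R
    PR ρ = sum (λ j → c j * expR (dotR (a j) ρ))

    P-cong : ∀ {ω ω′} → (∀ i → ω i ≈ᶜ ω′ i) → P ω ≈ᶜ P ω′
    P-cong h = sumᶜ-cong {m} λ j → *ᶜ-congˡ (exp-cong (dot-cong (a j) h))

    P-conj : ∀ ω → P (conj ∘ ω) ≈ᶜ conj (P ω)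
    P-conj ω = csym (ctrans (sumᶜ-conj {m} _) (sumᶜ-cong {m} λ j → ctrans (conj-* _ _)
      (*ᶜ-cong (conj-ofR (c j)) (ctrans (csym (exp-conj _)) (exp-cong (csym (dot-conj (a j) ω)))))))

    P-real : ∀ ρ → P (ofR ∘ ρ) ≈ᶜ ofR (PR ρ)
    P-real ρ = ctrans (sumᶜ-cong {m} λ j → ctrans (*ᶜ-congˡ (ctrans (exp-cong (dot-ofR (a j) ρ)) (exp-ofR _)))
      (csym (ofR-* _ _))) (sumᶜ-ofR {m} _)

    P-shift : ∀ ω z → P (λ i → ω i +ᶜ z) ≈ᶜ P ω *ᶜ exp (ofR d *ᶜ z)
    P-shift ω z = ctrans (sumᶜ-cong {m} λ j → ctrans (*ᶜ-congˡ (ctrans (exp-cong (ctrans (dot-+ (a j) ω (λ _ → z))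
        (+ᶜ-congˡ (ctrans (dot-const (a j) z) (*ᶜ-congʳ (ofR-cong (homogeneous j))))))) (exp-+ _ _)))
          (csym (*ᶜ-assoc _ _ _)))
      (sumᶜ-*ʳ {m} _ _)

    d≥0 : 0# ≤ d
    d≥0 = <⇒≤ d>0

    real∈Tube : ∀ ρ → Tube {n} (ofR ∘ ρ)
    real∈Tube ρ i = <-resp₂ (sym (nonneg⇒∣∣ ≤-refl)) refl π/2>0

    PR-pos : ∀ ρ → 0# < PR ρ
    PR-pos ρ = [ (λ lt → lt) , (λ e → ⊥-elim (stable _ (real∈Tube ρ) (ctrans (P-real ρ) (ofR-cong (sym e))))) ]′
      (≤-split (sum-nonneg {m} λ j → *-nonneg (<⇒≤ (c>0 j)) (<⇒≤ (expR-pos _))))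

    PR-cong : ∀ {ρ ρ′} → (∀ i → ρ i ≈ ρ′ i) → PR ρ ≈ PR ρ′
    PR-cong h = sum-cong {m} λ j → *-congˡ (expR-cong (sum-cong {n} λ i → *-congˡ (h i)))

    P-lipschitz : ∀ r → 0# ≤ r → ∃ λ K → 0# ≤ K × (∀ ω ω′ δ → (∀ i → ‖ ω i ‖ ≤ r) → (∀ i → ‖ ω′ i ‖ ≤ r) →
      (∀ i → ‖ ω i -ᶜ ω′ i ‖ ≤ δ) → ‖ P ω -ᶜ P ω′ ‖ ≤ K * δ)
    P-lipschitz r r≥0 = sum (λ j → c j * E) , sum-nonneg {m} (λ j → *-nonneg (<⇒≤ (c>0 j)) E≥0) , bound
      where
      E : R
      E = expR (d * r) * (1# + 2# * (d * r)) * d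
      E≥0 : 0# ≤ E
      E≥0 = *-nonneg (*-nonneg (<⇒≤ (expR-pos _)) (+-nonneg (<⇒≤ 0<1) (*-nonneg (<⇒≤ 0<2) (*-nonneg d≥0 r≥0)))) d≥0
      dot≤ : ∀ j {ω r} → (∀ i → ‖ ω i ‖ ≤ r) → ‖ dot (a j) ω ‖ ≤ d * r
      dot≤ j h = ≤-trans (dot-norm (a≥0 j) h) (≤-reflexive (*-congʳ (homogeneous j)))
      bound : ∀ ω ω′ δ → (∀ i → ‖ ω i ‖ ≤ r) → (∀ i → ‖ ω′ i ‖ ≤ r) →
        (∀ i → ‖ ω i -ᶜ ω′ i ‖ ≤ δ) → ‖ P ω -ᶜ P ω′ ‖ ≤ sum (λ j → c j * E) * δ
      bound ω ω′ δ h h′ near = ≤-trans (≤-reflexive (‖‖-cong (ctrans (+ᶜ-congˡ (csym (sumᶜ-neg {m} _)))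
        (csym (sumᶜ-+ {m} _ _)))))
        (≤-trans (sumᶜ-norm {m} _) (≤-trans (sum-mono-≤ {m} term) (≤-reflexive (sum-*ʳ {m} _ δ))))
        where
        term : ∀ j → ‖ ofR (c j) *ᶜ exp (dot (a j) ω) +ᶜ -ᶜ (ofR (c j) *ᶜ exp (dot (a j) ω′)) ‖ ≤ c j * E * δ
        term j = ≤-trans (≤-reflexive (trans (‖‖-cong (csolve 3 (λ c x y → c ⊗ x ⊕ ⊝ (c ⊗ y) ⊜ c ⊗ (x ⊖ y)) tt
          (ofR (c j)) (exp (dot (a j) ω)) (exp (dot (a j) ω′))))
            (trans (‖ofR*‖ _ _) (*-congʳ (nonneg⇒∣∣ (<⇒≤ (c>0 j)))))))
          (≤-trans (*-monoˡ-≤ (<⇒≤ (c>0 j)) (≤-trans (exp-lipschitz (dot≤ j h) (dot≤ j h′))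
            (*-monoˡ-≤ (*-nonneg (<⇒≤ (expR-pos _)) (+-nonneg (<⇒≤ 0<1) (*-nonneg (<⇒≤ 0<2) (*-nonneg d≥0 r≥0))))
              (≤-trans (≤-reflexive (‖‖-cong (dot-- (a j) ω ω′))) (dot≤ j near)))))
            (≤-reflexive (solve 4 (λ c e d x → c :* (e :* (d :* x)) := c :* (e :* d) :* x) tt (c j)
              (expR (d * r) * (1# + 2# * (d * r))) d δ)))

    vertical : Point → R → Point
    vertical ω τ i = mkC (re (ω i)) (τ * im (ω i))

    path : Point → R → C
    path ω τ = P (vertical ω τ)

    ∣*im∣≤ : ∀ {τ} y → 𝕀 τ → ∣ τ * y ∣ ≤ ∣ y ∣
    ∣*im∣≤ {τ} y (p , q) = ≤-trans (≤-reflexive (trans (∣∣-* τ y) (*-congʳ (nonneg⇒∣∣ p))))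
      (≤-trans (*-monoʳ-≤ (∣∣-nonneg y) q) (≤-reflexive (*-identityˡ _)))

    vertical∈Tube : ∀ {ω τ} → Tube {n} ω → 𝕀 τ → Tube {n} (vertical ω τ)
    vertical∈Tube {ω} t r i = ≤-<-trans (∣*im∣≤ (im (ω i)) r) (t i)

    vertical-norm : ∀ ω {τ} → 𝕀 τ → ∀ i → ‖ vertical ω τ i ‖ ≤ ‖ ω i ‖
    vertical-norm ω r i = +-mono-≤ ≤-refl (∣*im∣≤ (im (ω i)) r)

    vertical-- : ∀ ω ω′ {τ} → 𝕀 τ → ∀ i → ‖ vertical ω τ i -ᶜ vertical ω′ τ i ‖ ≤ ‖ ω i -ᶜ ω′ i ‖
    vertical-- ω ω′ {τ} r i = +-mono-≤ (≤-reflexive (∣∣-cong (trans (re-+ _ _)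
      (trans (+-congˡ (re-neg _)) (sym (trans (re-+ _ _) (+-congˡ (re-neg _))))))))
      (≤-trans (≤-reflexive (∣∣-cong (trans (im-+ _ _) (trans (+-congˡ (im-neg _))
        (trans (solve 3 (λ t x y → t :* x :+ :- (t :* y) := t :* (x :+ :- y)) tt τ (im (ω i)) (im (ω′ i)))
        (*-congˡ (sym (trans (im-+ _ _) (+-congˡ (im-neg _))))))))))
        (∣*im∣≤ _ r))

    vertical-step : ∀ ω τ σ i → ‖ vertical ω τ i -ᶜ vertical ω σ i ‖ ≤ ‖ ω i ‖ * ∣ τ - σ ∣
    vertical-step ω τ σ i = ≤-trans (+-mono-≤ (≤-reflexive (trans
      (∣∣-cong (trans (re-+ _ _) (trans (+-congˡ (re-neg _)) (-‿inverseʳ _)))) (nonneg⇒∣∣ ≤-refl)))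
        (≤-reflexive (trans (∣∣-cong (trans (im-+ _ _) (trans (+-congˡ (im-neg _))
          (solve 3 (λ t s y → t :* y :+ :- (s :* y) := y :* (t :- s)) tt τ σ (im (ω i)))))) (∣∣-* _ _))))
      (≤-trans (≤-reflexive (+-identityˡ _)) (*-monoʳ-≤ (∣∣-nonneg _) (∣im∣≤‖‖ (ω i))))

    size : Point → R
    size ω = sum (λ i → ‖ ω i ‖)

    ≤size : ∀ ω i → ‖ ω i ‖ ≤ size ω
    ≤size ω = term≤sum {n} λ i → ‖‖-nonneg (ω i)

    size≥0 : ∀ ω → 0# ≤ size ω
    size≥0 ω = sum-nonneg {n} λ i → ‖‖-nonneg (ω i)

    path-lipschitz : ∀ ω → ∃ λ K → 0# ≤ K × Lipschitz K (path ω)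
    path-lipschitz ω = let K , K≥0 , h = P-lipschitz (size ω) (size≥0 ω) in
      K * size ω , *-nonneg K≥0 (size≥0 ω) , λ τ σ r r′ →
        ≤-trans (h _ _ (size ω * ∣ τ - σ ∣) (λ i → ≤-trans (vertical-norm ω r i) (≤size ω i))
          (λ i → ≤-trans (vertical-norm ω r′ i) (≤size ω i))
          (λ i → ≤-trans (vertical-step ω τ σ i) (*-monoʳ-≤ (∣∣-nonneg _) (≤size ω i))))
        (≤-reflexive (sym (*-assoc _ _ _)))

    path≉0 : ∀ {ω} → Tube {n} ω → ∀ τ → 𝕀 τ → ¬ (path ω τ ≈ᶜ 0ᶜ)
    path≉0 {ω} t τ r = stable _ (vertical∈Tube {ω} t r)

    path-zero : ∀ ω → path ω 0# ≈ᶜ ofR (PR (re ∘ ω))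
    path-zero ω = ctrans (P-cong λ i → refl ,ᶜ zeroˡ _) (P-real (re ∘ ω))

    path-one : ∀ ω → path ω 1# ≈ᶜ P ω
    path-one ω = P-cong λ i → refl ,ᶜ *-identityˡ _

    lnPR : Point → C
    lnPR ω = ofR (ln (PR (re ∘ ω)))

    exp-lnPR : ∀ ω → exp (lnPR ω) ≈ᶜ ofR (PR (re ∘ ω))
    exp-lnPR ω = ctrans (exp-ofR _) (ofR-cong (expR-ln (PR-pos _)))

    IsLogPath : Point → (R → C) → Set
    IsLogPath ω L = Lift (path ω) L × L 0# ≈ᶜ lnPR ω

    opaque
      ℓ-spec : ∀ ω → ∃ λ l → Tube {n} ω → ∃ λ L → IsLogPath ω L × L 1# ≈ᶜ l
      ℓ-spec ω with lem {Tube {n} ω}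
      ... | yes t = proj₁ lifted 1# , λ _ → proj₁ lifted , proj₂ lifted , crefl
        where
        lifted : ∃ λ L → IsLogPath ω L
        lifted = let K , K≥0 , lip = path-lipschitz ω in
          LiftExists.lift-exists (path ω) K K≥0 lip (path≉0 t) (lnPR ω) (ctrans (exp-lnPR ω) (csym (path-zero ω)))
      ... | no ¬t = 0ᶜ , λ t → ⊥-elim (¬t t)

    ℓ : Point → C
    ℓ ω = proj₁ (ℓ-spec ω)

    ℓ-unique : ∀ {ω L} → Tube {n} ω → IsLogPath ω L → ℓ ω ≈ᶜ L 1#
    ℓ-unique {ω} t (lift , start) = let M , (lift′ , start′) , e = proj₂ (ℓ-spec ω) t in
      ctrans (csym e) (lift-unique lift lift′ (λ _ _ → crefl) (ctrans start′ (csym start)))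

    exp-ℓ : ∀ {ω} → Tube {n} ω → exp (ℓ ω) ≈ᶜ P ω
    exp-ℓ {ω} t = let M , (lift , _) , e = proj₂ (ℓ-spec ω) t in
      ctrans (exp-cong (csym e)) (ctrans (Lift.exp-lift lift 1# 1∈𝕀) (path-one ω))

    -- The two branches need not be assumed close at τ = 0: both start at real values, where each
    -- must be the real logarithm of its positive start, and so they differ by exactly
    -- `log1p (x 0#)`.
    ℓ-compare : ∀ {f L ω} (x : R → C) → Lift f L → L 0# ≈ᶜ ofR (re (L 0#)) → Tube {n} ω →
      (∀ τ → 𝕀 τ → ‖ x τ ‖ ≤ r₁ × path ω τ ≈ᶜ f τ *ᶜ (1ᶜ +ᶜ x τ)) → ℓ ω ≈ᶜ L 1# +ᶜ log1p (x 1#)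
    ℓ-compare {f} {L} {ω} x lift real t rel = let M , (lift′ , start′) , e = proj₂ (ℓ-spec ω) t in
      ctrans (csym e) (lift-compare x lift lift′ rel (ctrans start′ start))
      where
      l : R
      l = re (L 0#)
      y : R
      y = PR (re ∘ ω) * expR (- l) - 1#
      product : ofR (PR (re ∘ ω)) ≈ᶜ ofR (expR l) *ᶜ (1ᶜ +ᶜ x 0#)
      product = ctrans (csym (path-zero ω)) (ctrans (proj₂ (rel 0# 0∈𝕀))
        (*ᶜ-congʳ (ctrans (csym (Lift.exp-lift lift 0# 0∈𝕀)) (ctrans (exp-cong real) (exp-ofR l)))))
      x0 : x 0# ≈ᶜ ofR y
      x0 = csym (ctrans (ofR-- _ _) (ctrans (+ᶜ-congʳ (ctrans (ofR-* _ _) (ctrans (*ᶜ-congʳ product)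
        (ctrans (csolve 3 (λ e x f → e ⊗ (ccon 1ℚ ⊕ x) ⊗ f ⊜ (e ⊗ f) ⊗ (ccon 1ℚ ⊕ x)) tt (ofR (expR l)) (x 0#)
          (ofR (expR (- l))))
          (*ᶜ-congʳ (ctrans (csym (ofR-* _ _)) (ofR-cong (expR-neg l))))))))
            (csolve 1 (λ x → ccon 1ℚ ⊗ (ccon 1ℚ ⊕ x) ⊖ ccon 1ℚ ⊜ x) tt (x 0#))))
      x0≤ : ‖ x 0# ‖ ≤ r₀
      x0≤ = ≤-trans (proj₁ (rel 0# 0∈𝕀)) r₁≤r₀
      k : C
      k = log1p (x 0#)
      k-real : im k ≈ 0#
      k-real = trans (im-cong (log1p-cong x0≤ x0)) (log1p-real (≤-trans (≤-reflexive (‖‖-cong (csym x0))) x0≤))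
      start : lnPR ω ≈ᶜ L 0# +ᶜ k
      start = ctrans (ofR-cong (sym (ln-unique (PR-pos (re ∘ ω)) (re-cong (begin
          exp (ofR (re (L 0# +ᶜ k))) ≈⟨ exp-cong (refl ,ᶜ sym
            (trans (im-+ _ _) (trans (+-cong (im-cong real) k-real) (+-identityˡ 0#)))) ⟩
          exp (L 0# +ᶜ k) ≈⟨ exp-+ _ _ ⟩
          exp (L 0#) *ᶜ exp k ≈⟨ *ᶜ-cong (Lift.exp-lift lift 0# 0∈𝕀) (exp-log1p x0≤) ⟩
          f 0# *ᶜ (1ᶜ +ᶜ x 0#) ≈⟨ csym (proj₂ (rel 0# 0∈𝕀)) ⟩
          path ω 0# ≈⟨ path-zero ω ⟩
          ofR (PR (re ∘ ω)) ∎)))))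
        (refl ,ᶜ sym (trans (im-+ _ _) (trans (+-cong (im-cong real) k-real) (+-identityˡ 0#))))
        where open C-Reasoning

    ℓ-compare-ℓ : ∀ {ω ω′} (x : R → C) → Tube {n} ω → Tube {n} ω′ →
      (∀ τ → 𝕀 τ → ‖ x τ ‖ ≤ r₁ × path ω′ τ ≈ᶜ path ω τ *ᶜ (1ᶜ +ᶜ x τ)) → ℓ ω′ ≈ᶜ ℓ ω +ᶜ log1p (x 1#)
    ℓ-compare-ℓ {ω} x t t′ rel = let L , (lift , start) , e = proj₂ (ℓ-spec ω) t in
      ctrans (ℓ-compare x lift (refl ,ᶜ im-cong start) t′ rel) (+ᶜ-congʳ e)

    near-rel : ∀ {ω ω′ δ K c s} → 0# < c → K * δ * (2# / c) ≤ s → ∀ τ → ¬ (path ω τ ≈ᶜ 0ᶜ) → c ≤ ‖ path ω τ ‖ →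
      ‖ path ω′ τ -ᶜ path ω τ ‖ ≤ K * δ →
      ‖ (path ω′ τ -ᶜ path ω τ) *ᶜ path ω τ ⁻¹ᶜ ‖ ≤ s × path ω′ τ ≈ᶜ path ω τ *ᶜ
        (1ᶜ +ᶜ (path ω′ τ -ᶜ path ω τ) *ᶜ path ω τ ⁻¹ᶜ)
    near-rel {ω} {ω′} c>0 small τ ≉0 c≤ near = ≤-trans (‖‖-mult-≤ near (⁻¹ᶜ-norm-≤ c>0 c≤)) small ,
      csym (ctrans (csolve 3 (λ f g i → f ⊗ (ccon 1ℚ ⊕ (g ⊖ f) ⊗ i) ⊜ f ⊕ (g ⊖ f) ⊗ (f ⊗ i)) tt (path ω τ)
        (path ω′ τ) (path ω τ ⁻¹ᶜ))
        (ctrans (+ᶜ-congˡ (*ᶜ-congˡ (*ᶜ-inverseʳ ≉0))) (csolve 2 (λ f g → f ⊕ (g ⊖ f) ⊗ ccon 1ℚ ⊜ g) tt (path ω τ)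
          (path ω′ τ))))

    ratio-one : ∀ {ω} → Tube {n} ω → ∀ ω′ → (path ω′ 1# -ᶜ path ω 1#) *ᶜ path ω 1# ⁻¹ᶜ ≈ᶜ (P ω′ -ᶜ P ω) *ᶜ P ω ⁻¹ᶜ
    ratio-one {ω} t ω′ = *ᶜ-cong (+ᶜ-cong (path-one ω′) (-ᶜ-cong (path-one ω)))
      (⁻¹ᶜ-cong (path≉0 t 1# 1∈𝕀) (path-one ω))

    ℓ-local : ∀ {ω} → Tube {n} ω → ∃ λ δ → 0# < δ × (∀ ω′ → Tube {n} ω′ → (∀ i → ‖ ω′ i -ᶜ ω i ‖ ≤ δ) →
      ‖ (P ω′ -ᶜ P ω) *ᶜ P ω ⁻¹ᶜ ‖ ≤ r₁ × ℓ ω′ ≈ᶜ ℓ ω +ᶜ log1p ((P ω′ -ᶜ P ω) *ᶜ P ω ⁻¹ᶜ))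
    ℓ-local {ω} t = δ , ⊓-pos 0<1 δ′>0 , local
      where
      r : R
      r = size ω + 1#
      r≥0 : 0# ≤ r
      r≥0 = +-nonneg (size≥0 ω) (<⇒≤ 0<1)
      lipP = P-lipschitz r r≥0
      K : R
      K = proj₁ lipP
      K≥0 : 0# ≤ K
      K≥0 = proj₁ (proj₂ lipP)
      below : ∃ λ c → 0# < c × (∀ τ → 𝕀 τ → c ≤ ‖ path ω τ ‖)
      below = let K , K≥0 , lip = path-lipschitz ω in path-bounded-below K≥0 lip (path≉0 t)
      B : R
      B = 2# / proj₁ below
      B>0 : 0# < B
      B>0 = /-pos 0<2 (proj₁ (proj₂ below))
      md = modulus (K * B) (*-nonneg K≥0 (<⇒≤ B>0)) r₁>0
      δ′ δ : R
      δ′ = proj₁ md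
      δ = 1# ⊓ δ′
      δ′>0 : 0# < δ′
      δ′>0 = proj₁ (proj₂ md)
      small : K * δ * B ≤ r₁
      small = ≤-trans (≤-trans (≤-reflexive (solve 3 (λ k d b → k :* d :* b := k :* b :* d) tt K δ B))
        (*-monoˡ-≤ (*-nonneg K≥0 (<⇒≤ B>0))
        (≤-trans (x⊓y≤y 1# δ′) (≤-by (<⇒≤ δ′>0) (solve 1 (λ d → d :- con 0ℚ := (d :+ d) :- d) tt δ′)))))
          (proj₂ (proj₂ md))
      local : ∀ ω′ → Tube {n} ω′ → (∀ i → ‖ ω′ i -ᶜ ω i ‖ ≤ δ) →
        ‖ (P ω′ -ᶜ P ω) *ᶜ P ω ⁻¹ᶜ ‖ ≤ r₁ × ℓ ω′ ≈ᶜ ℓ ω +ᶜ log1p ((P ω′ -ᶜ P ω) *ᶜ P ω ⁻¹ᶜ)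
      local ω′ t′ near = ≤-trans (≤-reflexive (‖‖-cong (csym (ratio-one t ω′)))) (proj₁ (rel 1# 1∈𝕀)) ,
        ctrans (ℓ-compare-ℓ x t t′ rel) (+ᶜ-congˡ (log1p-cong (≤-trans (proj₁ (rel 1# 1∈𝕀)) r₁≤r₀)
          (ratio-one t ω′)))
        where
        x : R → C
        x τ = (path ω′ τ -ᶜ path ω τ) *ᶜ path ω τ ⁻¹ᶜ
        ω≤ : ∀ i → ‖ ω i ‖ ≤ r
        ω≤ i = ≤-trans (≤size ω i) (≤-by (<⇒≤ 0<1) (solve 1 (λ s → con 1ℚ :- con 0ℚ := (s :+ con 1ℚ) :- s) tt
          (size ω)))
        ω′≤ : ∀ i → ‖ ω′ i ‖ ≤ r
        ω′≤ i = ≤-trans (‖‖-reverse (ω′ i) (ω i)) (+-mono-≤ (≤size ω i) (≤-trans (near i) (x⊓y≤x 1# δ′)))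
        rel : ∀ τ → 𝕀 τ → ‖ x τ ‖ ≤ r₁ × path ω′ τ ≈ᶜ path ω τ *ᶜ (1ᶜ +ᶜ x τ)
        rel τ q = near-rel {ω} {ω′} {δ} {K} (proj₁ (proj₂ below)) small τ (path≉0 t τ q) (proj₂ (proj₂ below) τ q)
          (proj₂ (proj₂ lipP) _ _ δ (λ i → ≤-trans (vertical-norm ω′ q i) (ω′≤ i))
            (λ i → ≤-trans (vertical-norm ω q i) (ω≤ i))
            (λ i → ≤-trans (vertical-- ω′ ω q i) (near i)))

    ℓ-conj : ∀ {ω} → Tube {n} ω → ℓ (conj ∘ ω) ≈ᶜ conj (ℓ ω)
    ℓ-conj {ω} t = let L , (lift , start) , e = proj₂ (ℓ-spec ω) t ; lc = lift-conj lift in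
      ctrans (ℓ-unique {L = conj ∘ L} (λ i → <-resp₂ (sym (trans (∣∣-cong (im-conj _)) (∣∣-neg _))) refl (t i))
        (record { constant = Lift.constant lc ; constant≥0 = Lift.constant≥0 lc ; lipschitz = Lift.lipschitz lc
                ; exp-lift = λ τ q → ctrans (Lift.exp-lift lc τ q) (ctrans (csym (P-conj (vertical ω τ)))
                    (P-cong λ i → trans (re-conj _) (sym (re-conj _)) ,ᶜ trans (im-conj _)
                      (sym (trans (*-congˡ (im-conj _)) (solve 2 (λ t y → t :* :- y := :- (t :* y)) tt τ
                      (im (ω i))))))) } ,
         ctrans (conj-cong start) (ctrans (conj-ofR _) (ofR-cong
           (ln-cong (PR-pos _) (PR-cong λ i → sym (re-conj _)))))))
        (conj-cong e)
      where
      ln-cong : ∀ {x y} → 0# < x → x ≈ y → ln x ≈ ln y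
      ln-cong p q = re-cong (Log-cong p (ofR-cong q))

    ℓ-real : ∀ ρ → ℓ (ofR ∘ ρ) ≈ᶜ ofR (ln (PR ρ))
    ℓ-real ρ = ℓ-unique {L = λ _ → ofR (ln (PR ρ))} (real∈Tube ρ) (record
      { constant = 0# ; constant≥0 = ≤-refl
      ; lipschitz = λ τ σ _ _ → ≤-trans (≈⇒‖-‖≤0 crefl) (≤-reflexive (sym (zeroˡ _)))
      ; exp-lift = λ τ _ → ctrans (exp-ofR _) (ctrans (ofR-cong (expR-ln (PR-pos ρ)))
        (csym (ctrans (P-cong λ i → refl ,ᶜ zeroʳ τ) (P-real ρ)))) } , crefl)

    -- Homogeneity in logarithmic coordinates: scaling all variables by exp z adds z to each
    -- coordinate. The lift for the shifted point is the old lift plus d times the vertical path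
    -- ending at z.
    ℓ-shift : ∀ {ω} z → Tube {n} ω → Tube {n} (λ i → ω i +ᶜ z) → ℓ (λ i → ω i +ᶜ z) ≈ᶜ ℓ ω +ᶜ ofR d *ᶜ z
    ℓ-shift {ω} z t t′ = let L , (lift , start) , e = proj₂ (ℓ-spec ω) t in
      ctrans (ℓ-unique {L = λ τ → L τ +ᶜ ofR d *ᶜ v τ} t′ (shifted L lift , start′ L start))
        (+ᶜ-cong e (*ᶜ-congˡ (refl ,ᶜ *-identityˡ _)))
      where
      v : R → C
      v τ = mkC (re z) (τ * im z)
      vertical-shift : ∀ τ i → vertical (λ i → ω i +ᶜ z) τ i ≈ᶜ vertical ω τ i +ᶜ v τ
      vertical-shift τ i = trans (re-+ _ _) (sym (re-+ _ _)) ,ᶜ trans (*-congˡ (im-+ _ _))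
        (trans (distribˡ τ _ _) (sym (im-+ _ _)))
      v-step : ∀ τ σ → ‖ v τ -ᶜ v σ ‖ ≤ ∣ im z ∣ * ∣ τ - σ ∣
      v-step τ σ = ≤-trans (+-mono-≤ (≤-reflexive (trans (∣∣-cong
        (trans (re-+ _ _) (trans (+-congˡ (re-neg _)) (-‿inverseʳ _)))) (nonneg⇒∣∣ ≤-refl)))
        (≤-reflexive (trans (∣∣-cong (trans (im-+ _ _) (trans (+-congˡ (im-neg _))
          (solve 3 (λ t s y → t :* y :+ :- (s :* y) := y :* (t :- s)) tt τ σ (im z))))) (∣∣-* _ _))))
        (≤-reflexive (+-identityˡ _))
      shifted : ∀ L → Lift (path ω) L → Lift (path (λ i → ω i +ᶜ z)) (λ τ → L τ +ᶜ ofR d *ᶜ v τ)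
      shifted L lift = record
        { constant = Lift.constant lift + d * ∣ im z ∣
        ; constant≥0 = +-nonneg (Lift.constant≥0 lift) (*-nonneg d≥0 (∣∣-nonneg _))
        ; lipschitz = λ τ σ q r → ≤-trans (≤-reflexive (‖‖-cong
          (csolve 5 (λ a b d x y → (a ⊕ d ⊗ x) ⊖ (b ⊕ d ⊗ y) ⊜ (a ⊖ b) ⊕ d ⊗ (x ⊖ y)) tt (L τ) (L σ) (ofR d) (v τ)
          (v σ))))
            (≤-trans (‖‖-+-≤ (Lift.lipschitz lift τ σ q r) (≤-trans
              (≤-reflexive (trans (‖ofR*‖ d _) (*-congʳ (nonneg⇒∣∣ d≥0)))) (*-monoˡ-≤ d≥0 (v-step τ σ))))
              (≤-reflexive (solve 4 (λ k d y x → k :* x :+ d :* (y :* x) := (k :+ d :* y) :* x) tt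
                (Lift.constant lift) d (∣ im z ∣) (∣ τ - σ ∣))))
        ; exp-lift = λ τ q → ctrans (exp-+ _ _) (ctrans (*ᶜ-congʳ (Lift.exp-lift lift τ q))
            (csym (ctrans (P-cong (vertical-shift τ)) (P-shift _ _)))) }
      PR-shift : PR (λ i → re (ω i +ᶜ z)) ≈ PR (re ∘ ω) * expR (d * re z)
      PR-shift = re-cong (ctrans (csym (P-real _)) (ctrans (P-cong λ i → ctrans (ofR-cong (re-+ _ _)) (ofR-+ _ _))
        (ctrans (P-shift (ofR ∘ re ∘ ω) (ofR (re z))) (ctrans
          (*ᶜ-cong (P-real _) (ctrans (exp-cong (csym (ofR-* _ _))) (exp-ofR _))) (csym (ofR-* _ _))))))
      start′ : ∀ L → L 0# ≈ᶜ lnPR ω → L 0# +ᶜ ofR d *ᶜ v 0# ≈ᶜ lnPR (λ i → ω i +ᶜ z)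
      start′ L s = ctrans (+ᶜ-cong s (ctrans (*ᶜ-congˡ {x = ofR d} (refl ,ᶜ zeroˡ _)) (csym (ofR-* _ _))))
        (ctrans (csym (ofR-+ _ _))
        (ofR-cong (ln-unique (PR-pos _) (trans (expR-+ _ _) (trans (*-congʳ (expR-ln (PR-pos _)))
          (sym PR-shift))))))

  -- Descartes' rule of signs for sums of exponentials sampled on an arithmetic progression:
  -- the operator v ↦ v (k + 1) - y v k loses at most one sign change.

  signed : Bool → R → R
  signed true x = x
  signed false x = - x

  signed-not : ∀ b x → signed (not b) x ≈ - signed b x
  signed-not true x = refl
  signed-not false x = solve 1 (λ x → x := :- :- x) tt x

  signed-neg : ∀ b x → signed (not b) (- x) ≈ signed b x
  signed-neg true x = solve 1 (λ x → :- :- x := x) tt x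
  signed-neg false x = refl

  signed-cong : ∀ b {x y} → x ≈ y → signed b x ≈ signed b y
  signed-cong true e = e
  signed-cong false e = -‿cong e

  signed-* : ∀ b r x → signed b (r * x) ≈ r * signed b x
  signed-* true r x = refl
  signed-* false r x = solve 2 (λ r x → :- (r :* x) := r :* :- x) tt r x

  signed-product : ∀ b {x y} → 0# ≤ signed b x → 0# ≤ signed b y → 0# ≤ x * y
  signed-product true p q = *-nonneg p q
  signed-product false {x} {y} p q = ≤-resp₂ refl (solve 2 (λ x y → (:- x) :* (:- y) := x :* y) tt x y)
    (*-nonneg p q)

  -- Counts n sign changes from index `lo` on, the first sign being `b`, with `true` for positive.
  -- Weak inequalities between the indices suffice, as opposite signs already force them apart.
  Alternates : ℕ → Bool → (ℕ → R) → ℕ → Set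
  Alternates zero b v lo = ∃ λ k → lo ℕ.≤ k × 0# < signed b (v k)
  Alternates (suc n) b v lo = ∃ λ k → lo ℕ.≤ k × 0# < signed b (v k) × Alternates n (not b) v k

  alternates-weaken : ∀ n {b v lo lo′} → lo ℕ.≤ lo′ → Alternates n b v lo′ → Alternates n b v lo
  alternates-weaken zero le (k , p , q) = k , ℕ.≤-trans le p , q
  alternates-weaken (suc n) le (k , p , q , r) = k , ℕ.≤-trans le p , q , r

  Δ : R → (ℕ → R) → ℕ → R
  Δ y v k = v (suc k) - y * v k

  -- While `Δ y v` avoids the sign `not b`, the positivity of y makes v keep the sign b. So `Δ y v`
  -- takes the sign `not b` before v does; the bound on `suc l` keeps the indices found for
  -- successive sign changes in order.
  Δ-sign-change : ∀ b y v → 0# < y → ∀ i k → 0# < signed b (v k) → 0# < signed (not b) (v (i ℕ.+ k)) →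
    ∃ λ l → k ℕ.≤ l × suc l ℕ.≤ i ℕ.+ k × 0# < signed (not b) (Δ y v l)
  Δ-sign-change b y v y>0 zero k p q = ⊥-elim (<-irrefl (<-trans p
    (<-by q (trans (+-congʳ (signed-not b (v k))) (solve 1 (λ x → :- x :- con 0ℚ := con 0ℚ :- x) tt
    (signed b (v k)))))))
  Δ-sign-change b y v y>0 (suc i) k p q with lem {0# < signed (not b) (Δ y v k)}
  ... | yes r = k , ℕ.≤-refl , s≤s (ℕ.m≤n+m k i) , r
  ... | no ¬r = let l , k<l , l< , r = Δ-sign-change b y v y>0 i (suc k) next (≡.subst (λ j → 0# < signed (not b) (v j)) (≡.sym (ℕ.+-suc i k)) q) in
      l , ℕ.≤-trans (ℕ.n≤1+n k) k<l , ≡.subst (suc l ℕ.≤_) (ℕ.+-suc i k) l< , r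
    where
    linear : ∀ b x z → signed b (x - z) ≈ signed b x - signed b z
    linear true x z = refl
    linear false x z = solve 2 (λ x z → :- (x :- z) := :- x :- :- z) tt x z
    next : 0# < signed b (v (suc k))
    next = <-≤-trans (*-pos y>0 p) (≤-by ¬r (trans (+-congˡ (-‿cong
      (trans (signed-not b _) (-‿cong (trans (linear b _ _) (+-congˡ (-‿cong (signed-* b y _))))))))
      (solve 2 (λ x z → con 0ℚ :- :- (x :- z) := x :- z) tt (signed b (v (suc k))) (y * signed b (v k)))))

  Δ-alternates : ∀ n {b y v lo} → 0# < y → (α : Alternates (suc n) b v lo) → Alternates n (not b) (Δ y v) (proj₁ α)
  Δ-alternates zero {b} {y} {v} y>0 (k , _ , p , (k′ , k≤k′ , q)) =
    let l , k≤l , _ , r = Δ-sign-change b y v y>0 (k′ ℕ.∸ k) k p (≡.subst (λ j → 0# < signed (not b) (v j)) (≡.sym (ℕ.m∸n+n≡m k≤k′)) q) in l , k≤l , r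
  Δ-alternates (suc n) {b} {y} {v} y>0 (k , _ , p , α@(k′ , k≤k′ , q , _)) =
    let l , k≤l , l< , r = Δ-sign-change b y v y>0 (k′ ℕ.∸ k) k p (≡.subst (λ j → 0# < signed (not b) (v j)) (≡.sym (ℕ.m∸n+n≡m k≤k′)) q) in
    l , k≤l , r , alternates-weaken n (ℕ.≤-trans (ℕ.n≤1+n l) (≡.subst (suc l ℕ.≤_) (ℕ.m∸n+n≡m k≤k′) l<))
      (Δ-alternates n y>0 α)

  Δs : (ℕ → R) → ℕ → (ℕ → R) → ℕ → R
  Δs y zero v = v
  Δs y (suc J) v = Δ (y J) (Δs y J v)

  Δs-alternates : ∀ y J i {b v lo} → (∀ j → 0# < y j) → Alternates (i ℕ.+ J) b v lo → ∃ λ b′ → ∃ λ lo′ → Alternates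
    i b′ (Δs y J v) lo′
  Δs-alternates y zero i {b} {v} {lo} y>0 α = b , lo , ≡.subst (λ k → Alternates k b v lo) (ℕ.+-identityʳ i) α
  Δs-alternates y (suc J) i {b} {v} {lo} y>0 α =
    let b′ , lo′ , α′ = Δs-alternates y J (suc i) y>0 (≡.subst (λ k → Alternates k b v lo) (ℕ.+-suc i J) α) in
    not b′ , _ , Δ-alternates i (y>0 J) α′

  nonpos⇒¬alternates : ∀ {v} → (∀ k → v k ≤ 0#) → ∀ b lo → ¬ Alternates 1 b v lo
  nonpos⇒¬alternates h true lo (k , _ , p , _) = h k p
  nonpos⇒¬alternates h false lo (_ , _ , _ , (k , _ , p)) = h k p

  pow : R → ℕ → R
  pow x zero = 1#
  pow x (suc k) = pow x k * x

  pow-pos : ∀ {x} → 0# < x → ∀ k → 0# < pow x k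
  pow-pos p zero = 0<1
  pow-pos p (suc k) = *-pos (pow-pos p k) p

  factors : (ℕ → R) → ℕ → R → R
  factors y zero x = 1#
  factors y (suc J) x = factors y J x * (x - y J)

  -- Geometric sequences are eigenvectors: `Δ y` multiplies k ↦ x^k by x - y.
  Δs-powers : ∀ {m} y J (C x : Fin m → R) k →
    Δs y J (λ k → sum (λ j → C j * pow (x j) k)) k ≈ sum (λ j → C j * factors y J (x j) * pow (x j) k)
  Δs-powers {m} y zero C x k = sum-cong {m} λ j → *-congʳ (sym (*-identityʳ (C j)))
  Δs-powers {m} y (suc J) C x k = trans (+-cong (Δs-powers y J C x (suc k))
    (-‿cong (*-congˡ (Δs-powers y J C x k))))
    (combine (λ j → C j * factors y J (x j) * pow (x j) (suc k)) (λ j → C j * factors y J (x j) * pow (x j) k) _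
      (y J)
      λ j → solve 5 (λ c f x p y → c :* f :* (p :* x) :- y :* (c :* f :* p) := c :* (f :* (x :- y)) :* p) tt (C j)
        (factors y J (x j)) (x j) (pow (x j) k) (y J))
    where
    combine : ∀ {m} (f g h : Fin m → R) r → (∀ j → f j - r * g j ≈ h j) → sum f - r * sum g ≈ sum h
    combine {zero} f g h r e = solve 1 (λ r → con 0ℚ :- r :* con 0ℚ := con 0ℚ) tt r
    combine {suc m} f g h r e = trans (solve 5 (λ a b c d r → (a :+ b) :- r :* (c :+ d) := (a :- r :* c) :+
      (b :- r :* d)) tt (f zero) (sum (f ∘ suc)) (g zero) (sum (g ∘ suc)) r)
      (+-cong (e zero) (combine (f ∘ suc) (g ∘ suc) (h ∘ suc) r (e ∘ suc)))

  parity : ℕ → Bool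
  parity zero = true
  parity (suc k) = not (parity k)

  sin-half-turn : ∀ k z → signed (parity k) (sin (z - nat k * π)) ≈ sin z
  sin-half-turn zero z = sin-cong (trans (+-congˡ (-‿cong (trans (*-congʳ nat-zero) (zeroˡ π))))
    (solve 1 (λ z → z :- con 0ℚ := z) tt z))
  sin-half-turn (suc k) z = trans (signed-cong (not (parity k))
    (trans (solve 1 (λ s → s := :- :- s) tt _) (-‿cong (trans (sym (sin-+π _)) (sin-cong e)))))
    (trans (signed-neg (parity k) _) (sin-half-turn k z))
    where
    e : (z - nat (suc k) * π) + π ≈ z - nat k * π
    e = trans (+-congʳ (+-congˡ (-‿cong (*-congʳ (nat-suc k)))))
      (solve 3 (λ z n p → (z :- (con 1ℚ :+ n) :* p) :+ p := z :- n :* p) tt z (nat k) π)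

  sin-+half-turn : ∀ k z → signed (parity k) (sin (z + nat k * π)) ≈ sin z
  sin-+half-turn zero z = sin-cong (trans (+-congˡ (trans (*-congʳ nat-zero) (zeroˡ π))) (+-identityʳ z))
  sin-+half-turn (suc k) z = trans (signed-cong (not (parity k)) (trans (sin-cong e) (sin-+π _)))
    (trans (signed-neg (parity k) _) (sin-+half-turn k z))
    where
    e : z + nat (suc k) * π ≈ (z + nat k * π) + π
    e = trans (+-congˡ (*-congʳ (nat-suc k))) (solve 3 (λ z n p → z :+ (con 1ℚ :+ n) :* p := (z :+ n :* p) :+ p) tt
      z (nat k) π)

  sin-top-interval : ∀ k {y} → nat k * π ≤ y → y ≤ nat (suc k) * π → 0# ≤ signed (parity k) (sin y)
  sin-top-interval k {y} p q = ≤-resp₂ refl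
    (trans (sym (sin-+half-turn k (y - nat k * π))) (signed-cong (parity k)
      (sin-cong (solve 2 (λ y a → (y :- a) :+ a := y) tt y (nat k * π)))))
    (sin-nonneg (≤⇒0≤ p) (≤-by q (trans (+-congʳ (*-congʳ (nat-suc k)))
      (solve 3 (λ y n p → (con 1ℚ :+ n) :* p :- y := p :- (y :- n :* p)) tt y (nat k) π))))

  -- sin changes sign exactly where one of the factors does.
  sin*factors-nonneg : ∀ y J {z x} → 0# ≤ z → z ≤ nat (suc J) * π →
    (∀ i → z ≤ nat (suc i) * π → y i ≤ x) → (∀ i → nat (suc i) * π ≤ z → x ≤ y i) → 0# ≤ sin z * factors y J x
  sin*factors-nonneg y zero {z} p q _ _ = *-nonneg (sin-nonneg p
    (≤-trans q (≤-reflexive (trans (*-congʳ (trans (nat-suc 0) (trans (+-congˡ nat-zero) (+-identityʳ 1#))))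
    (*-identityˡ π))))) (<⇒≤ 0<1)
  sin*factors-nonneg y (suc J) {z} {x} p q below above with ≤-or-> z (nat (suc J) * π)
  ... | inj₁ le = ≤-resp₂ refl (*-assoc _ _ _) (*-nonneg (sin*factors-nonneg y J p le below above)
    (≤⇒0≤ (below J le)))
  -- Beyond the last node sin z has the sign (-1)^{J+1}, and all J + 1 factors are nonpositive.
  ... | inj₂ gt = signed-product (parity (suc J)) (sin-top-interval (suc J) (<⇒≤ gt) q)
    (all-negative (suc J) λ i i≤J → above i (≤-trans (*-monoʳ-≤ (<⇒≤ π>0) (nat-mono i≤J)) (<⇒≤ gt)))
    where
    all-negative : ∀ k → (∀ i → suc i ℕ.≤ k → x ≤ y i) → 0# ≤ signed (parity k) (factors y k x)
    all-negative zero h = <⇒≤ 0<1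
    all-negative (suc k) h = ≤-trans (*-nonneg (≤⇒0≤ (h k ℕ.≤-refl))
      (all-negative k λ i le → h i (ℕ.≤-trans le (ℕ.n≤1+n k))))
      (≤-reflexive (trans (sym (signed-* (parity k) _ _)) (trans (sym (signed-neg (parity k) _))
        (signed-cong (not (parity k)) (solve 3 (λ x y f → :- ((y :- x) :* f) := f :* (x :- y)) tt x (y k)
        (factors y k x))))))

  -- A real sequence with steps smaller than π visits every interval of length π on its way up.
  module Crossing (B u : ℕ → R) (β : R) (K : ℕ) (top : β < B K)
    (step : ∀ k → k ℕ.< K → B (suc k) < B k + π)
    (sign : ∀ k → ∃ λ E → 0# < E × u k ≈ E * sin (B k - β)) where

    crossing : ∀ A → A < B K → ∀ i k → i ℕ.+ k ≡ K → B k < A + π → ∃ λ l → k ℕ.≤ l × l ℕ.≤ K × A < B l × B l < A + π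
    crossing A A<top i k e lt with lem {A < B k}
    ... | yes gt = k , ℕ.≤-refl , ≡.subst (k ℕ.≤_) e (ℕ.m≤n+m k i) , gt , lt
    crossing A A<top zero k ≡.refl lt | no ¬gt = ⊥-elim (¬gt A<top)
    crossing A A<top (suc i) k e lt | no ¬gt =
      let l , p , q , r = crossing A A<top i (suc k) (≡.trans (ℕ.+-suc i k) e)
            (<-≤-trans (step k (≡.subst (k ℕ.<_) e (s≤s (ℕ.m≤n+m k i)))) (+-mono-≤ ¬gt ≤-refl))
      in l , ℕ.≤-trans (ℕ.n≤1+n k) p , q , r

    sign-at : ∀ i l → β - nat i * π < B l → B l < β - nat i * π + π → 0# < signed (parity i) (u l)
    sign-at i l p q = let E , E>0 , e = sign l in
      <-resp₂ refl (sym (trans (signed-cong (parity i) e) (trans (signed-* (parity i) E _)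
        (*-congˡ (trans (signed-cong (parity i) (sin-cong (solve 3 (λ b s n → b :- s := (b :- s :+ n) :- n) tt
          (B l) β (nat i * π)))) (sin-half-turn i _))))))
        (*-pos E>0 (sin-pos (<-by p (solve 3 (λ b s n → b :- (s :- n) := (b :- s :+ n) :- con 0ℚ) tt (B l) β
          (nat i * π))) (<-by q (solve 4 (λ b s n p → (s :- n :+ p) :- b := p :- (b :- s :+ n)) tt (B l) β
          (nat i * π) π))))

    Crossed : ℕ → ℕ → Set
    Crossed i k = ∃ λ l → k ℕ.≤ l × l ℕ.≤ K × β - nat i * π < B l × B l < β - nat i * π + π

    crossed : ∀ i k → k ℕ.≤ K → B k < β - nat i * π + π → Crossed i k
    crossed i k k≤K = crossing (β - nat i * π)
      (≤-<-trans (≤-by (*-nonneg (nat-nonneg i) (<⇒≤ π>0)) (solve 2 (λ s n → n :- con 0ℚ := s :- (s :- n)) tt β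
        (nat i * π))) top) (K ℕ.∸ k) k (ℕ.m∸n+n≡m k≤K)

    next-level : ∀ i l → B l < β - nat (suc i) * π + π → B l < β - nat i * π + π
    next-level i l q = <-≤-trans q (≤-trans
      (≤-reflexive (trans (+-congʳ (+-congˡ (-‿cong (*-congʳ (nat-suc i)))))
        (solve 3 (λ s n p → s :- (con 1ℚ :+ n) :* p :+ p := s :- n :* p) tt β (nat i) π)))
      (≤-by (<⇒≤ π>0) (solve 2 (λ a p → p :- con 0ℚ := (a :+ p) :- a) tt (β - nat i * π) π)))

    not-not : ∀ b → b ≡ not (not b)
    not-not true = ≡.refl
    not-not false = ≡.refl

    -- In the interval of length π above β - i π the sine of B - β has the sign (-1)^i. After
    -- visiting it the sequence, which ends above β, must still visit the intervals for i - 1, ...,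
    -- 0, with a change of sign each time.
    crossed⇒alternates : ∀ i {k} → Crossed i k → Alternates i (parity i) u k
    crossed⇒alternates zero (l , k≤l , l≤K , p , q) = l , k≤l , sign-at 0 l p q
    crossed⇒alternates (suc i) (l , k≤l , l≤K , p , q) = l , k≤l , sign-at (suc i) l p q ,
      ≡.subst (λ b → Alternates i b u l) (not-not (parity i))
        (crossed⇒alternates i (crossed i l l≤K (next-level i l q)))

    parity-alternates : ∀ i k → k ℕ.≤ K → B k < β - nat i * π + π → Alternates i (parity i) u k
    parity-alternates i k k≤K lt = crossed⇒alternates i (crossed i k k≤K lt)

  -- The bound |Im ℓ| ≤ d π/2

  exponential-decay : ∀ {C r ε} → 0# ≤ C → 0# < r → 0# < ε → ∃ λ T → 0# ≤ T × (∀ t → t ≤ - T → C * expR (t * r) ≤ ε)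
  exponential-decay {C} {r} {ε} C≥0 r>0 ε>0 = T , T≥0 , λ t t≤ → bound t t≤
    where
    T : R
    -- For t ≤ -T this gives C ≤ ε · (-t r), and exp y ≥ y for y = -t r ≥ 0.
    T = C * (ε * r) ⁻¹
    εr>0 : 0# < ε * r
    εr>0 = *-pos ε>0 r>0
    T≥0 : 0# ≤ T
    T≥0 = *-nonneg C≥0 (<⇒≤ (⁻¹-pos εr>0))
    bound : ∀ t → t ≤ - T → C * expR (t * r) ≤ ε
    bound t t≤ = ≤-trans (*-monoʳ-≤ (<⇒≤ (expR-pos _)) C≤) (≤-reflexive (trans (*-assoc _ _ _)
      (trans (*-congˡ (trans (*-comm _ _) (expR-neg (t * r)))) (*-identityʳ ε))))
      where
      y≥ : T * r ≤ - (t * r)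
      y≥ = ≤-trans (*-monoʳ-≤ (<⇒≤ r>0) (≤-by t≤ (solve 2 (λ t T → :- T :- t := :- t :- T) tt t T)))
        (≤-reflexive (solve 2 (λ t r → (:- t) :* r := :- (t :* r)) tt t r))
      y≥0 : 0# ≤ - (t * r)
      y≥0 = ≤-trans (*-nonneg T≥0 (<⇒≤ r>0)) y≥
      C≤ : C ≤ ε * expR (- (t * r))
      C≤ = ≤-trans (≤-reflexive (trans (sym (*-/-cancel (pos⇒≉0 εr>0)))
        (solve 4 (λ e r c i → e :* r :* (c :* i) := e :* (c :* i :* r)) tt ε r C ((ε * r) ⁻¹))))
        (*-monoˡ-≤ (<⇒≤ ε>0) (≤-trans y≥ (≤-trans (≤-by (<⇒≤ 0<1)
          (solve 1 (λ y → con 1ℚ :- con 0ℚ := (con 1ℚ :+ y) :- y) tt (- (t * r)))) (1+x≤expR y≥0))))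

  argmin : ∀ {m} (f : Fin m → R) → Fin m → ∃ λ j₀ → ∀ j → f j₀ ≤ f j
  argmin {suc zero} f _ = zero , λ { zero → ≤-refl }
  argmin {suc (suc m)} f _ = pick (argmin (f ∘ suc) zero)
    where
    pick : (∃ λ j₀ → ∀ j → f (suc j₀) ≤ f (suc j)) → ∃ λ j₀ → ∀ j → f j₀ ≤ f j
    pick (j₀ , h) with ≤-or-> (f zero) (f (suc j₀))
    ... | inj₁ le = zero , λ { zero → ≤-refl ; (suc j) → ≤-trans le (h j) }
    ... | inj₂ gt = suc j₀ , λ { zero → <⇒≤ gt ; (suc j) → h j }

  common-threshold : ∀ {m} (Q : Fin m → R → Set) → (∀ j → ∃ λ T → 0# ≤ T × (∀ t → t ≤ - T → Q j t)) →
    ∃ λ T → 0# ≤ T × (∀ t → t ≤ - T → ∀ j → Q j t)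
  common-threshold {m} Q h = sum {m} (λ j → proj₁ (h j)) , sum-nonneg (λ j → proj₁ (proj₂ (h j))) ,
    λ t t≤ j → proj₂ (proj₂ (h j)) t (≤-trans t≤ (neg-mono-≤ (term≤sum {m} {λ j → proj₁ (h j)}
      (λ j → proj₁ (proj₂ (h j))) j)))

  sum-const : ∀ m ε → sum {m} (λ _ → ε) ≈ nat m * ε
  sum-const zero ε = trans (sym (zeroˡ ε)) (*-congʳ (sym nat-zero))
  sum-const (suc m) ε = trans (+-congˡ (sum-const m ε)) (trans
    (solve 2 (λ n e → e :+ n :* e := (con 1ℚ :+ n) :* e) tt (nat m) ε) (*-congʳ (sym (nat-suc m))))

  expR-nat : ∀ k y → expR (nat k * y) ≈ pow (expR y) k
  expR-nat zero y = trans (expR-cong (trans (*-congʳ nat-zero) (zeroˡ y))) expR-zero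
  expR-nat (suc k) y = trans (expR-cong (trans (*-congʳ (nat-suc k))
    (solve 2 (λ n y → (con 1ℚ :+ n) :* y := n :* y :+ y) tt (nat k) y)))
    (trans (expR-+ _ _) (*-congʳ (expR-nat k y)))

  half-turns : ∀ {z} → 0# < z → ∃ λ J → nat J * π < z × z ≤ nat (suc J) * π
  half-turns {z} z>0 = let K , lt = nat-archimedean (z / π) in search K (<⇒≤ (<-resp₂ (*-/-cancel (pos⇒≉0 π>0)) (*-comm π _) (*-monoˡ-< π>0 lt)))
    where
    search : ∀ k → z ≤ nat k * π → ∃ λ J → nat J * π < z × z ≤ nat (suc J) * π
    search zero le = ⊥-elim (≤-trans le (≤-reflexive (trans (*-congʳ nat-zero) (zeroˡ π))) z>0)
    search (suc k) le = [ search k , (λ gt → k , gt , le) ]′ (≤-or-> z (nat k * π))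

  -- An empty sum vanishes everywhere, which stability forbids; the least exponent below therefore
  -- exists.
  term-index : ∀ n m → StablePosynomial n m → Fin m
  term-index n zero p = ⊥-elim (StablePosynomial.stable p (λ _ → 0ᶜ)
    (λ i → <-resp₂ (sym (nonneg⇒∣∣ ≤-refl)) refl π/2>0) crefl)
  term-index n (suc m) p = zero

  module Argument {n m : ℕ} (p : StablePosynomial n m) where
    open Logarithm p

    ℓ-cong : ∀ {ω ω′} → Tube {n} ω → Tube {n} ω′ → (∀ i → ω i ≈ᶜ ω′ i) → ℓ ω′ ≈ᶜ ℓ ω
    ℓ-cong {ω} {ω′} t t′ e = ctrans (ℓ-compare-ℓ (λ _ → 0ᶜ) t t′ (λ τ q → ≤-trans (≤-reflexive ‖0‖) (<⇒≤ r₁>0) ,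
        ctrans (P-cong λ i → re-cong (csym (e i)) ,ᶜ *-congˡ (im-cong (csym (e i))))
          (csolve 1 (λ f → f ⊜ f ⊗ (ccon 1ℚ ⊕ ccon 0ℚ)) tt (path ω τ))))
      (ctrans (+ᶜ-congˡ log1p-zero) (+ᶜ-identityʳ _))

    D : R
    D = d * π/2

    -- Moving z_i along z_i exp (t φ_i), φ_i the argument of z_i, leaves all arguments unchanged.
    module Flow (ω : Point) (ω∈ : Tube {n} ω) where
      ρᵢ φ : Fin n → R
      ρᵢ i = re (ω i)
      φ i = im (ω i)

      μ w : Fin m → R
      μ j = dotR (a j) φ
      w j = c j * expR (dotR (a j) ρᵢ)

      w>0 : ∀ j → 0# < w j
      w>0 j = *-pos (c>0 j) (expR-pos _)

      flow : R → Point
      flow t i = mkC (ρᵢ i + t * φ i) (φ i)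

      μ≤D : ∀ j → μ j ≤ D
      μ≤D j = ≤-trans (x≤∣x∣ _) (≤-trans (≤-reflexive (sym (trans (‖‖-cong (dot-ofR (a j) φ)) (‖ofR‖ _))))
        (≤-trans (dot-norm (a≥0 j) (λ i → ≤-trans (≤-reflexive (‖ofR‖ (φ i))) (<⇒≤ (ω∈ i))))
          (≤-reflexive (*-congʳ (homogeneous j)))))

      path-flow : ∀ t τ → path (flow t) τ ≈ᶜ sumᶜ {m} (λ j → ofR (w j * expR (t * μ j)) *ᶜ exp (imag (τ * μ j)))
      path-flow t τ = sumᶜ-cong {m} λ j → ctrans (*ᶜ-congˡ (ctrans (exp-cong (exponent j))
        (ctrans (exp-+ _ _) (*ᶜ-congʳ (exp-ofR _)))))
        (ctrans (csym (*ᶜ-assoc _ _ _)) (*ᶜ-congʳ (ctrans (csym (ofR-* _ _))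
          (ofR-cong (trans (*-congˡ (expR-+ _ _)) (sym (*-assoc _ _ _)))))))
        where
        point : ∀ i → vertical (flow t) τ i ≈ᶜ ofR (ρᵢ i) +ᶜ ofR (φ i) *ᶜ mkC t τ
        point i = sym (trans (re-+ _ _) (+-congˡ (trans (re-ofR-* _ _) (*-comm _ _)))) ,ᶜ
          sym (trans (im-+ _ _) (trans (+-identityˡ _) (trans (im-ofR-* _ _) (*-comm _ _))))
        exponent : ∀ j → dot (a j) (vertical (flow t) τ) ≈ᶜ ofR (dotR (a j) ρᵢ + t * μ j) +ᶜ imag (τ * μ j)
        exponent j = ctrans (dot-cong (a j) point) (ctrans (dot-+ (a j) (ofR ∘ ρᵢ) (λ i → ofR (φ i) *ᶜ mkC t τ))
          (ctrans (+ᶜ-cong (dot-ofR (a j) ρᵢ) (ctrans (dot-*ʳ (a j) (ofR ∘ φ) (mkC t τ))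
            (*ᶜ-congʳ (dot-ofR (a j) φ))))
            ((trans (re-+ _ _) (trans (+-congˡ (trans (re-ofR-* _ _) (*-comm _ _)))
              (sym (trans (re-+ _ _) (+-identityʳ _))))) ,ᶜ
             (trans (im-+ _ _) (trans (+-congˡ (trans (im-ofR-* _ _) (*-comm _ _))) (sym (im-+ _ _)))))))

      least : ∃ λ j₀ → ∀ j → μ j₀ ≤ μ j
      least = argmin μ (term-index n m p)

      j₀ : Fin m
      j₀ = proj₁ least

      μ₀ : R
      μ₀ = μ j₀

      excess : Fin m → R
      excess j = μ j - μ₀

      excess≥0 : ∀ j → 0# ≤ excess j
      excess≥0 j = ≤⇒0≤ (proj₂ least j)

      g : R → R
      g t = sum {m} (λ j → w j * expR (t * excess j))

      w₀≤g : ∀ t → w j₀ ≤ g t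
      w₀≤g t = ≤-trans (≤-reflexive (sym (trans (*-congˡ (trans
        (expR-cong (solve 2 (λ t x → t :* (x :- x) := con 0ℚ) tt t μ₀)) expR-zero)) (*-identityʳ _))))
        (term≤sum {m} {λ j → w j * expR (t * excess j)} (λ j → *-nonneg (<⇒≤ (w>0 j)) (<⇒≤ (expR-pos _))) j₀)

      g>0 : ∀ t → 0# < g t
      g>0 t = <-≤-trans (w>0 j₀) (w₀≤g t)

      -- The path with the factor exp (μ₀ (t + i τ)) of the least exponent divided out. As t → -∞
      -- only the terms of excess 0 survive, and these do not depend on τ, so H becomes
      -- indistinguishable from the positive number `g t`.
      H : R → R → C
      H t τ = sumᶜ {m} (λ j → ofR (w j * expR (t * excess j)) *ᶜ exp (imag (τ * excess j)))

      path-H : ∀ t τ → path (flow t) τ ≈ᶜ H t τ *ᶜ exp (ofR μ₀ *ᶜ mkC t τ)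
      path-H t τ = ctrans (path-flow t τ) (ctrans (sumᶜ-cong {m} term) (sumᶜ-*ʳ {m} _ _))
        where
        E₀ : exp (ofR μ₀ *ᶜ mkC t τ) ≈ᶜ ofR (expR (t * μ₀)) *ᶜ exp (imag (τ * μ₀))
        E₀ = ctrans (exp-polar _) (*ᶜ-cong (ofR-cong (expR-cong (trans (re-ofR-* _ _) (*-comm _ _))))
          (exp-cong (imag-cong (trans (im-ofR-* _ _) (*-comm _ _)))))
        term : ∀ j → ofR (w j * expR (t * μ j)) *ᶜ exp (imag (τ * μ j)) ≈ᶜ
          (ofR (w j * expR (t * excess j)) *ᶜ exp (imag (τ * excess j))) *ᶜ exp (ofR μ₀ *ᶜ mkC t τ)
        term j = csym (ctrans (*ᶜ-congˡ E₀) (ctrans (csolve 4 (λ a b c e → (a ⊗ b) ⊗ (c ⊗ e) ⊜ (a ⊗ c) ⊗ (b ⊗ e)) tt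
          _ _ _ _)
          (*ᶜ-cong (ctrans (csym (ofR-* _ _)) (ofR-cong (trans (*-assoc _ _ _)
            (*-congˡ (trans (sym (expR-+ _ _)) (expR-cong (solve 3 (λ t x y → t :* (x :- y) :+ t :* y := t :* x) tt
            t (μ j) μ₀)))))))
            (ctrans (csym (exp-+ _ _)) (exp-cong (ctrans (csym (imag-+ _ _))
              (imag-cong (solve 3 (λ t x y → t :* (x :- y) :+ t :* y := t :* x) tt τ (μ j) μ₀))))))))

      -- Far to the left H t τ lies within η · `g t` of `g t` for all τ at once. The path is then a
      -- small relative perturbation of exp (μ₀ (t + i τ)) · `g t`, whose lift is explicit, starts
      -- at a real value and has imaginary part μ₀ at τ = 1.
      left-end : ∀ {δ} → 0# < δ → ∃ λ T → 0# ≤ T × im (ℓ (flow (- T))) < μ₀ + δ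
      left-end {δ} δ>0 = T , T≥0 , <-resp₂ (sym (trans (im-cong compared) (trans (im-+ _ _) (+-congʳ imL)))) refl
          (+-mono-≤-< ≤-refl (≤-<-trans (≤-trans (x≤∣x∣ _) (∣im∣≤‖‖ _))
            (≤-<-trans (log1p-bound (≤-trans (x≤η 1# 1∈𝕀) (≤-trans (x⊓y≤x r₁ _) r₁≤r₀)))
            (≤-<-trans (*-monoˡ-≤ (<⇒≤ 0<2) (≤-trans (x≤η 1# 1∈𝕀) (x⊓y≤y r₁ _)))
              (≤-<-trans (≤-reflexive (solve 1 (λ d → (con 1ℚ :+ con 1ℚ) :* (con ½ :* (con ½ :* d)) := con ½ :* d)
              tt δ)) (half-< δ>0))))))
        where
        η ε : R
        -- Each of the m terms is to contribute at most ε, together at most η times the weight of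
        -- the least exponent, which is at most η · `g t`. `log1p` doubles η, so δ/2 is left.
        η = r₁ ⊓ (½# * (½# * δ))
        ε = η * w j₀ * unit m
        η>0 : 0# < η
        η>0 = ⊓-pos r₁>0 (half-pos (half-pos δ>0))
        ε>0 : 0# < ε
        ε>0 = *-pos (*-pos η>0 (w>0 j₀)) (unit-pos m)
        Small : Fin m → R → Set
        Small j t = ∀ τ → 𝕀 τ → w j * expR (t * excess j) * ‖ exp (imag (τ * excess j)) -ᶜ 1ᶜ ‖ ≤ ε
        small : ∀ j → ∃ λ T → 0# ≤ T × (∀ t → t ≤ - T → Small j t)
        small j = [ positive , zero-excess ]′ (≤-split (excess≥0 j))
          where
          positive : 0# < excess j → ∃ λ T → 0# ≤ T × (∀ t → t ≤ - T → Small j t)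
          positive pos = let T , T≥0 , h = exponential-decay {w j * (expR (excess j) + 1#)} {excess j} {ε}
                               (*-nonneg (<⇒≤ (w>0 j)) (+-nonneg (<⇒≤ (expR-pos _)) (<⇒≤ 0<1))) pos ε>0 in
            T , T≥0 , λ t t≤ τ q → ≤-trans (*-monoˡ-≤ (*-nonneg (<⇒≤ (w>0 j)) (<⇒≤ (expR-pos _)))
                (≤-trans (‖‖-triangle-- _ _) (+-mono-≤ (exp-bound
                  (≤-trans (≤-reflexive (‖imag‖ _)) (≤-trans (∣*im∣≤ (excess j) q)
                  (≤-reflexive (nonneg⇒∣∣ (excess≥0 j)))))) (≤-reflexive ‖1‖))))
              (≤-trans (≤-reflexive (solve 3 (λ w e f → w :* e :* (f :+ con 1ℚ) := w :* (f :+ con 1ℚ) :* e) tt (w j)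
                (expR (t * excess j)) (expR (excess j)))) (h t t≤))
          zero-excess : 0# ≈ excess j → ∃ λ T → 0# ≤ T × (∀ t → t ≤ - T → Small j t)
          zero-excess e = 0# , ≤-refl , λ t _ τ _ → ≤-trans (≤-reflexive
            (trans (*-congˡ (trans (‖‖-cong (ctrans (+ᶜ-congʳ
            (ctrans (exp-cong (imag-cong (trans (*-congˡ (sym e)) (zeroʳ τ)))) exp-zero)) (-ᶜ-inverseʳ 1ᶜ))) ‖0‖))
            (zeroʳ _))) (<⇒≤ ε>0)
        threshold : ∃ λ T → 0# ≤ T × (∀ t → t ≤ - T → ∀ j → Small j t)
        threshold = common-threshold Small small
        T : R
        T = proj₁ threshold
        T≥0 : 0# ≤ T
        T≥0 = proj₁ (proj₂ threshold)
        t : R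
        t = - T
        x : R → C
        x τ = (H t τ -ᶜ ofR (g t)) *ᶜ ofR (g t ⁻¹)
        H-g : ∀ τ → 𝕀 τ → ‖ H t τ -ᶜ ofR (g t) ‖ ≤ η * w j₀
        H-g τ q = ≤-trans (≤-reflexive (‖‖-cong (ctrans (+ᶜ-congˡ
          (ctrans (-ᶜ-cong (csym (sumᶜ-ofR {m} _))) (csym (sumᶜ-neg {m} _)))) (csym (sumᶜ-+ {m} _ _)))))
          (≤-trans (sumᶜ-norm {m} _) (≤-trans (sum-mono-≤ {m} {g = λ _ → ε} (λ j → ≤-trans (≤-reflexive
              (trans (‖‖-cong (csolve 2 (λ r e → r ⊗ e ⊕ ⊝ r ⊜ r ⊗ (e ⊖ ccon 1ℚ)) tt
                (ofR (w j * expR (t * excess j))) (exp (imag (τ * excess j)))))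
                (trans (‖ofR*‖ _ _) (*-congʳ (nonneg⇒∣∣ (*-nonneg (<⇒≤ (w>0 j)) (<⇒≤ (expR-pos _))))))))
              (proj₂ (proj₂ threshold) t ≤-refl j τ q)))
            (≤-trans (≤-reflexive (sum-const m ε)) (≤-trans (*-monoʳ-≤ (<⇒≤ ε>0) (nat-mono (ℕ.n≤1+n m)))
              (≤-reflexive (trans (solve 3 (λ k e u → k :* (e :* u) := e :* (u :* k)) tt (nat (suc m)) (η * w j₀)
                (unit m)) (trans (*-congˡ (unit-cancel m)) (*-identityʳ _))))))))
        x≤η : ∀ τ → 𝕀 τ → ‖ x τ ‖ ≤ η
        x≤η τ q = ≤-trans (‖‖-mult-≤ (≤-trans (H-g τ q) (*-monoˡ-≤ (<⇒≤ η>0) (w₀≤g t)))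
          (≤-reflexive (trans (‖ofR‖ _) (nonneg⇒∣∣ (<⇒≤ (⁻¹-pos (g>0 t)))))))
          (≤-reflexive (trans (*-assoc _ _ _) (trans (*-congˡ (*-inverseʳ (pos⇒≉0 (g>0 t)))) (*-identityʳ η))))
        L f : R → C
        L τ = ofR μ₀ *ᶜ mkC t τ +ᶜ ofR (ln (g t))
        f τ = exp (ofR μ₀ *ᶜ mkC t τ) *ᶜ ofR (g t)
        L-lift : Lift f L
        L-lift = record
          { constant = ∣ μ₀ ∣ ; constant≥0 = ∣∣-nonneg μ₀
          ; lipschitz = λ τ σ _ _ → ≤-reflexive (trans (‖‖-cong
            (csolve 4 (λ u x y l → (u ⊗ x ⊕ l) ⊖ (u ⊗ y ⊕ l) ⊜ u ⊗ (x ⊖ y)) tt (ofR μ₀) (mkC t τ) (mkC t σ)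
            (ofR (ln (g t)))))
              (trans (‖ofR*‖ _ _) (*-congˡ (trans (+-cong (trans
                (∣∣-cong (trans (re-+ _ _) (trans (+-congˡ (re-neg _)) (-‿inverseʳ t)))) (nonneg⇒∣∣ ≤-refl))
                (∣∣-cong (trans (im-+ _ _) (+-congˡ (im-neg _))))) (+-identityˡ _)))))
          ; exp-lift = λ τ _ → ctrans (exp-+ _ _) (*ᶜ-congˡ (ctrans (exp-ofR _) (ofR-cong (expR-ln (g>0 t))))) }
        L0-real : L 0# ≈ᶜ ofR (re (L 0#))
        L0-real = refl ,ᶜ trans (im-+ _ _) (trans (+-identityʳ _) (trans (im-ofR-* _ _) (zeroʳ _)))
        imL : im (L 1#) ≈ μ₀
        imL = trans (im-+ _ _) (trans (+-identityʳ _) (trans (im-ofR-* _ _) (*-identityʳ _)))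
        related : ∀ τ → 𝕀 τ → ‖ x τ ‖ ≤ r₁ × path (flow t) τ ≈ᶜ f τ *ᶜ (1ᶜ +ᶜ x τ)
        related τ q = ≤-trans (x≤η τ q) (x⊓y≤x r₁ _) , ctrans (path-H t τ)
          (csym (ctrans (csolve 4 (λ e g h i → e ⊗ g ⊗ (ccon 1ℚ ⊕ (h ⊖ g) ⊗ i) ⊜ (g ⊕ (h ⊖ g) ⊗ (g ⊗ i)) ⊗ e) tt
            (exp (ofR μ₀ *ᶜ mkC t τ)) (ofR (g t)) (H t τ) (ofR (g t ⁻¹)))
            (*ᶜ-congʳ (ctrans (+ᶜ-congˡ (*ᶜ-congˡ (ctrans (csym (ofR-* _ _))
              (ofR-cong (*-inverseʳ (pos⇒≉0 (g>0 t))))))) (csolve 2 (λ g h → g ⊕ (h ⊖ g) ⊗ ccon 1ℚ ⊜ h) tt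
              (ofR (g t)) (H t τ))))))
        compared : ℓ (flow t) ≈ᶜ L 1# +ᶜ log1p (x 1#)
        compared = ℓ-compare {f} {L} {flow t} x L-lift L0-real ω∈ related

  -- The nodes are the values of exp (h m) at the zeros m = β - (i + 1) π of sin (m - β). The
  -- eigenvalue factors thus change sign together with the coefficients, and after J steps no
  -- coefficient is positive.
  Δs-nonpos : ∀ {m} (A μ : Fin m → R) {β h} J → (∀ j → 0# ≤ A j) → 0# ≤ h →
    (∀ j → 0# ≤ β - μ j × β - μ j ≤ nat (suc J) * π) → ∀ k →
    Δs (λ i → expR (h * (β - nat (suc i) * π))) J (λ k → sum (λ j → A j * sin (μ j - β) * pow (expR (h * μ j)) k)) k
      ≤ 0#
  Δs-nonpos {m} A μ {β} {h} J A≥0 h≥0 range k = ≤-trans (≤-reflexive (Δs-powers {m} Y J _ _ k))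
    (≤-trans (sum-mono-≤ {m} {g = λ _ → 0#} nonpos) (≤-reflexive (trans (sum-const m 0#) (zeroʳ _))))
    where
    Y : ℕ → R
    Y i = expR (h * (β - nat (suc i) * π))
    changes : ∀ j → 0# ≤ sin (β - μ j) * factors Y J (expR (h * μ j))
    changes j = sin*factors-nonneg Y J (proj₁ (range j)) (proj₂ (range j))
      (λ i le → expR-mono-≤ (*-monoˡ-≤ h≥0 (≤-by le (solve 3 (λ b m n → n :- (b :- m) := m :- (b :- n)) tt β (μ j)
        (nat (suc i) * π)))))
      (λ i ge → expR-mono-≤ (*-monoˡ-≤ h≥0 (≤-by ge (solve 3 (λ b m n → (b :- m) :- n := (b :- n) :- m) tt β (μ j)
        (nat (suc i) * π)))))
    nonpos : ∀ j → A j * sin (μ j - β) * factors Y J (expR (h * μ j)) * pow (expR (h * μ j)) k ≤ 0#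
    nonpos j = ≤-trans (≤-reflexive (trans (*-congʳ (*-congʳ (*-congˡ
      (trans (sin-cong (solve 2 (λ m b → m :- b := :- (b :- m)) tt (μ j) β)) (sin-neg _)))))
          (solve 4 (λ a s f p → a :* (:- s) :* f :* p := :- (a :* (s :* f) :* p)) tt (A j) (sin (β - μ j))
            (factors Y J (expR (h * μ j))) (pow (expR (h * μ j)) k))))
        (neg-nonpos (*-nonneg (*-nonneg (A≥0 j) (changes j)) (<⇒≤ (pow-pos (expR-pos _) k))))

  module ArgumentBound {n m : ℕ} (p : StablePosynomial n m) where
    open Logarithm p
    open Argument p

    module Contradiction (ω : Point) (ω∈ : Tube {n} ω) (β : R) (D<β : D < β) (β<B : β < im (ℓ ω))
      (J : ℕ) (z≤ : β - Flow.μ₀ ω ω∈ ≤ nat (suc J) * π)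
      (T : R) (T≥0 : 0# ≤ T) (left : im (ℓ (Flow.flow ω ω∈ (- T))) < Flow.μ₀ ω ω∈ + (β - Flow.μ₀ ω ω∈ - nat J * π)) where
      open Flow ω ω∈

      s : R
      s = size ω

      s≥0 : 0# ≤ s
      s≥0 = size≥0 ω

      ∣ρ∣≤s : ∀ i → ∣ ρᵢ i ∣ ≤ s
      ∣ρ∣≤s i = ≤-trans (∣re∣≤‖‖ (ω i)) (≤size ω i)

      ∣φ∣≤s : ∀ i → ∣ φ i ∣ ≤ s
      ∣φ∣≤s i = ≤-trans (∣im∣≤‖‖ (ω i)) (≤size ω i)

      r : R
      r = s + T * s + s

      r≥0 : 0# ≤ r
      r≥0 = +-nonneg (+-nonneg s≥0 (*-nonneg T≥0 s≥0)) s≥0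

      Past : R → Set
      Past t = Between (- T) (- T + T) t

      ∣t∣≤T : ∀ {t} → Past t → ∣ t ∣ ≤ T
      ∣t∣≤T {t} (q , q′) = ∣∣-lub (≤-trans q′ (≤-trans (≤-reflexive (solve 1 (λ T → :- T :+ T := con 0ℚ) tt T))
        T≥0)) (≤-by q (solve 2 (λ t T → t :- :- T := T :- :- t) tt t T))

      flow-norm : ∀ {t} → Past t → ∀ i → ‖ flow t i ‖ ≤ r
      flow-norm {t} q i = +-mono-≤ (≤-trans (∣∣-triangle _ _) (+-mono-≤ (∣ρ∣≤s i)
        (≤-trans (≤-reflexive (∣∣-* t (φ i))) (*-mono-≤ (∣∣-nonneg t) s≥0 (∣t∣≤T q) (∣φ∣≤s i))))) (∣φ∣≤s i)

      lipP : ∃ λ K → 0# ≤ K × (∀ ω ω′ δ → (∀ i → ‖ ω i ‖ ≤ r) → (∀ i → ‖ ω′ i ‖ ≤ r) →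
        (∀ i → ‖ ω i -ᶜ ω′ i ‖ ≤ δ) → ‖ P ω -ᶜ P ω′ ‖ ≤ K * δ)
      lipP = P-lipschitz r r≥0

      opaque
        K : R
        K = proj₁ lipP

        K≥0 : 0# ≤ K
        K≥0 = proj₁ (proj₂ lipP)

        P-close : ∀ ω ω′ δ → (∀ i → ‖ ω i ‖ ≤ r) → (∀ i → ‖ ω′ i ‖ ≤ r) → (∀ i → ‖ ω i -ᶜ ω′ i ‖ ≤ δ) → ‖ P ω -ᶜ P
          ω′ ‖ ≤ K * δ
        P-close = proj₂ (proj₂ lipP)

      in𝕀 : ∀ {τ} → Between 0# (0# + 1#) τ → 𝕀 τ
      in𝕀 (q , q′) = q , ≤-trans q′ (≤-reflexive (+-identityˡ 1#))

      path-close : ∀ {t τ t′ τ′} → Past t → 𝕀 τ → Past t′ → 𝕀 τ′ →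
        ‖ path (flow t) τ -ᶜ path (flow t′) τ′ ‖ ≤ K * (s * (∣ t - t′ ∣ + ∣ τ - τ′ ∣))
      path-close {t} {τ} {t′} {τ′} q u q′ u′ = P-close (vertical (flow t) τ) (vertical (flow t′) τ′)
        (s * (∣ t - t′ ∣ + ∣ τ - τ′ ∣))
        (λ i → ≤-trans (vertical-norm (flow t) u i) (flow-norm q i))
          (λ i → ≤-trans (vertical-norm (flow t′) u′ i) (flow-norm q′ i))
        λ i → ≤-trans (+-mono-≤
            (≤-trans (≤-reflexive (trans (∣∣-cong (trans (re-+ _ _)
              (trans (+-congˡ (re-neg _)) (solve 4 (λ r t t' f → (r :+ t :* f) :+ :- (r :+ t' :* f) :=
              (t :- t') :* f) tt (ρᵢ i) t t′ (φ i))))) (∣∣-* _ _)))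
              (*-monoˡ-≤ (∣∣-nonneg _) (∣φ∣≤s i)))
            (≤-trans (≤-reflexive (trans (∣∣-cong (trans (im-+ _ _)
              (trans (+-congˡ (im-neg _)) (solve 3 (λ t t' f → t :* f :+ :- (t' :* f) := (t :- t') :* f) tt τ τ′
              (φ i))))) (∣∣-* _ _)))
              (*-monoˡ-≤ (∣∣-nonneg _) (∣φ∣≤s i))))
          (≤-reflexive (solve 3 (λ x y s → x :* s :+ y :* s := s :* (x :+ y)) tt (∣ t - t′ ∣) (∣ τ - τ′ ∣) s))

      -- The bound is uniform in t and τ together, so that one mesh in t serves every step of the
      -- flow and every point of the vertical paths.
      below : ∃ λ c → 0# < c × (∀ t τ → Past t × Between 0# (0# + 1#) τ → c ≤ ‖ path (flow t) τ ‖)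
      below = norm-bounded-below (λ t τ → path (flow t) τ) (- T) T 0# 1# T≥0 (<⇒≤ 0<1) (K * s) (*-nonneg K≥0 s≥0)
        (λ { t τ t′ τ′ (q , u) (q′ , u′) → ≤-trans (path-close q (in𝕀 u) q′ (in𝕀 u′))
          (≤-reflexive (trans (sym (*-assoc K s _)) (*-congˡ (+-cong (∣-∣-swap t t′) (∣-∣-swap τ τ′))))) })
        (λ { t τ (q , u) → path≉0 {flow t} ω∈ τ (in𝕀 u) })

      opaque
        b : R
        b = proj₁ below

        b>0 : 0# < b
        b>0 = proj₁ (proj₂ below)

        b≤ : ∀ {t τ} → Past t → 𝕀 τ → b ≤ ‖ path (flow t) τ ‖
        b≤ {t} {τ} q (u , u′) = proj₂ (proj₂ below) t τ (q , (u , ≤-trans u′ (≤-reflexive (sym (+-identityˡ 1#)))))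

      η : R
      -- Doubled by `log1p`, this keeps each increase of the argument at most π/2, below the π that
      -- `Crossing` demands.
      η = r₁ ⊓ (½# * (½# * π))

      η>0 : 0# < η
      η>0 = ⊓-pos r₁>0 (half-pos (half-pos π>0))

      mesh : ∃ λ N → ∀ n → N ℕ.≤ n → K * (s * T) * (2# / b) * unit n < η
      mesh = archimedean-small (K * (s * T) * (2# / b)) η>0

      opaque
        N : ℕ
        N = proj₁ mesh

        mesh-N : K * (s * T) * (2# / b) * unit N < η
        mesh-N = proj₂ mesh N ℕ.≤-refl

      h : R
      h = T * unit N

      h≥0 : 0# ≤ h
      h≥0 = *-nonneg T≥0 (<⇒≤ (unit-pos N))

      at : ℕ → R
      at k = - T + nat k * h

      at-past : ∀ {k} → k ℕ.≤ suc N → Past (at k)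
      at-past {k} le = ≤-by (*-nonneg (nat-nonneg k) h≥0) (solve 2 (λ T x → x :- con 0ℚ := (:- T :+ x) :- :- T) tt T
        (nat k * h)) ,
        +-mono-≤ ≤-refl (≤-trans (*-monoʳ-≤ h≥0 (nat-mono le))
          (≤-reflexive (trans (solve 3 (λ n T u → n :* (T :* u) := T :* (u :* n)) tt (nat (suc N)) T (unit N))
          (trans (*-congˡ (unit-cancel N)) (*-identityʳ T)))))

      B : ℕ → R
      B k = im (ℓ (flow (at k)))

      step : ∀ k → k ℕ.< suc N → B (suc k) < B k + π
      step k lt = <-resp₂ (sym (trans (im-cong compared) (im-+ _ _))) refl (+-mono-≤-< ≤-refl
        (≤-<-trans (≤-trans (x≤∣x∣ _) (≤-trans (∣im∣≤‖‖ _) (log1p-bound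
          (≤-trans (x-small 1# 1∈𝕀) (≤-trans (x⊓y≤x r₁ _) r₁≤r₀)))))
          (≤-<-trans (*-monoˡ-≤ (<⇒≤ 0<2) (≤-trans (x-small 1# 1∈𝕀) (x⊓y≤y r₁ _)))
            (≤-<-trans (≤-reflexive (solve 1 (λ d → (con 1ℚ :+ con 1ℚ) :* (con ½ :* (con ½ :* d)) := con ½ :* d) tt
            π)) (half-< π>0)))))
        where
        t t′ : R
        t = at k
        t′ = at (suc k)
        q : Past t
        q = at-past (ℕ.≤-trans (ℕ.n≤1+n k) lt)
        q′ : Past t′
        q′ = at-past lt
        t′-t : ∣ t′ - t ∣ ≈ h
        t′-t = trans (∣∣-cong (trans (+-congʳ (+-congˡ (*-congʳ (nat-suc k))))
          (solve 3 (λ T n h → (:- T :+ (con 1ℚ :+ n) :* h) :- (:- T :+ n :* h) := h) tt T (nat k) h)))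
          (nonneg⇒∣∣ h≥0)
        close : ∀ τ → 𝕀 τ → ‖ path (flow t′) τ -ᶜ path (flow t) τ ‖ ≤ K * (s * h)
        close τ u = ≤-trans (path-close q′ u q u) (*-monoˡ-≤ K≥0 (*-monoˡ-≤ s≥0 (≤-reflexive
          (trans (+-cong t′-t (trans (∣∣-cong (-‿inverseʳ τ)) (nonneg⇒∣∣ ≤-refl))) (+-identityʳ h)))))
        small : K * (s * h) * (2# / b) ≤ η
        small = ≤-trans (≤-reflexive (solve 5 (λ K s T u b → K :* (s :* (T :* u)) :* b := K :* (s :* T) :* b :* u)
          tt K s T (unit N) (2# / b))) (<⇒≤ mesh-N)
        x : R → C
        x τ = (path (flow t′) τ -ᶜ path (flow t) τ) *ᶜ path (flow t) τ ⁻¹ᶜ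
        rel : ∀ τ → 𝕀 τ → ‖ x τ ‖ ≤ η × path (flow t′) τ ≈ᶜ path (flow t) τ *ᶜ (1ᶜ +ᶜ x τ)
        rel τ u = near-rel {flow t} {flow t′} {s * h} {K} {b} {η} b>0 small τ (path≉0 {flow t} ω∈ τ u) (b≤ q u)
          (close τ u)
        x-small : ∀ τ → 𝕀 τ → ‖ x τ ‖ ≤ η
        x-small τ u = proj₁ (rel τ u)
        compared : ℓ (flow t′) ≈ᶜ ℓ (flow t) +ᶜ log1p (x 1#)
        compared = ℓ-compare-ℓ {flow t} {flow t′} x ω∈ ω∈ λ τ u → ≤-trans (x-small τ u) (x⊓y≤x r₁ _) , proj₂
          (rel τ u)

      Cⱼ X : Fin m → R
      Cⱼ j = w j * expR (- T * μ j) * sin (μ j - β)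
      X j = expR (h * μ j)

      u : ℕ → R
      u k = sum {m} (λ j → Cⱼ j * pow (X j) k)

      sign : ∀ k → ∃ λ E → 0# < E × u k ≈ E * sin (B k - β)
      sign k = expR (re l) , expR-pos _ , trans (sym direct) (trans
        (im-cong (ctrans (*ᶜ-congʳ (csym (exp-ℓ {flow t} ω∈))) (csym (exp-+ l (imag (- β))))))
          (trans (im-exp _) (*-cong (expR-cong (trans (re-+ _ _) (+-identityʳ _))) (sin-cong (im-+ _ _)))))
        where
        t : R
        t = at k
        l : C
        l = ℓ (flow t)
        weight : ∀ j → w j * expR (t * μ j) ≈ w j * expR (- T * μ j) * pow (X j) k
        weight j = trans (*-congˡ (trans (expR-cong (solve 4 (λ T n h y → (:- T :+ n :* h) :* y := :- T :* y :+ n :*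
          (h :* y)) tt T (nat k) h (μ j)))
          (trans (expR-+ _ _) (*-congˡ (expR-nat k (h * μ j)))))) (sym (*-assoc _ _ _))
        term : ∀ j → im (ofR (w j * expR (t * μ j)) *ᶜ exp (imag (1# * μ j)) *ᶜ exp (imag (- β))) ≈ Cⱼ j * pow
          (X j) k
        term j = trans (im-cong (ctrans (*ᶜ-assoc _ _ _) (*ᶜ-congˡ
          (ctrans (csym (exp-+ _ _)) (exp-cong (csym (imag-+ _ _)))))))
          (trans (im-ofR-* _ _) (trans (*-cong (weight j) (sin-cong (+-congʳ (*-identityˡ (μ j)))))
            (solve 3 (λ a p s → a :* p :* s := a :* s :* p) tt (w j * expR (- T * μ j)) (pow (X j) k)
            (sin (μ j - β)))))
        direct : im (P (flow t) *ᶜ exp (imag (- β))) ≈ u k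
        direct = trans (im-cong (ctrans (*ᶜ-congʳ (ctrans (csym (path-one (flow t))) (path-flow t 1#)))
            (csym (sumᶜ-*ʳ {m} (λ j → ofR (w j * expR (t * μ j)) *ᶜ exp (imag (1# * μ j))) (exp (imag (- β)))))))
          (trans (im-sumᶜ {m} _) (sum-cong {m} term))

      u-nonpos : ∀ k → Δs (λ i → expR (h * (β - nat (suc i) * π))) J u k ≤ 0#
      u-nonpos = Δs-nonpos (λ j → w j * expR (- T * μ j)) μ J (λ j → *-nonneg (<⇒≤ (w>0 j)) (<⇒≤ (expR-pos _))) h≥0
        λ j → <⇒≤ (<⇒0< (≤-<-trans (μ≤D j) D<β)) , ≤-trans (+-mono-≤ ≤-refl (neg-mono-≤ (proj₂ least j))) z≤

      at-zero : ∀ i → flow (- T) i ≈ᶜ flow (at 0) i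
      at-zero i = +-congˡ (*-congʳ (sym (trans (+-congˡ (trans (*-congʳ nat-zero) (zeroˡ h))) (+-identityʳ _)))) ,ᶜ
        refl

      at-end : ∀ i → ω i ≈ᶜ flow (at (suc N)) i
      at-end i = sym (trans (+-congˡ (trans (*-congʳ (trans (+-congˡ
        (trans (solve 3 (λ n T u → n :* (T :* u) := T :* (u :* n)) tt (nat (suc N)) T (unit N))
        (trans (*-congˡ (unit-cancel N)) (*-identityʳ T)))) (-‿inverseˡ T))) (zeroˡ _))) (+-identityʳ _)) ,ᶜ refl

      contradiction : ⊥
      contradiction =
        let b′ , lo , α = Δs-alternates _ J 1 (λ i → expR-pos _)
              (Crossing.parity-alternates B u β (suc N) (<-resp₂ refl
                (im-cong (csym (ℓ-cong {ω} {flow (at (suc N))} ω∈ ω∈ at-end))) β<B) step sign (suc J) 0 z≤n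
                (<-resp₂ (im-cong (csym (ℓ-cong {flow (- T)} {flow (at 0)} ω∈ ω∈ at-zero)))
                  (trans (solve 4 (λ m b n p → m :+ (b :- m :- n :* p) := b :- (con 1ℚ :+ n) :* p :+ p) tt μ₀ β
                    (nat J) π) (+-congʳ (+-congˡ (-‿cong (*-congʳ (sym (nat-suc J)))))))
                  left))
        in nonpos⇒¬alternates u-nonpos b′ lo α

    im-ℓ≤D : ∀ {ω} → Tube {n} ω → im (ℓ ω) ≤ D
    im-ℓ≤D {ω} ω∈ D<B =
      let β = ½# * (D + im (ℓ ω))
          D<β = <-by (half-pos (<⇒0< D<B)) (solve 2 (λ d b → con ½ :* (b :- d) :- con 0ℚ := con ½ :* (d :+ b) :- d)
            tt D (im (ℓ ω)))
          J , lt , le = half-turns (<⇒0< (≤-<-trans (μ≤D j₀) D<β))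
          T , T≥0 , left = left-end (<⇒0< lt)
      in Contradiction.contradiction ω ω∈ β D<β
           (<-by (half-pos (<⇒0< D<B)) (solve 2 (λ d b → con ½ :* (b :- d) :- con 0ℚ := b :- con ½ :* (d :+ b)) tt D
             (im (ℓ ω)))) J le T T≥0 left
      where open Flow ω ω∈

    -- P has real coefficients, so conjugation turns the upper bound into the lower one.
    argument-bound : ∀ {ω} → Tube {n} ω → ∣ im (ℓ ω) ∣ ≤ D
    argument-bound {ω} ω∈ = ∣∣-lub (im-ℓ≤D ω∈) (≤-trans (≤-reflexive
      (sym (trans (im-cong (ℓ-conj ω∈)) (im-conj _))))
      (im-ℓ≤D {conj ∘ ω} λ i → <-resp₂ (sym (trans (∣∣-cong (im-conj _)) (∣∣-neg _))) refl (ω∈ i)))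

  -- Second order expansions at 0

  cube : C → R
  cube h = ‖ h ‖ * (‖ h ‖ * ‖ h ‖)

  polynomial : C → C → C → C → C
  polynomial c₀ c₁ c₂ h = c₀ +ᶜ c₁ *ᶜ h +ᶜ c₂ *ᶜ (h *ᶜ h)

  -- Stands in for holomorphy at a point, moved to 0. A complex quadratic polynomial with cubic
  -- error is all that the minimum principle uses, and it passes through sums and compositions by
  -- algebra alone. `δ≤1` lets higher powers of |h| be absorbed into lower ones.
  record Jet (f : C → C) (c₀ : C) : Set where
    field
      c₁ c₂ : C
      K δ : R
      K≥0 : 0# ≤ K
      δ>0 : 0# < δ
      δ≤1 : δ ≤ 1#
      remainder : ∀ h → ‖ h ‖ ≤ δ → ‖ f h -ᶜ polynomial c₀ c₁ c₂ h ‖ ≤ K * cube h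

  jet-exact : ∀ {f c₀} c₁ c₂ → (∀ h → f h ≈ᶜ polynomial c₀ c₁ c₂ h) → Jet f c₀
  jet-exact c₁ c₂ e = record { c₁ = c₁ ; c₂ = c₂ ; K = 0# ; δ = 1# ; K≥0 = ≤-refl ; δ>0 = 0<1 ; δ≤1 = ≤-refl
    ; remainder = λ h _ → ≤-trans (≈⇒‖-‖≤0 (e h)) (≤-reflexive (sym (zeroˡ _))) }

  jet-const : ∀ c → Jet (λ _ → c) c
  jet-const c = jet-exact 0ᶜ 0ᶜ λ h → csolve 2 (λ c h → c ⊜ c ⊕ ccon 0ℚ ⊗ h ⊕ ccon 0ℚ ⊗ (h ⊗ h)) tt c h

  jet-id : Jet (λ h → h) 0ᶜ
  jet-id = jet-exact 1ᶜ 0ᶜ λ h → csolve 1 (λ h → h ⊜ ccon 0ℚ ⊕ ccon 1ℚ ⊗ h ⊕ ccon 0ℚ ⊗ (h ⊗ h)) tt h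

  jet-cong : ∀ {f g c₀ d₀} → Jet f c₀ → (∃ λ δ → 0# < δ × (∀ h → ‖ h ‖ ≤ δ → g h ≈ᶜ f h)) → d₀ ≈ᶜ c₀ → Jet g d₀
  jet-cong {f} {g} {c₀} {d₀} j (δ′ , δ′>0 , e) e₀ = record
    { c₁ = c₁ ; c₂ = c₂ ; K = K ; δ = δ ⊓ δ′ ; K≥0 = K≥0 ; δ>0 = ⊓-pos δ>0 δ′>0 ; δ≤1 = ≤-trans (x⊓y≤x δ δ′) δ≤1
    ; remainder = λ h le → ≤-trans (≤-reflexive (‖‖-cong (+ᶜ-cong (e h (≤-trans le (x⊓y≤y δ δ′)))
      (-ᶜ-cong (+ᶜ-congʳ (+ᶜ-congʳ e₀))))))
        (remainder h (≤-trans le (x⊓y≤x δ δ′))) }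
    where open Jet j

  jet-+ : ∀ {f g c₀ d₀} → Jet f c₀ → Jet g d₀ → Jet (λ h → f h +ᶜ g h) (c₀ +ᶜ d₀)
  jet-+ {f} {g} {c₀} {d₀} j k = record
    { c₁ = J.c₁ +ᶜ K.c₁ ; c₂ = J.c₂ +ᶜ K.c₂ ; K = J.K + K.K ; δ = J.δ ⊓ K.δ
    ; K≥0 = +-nonneg J.K≥0 K.K≥0 ; δ>0 = ⊓-pos J.δ>0 K.δ>0 ; δ≤1 = ≤-trans (x⊓y≤x J.δ K.δ) J.δ≤1
    ; remainder = λ h le → ≤-trans (≤-reflexive (‖‖-cong (csolve 9
      (λ f g c d a b x y h → (f ⊕ g) ⊖ (c ⊕ d ⊕ (a ⊕ b) ⊗ h ⊕ (x ⊕ y) ⊗ (h ⊗ h)) ⊜ (f ⊖ (c ⊕ a ⊗ h ⊕ x ⊗ (h ⊗ h))) ⊕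
      (g ⊖ (d ⊕ b ⊗ h ⊕ y ⊗ (h ⊗ h)))) tt
          (f h) (g h) c₀ d₀ J.c₁ K.c₁ J.c₂ K.c₂ h)))
        (≤-trans (‖‖-+-≤ (J.remainder h (≤-trans le (x⊓y≤x J.δ K.δ))) (K.remainder h (≤-trans le (x⊓y≤y J.δ K.δ))))
          (≤-reflexive (sym (distribʳ _ _ _)))) }
    where
    module J = Jet j
    module K = Jet k

  jet-scale : ∀ {f c₀} s → Jet f c₀ → Jet (λ h → s *ᶜ f h) (s *ᶜ c₀)
  jet-scale {f} {c₀} s j = record
    { c₁ = s *ᶜ c₁ ; c₂ = s *ᶜ c₂ ; K = ‖ s ‖ * K ; δ = δ ; K≥0 = *-nonneg (‖‖-nonneg s) K≥0 ; δ>0 = δ>0 ; δ≤1 = δ≤1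
    ; remainder = λ h le → ≤-trans (≤-reflexive (‖‖-cong (csolve 6
      (λ s f c a b h → s ⊗ f ⊖ (s ⊗ c ⊕ s ⊗ a ⊗ h ⊕ s ⊗ b ⊗ (h ⊗ h)) ⊜ s ⊗ (f ⊖ (c ⊕ a ⊗ h ⊕ b ⊗ (h ⊗ h)))) tt s
      (f h) c₀ c₁ c₂ h)))
        (≤-trans (‖‖-mult-≤ ≤-refl (remainder h le)) (≤-reflexive (sym (*-assoc _ _ _)))) }
    where open Jet j

  jet-sum : ∀ {m} {f : Fin m → C → C} {c : Fin m → C} → (∀ j → Jet (f j) (c j)) → Jet (λ h → sumᶜ (λ j → f j h))
    (sumᶜ c)
  jet-sum {zero} js = jet-const 0ᶜ
  jet-sum {suc m} js = jet-+ (js zero) (jet-sum (js ∘ suc))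

  ‖h‖²≤‖h‖ : ∀ {h} → ‖ h ‖ ≤ 1# → ‖ h ‖ * ‖ h ‖ ≤ ‖ h ‖
  ‖h‖²≤‖h‖ {h} le = ≤-trans (*-monoˡ-≤ (‖‖-nonneg h) le) (≤-reflexive (*-identityʳ _))

  module JetBounds {f c₀} (j : Jet f c₀) where
    open Jet j

    slope : R
    slope = ‖ c₁ ‖ + (‖ c₂ ‖ + K)

    slope≥0 : 0# ≤ slope
    slope≥0 = +-nonneg (‖‖-nonneg c₁) (+-nonneg (‖‖-nonneg c₂) K≥0)

    second-order : ∀ h → ‖ h ‖ ≤ δ → ‖ f h -ᶜ c₀ -ᶜ c₁ *ᶜ h ‖ ≤ (‖ c₂ ‖ + K) * (‖ h ‖ * ‖ h ‖)
    second-order h le = ≤-trans (≤-reflexive (‖‖-cong (csolve 5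
      (λ f c a b h → f ⊖ c ⊖ a ⊗ h ⊜ b ⊗ (h ⊗ h) ⊕ (f ⊖ (c ⊕ a ⊗ h ⊕ b ⊗ (h ⊗ h)))) tt (f h) c₀ c₁ c₂ h)))
      (≤-trans (‖‖-+-≤ (‖‖-mult-≤ ≤-refl (‖‖-mult h h)) (≤-trans (remainder h le)
          (*-monoˡ-≤ K≥0 (≤-trans (*-monoʳ-≤ (square-nonneg ‖ h ‖) (≤-trans le δ≤1))
            (≤-reflexive (*-identityˡ _))))))
        (≤-reflexive (sym (distribʳ _ _ _))))

    first-order : ∀ h → ‖ h ‖ ≤ δ → ‖ f h -ᶜ c₀ ‖ ≤ slope * ‖ h ‖
    first-order h le = ≤-trans (≤-reflexive (‖‖-cong (csolve 4 (λ f c a h → f ⊖ c ⊜ a ⊗ h ⊕ (f ⊖ c ⊖ a ⊗ h)) tt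
      (f h) c₀ c₁ h)))
      (≤-trans (‖‖-+-≤ (‖‖-mult c₁ h) (≤-trans (second-order h le)
        (*-monoˡ-≤ (+-nonneg (‖‖-nonneg c₂) K≥0) (‖h‖²≤‖h‖ (≤-trans le δ≤1)))))
        (≤-reflexive (sym (distribʳ _ _ _))))

    continuous : ∀ {ε} → 0# < ε → ∃ λ η → 0# < η × η ≤ δ × (∀ h → ‖ h ‖ ≤ η → ‖ f h -ᶜ c₀ ‖ ≤ ε)
    continuous {ε} ε>0 = let η , η>0 , small = modulus slope slope≥0 ε>0 in
      η ⊓ δ , ⊓-pos η>0 δ>0 , x⊓y≤y η δ , λ h le → ≤-trans (first-order h (≤-trans le (x⊓y≤y η δ)))
        (≤-trans (*-monoˡ-≤ slope≥0 (≤-trans le (≤-trans (x⊓y≤x η δ)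
          (≤-by (<⇒≤ η>0) (solve 1 (λ d → d :- con 0ℚ := (d :+ d) :- d) tt η))))) small)

    at-zero : f 0ᶜ ≈ᶜ c₀
    at-zero = ‖-‖≤0⇒≈ (≤-trans (first-order 0ᶜ (≤-trans (≤-reflexive ‖0‖) (<⇒≤ δ>0)))
      (≤-reflexive (trans (*-congˡ ‖0‖) (zeroʳ _))))

  -- With k = f h - c₀ the error has three cubic parts: the error of f times the linear coefficient
  -- of g, the quadratic coefficient of g times k² - (c₁ h)² = (k - c₁ h)(k + c₁ h), where the first
  -- factor is quadratic and the second linear in h, and the error of g at k.
  jet-comp : ∀ {g f a₀ c₀} → Jet g a₀ → Jet f c₀ → Jet (λ h → g (f h -ᶜ c₀)) a₀
  jet-comp {g} {f} {a₀} {c₀} jg jf = record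
    { c₁ = G.c₁ *ᶜ F.c₁ ; c₂ = G.c₁ *ᶜ F.c₂ +ᶜ G.c₂ *ᶜ (F.c₁ *ᶜ F.c₁)
    ; K = K′ ; δ = η ; K≥0 = K′≥0 ; δ>0 = proj₁ (proj₂ cont) ; δ≤1 = ≤-trans η≤δ F.δ≤1 ; remainder = bound }
    where
    module G = Jet jg
    module F = Jet jf
    module FB = JetBounds jf
    cont : ∃ λ η → 0# < η × η ≤ F.δ × (∀ h → ‖ h ‖ ≤ η → ‖ f h -ᶜ c₀ ‖ ≤ G.δ)
    cont = FB.continuous G.δ>0
    η : R
    η = proj₁ cont
    η≤δ : η ≤ F.δ
    η≤δ = proj₁ (proj₂ (proj₂ cont))
    S₂ K′ : R
    S₂ = ‖ F.c₂ ‖ + F.K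
    K′ = ‖ G.c₁ ‖ * F.K + (‖ G.c₂ ‖ * (S₂ * (FB.slope + ‖ F.c₁ ‖)) + G.K * (FB.slope * (FB.slope * FB.slope)))
    S₂≥0 : 0# ≤ S₂
    S₂≥0 = +-nonneg (‖‖-nonneg F.c₂) F.K≥0
    K′≥0 : 0# ≤ K′
    K′≥0 = +-nonneg (*-nonneg (‖‖-nonneg G.c₁) F.K≥0)
      (+-nonneg (*-nonneg (‖‖-nonneg G.c₂) (*-nonneg S₂≥0 (+-nonneg FB.slope≥0 (‖‖-nonneg F.c₁))))
        (*-nonneg G.K≥0 (*-nonneg FB.slope≥0 (square-nonneg FB.slope))))
    bound : ∀ h → ‖ h ‖ ≤ η → ‖ g (f h -ᶜ c₀) -ᶜ polynomial a₀ (G.c₁ *ᶜ F.c₁)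
      (G.c₁ *ᶜ F.c₂ +ᶜ G.c₂ *ᶜ (F.c₁ *ᶜ F.c₁)) h ‖ ≤ K′ * cube h
    bound h le = ≤-trans (≤-reflexive (‖‖-cong
        (csolve 8 (λ y a p q k c e h → y ⊖ (a ⊕ p ⊗ c ⊗ h ⊕ (p ⊗ e ⊕ q ⊗ (c ⊗ c)) ⊗ (h ⊗ h)) ⊜ p ⊗
          (k ⊖ (ccon 0ℚ ⊕ c ⊗ h ⊕ e ⊗ (h ⊗ h))) ⊕ (q ⊗ ((k ⊖ c ⊗ h) ⊗ (k ⊕ c ⊗ h)) ⊕
          (y ⊖ (a ⊕ p ⊗ k ⊕ q ⊗ (k ⊗ k))))) tt
          (g k) a₀ G.c₁ G.c₂ k F.c₁ F.c₂ h)))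
      (≤-trans (‖‖-+-≤ (‖‖-mult-≤ ≤-refl r₁′) (‖‖-+-≤ (‖‖-mult-≤ ≤-refl (‖‖-mult-≤ (FB.second-order h le′) sum≤))
        (≤-trans (G.remainder k (proj₂ (proj₂ (proj₂ cont)) h le)) (*-monoˡ-≤ G.K≥0 cube≤))))
        (≤-reflexive (solve 8 (λ p fk q s l c gk h → p :* (fk :* (h :* (h :* h))) :+
          (q :* (s :* (h :* h) :* ((l :+ c) :* h)) :+ gk :* (l :* h :* (l :* h :* (l :* h)))) :=
          (p :* fk :+ (q :* (s :* (l :+ c)) :+ gk :* (l :* (l :* l)))) :* (h :* (h :* h))) tt
          (‖ G.c₁ ‖) F.K (‖ G.c₂ ‖) S₂ FB.slope (‖ F.c₁ ‖) G.K (‖ h ‖))))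
      where
      k : C
      k = f h -ᶜ c₀
      le′ : ‖ h ‖ ≤ F.δ
      le′ = ≤-trans le η≤δ
      k≤ : ‖ k ‖ ≤ FB.slope * ‖ h ‖
      k≤ = FB.first-order h le′
      r₁′ : ‖ k -ᶜ (0ᶜ +ᶜ F.c₁ *ᶜ h +ᶜ F.c₂ *ᶜ (h *ᶜ h)) ‖ ≤ F.K * cube h
      r₁′ = ≤-trans (≤-reflexive (‖‖-cong (csolve 4 (λ f c a b → (f ⊖ c) ⊖ (ccon 0ℚ ⊕ a ⊕ b) ⊜ f ⊖ (c ⊕ a ⊕ b)) tt
        (f h) c₀ (F.c₁ *ᶜ h) (F.c₂ *ᶜ (h *ᶜ h))))) (F.remainder h le′)
      sum≤ : ‖ k +ᶜ F.c₁ *ᶜ h ‖ ≤ (FB.slope + ‖ F.c₁ ‖) * ‖ h ‖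
      sum≤ = ≤-trans (‖‖-+-≤ k≤ (‖‖-mult F.c₁ h)) (≤-reflexive (sym (distribʳ _ _ _)))
      cube≤ : cube k ≤ FB.slope * ‖ h ‖ * (FB.slope * ‖ h ‖ * (FB.slope * ‖ h ‖))
      cube≤ = *-mono-≤ (‖‖-nonneg k) (*-nonneg s≥0 s≥0) k≤ (*-mono-≤ (‖‖-nonneg k) s≥0 k≤ k≤)
        where
        s≥0 : 0# ≤ FB.slope * ‖ h ‖
        s≥0 = *-nonneg FB.slope≥0 (‖‖-nonneg h)

  jet-exp-at-0 : Jet exp 1ᶜ
  jet-exp-at-0 = record { c₁ = 1ᶜ ; c₂ = ofR ½# ; K = expR 1# ; δ = 1# ; K≥0 = <⇒≤ (expR-pos 1#) ; δ>0 = 0<1 ; δ≤1 =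
    ≤-refl
    ; remainder = λ h le → ≤-trans (≤-reflexive (‖‖-cong (+ᶜ-congˡ
      (-ᶜ-cong (csolve 1 (λ h → ccon 1ℚ ⊕ ccon 1ℚ ⊗ h ⊕ ccon ½ ⊗ (h ⊗ h) ⊜ ccon 1ℚ ⊕ h ⊕ ccon ½ ⊗ (h ⊗ h)) tt h)))))
        (≤-trans (exp-third-order le) (≤-reflexive (solve 2 (λ h e → h :* (h :* (h :* e)) := e :* (h :* (h :* h)))
          tt (‖ h ‖) (expR 1#)))) }

  jet-exp : ∀ {f c₀} → Jet f c₀ → Jet (λ h → exp (f h)) (exp c₀)
  jet-exp {f} {c₀} j = jet-cong (jet-scale (exp c₀) (jet-comp jet-exp-at-0 j))
    (1# , 0<1 , λ h _ → ctrans (exp-cong (csolve 2 (λ f c → f ⊜ c ⊕ (f ⊖ c)) tt (f h) c₀)) (exp-+ _ _))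
      (csym (*ᶜ-identityʳ _))

  -- Inversion of the expansion of exp. For l = `log1p x`, the quantity l + l²/2 - x is up to sign
  -- the cubic error of exp at l, and l - x + x²/2 differs from it by (l - x)(l + x)/2, which is
  -- cubic as well.
  jet-log1p-at-0 : Jet log1p 0ᶜ
  jet-log1p-at-0 = record { c₁ = 1ᶜ ; c₂ = -ᶜ ofR ½# ; K = K ; δ = 1# ⊓ r₀ ; K≥0 = K≥0 ; δ>0 = ⊓-pos 0<1 r₀>0 ; δ≤1
    = x⊓y≤x 1# r₀ ; remainder = bound }
    where
    E K : R
    E = expR 1#
    K = ½# * ((2# + 2# * (2# * (2# * E))) * (1# + 2#)) + 2# * (2# * (2# * E))
    E₈≥0 : 0# ≤ 2# * (2# * (2# * E))
    E₈≥0 = *-nonneg (<⇒≤ 0<2) (*-nonneg (<⇒≤ 0<2) (*-nonneg (<⇒≤ 0<2) (<⇒≤ (expR-pos 1#))))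
    K≥0 : 0# ≤ K
    K≥0 = +-nonneg (*-nonneg (<⇒≤ 0<½) (*-nonneg (+-nonneg (<⇒≤ 0<2) E₈≥0) (+-nonneg (<⇒≤ 0<1) (<⇒≤ 0<2)))) E₈≥0
    bound : ∀ x → ‖ x ‖ ≤ 1# ⊓ r₀ → ‖ log1p x -ᶜ polynomial 0ᶜ 1ᶜ (-ᶜ ofR ½#) x ‖ ≤ K * cube x
    bound x le = ≤-trans (≤-reflexive (‖‖-cong (ctrans (csolve 2
      (λ l x → l ⊖ (ccon 0ℚ ⊕ ccon 1ℚ ⊗ x ⊕ (⊝ ccon ½) ⊗ (x ⊗ x)) ⊜ ⊝ (ccon ½ ⊗ ((l ⊖ x) ⊗ (l ⊕ x))) ⊕
      (l ⊕ ccon ½ ⊗ (l ⊗ l) ⊖ x)) tt l x) (+ᶜ-congˡ err-eq))))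
      (≤-trans (‖‖-+-≤ (≤-trans (≤-reflexive (trans (‖‖-neg _)
        (trans (‖ofR*‖ _ _) (*-congʳ (nonneg⇒∣∣ (<⇒≤ 0<½))))))
        (*-monoˡ-≤ (<⇒≤ 0<½) (‖‖-mult-≤ l-x≤ (‖‖-+-≤ l≤ ≤-refl))))
          (≤-trans (≤-reflexive (‖‖-neg _)) err≤))
        (≤-reflexive (solve 2 (λ e X → con ½ :* (((con 1ℚ :+ con 1ℚ) :+ (con 1ℚ :+ con 1ℚ) :*
          ((con 1ℚ :+ con 1ℚ) :* ((con 1ℚ :+ con 1ℚ) :* e))) :* (X :* X) :* ((con 1ℚ :+ con 1ℚ) :* X :+ X)) :+
          (con 1ℚ :+ con 1ℚ) :* ((con 1ℚ :+ con 1ℚ) :* ((con 1ℚ :+ con 1ℚ) :* e)) :* (X :* (X :* X)) :=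
          (con ½ :* (((con 1ℚ :+ con 1ℚ) :+ (con 1ℚ :+ con 1ℚ) :* ((con 1ℚ :+ con 1ℚ) :* ((con 1ℚ :+ con 1ℚ) :* e)))
          :* (con 1ℚ :+ (con 1ℚ :+ con 1ℚ))) :+ (con 1ℚ :+ con 1ℚ) :*
          ((con 1ℚ :+ con 1ℚ) :* ((con 1ℚ :+ con 1ℚ) :* e))) :* (X :* (X :* X))) tt E X)))
      where
      X : R
      X = ‖ x ‖
      l : C
      l = log1p x
      x≤r₀ : ‖ x ‖ ≤ r₀
      x≤r₀ = ≤-trans le (x⊓y≤y 1# r₀)
      l≤ : ‖ l ‖ ≤ 2# * X
      l≤ = log1p-bound x≤r₀
      e : C
      e = exp l -ᶜ quadratic l
      err-eq : l +ᶜ ofR ½# *ᶜ (l *ᶜ l) -ᶜ x ≈ᶜ -ᶜ e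
      err-eq = ctrans (csolve 2 (λ l x → l ⊕ ccon ½ ⊗ (l ⊗ l) ⊖ x ⊜ ⊝
        ((ccon 1ℚ ⊕ x) ⊖ (ccon 1ℚ ⊕ l ⊕ ccon ½ ⊗ (l ⊗ l)))) tt l x) (-ᶜ-cong (+ᶜ-congʳ (csym (exp-log1p x≤r₀))))
      err≤ : ‖ e ‖ ≤ 2# * (2# * (2# * E)) * cube x
      err≤ = ≤-trans (exp-third-order {l} {1#} (≤-trans (log1p≤ρ x≤r₀) ρ≤1))
        (≤-trans (*-mono-≤ (‖‖-nonneg l) 2X³≥0 l≤ (*-mono-≤ (‖‖-nonneg l) 2X²≥0 l≤
          (*-monoʳ-≤ (<⇒≤ (expR-pos 1#)) l≤)))
          (≤-reflexive (solve 2 (λ e X → (con 1ℚ :+ con 1ℚ) :* X :*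
            ((con 1ℚ :+ con 1ℚ) :* X :* ((con 1ℚ :+ con 1ℚ) :* X :* e)) := (con 1ℚ :+ con 1ℚ) :*
            ((con 1ℚ :+ con 1ℚ) :* ((con 1ℚ :+ con 1ℚ) :* e)) :* (X :* (X :* X))) tt E X)))
        where
        2X≥0 : 0# ≤ 2# * X
        2X≥0 = *-nonneg (<⇒≤ 0<2) (‖‖-nonneg x)
        2X²≥0 : 0# ≤ 2# * X * E
        2X²≥0 = *-nonneg 2X≥0 (<⇒≤ (expR-pos 1#))
        2X³≥0 : 0# ≤ 2# * X * (2# * X * E)
        2X³≥0 = *-nonneg 2X≥0 2X²≥0
      X³≤X² : cube x ≤ X * X
      X³≤X² = ≤-trans (*-monoʳ-≤ (square-nonneg X) (≤-trans le (x⊓y≤x 1# r₀))) (≤-reflexive (*-identityˡ _))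
      l-x≤ : ‖ l -ᶜ x ‖ ≤ (2# + 2# * (2# * (2# * E))) * (X * X)
      l-x≤ = ≤-trans (≤-reflexive (‖‖-cong (ctrans (csolve 2 (λ l x → l ⊖ x ⊜ (l ⊕ ccon ½ ⊗ (l ⊗ l) ⊖ x) ⊕ ⊝
        (ccon ½ ⊗ (l ⊗ l))) tt l x) (+ᶜ-congʳ err-eq))))
        (≤-trans (‖‖-+-≤ (≤-trans (≤-reflexive (‖‖-neg _)) (≤-trans err≤ (*-monoˡ-≤ E₈≥0 X³≤X²)))
            (≤-trans (≤-reflexive (trans (‖‖-neg _) (trans (‖ofR*‖ _ _) (*-congʳ (nonneg⇒∣∣ (<⇒≤ 0<½))))))
              (*-monoˡ-≤ (<⇒≤ 0<½) (‖‖-mult-≤ l≤ l≤))))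
          (≤-reflexive (solve 2 (λ e X → e :* (X :* X) :+ con ½ :*
            ((con 1ℚ :+ con 1ℚ) :* X :* ((con 1ℚ :+ con 1ℚ) :* X)) := ((con 1ℚ :+ con 1ℚ) :+ e) :* (X :* X)) tt
            (2# * (2# * (2# * E))) X)))

  jet-log1p : ∀ {f c₀} → c₀ ≈ᶜ 0ᶜ → Jet f c₀ → Jet (λ h → log1p (f h)) 0ᶜ
  jet-log1p {f} {c₀} e j = jet-cong (jet-comp jet-log1p-at-0 j)
    (let η , η>0 , _ , close = JetBounds.continuous j r₀>0 in η , η>0 , λ h le →
      csym (log1p-cong (close h le) (ctrans (+ᶜ-congˡ (-ᶜ-cong e)) (csolve 1 (λ f → f ⊖ ccon 0ℚ ⊜ f) tt (f h)))))
        crefl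

  -- Averaging over h, -h, ih, -ih cancels the terms of first and second order.
  four-point : ∀ {f c₀} (j : Jet f c₀) s → 0# ≤ s → s ≤ Jet.δ j →
    re (f (ofR s)) + re (f (-ᶜ ofR s)) + (re (f (imag s)) + re (f (-ᶜ imag s))) ≤ (2# + 2#) * re c₀ +
      (2# + 2#) * Jet.K j * (s * (s * s))
  four-point {f} {c₀} j s s≥0 s≤δ = ≤-trans
    (≤-by (≤-trans (x≤∣x∣ _) (≤-trans (∣re∣≤‖‖ total) total≤))
      (trans (+-congˡ (-‿cong re-total)) (solve 6 (λ a b c d z k → k :-
        (a :+ b :+ (c :+ d) :- ((con 1ℚ :+ con 1ℚ) :+ (con 1ℚ :+ con 1ℚ)) :* z) :=
        (((con 1ℚ :+ con 1ℚ) :+ (con 1ℚ :+ con 1ℚ)) :* z :+ k) :- (a :+ b :+ (c :+ d))) tt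
        (re (f h)) (re (f (-ᶜ h))) (re (f i)) (re (f (-ᶜ i))) (re c₀) ((2# + 2#) * K * (s * (s * s)))))) ≤-refl
    where
    open Jet j
    h i : C
    h = ofR s
    i = imag s
    i≈ : i ≈ᶜ 𝕚 *ᶜ h
    i≈ = trans (solve 1 (λ s → con 0ℚ := con 0ℚ :* s :- con 1ℚ :* con 0ℚ) tt s) (sym (re-* _ _)) ,ᶜ trans
      (solve 1 (λ s → s := con 0ℚ :* con 0ℚ :+ con 1ℚ :* s) tt s) (sym (im-* _ _))
    ii : i *ᶜ i ≈ᶜ -ᶜ (h *ᶜ h)
    ii = ctrans (*ᶜ-cong i≈ i≈) (ctrans (csolve 2 (λ i h → i ⊗ h ⊗ (i ⊗ h) ⊜ i ⊗ i ⊗ (h ⊗ h)) tt 𝕚 h)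
      (ctrans (*ᶜ-congʳ 𝕚*𝕚) (csolve 1 (λ x → (⊝ ccon 1ℚ) ⊗ x ⊜ ⊝ x) tt (h *ᶜ h))))
    E : C → C
    E x = f x -ᶜ polynomial c₀ c₁ c₂ x
    total : C
    total = E h +ᶜ E (-ᶜ h) +ᶜ (E i +ᶜ E (-ᶜ i))
    E≤ : ∀ x → ‖ x ‖ ≈ s → ‖ E x ‖ ≤ K * (s * (s * s))
    E≤ x e = ≤-trans (remainder x (≤-trans (≤-reflexive e) s≤δ)) (≤-reflexive (*-congˡ (*-cong e (*-cong e e))))
    ‖h‖ : ‖ h ‖ ≈ s
    ‖h‖ = trans (‖ofR‖ s) (nonneg⇒∣∣ s≥0)
    ‖i‖ : ‖ i ‖ ≈ s
    ‖i‖ = trans (‖imag‖ s) (nonneg⇒∣∣ s≥0)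
    total≤ : ‖ total ‖ ≤ (2# + 2#) * K * (s * (s * s))
    total≤ = ≤-trans (‖‖-+-≤ (‖‖-+-≤ (E≤ h ‖h‖) (E≤ (-ᶜ h) (trans (‖‖-neg h) ‖h‖)))
      (‖‖-+-≤ (E≤ i ‖i‖) (E≤ (-ᶜ i) (trans (‖‖-neg i) ‖i‖))))
      (≤-reflexive (solve 2 (λ k s → (k :* s :+ k :* s) :+ (k :* s :+ k :* s) :=
        ((con 1ℚ :+ con 1ℚ) :+ (con 1ℚ :+ con 1ℚ)) :* k :* s) tt K (s * (s * s))))
    total-eq : total ≈ᶜ f h +ᶜ f (-ᶜ h) +ᶜ (f i +ᶜ f (-ᶜ i)) -ᶜ (c₀ +ᶜ c₀ +ᶜ (c₀ +ᶜ c₀))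
    total-eq = ctrans (csolve 9 (λ a b c d z p q h i → (a ⊖ (z ⊕ p ⊗ h ⊕ q ⊗ (h ⊗ h))) ⊕
      (b ⊖ (z ⊕ p ⊗ (⊝ h) ⊕ q ⊗ ((⊝ h) ⊗ (⊝ h)))) ⊕ ((c ⊖ (z ⊕ p ⊗ i ⊕ q ⊗ (i ⊗ i))) ⊕
      (d ⊖ (z ⊕ p ⊗ (⊝ i) ⊕ q ⊗ ((⊝ i) ⊗ (⊝ i))))) ⊜ (a ⊕ b ⊕ (c ⊕ d) ⊖ (z ⊕ z ⊕ (z ⊕ z))) ⊖
      (ccon 1ℚ ⊕ ccon 1ℚ) ⊗ q ⊗ (h ⊗ h ⊕ i ⊗ i)) tt (f h) (f (-ᶜ h)) (f i) (f (-ᶜ i)) c₀ c₁ c₂ h i)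
      (ctrans (+ᶜ-congˡ (-ᶜ-cong (*ᶜ-congˡ (ctrans (+ᶜ-congˡ ii) (-ᶜ-inverseʳ _)))))
        (csolve 2 (λ x q → x ⊖ (ccon 1ℚ ⊕ ccon 1ℚ) ⊗ q ⊗ ccon 0ℚ ⊜ x) tt _ c₂))
    re-total : re total ≈ re (f h) + re (f (-ᶜ h)) + (re (f i) + re (f (-ᶜ i))) - (2# + 2#) * re c₀
    re-total = trans (re-cong total-eq) (trans (re-+ _ _) (+-cong (trans (re-+ _ _) (+-cong (re-+ _ _) (re-+ _ _)))
      (trans (re-neg _) (-‿cong (trans (re-+ _ _) (trans (+-cong (re-+ _ _) (re-+ _ _))
        (solve 1 (λ z → (z :+ z) :+ (z :+ z) := ((con 1ℚ :+ con 1ℚ) :+ (con 1ℚ :+ con 1ℚ)) :* z) tt (re c₀))))))))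

  -- The minimum principle on a rectangle

  InRectangle : R → R → R → R → R → R → Set
  InRectangle a₀ A b₀ B x y = Between a₀ (a₀ + A) x × Between b₀ (b₀ + B) y

  -- If Re f fell below -ε inside, then for small μ the function Re f - μ x² would attain its
  -- minimum in the interior. Summed over four points at distance s, the term μ x² forces Re f to
  -- exceed four times its value at the centre by at least 2 μ s², while the jet allows only O(s³).
  module MinimumPrinciple (f : C → C) (a₀ A b₀ B : R) (A≥0 : 0# ≤ A) (B≥0 : 0# ≤ B)
    (f-cong : ∀ {x y w} → InRectangle a₀ A b₀ B x y → mkC x y ≈ᶜ w → f w ≈ᶜ f (mkC x y))
    (jet : ∀ x y → InRectangle a₀ A b₀ B x y → Jet (λ h → f (mkC x y +ᶜ h)) (f (mkC x y)))
    (ε : R)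
    (left : ∀ {y} → Between b₀ (b₀ + B) y → - ε ≤ re (f (mkC a₀ y)))
    (right : ∀ {y} → Between b₀ (b₀ + B) y → - ε ≤ re (f (mkC (a₀ + A) y)))
    (bottom : ∀ {x} → Between a₀ (a₀ + A) x → - ε ≤ re (f (mkC x b₀)))
    (top : ∀ {x} → Between a₀ (a₀ + A) x → - ε ≤ re (f (mkC x (b₀ + B)))) where

    private
      V : R → R → R
      V x y = re (f (mkC x y))

      X S : R
      X = ∣ a₀ ∣ + A
      S = X * X

      x≤X : ∀ {x} → Between a₀ (a₀ + A) x → ∣ x ∣ ≤ X
      x≤X (p , q) = ∣∣-lub (≤-trans q (+-mono-≤ (x≤∣x∣ a₀) ≤-refl))
        (≤-trans (neg-mono-≤ p) (≤-trans (-x≤∣x∣ a₀) (≤-by A≥0 (solve 2 (λ x a → a :- con 0ℚ := (x :+ a) :- x) tt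
          (∣ a₀ ∣) A))))

      X≥0 : 0# ≤ X
      X≥0 = +-nonneg (∣∣-nonneg a₀) A≥0

      x²≤S : ∀ {x} → Between a₀ (a₀ + A) x → x * x ≤ S
      x²≤S {x} p = ≤-trans (≤-trans (x≤∣x∣ _) (≤-reflexive (∣∣-* x x))) (*-mono-≤ (∣∣-nonneg x) X≥0 (x≤X p) (x≤X p))

    module _ (x₁ y₁ : R) (r₁′ : InRectangle a₀ A b₀ B x₁ y₁) (below : V x₁ y₁ < - ε) where
      private
        gap μ : R
        gap = - ε - V x₁ y₁
        -- S bounds x² on the rectangle, so μ x² cannot make up for the gap between the value at
        -- (x₁, y₁) and -ε; this keeps the minimum off the boundary.
        μ = gap / (2# * (1# + S))

        D>0 : 0# < 2# * (1# + S)
        D>0 = *-pos 0<2 (+-pos 0<1 (square-nonneg X))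

        μ>0 : 0# < μ
        μ>0 = /-pos (<⇒0< below) D>0

        2μS<gap : μ * S < gap
        2μS<gap = <-by (+-pos (*-pos 0<2 μ>0) (*-nonneg (<⇒≤ μ>0) (square-nonneg X)))
          (trans (solve 2 (λ m s → ((con 1ℚ :+ con 1ℚ) :* m :+ m :* s) :- con 0ℚ := (con 1ℚ :+ con 1ℚ) :*
            (con 1ℚ :+ s) :* m :- m :* s) tt μ S) (+-congʳ (*-/-cancel (pos⇒≉0 D>0))))

        U : R → R → R
        U x y = V x y - μ * (x * x)

      open Minimum U a₀ A b₀ B A≥0 B≥0

      shift : ∀ x y x′ y′ → mkC x′ y′ ≈ᶜ mkC x y +ᶜ mkC (x′ - x) (y′ - y)
      shift x y x′ y′ = trans (solve 2 (λ x x' → x' := x :+ (x' :- x)) tt x x′) (sym (re-+ _ _)) ,ᶜ trans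
        (solve 2 (λ x x' → x' := x :+ (x' :- x)) tt y y′) (sym (im-+ _ _))

      lsc : LowerSemicontinuous
      lsc x y rect η η>0 = δ , ⊓-pos (half-pos δ₁>0) δ₂>0 , close
        where
        cont = JetBounds.continuous (jet x y rect) (half-pos η>0)
        δ₁ : R
        δ₁ = proj₁ cont
        δ₁>0 : 0# < δ₁
        δ₁>0 = proj₁ (proj₂ cont)
        md = modulus (μ * X) (*-nonneg (<⇒≤ μ>0) X≥0) (half-pos η>0)
        δ₂ δ : R
        δ₂ = proj₁ md
        δ = (½# * δ₁) ⊓ δ₂
        δ₂>0 : 0# < δ₂
        δ₂>0 = proj₁ (proj₂ md)
        close : ∀ x′ y′ → Rectangle x′ y′ → ∣ x′ - x ∣ ≤ δ → ∣ y′ - y ∣ ≤ δ → U x y ≤ U x′ y′ + η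
        close x′ y′ rect′ p q = ≤-by (+-mono-≤ V-close sq-close)
          (solve 6 (λ v v' e m s s' → (v' :+ con ½ :* e :+ con ½ :* e) :- (v :+ (m :* s' :- m :* s)) :=
            (v' :- m :* s' :+ e) :- (v :- m :* s)) tt (V x y) (V x′ y′) η μ (x * x) (x′ * x′))
          where
          h≤ : ‖ mkC (x′ - x) (y′ - y) ‖ ≤ δ₁
          h≤ = ≤-trans (+-mono-≤ (≤-trans p (x⊓y≤x (½# * δ₁) δ₂)) (≤-trans q (x⊓y≤x (½# * δ₁) δ₂)))
            (≤-reflexive (halves δ₁))
          V-close : V x y ≤ V x′ y′ + ½# * η
          V-close = ∣-∣≤⇒≤ (≤-trans (≤-reflexive (∣-∣-swap _ _)) (≤-trans (∣re-re∣≤ _ _)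
            (≤-trans (≤-reflexive (‖‖-cong (+ᶜ-congʳ (csym (f-cong rect′ (shift x y x′ y′))))))
              (proj₂ (proj₂ (proj₂ cont)) _ h≤))))
          sq-close : μ * (x′ * x′) - μ * (x * x) ≤ ½# * η
          sq-close = ≤-trans (≤-trans (x≤∣x∣ _) (≤-reflexive (trans
            (∣∣-cong (solve 3 (λ m x x' → m :* (x' :* x') :- m :* (x :* x) := m :* ((x' :- x) :* (x' :+ x))) tt μ x
            x′))
              (trans (∣∣-* _ _) (*-cong (nonneg⇒∣∣ (<⇒≤ μ>0)) (∣∣-* _ _))))))
            (≤-trans (*-monoˡ-≤ (<⇒≤ μ>0) (*-mono-≤ (∣∣-nonneg _) (+-nonneg X≥0 X≥0)
              (≤-trans p (x⊓y≤y (½# * δ₁) δ₂))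
                (≤-trans (∣∣-triangle _ _) (+-mono-≤ (x≤X (proj₁ rect′)) (x≤X (proj₁ rect))))))
              (≤-trans (≤-reflexive (solve 3 (λ m d x → m :* (d :* (x :+ x)) := m :* x :* (d :+ d)) tt μ δ₂ X))
                (proj₂ (proj₂ md))))

      not-boundary : ∀ {x y} → Rectangle x y → U x y ≤ U x₁ y₁ → ¬ (- ε ≤ V x y)
      not-boundary {x} {y} rect le ge = <-irrefl (<-≤-trans (<-≤-trans 2μS<gap (≤-by (+-mono-≤ ge le)
        (solve 5 (λ e v v1 s s1 → (v :+ (v1 :- s1)) :- (:- e :+ (v :- s)) := (s :- s1) :- (:- e :- v1)) tt ε (V x y)
          (V x₁ y₁) (μ * (x * x)) (μ * (x₁ * x₁)))))
        (≤-trans (≤-by (*-nonneg (<⇒≤ μ>0) (square-nonneg x₁)) (solve 2 (λ s s1 → s1 :- con 0ℚ := s :- (s :- s1)) tt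
          (μ * (x * x)) (μ * (x₁ * x₁)))) (*-monoˡ-≤ (<⇒≤ μ>0) (x²≤S (proj₁ rect)))))

      interior-contradiction : ∀ {x y} → (a₀ < x × x < a₀ + A) → (b₀ < y × y < b₀ + B) →
        (∀ x′ y′ → Rectangle x′ y′ → U x y ≤ U x′ y′) → ⊥
      interior-contradiction {x} {y} (p , p′) (q , q′) least = <-irrefl (<-≤-trans strict sum≥)
        where
        rect : Rectangle x y
        rect = (<⇒≤ p , <⇒≤ p′) , (<⇒≤ q , <⇒≤ q′)
        j : Jet (λ h → f (mkC x y +ᶜ h)) (f (mkC x y))
        j = jet x y rect
        open Jet j using (K; K≥0; δ; δ>0)
        D′>0 : 0# < 1# + (2# + 2#) * K
        D′>0 = +-pos 0<1 (*-nonneg (+-nonneg (<⇒≤ 0<2) (<⇒≤ 0<2)) K≥0)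
        m₁ m₂ m₃ s : R
        m₁ = (x - a₀) ⊓ (a₀ + A - x)
        m₂ = (y - b₀) ⊓ (b₀ + B - y)
        m₃ = δ ⊓ (μ / (1# + (2# + 2#) * K))
        -- The minima `m₁` and `m₂` keep the four points in the rectangle; `m₃` keeps them in the
        -- range of the jet and makes 4 K s smaller than 2 μ.
        s = m₁ ⊓ m₂ ⊓ m₃
        m₃>0 : 0# < m₃
        m₃>0 = ⊓-pos δ>0 (/-pos μ>0 D′>0)
        s>0 : 0# < s
        s>0 = ⊓-pos (⊓-pos (⊓-pos (<⇒0< p) (<⇒0< p′)) (⊓-pos (<⇒0< q) (<⇒0< q′))) m₃>0
        s≥0 : 0# ≤ s
        s≥0 = <⇒≤ s>0
        s≤m₁₂ : s ≤ m₁ ⊓ m₂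
        s≤m₁₂ = x⊓y≤x (m₁ ⊓ m₂) m₃
        s≤m₁ : s ≤ m₁
        s≤m₁ = ≤-trans s≤m₁₂ (x⊓y≤x m₁ m₂)
        s≤m₂ : s ≤ m₂
        s≤m₂ = ≤-trans s≤m₁₂ (x⊓y≤y m₁ m₂)
        s≤m₃ : s ≤ m₃
        s≤m₃ = x⊓y≤y (m₁ ⊓ m₂) m₃
        Ks<μ : (2# + 2#) * K * s < 2# * μ
        Ks<μ = <-≤-trans (≤-<-trans (*-monoˡ-≤ (*-nonneg (+-nonneg (<⇒≤ 0<2) (<⇒≤ 0<2)) K≥0)
          (≤-trans s≤m₃ (x⊓y≤y δ _)))
            (<-by (/-pos μ>0 D′>0) (solve 2 (λ k d → d :- con 0ℚ := (con 1ℚ :+ k) :* d :- k :* d) tt ((2# + 2#) * K)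
              (μ / (1# + (2# + 2#) * K)))))
          (≤-trans (≤-reflexive (*-/-cancel (pos⇒≉0 D′>0))) (≤-by (<⇒≤ μ>0)
            (solve 1 (λ m → m :- con 0ℚ := (con 1ℚ :+ con 1ℚ) :* m :- m) tt μ)))
        plus : ∀ {c C z} → s ≤ (z - c) ⊓ (c + C - z) → Between c (c + C) z → Between c (c + C) (z + s)
        plus {c} {C} {z} le (u , v) = ≤-trans u (≤-by s≥0 (solve 2 (λ z s → s :- con 0ℚ := (z :+ s) :- z) tt z s)) ,
          ≤-by (≤-trans le (x⊓y≤y (z - c) (c + C - z))) (solve 3 (λ z s c → (c :- z) :- s := c :- (z :+ s)) tt z s
            (c + C))
        minus : ∀ {c C z} → s ≤ (z - c) ⊓ (c + C - z) → Between c (c + C) z → Between c (c + C) (z - s)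
        minus {c} {C} {z} le (u , v) = ≤-by (≤-trans le (x⊓y≤x (z - c) (c + C - z)))
          (solve 3 (λ z s c → (z :- c) :- s := (z :- s) :- c) tt z s c) ,
          ≤-trans (≤-by s≥0 (solve 2 (λ z s → s :- con 0ℚ := z :- (z :- s)) tt z s)) v
        value : ∀ {x′ y′ h} → Rectangle x′ y′ → mkC x′ y′ ≈ᶜ mkC x y +ᶜ h → V x′ y′ ≈ re (f (mkC x y +ᶜ h))
        value rect′ e = re-cong (csym (f-cong rect′ e))
        e₁ : V (x + s) y ≈ re (f (mkC x y +ᶜ ofR s))
        e₁ = value (plus s≤m₁ (proj₁ rect) , proj₂ rect) (sym (re-+ _ _) ,ᶜ sym (trans (im-+ _ _) (+-identityʳ y)))
        e₂ : V (x - s) y ≈ re (f (mkC x y +ᶜ -ᶜ ofR s))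
        e₂ = value (minus s≤m₁ (proj₁ rect) , proj₂ rect) (sym (trans (re-+ _ _) (+-congˡ (re-neg _))) ,ᶜ
          sym (trans (im-+ _ _) (trans (+-congˡ (im-neg _)) (solve 1 (λ y → y :+ :- con 0ℚ := y) tt y))))
        e₃ : V x (y + s) ≈ re (f (mkC x y +ᶜ imag s))
        e₃ = value (proj₁ rect , plus s≤m₂ (proj₂ rect)) (sym (trans (re-+ _ _) (+-identityʳ x)) ,ᶜ sym (im-+ _ _))
        e₄ : V x (y - s) ≈ re (f (mkC x y +ᶜ -ᶜ imag s))
        e₄ = value (proj₁ rect , minus s≤m₂ (proj₂ rect)) (sym
          (trans (re-+ _ _) (trans (+-congˡ (re-neg _)) (solve 1 (λ y → y :+ :- con 0ℚ := y) tt x))) ,ᶜ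
          sym (trans (im-+ _ _) (+-congˡ (im-neg _))))
        average : V (x + s) y + V (x - s) y + (V x (y + s) + V x (y - s)) ≤ (2# + 2#) * V x y + (2# + 2#) * K *
          (s * (s * s))
        average = ≤-trans (≤-reflexive (+-cong (+-cong e₁ e₂) (+-cong e₃ e₄)))
          (four-point j s s≥0 (≤-trans s≤m₃ (x⊓y≤x δ _)))
        strict : (2# + 2#) * V x y + (2# + 2#) * K * (s * (s * s)) < (2# + 2#) * V x y + 2# * μ * (s * s)
        strict = +-mono-≤-< ≤-refl (<-resp₂ (solve 2 (λ k s → k :* s :* (s :* s) := k :* (s :* (s :* s))) tt
          ((2# + 2#) * K) s) refl (*-monoʳ-< (*-pos s>0 s>0) Ks<μ))
        sum≥ : (2# + 2#) * V x y + 2# * μ * (s * s) ≤ (2# + 2#) * V x y + (2# + 2#) * K * (s * (s * s))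
        sum≥ = ≤-trans (≤-by (+-mono-≤ (+-mono-≤ (least _ _ (plus s≤m₁ (proj₁ rect) , proj₂ rect))
          (least _ _ (minus s≤m₁ (proj₁ rect) , proj₂ rect)))
              (+-mono-≤ (least _ _ (proj₁ rect , plus s≤m₂ (proj₂ rect)))
                (least _ _ (proj₁ rect , minus s≤m₂ (proj₂ rect)))))
            (solve 8 (λ v a b c d m x s → ((a :- m :* ((x :+ s) :* (x :+ s))) :+ (b :- m :* ((x :- s) :* (x :- s)))
              :+ ((c :- m :* (x :* x)) :+ (d :- m :* (x :* x)))) :-
              ((v :- m :* (x :* x)) :+ (v :- m :* (x :* x)) :+ ((v :- m :* (x :* x)) :+ (v :- m :* (x :* x)))) :=
              (a :+ b :+ (c :+ d)) :- (((con 1ℚ :+ con 1ℚ) :+ (con 1ℚ :+ con 1ℚ)) :* v :+ (con 1ℚ :+ con 1ℚ) :* m :*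
              (s :* s))) tt (V x y) (V (x + s) y) (V (x - s) y) (V x (y + s)) (V x (y - s)) μ x s))
          average

      contradiction : ⊥
      contradiction = let x , y , rect , least = attained lsc ; nb = not-boundary rect (least x₁ y₁ r₁′) in
        inside x y rect least nb
        where
        inside : ∀ x y → Rectangle x y → (∀ x′ y′ → Rectangle x′ y′ → U x y ≤ U x′ y′) → ¬ (- ε ≤ V x y) → ⊥
        inside x y rect@((p , p′) , (q , q′)) least nb = interior-contradiction
          (strictly p (λ e → nb (≤-trans (left (q , q′)) (≤-reflexive (re-cong (csym (transport e refl)))))) ,
           strictly p′ (λ e → nb (≤-trans (right (q , q′)) (≤-reflexive
             (re-cong (csym (transport (sym e) refl)))))))
          (strictly q (λ e → nb (≤-trans (bottom (p , p′)) (≤-reflexive (re-cong (csym (transport refl e)))))) ,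
           strictly q′ (λ e → nb (≤-trans (top (p , p′)) (≤-reflexive (re-cong (csym (transport refl (sym e))))))))
             least
          where
          strictly : ∀ {u v} → u ≤ v → ¬ (u ≈ v) → u < v
          strictly le ne = [ (λ lt → lt) , (λ e → ⊥-elim (ne e)) ]′ (≤-split le)
          transport : ∀ {x′ y′} → x′ ≈ x → y′ ≈ y → f (mkC x y) ≈ᶜ f (mkC x′ y′)
          transport e e′ = csym (f-cong rect (sym e ,ᶜ sym e′))

    minimum-principle : ∀ x y → InRectangle a₀ A b₀ B x y → - ε ≤ V x y
    minimum-principle x y rect lt = contradiction x y rect lt

  finite-threshold : ∀ {n} (Q : Fin n → R → Set) → (∀ i {δ η} → η ≤ δ → Q i δ → Q i η) →
    (∀ i → ∃ λ δ → 0# < δ × Q i δ) → ∃ λ δ → 0# < δ × (∀ i → Q i δ)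
  finite-threshold {zero} Q anti h = 1# , 0<1 , λ ()
  finite-threshold {suc n} Q anti h =
    let δ , δ>0 , q = h zero ; η , η>0 , r = finite-threshold (Q ∘ suc) (λ i → anti (suc i)) (h ∘ suc) in
    δ ⊓ η , ⊓-pos δ>0 η>0 , λ { zero → anti zero (x⊓y≤x δ η) q ; (suc i) → anti (suc i) (x⊓y≤y δ η) (r i) }

  InStrip : C → Set
  InStrip w = ∣ im w ∣ < π/2

  strip-open : ∀ {w} → InStrip w → ∃ λ δ → 0# < δ × (∀ h → ‖ h ‖ ≤ δ → InStrip (w +ᶜ h))
  strip-open {w} s = ½# * (π/2 - ∣ im w ∣) , half-pos (<⇒0< s) , λ h le →
    ≤-<-trans (≤-trans (≤-reflexive (∣∣-cong (im-+ w h))) (≤-trans (∣∣-triangle _ _)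
      (+-mono-≤ ≤-refl (≤-trans (∣im∣≤‖‖ h) le))))
      (<-by (half-pos (<⇒0< s)) (solve 2 (λ p w → con ½ :* (p :- w) :- con 0ℚ := p :- (w :+ con ½ :* (p :- w))) tt
        π/2 (∣ im w ∣)))

  strip-neg : ∀ {w} → InStrip w → InStrip (-ᶜ w)
  strip-neg s = <-resp₂ (sym (trans (∣∣-cong (im-neg _)) (∣∣-neg _))) refl s

  strip-cos-pos : ∀ {w} → InStrip w → 0# < cos (im w)
  strip-cos-pos s = cos-pos (proj₁ (∣∣<⇒ s)) (proj₂ (∣∣<⇒ s))

  ln-cong : ∀ {x y} → 0# < x → x ≈ y → ln x ≈ ln y
  ln-cong p q = re-cong (Log-cong p (ofR-cong q))

  strip-cong : ∀ {w w′} → w ≈ᶜ w′ → InStrip w → InStrip w′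
  strip-cong e s = <-resp₂ (∣∣-cong (im-cong e)) refl s

  ∣sin∣≤1 : ∀ x → ∣ sin x ∣ ≤ 1#
  ∣sin∣≤1 x lt = <-irrefl (<-≤-trans (<-≤-trans (<-≤-trans lt (≤-reflexive (sym (*-identityʳ _))))
    (≤-trans (*-monoˡ-≤ (∣∣-nonneg _) (<⇒≤ lt))
    (≤-trans (≤-reflexive (trans (sym (∣∣-* (sin x) (sin x))) (nonneg⇒∣∣ (square-nonneg (sin x)))))
      (≤-by (square-nonneg (cos x)) (solve 2 (λ c s → c :* c :- con 0ℚ := (c :* c :+ s :* s) :- s :* s) tt (cos x)
        (sin x)))))) (≤-reflexive (cos²+sin² x)))

  ∣cos∣≤1 : ∀ x → ∣ cos x ∣ ≤ 1#
  ∣cos∣≤1 x = ≤-trans (≤-reflexive (∣∣-cong (sym (sin-+π/2 x)))) (∣sin∣≤1 _)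

  exp-norm : ∀ z → ‖ exp z ‖ ≤ 2# * expR (re z)
  exp-norm z = ≤-trans (+-mono-≤ (≤-reflexive (trans (∣∣-cong (re-exp z)) (∣∣-* _ _)))
    (≤-reflexive (trans (∣∣-cong (im-exp z)) (∣∣-* _ _))))
    (≤-trans (+-mono-≤ (*-monoˡ-≤ (∣∣-nonneg _) (∣cos∣≤1 _)) (*-monoˡ-≤ (∣∣-nonneg _) (∣sin∣≤1 _)))
      (≤-trans (≤-reflexive (solve 1 (λ e → e :* con 1ℚ :+ e :* con 1ℚ := (con 1ℚ :+ con 1ℚ) :* e) tt _))
        (*-monoˡ-≤ (<⇒≤ 0<2) (≤-reflexive (nonneg⇒∣∣ (<⇒≤ (expR-pos _)))))))

  module Branch {n m : ℕ} (p : StablePosynomial n m) where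
    open Logarithm p
    open Argument p using (ℓ-cong)
    open ArgumentBound p using (argument-bound)

    d⁻¹ : R
    d⁻¹ = d ⁻¹

    d⁻¹>0 : 0# < d⁻¹
    d⁻¹>0 = ⁻¹-pos d>0

    d⁻¹*d : d⁻¹ * d ≈ 1#
    d⁻¹*d = *-inverseˡ (pos⇒≉0 d>0)

    -- The branch of P^(1/d) that is positive on real points.
    Q : Point → C
    Q ω = exp (ofR d⁻¹ *ᶜ ℓ ω)

    logq : (Fin n → R) → R
    logq ρ = d⁻¹ * ln (PR ρ)

    Q-real : ∀ ρ → Q (ofR ∘ ρ) ≈ᶜ ofR (expR (logq ρ))
    Q-real ρ = ctrans (exp-cong (ctrans (*ᶜ-congˡ (ℓ-real ρ)) (csym (ofR-* _ _)))) (exp-ofR _)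

    re-Q-nonneg : ∀ {ω} → Tube {n} ω → 0# ≤ re (Q ω)
    re-Q-nonneg {ω} t = ≤-trans (*-nonneg (<⇒≤ (expR-pos _)) (cos-nonneg y≤ y≤′)) (≤-reflexive (sym (re-exp _)))
      where
      y : R
      y = im (ofR d⁻¹ *ᶜ ℓ ω)
      ∣y∣≤ : ∣ y ∣ ≤ π/2
      ∣y∣≤ = ≤-trans (≤-reflexive (trans (∣∣-cong (im-ofR-* _ _))
        (trans (∣∣-* _ _) (*-congʳ (nonneg⇒∣∣ (<⇒≤ d⁻¹>0))))))
        (≤-trans (*-monoˡ-≤ (<⇒≤ d⁻¹>0) (argument-bound t)) (≤-reflexive
          (trans (sym (*-assoc _ _ _)) (trans (*-congʳ d⁻¹*d) (*-identityˡ _)))))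
      y≤ : - π/2 ≤ y
      y≤ = ≤-by (≤-trans (-x≤∣x∣ y) ∣y∣≤) (solve 2 (λ p y → p :- :- y := y :- :- p) tt π/2 y)
      y≤′ : y ≤ π/2
      y≤′ = ≤-trans (x≤∣x∣ y) ∣y∣≤

    Q-cong : ∀ {ω ω′} → Tube {n} ω → Tube {n} ω′ → (∀ i → ω i ≈ᶜ ω′ i) → Q ω ≈ᶜ Q ω′
    Q-cong t t′ e = exp-cong (*ᶜ-congˡ (csym (ℓ-cong t t′ e)))

    Q-shift : ∀ {ω} z → Tube {n} ω → Tube {n} (λ i → ω i +ᶜ z) → Q (λ i → ω i +ᶜ z) ≈ᶜ exp z *ᶜ Q ω
    Q-shift {ω} z t t′ = ctrans (exp-cong (ctrans (*ᶜ-congˡ (ℓ-shift z t t′))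
        (ctrans (csolve 4 (λ i l d z → i ⊗ (l ⊕ d ⊗ z) ⊜ (i ⊗ d) ⊗ z ⊕ i ⊗ l) tt (ofR d⁻¹) (ℓ ω) (ofR d) z)
          (+ᶜ-congʳ (ctrans (*ᶜ-congʳ (ctrans (csym (ofR-* _ _)) (ofR-cong d⁻¹*d))) (*ᶜ-identityˡ z))))))
            (exp-+ _ _)

    -- `ξ` and `η` are the coordinatewise logarithms of X and Y. `Ψ` is the function with a jet at
    -- every point of the strip whose real part is V.
    module Sum (ξ η : Fin n → R) where

      Z : C → Fin n → C
      Z w i = exp (ofR (ξ i) +ᶜ -ᶜ w) +ᶜ exp (ofR (η i) +ᶜ w)

      Ω : C → Point
      Ω w i = Log (Z w i)

      Ψ : C → C
      Ψ w = Q (Ω w) +ᶜ (-ᶜ 1ᶜ *ᶜ exp (ofR (logq ξ) +ᶜ -ᶜ w) +ᶜ -ᶜ 1ᶜ *ᶜ exp (ofR (logq η) +ᶜ w))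

      re-exp-affine : ∀ x w → re (exp (ofR x +ᶜ w)) ≈ expR (x + re w) * cos (im w)
      re-exp-affine x w = trans (re-exp _) (*-cong (expR-cong (re-+ _ _))
        (cos-cong (trans (im-+ _ _) (+-identityˡ _))))

      Z>0 : ∀ {w} → InStrip w → ∀ i → 0# < re (Z w i)
      Z>0 {w} s i = <-resp₂ refl (sym (re-+ _ _)) (+-pos (term (ξ i) (strip-neg s)) (<⇒≤ (term (η i) s)))
        where
        term : ∀ x {v} → InStrip v → 0# < re (exp (ofR x +ᶜ v))
        term x {v} s = <-resp₂ refl (sym (re-exp-affine x v)) (*-pos (expR-pos _) (strip-cos-pos {v} s))

      Ω∈Tube : ∀ {w} → InStrip w → Tube {n} (Ω w)
      Ω∈Tube s i = Log-argument (Z>0 s i)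

      Z-cong : ∀ {w w′} → w ≈ᶜ w′ → ∀ i → Z w i ≈ᶜ Z w′ i
      Z-cong e i = +ᶜ-cong (exp-cong (+ᶜ-congˡ (-ᶜ-cong e))) (exp-cong (+ᶜ-congˡ e))

      Ψ-cong : ∀ {w w′} → InStrip w → w ≈ᶜ w′ → Ψ w ≈ᶜ Ψ w′
      Ψ-cong {w} {w′} s e = +ᶜ-cong (Q-cong (Ω∈Tube s) (Ω∈Tube (strip-cong e s)) λ i → Log-cong (Z>0 s i)
        (Z-cong e i))
        (+ᶜ-cong (*ᶜ-congˡ (exp-cong (+ᶜ-congˡ (-ᶜ-cong e)))) (*ᶜ-congˡ (exp-cong (+ᶜ-congˡ e))))

      module At (w : C) (s : InStrip w) where

        jet-w : Jet (λ h → w +ᶜ h) w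
        jet-w = jet-cong (jet-+ (jet-const w) jet-id) (1# , 0<1 , λ h _ → crefl) (csym (+ᶜ-identityʳ w))

        jet-neg-w : Jet (λ h → -ᶜ (w +ᶜ h)) (-ᶜ w)
        jet-neg-w = jet-cong (jet-scale (-ᶜ 1ᶜ) jet-w) (1# , 0<1 , λ h _ → csolve 1 (λ x → ⊝ x ⊜ (⊝ ccon 1ℚ) ⊗ x) tt
          (w +ᶜ h)) (csolve 1 (λ x → ⊝ x ⊜ (⊝ ccon 1ℚ) ⊗ x) tt w)

        jet-exp⁻ : ∀ x → Jet (λ h → exp (ofR x +ᶜ -ᶜ (w +ᶜ h))) (exp (ofR x +ᶜ -ᶜ w))
        jet-exp⁻ x = jet-exp (jet-+ (jet-const (ofR x)) jet-neg-w)

        jet-exp⁺ : ∀ x → Jet (λ h → exp (ofR x +ᶜ (w +ᶜ h))) (exp (ofR x +ᶜ w))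
        jet-exp⁺ x = jet-exp (jet-+ (jet-const (ofR x)) jet-w)

        jet-Z : ∀ i → Jet (λ h → Z (w +ᶜ h) i) (Z w i)
        jet-Z i = jet-+ (jet-exp⁻ (ξ i)) (jet-exp⁺ (η i))

        strip : ∃ λ δ → 0# < δ × (∀ h → ‖ h ‖ ≤ δ → InStrip (w +ᶜ h))
        strip = strip-open s

        relative : ∀ {f c₀} → Jet f c₀ → Jet (λ h → (f h -ᶜ c₀) *ᶜ c₀ ⁻¹ᶜ) 0ᶜ
        relative {f} {c₀} j = jet-cong (jet-scale (c₀ ⁻¹ᶜ) (jet-+ j (jet-const (-ᶜ c₀))))
          (1# , 0<1 , λ h _ → *ᶜ-comm _ _)
          (csym (ctrans (*ᶜ-congˡ (-ᶜ-inverseʳ c₀)) (csolve 1 (λ x → x ⊗ ccon 0ℚ ⊜ ccon 0ℚ) tt (c₀ ⁻¹ᶜ))))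

        -- No derivative of the branches is needed: near each point `Log`, and in `jet-ℓ` also `ℓ`,
        -- is a constant plus `log1p` of the relative increment of its argument.
        jet-Ω : ∀ i → Jet (λ h → Ω (w +ᶜ h) i) (Ω w i)
        jet-Ω i = jet-cong (jet-+ (jet-const (Log (Z w i))) (jet-log1p crefl (relative (jet-Z i)))) near
          (csym (+ᶜ-identityʳ _))
          where
          near : ∃ λ δ → 0# < δ × (∀ h → ‖ h ‖ ≤ δ → Ω (w +ᶜ h) i ≈ᶜ Log (Z w i) +ᶜ log1p
            ((Z (w +ᶜ h) i -ᶜ Z w i) *ᶜ Z w i ⁻¹ᶜ))
          near = let δ , δ>0 , local = Log-local (Z>0 s i)
                     η , η>0 , _ , close = JetBounds.continuous (jet-Z i) δ>0
                     σ , σ>0 , inside = strip in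
            η ⊓ σ , ⊓-pos η>0 σ>0 , λ h le → proj₂ (local (Z (w +ᶜ h) i) (Z>0 (inside h (≤-trans le (x⊓y≤y η σ))) i)
              (close h (≤-trans le (x⊓y≤x η σ))))

        jet-P : Jet (λ h → P (Ω (w +ᶜ h))) (P (Ω w))
        jet-P = jet-sum {m} λ j → jet-scale (ofR (c j)) (jet-exp
          (jet-sum {n} λ i → jet-scale (ofR (a j i)) (jet-Ω i)))

        jet-ℓ : Jet (λ h → ℓ (Ω (w +ᶜ h))) (ℓ (Ω w))
        jet-ℓ = jet-cong (jet-+ (jet-const (ℓ (Ω w))) (jet-log1p crefl (relative jet-P))) near
          (csym (+ᶜ-identityʳ _))
          where
          near : ∃ λ δ → 0# < δ × (∀ h → ‖ h ‖ ≤ δ → ℓ (Ω (w +ᶜ h)) ≈ᶜ ℓ (Ω w) +ᶜ log1p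
            ((P (Ω (w +ᶜ h)) -ᶜ P (Ω w)) *ᶜ P (Ω w) ⁻¹ᶜ))
          near = let δ , δ>0 , local = ℓ-local (Ω∈Tube s)
                     η , η>0 , close = finite-threshold {n} (λ i η → ∀ h → ‖ h ‖ ≤ η → ‖ Ω
                       (w +ᶜ h) i -ᶜ Ω w i ‖ ≤ δ)
                       (λ i le q h le′ → q h (≤-trans le′ le))
                       (λ i → let η , η>0 , _ , close = JetBounds.continuous (jet-Ω i) δ>0 in η , η>0 , close)
                     σ , σ>0 , inside = strip in
            η ⊓ σ , ⊓-pos η>0 σ>0 , λ h le → proj₂ (local (Ω (w +ᶜ h)) (Ω∈Tube (inside h (≤-trans le (x⊓y≤y η σ))))
              (λ i → close i h (≤-trans le (x⊓y≤x η σ))))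

        jet-Ψ : Jet (λ h → Ψ (w +ᶜ h)) (Ψ w)
        jet-Ψ = jet-+ (jet-exp (jet-scale (ofR d⁻¹) jet-ℓ))
          (jet-+ (jet-scale (-ᶜ 1ᶜ) (jet-exp⁻ (logq ξ))) (jet-scale (-ᶜ 1ᶜ) (jet-exp⁺ (logq η))))

      re-Ψ : ∀ w → re (Ψ w) ≈ re (Q (Ω w)) - (expR (logq ξ - re w) + expR (logq η + re w)) * cos (im w)
      re-Ψ w = trans (re-+ _ _) (trans (+-congˡ (trans (re-+ _ _) (+-cong
          (trans (re-cong (csolve 1 (λ x → (⊝ ccon 1ℚ) ⊗ x ⊜ ⊝ x) tt _))
            (trans (re-neg _) (-‿cong (trans (re-exp-affine _ _)
            (*-cong (expR-cong (+-congˡ (re-neg w))) (trans (cos-cong (im-neg w)) (cos-neg _)))))))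
          (trans (re-cong (csolve 1 (λ x → (⊝ ccon 1ℚ) ⊗ x ⊜ ⊝ x) tt _))
            (trans (re-neg _) (-‿cong (re-exp-affine _ _)))))))
        (solve 4 (λ q a b c → q :+ (:- (a :* c) :+ :- (b :* c)) := q :- (a :+ b) :* c) tt _ _ _ _))

      -- On the horizontal edges nothing is used of q beyond Re q ≥ 0. The other terms, bounded in
      -- modulus for |Re w| ≤ T, have real parts with the small factor cos (Im w).
      edge : ∀ {w T κ ε} → InStrip w → ∣ re w ∣ ≤ T → cos (im w) ≤ κ → (expR (logq ξ + T) + expR (logq η + T)) * κ ≤
        ε → - ε ≤ re (Ψ w)
      edge {w} {T} {κ} {ε} s le cos≤ small = ≤-trans (≤-by (+-mono-≤ (re-Q-nonneg (Ω∈Tube s)) (≤-trans (*-mono-≤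
            (+-nonneg (<⇒≤ (expR-pos _)) (<⇒≤ (expR-pos _))) (≤-trans (<⇒≤ (strip-cos-pos {w} s)) cos≤)
            (+-mono-≤ (expR-mono-≤ (+-mono-≤ ≤-refl (≤-trans (-x≤∣x∣ (re w)) le)))
              (expR-mono-≤ (+-mono-≤ ≤-refl (≤-trans (x≤∣x∣ (re w)) le)))) cos≤) small))
          (solve 3 (λ q e k → (q :+ e) :- (con 0ℚ :+ k) := (q :- k) :- :- e) tt (re (Q (Ω w))) ε
            ((expR (logq ξ - re w) + expR (logq η + re w)) * cos (im w))))
        (≤-reflexive (sym (re-Ψ w)))

  -- Superadditivity of q on positive points

  exp-norm-affine : ∀ x w → ‖ exp (ofR x +ᶜ w) ‖ ≤ 2# * (expR x * expR (re w))
  exp-norm-affine x w = ≤-trans (exp-norm _) (≤-reflexive (*-congˡ (trans (expR-cong (re-+ _ _)) (expR-+ _ _))))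

  cos-small : ∀ {κ} → 0# < κ → ∃ λ ψ → 0# < ψ × ψ < π/2 × cos ψ ≤ κ
  cos-small {κ} κ>0 = π/2 - s , <-by (≤-<-trans s≤h (half-< π/2>0))
    (solve 2 (λ p s → p :- s := (p :- s) :- con 0ℚ) tt π/2 s) ,
    <-by s>0 (solve 2 (λ p s → s :- con 0ℚ := p :- (p :- s)) tt π/2 s) , cos≤
    where
    K s : R
    K = expR 1# * (1# + 2# * 1#)
    s = (½# * π/2) ⊓ (1# ⊓ (κ / K))
    K>0 : 0# < K
    K>0 = *-pos (expR-pos 1#) (+-pos 0<1 (<⇒≤ (*-pos 0<2 0<1)))
    s>0 : 0# < s
    s>0 = ⊓-pos (half-pos π/2>0) (⊓-pos 0<1 (/-pos κ>0 K>0))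
    s≤h : s ≤ ½# * π/2
    s≤h = x⊓y≤x (½# * π/2) (1# ⊓ (κ / K))
    s≤1 : s ≤ 1#
    s≤1 = ≤-trans (x⊓y≤y (½# * π/2) (1# ⊓ (κ / K))) (x⊓y≤x 1# (κ / K))
    s≤κ/K : s ≤ κ / K
    s≤κ/K = ≤-trans (x⊓y≤y (½# * π/2) (1# ⊓ (κ / K))) (x⊓y≤y 1# (κ / K))
    ∣s∣ : ∣ s ∣ ≈ s
    ∣s∣ = nonneg⇒∣∣ (<⇒≤ s>0)
    cos-eq : cos (π/2 - s) ≈ sin s
    cos-eq = trans (trans (cos-+ π/2 (- s)) (trans (+-cong (*-congʳ cos-π/2) (-‿cong (*-cong sin-π/2 (sin-neg s))))
      (solve 2 (λ c s → con 0ℚ :* c :- con 1ℚ :* :- s := s) tt (cos (- s)) (sin s)))) refl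
    cos≤ : cos (π/2 - s) ≤ κ
    cos≤ = ≤-trans (≤-reflexive cos-eq) (≤-trans (∣-∣≤⇒≤ (sin-lipschitz {s} {0#} {1#}
      (≤-trans (≤-reflexive ∣s∣) s≤1)
        (≤-trans (≤-reflexive (nonneg⇒∣∣ ≤-refl)) (<⇒≤ 0<1))))
      (≤-trans (≤-reflexive (trans (+-cong sin-zero (*-congˡ (trans
        (∣∣-cong (solve 1 (λ s → s :- con 0ℚ := s) tt s)) ∣s∣))) (+-identityˡ _)))
        (≤-trans (*-monoˡ-≤ (<⇒≤ K>0) s≤κ/K) (≤-reflexive (*-/-cancel (pos⇒≉0 K>0))))))

  module Superadditive {n m : ℕ} (p : StablePosynomial n m) where
    open Logarithm p
    open Argument p using (ℓ-cong)
    open Branch p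

    module RightEnd (ξ η : Fin n → R) where
      open Sum ξ η

      θ : C → R
      θ w = expR (- re w)

      θ>0 : ∀ w → 0# < θ w
      θ>0 w = expR-pos _

      Y v : C → Fin n → C
      Y w i = ofR (expR (η i))
      v w i = exp (ofR (ξ i) +ᶜ -ᶜ (w +ᶜ w)) +ᶜ Y w i

      Log-Y : ∀ i → Log (ofR (expR (η i))) ≈ᶜ ofR (η i)
      Log-Y i = ctrans (Log-real (expR-pos _)) (ofR-cong (sym (ln-unique (expR-pos _) refl)))

      v-Y≤ : ∀ w i → ‖ v w i -ᶜ Y w i ‖ ≤ 2# * expR (ξ i) * (θ w * θ w)
      v-Y≤ w i = ≤-trans (≤-reflexive (‖‖-cong (csolve 2 (λ e y → (e ⊕ y) ⊖ y ⊜ e) tt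
        (exp (ofR (ξ i) +ᶜ -ᶜ (w +ᶜ w))) (Y w i))))
        (≤-trans (exp-norm-affine _ _) (≤-reflexive (trans (*-congˡ
          (*-congˡ (trans (expR-cong (trans (re-neg _) (trans (-‿cong (re-+ _ _))
          (solve 1 (λ x → :- (x :+ x) := :- x :+ :- x) tt (re w))))) (expR-+ _ _))))
          (sym (*-assoc _ _ _)))))

      Cᵢ : Fin n → R
      Cᵢ i = 2# * (2# * expR (ξ i) * ‖ ofR (expR (η i)) ⁻¹ᶜ ‖)

      Near : Fin n → R → Set
      Near i θ₀ = ∀ w → θ w ≤ θ₀ → 0# < re (v w i) × ‖ Log (v w i) -ᶜ ofR (η i) ‖ ≤ Cᵢ i * (θ w * θ w)

      near : ∀ i → ∃ λ θ₀ → 0# < θ₀ × Near i θ₀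
      near i = θ₀ , ⊓-pos 0<1 (/-pos κ>0 α>0) , λ w le → re-v w le , bound w le
        where
        local : ∃ λ δ → 0# < δ × (∀ u → 0# < re u → ‖ u -ᶜ ofR (expR (η i)) ‖ ≤ δ →
          ‖ (u -ᶜ ofR (expR (η i))) *ᶜ ofR (expR (η i)) ⁻¹ᶜ ‖ ≤ r₁ × Log u ≈ᶜ Log (ofR (expR (η i))) +ᶜ log1p
            ((u -ᶜ ofR (expR (η i))) *ᶜ ofR (expR (η i)) ⁻¹ᶜ))
        local = Log-local (expR-pos (η i))
        δ α κ θ₀ : R
        δ = proj₁ local
        α = 2# * expR (ξ i)
        κ = (½# * expR (η i)) ⊓ δ
        θ₀ = 1# ⊓ (κ / α)
        α>0 : 0# < α
        α>0 = *-pos 0<2 (expR-pos _)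
        κ>0 : 0# < κ
        κ>0 = ⊓-pos (half-pos (expR-pos _)) (proj₁ (proj₂ local))
        close : ∀ w → θ w ≤ θ₀ → ‖ v w i -ᶜ ofR (expR (η i)) ‖ ≤ κ
        close w le = ≤-trans (v-Y≤ w i) (≤-trans (*-monoˡ-≤ (<⇒≤ α>0)
          (≤-trans (*-mono-≤ (<⇒≤ (θ>0 w)) (<⇒≤ 0<1) (≤-trans le (x⊓y≤y 1# (κ / α)))
          (≤-trans le (x⊓y≤x 1# (κ / α)))) (≤-reflexive (*-identityʳ _))))
          (≤-reflexive (*-/-cancel (pos⇒≉0 α>0))))
        re-v : ∀ w → θ w ≤ θ₀ → 0# < re (v w i)
        re-v w le = <-≤-trans (half-pos (expR-pos (η i))) (≤-by
          (≤-trans (≤-trans (-x≤∣x∣ _) (∣re-re∣≤ (v w i) (ofR (expR (η i))))) (≤-trans (close w le) (x⊓y≤x _ δ)))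
          (solve 2 (λ y x → con ½ :* y :- :- (x :- y) := x :- con ½ :* y) tt (expR (η i)) (re (v w i))))
        bound : ∀ w → θ w ≤ θ₀ → ‖ Log (v w i) -ᶜ ofR (η i) ‖ ≤ Cᵢ i * (θ w * θ w)
        bound w le = let small , e = proj₂ (proj₂ local) (v w i) (re-v w le) (≤-trans (close w le) (x⊓y≤y _ δ)) in
          ≤-trans (≤-reflexive (‖‖-cong (ctrans (+ᶜ-congʳ (ctrans e (+ᶜ-congʳ (Log-Y i))))
            (csolve 2 (λ a b → (a ⊕ b) ⊖ a ⊜ b) tt (ofR (η i))
            (log1p ((v w i -ᶜ ofR (expR (η i))) *ᶜ ofR (expR (η i)) ⁻¹ᶜ))))))
            (≤-trans (log1p-bound (≤-trans small r₁≤r₀)) (≤-trans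
              (*-monoˡ-≤ (<⇒≤ 0<2) (‖‖-mult-≤ (v-Y≤ w i) ≤-refl))
              (≤-reflexive (solve 3 (λ a t y → (con 1ℚ :+ con 1ℚ) :* (a :* t :* y) := (con 1ℚ :+ con 1ℚ) :*
                (a :* y) :* t) tt (2# * expR (ξ i)) (θ w * θ w) (‖ ofR (expR (η i)) ⁻¹ᶜ ‖)))))

      Cₛ : R
      Cₛ = sum {n} Cᵢ

      Cᵢ≥0 : ∀ i → 0# ≤ Cᵢ i
      Cᵢ≥0 i = *-nonneg (<⇒≤ 0<2) (*-nonneg (*-nonneg (<⇒≤ 0<2) (<⇒≤ (expR-pos _))) (‖‖-nonneg _))

      Cₛ≥0 : 0# ≤ Cₛ
      Cₛ≥0 = sum-nonneg {n} Cᵢ≥0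

      Z-factor : ∀ w i → Z w i ≈ᶜ exp (Log (v w i) +ᶜ w) ⊎ ¬ (0# < re (v w i))
      Z-factor w i with lem {0# < re (v w i)}
      ... | no ¬pos = inj₂ ¬pos
      ... | yes pos = inj₁ (csym (ctrans (exp-+ _ _) (ctrans (*ᶜ-congʳ (exp-Log pos))
        (ctrans (csolve 3 (λ e y x → (e ⊕ y) ⊗ x ⊜ e ⊗ x ⊕ y ⊗ x) tt (exp (ofR (ξ i) +ᶜ -ᶜ (w +ᶜ w))) (Y w i)
        (exp w))
        (+ᶜ-cong (ctrans (csym (exp-+ _ _)) (exp-cong (csolve 2 (λ x w → (x ⊕ ⊝ (w ⊕ w)) ⊕ w ⊜ x ⊕ ⊝ w) tt
          (ofR (ξ i)) w)))
          (ctrans (*ᶜ-congʳ (csym (exp-ofR _))) (csym (exp-+ _ _))))))))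

      -- Both sides are logarithms of `Z w i`. The three imaginary parts involved are each below π/2
      -- in absolute value, so the two sides differ by less than 3π/2 and not by a full turn.
      Ω-factor : ∀ w i → InStrip w → 0# < re (v w i) → Ω w i ≈ᶜ Log (v w i) +ᶜ w
      Ω-factor w i s pos = exp-injective-strip (ctrans (exp-Log (Z>0 s i))
        ([ (λ e → e) , (λ ¬pos → ⊥-elim (¬pos pos)) ]′ (Z-factor w i)))
        (≤-<-trans (≤-trans (∣∣-triangle _ _) (+-mono-≤ ≤-refl
          (≤-trans (≤-reflexive (trans (∣∣-neg _) (∣∣-cong (im-+ _ _)))) (∣∣-triangle _ _))))
          (<-trans (+-mono-< (Log-argument (Z>0 s i)) (+-mono-< (Log-argument pos) s))
            (<-by π/2>0 (solve 1 (λ p → con ½ :* p :- con 0ℚ := (con 1ℚ :+ con 1ℚ) :* p :-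
              (con ½ :* p :+ (con ½ :* p :+ con ½ :* p))) tt π))))

      right-end : ∀ {ε} → 0# < ε → ∃ λ T → 0# ≤ T × (∀ w → InStrip w → T ≤ re w → ‖ Ψ w ‖ ≤ ε)
      right-end {ε} ε>0 = T , T≥0 , small
        where
        ω₀ : Point
        ω₀ = ofR ∘ η
        near-all : ∃ λ θ₀ → 0# < θ₀ × (∀ i → Near i θ₀)
        near-all = finite-threshold {n} Near (λ i le q w le′ → q w (≤-trans le′ le)) near
        local : ∃ λ δ → 0# < δ × (∀ ω′ → Tube {n} ω′ → (∀ i → ‖ ω′ i -ᶜ ω₀ i ‖ ≤ δ) →
          ‖ (P ω′ -ᶜ P ω₀) *ᶜ P ω₀ ⁻¹ᶜ ‖ ≤ r₁ × ℓ ω′ ≈ᶜ ℓ ω₀ +ᶜ log1p ((P ω′ -ᶜ P ω₀) *ᶜ P ω₀ ⁻¹ᶜ))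
        local = ℓ-local (real∈Tube η)
        r : R
        r = size ω₀ + 1#
        r≥0 : 0# ≤ r
        r≥0 = +-nonneg (size≥0 ω₀) (<⇒≤ 0<1)
        lipP : ∃ λ K → 0# ≤ K × (∀ ω ω′ δ → (∀ i → ‖ ω i ‖ ≤ r) → (∀ i → ‖ ω′ i ‖ ≤ r) →
          (∀ i → ‖ ω i -ᶜ ω′ i ‖ ≤ δ) → ‖ P ω -ᶜ P ω′ ‖ ≤ K * δ)
        lipP = P-lipschitz r r≥0
        K I E rd C₂ C₃ : R
        K = proj₁ lipP
        I = ‖ P ω₀ ⁻¹ᶜ ‖
        rd = d⁻¹ * (2# * r₁)
        E = expR rd * (1# + 2# * rd)
        -- Writing q v = q Y · exp l, the bound for exp l - 1 is C₂ θ²; multiplied by e^w and joined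
        -- with the remaining term it becomes the bound C₃ θ for `Ψ`.
        C₂ = E * (d⁻¹ * (2# * (K * Cₛ * I)))
        C₃ = 2# * (expR (logq η) * C₂) + 2# * expR (logq ξ)
        K≥0 : 0# ≤ K
        K≥0 = proj₁ (proj₂ lipP)
        d⁻¹≥0 : 0# ≤ d⁻¹
        d⁻¹≥0 = <⇒≤ d⁻¹>0
        rd≥0 : 0# ≤ rd
        rd≥0 = *-nonneg d⁻¹≥0 (*-nonneg (<⇒≤ 0<2) (<⇒≤ r₁>0))
        E≥0 : 0# ≤ E
        E≥0 = *-nonneg (<⇒≤ (expR-pos _)) (+-nonneg (<⇒≤ 0<1) (*-nonneg (<⇒≤ 0<2) rd≥0))
        C₂≥0 : 0# ≤ C₂
        C₂≥0 = *-nonneg E≥0 (*-nonneg d⁻¹≥0 (*-nonneg (<⇒≤ 0<2) (*-nonneg (*-nonneg K≥0 Cₛ≥0) (‖‖-nonneg _))))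
        C₃≥0 : 0# ≤ C₃
        C₃≥0 = +-nonneg (*-nonneg (<⇒≤ 0<2) (*-nonneg (<⇒≤ (expR-pos _)) C₂≥0))
          (*-nonneg (<⇒≤ 0<2) (<⇒≤ (expR-pos _)))
        δ : R
        δ = 1# ⊓ proj₁ local
        md₁ : ∃ λ θ₁ → 0# < θ₁ × Cₛ * (θ₁ + θ₁) ≤ δ
        md₁ = modulus Cₛ Cₛ≥0 (⊓-pos 0<1 (proj₁ (proj₂ local)))
        md₂ : ∃ λ θ₂ → 0# < θ₂ × C₃ * (θ₂ + θ₂) ≤ ε
        md₂ = modulus C₃ C₃≥0 ε>0
        θ₀ θ₁ θ₂ θ* : R
        θ₀ = proj₁ near-all
        θ₁ = proj₁ md₁
        θ₂ = proj₁ md₂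
        θ* = 1# ⊓ (θ₀ ⊓ (θ₁ ⊓ θ₂))
        θ*>0 : 0# < θ*
        θ*>0 = ⊓-pos 0<1 (⊓-pos (proj₁ (proj₂ near-all)) (⊓-pos (proj₁ (proj₂ md₁)) (proj₁ (proj₂ md₂))))
        decay : ∃ λ T → 0# ≤ T × (∀ t → t ≤ - T → 1# * expR (t * 1#) ≤ θ*)
        decay = exponential-decay (<⇒≤ 0<1) 0<1 θ*>0
        T : R
        T = proj₁ decay
        T≥0 : 0# ≤ T
        T≥0 = proj₁ (proj₂ decay)
        small : ∀ w → InStrip w → T ≤ re w → ‖ Ψ w ‖ ≤ ε
        small w s T≤ = ≤-trans (≤-reflexive (‖‖-cong Ψ-eq)) (≤-trans (‖‖-triangle-- _ _)
            (≤-trans (+-mono-≤ (‖‖-mult-≤ (exp-norm w) (‖‖-mult-≤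
              (≤-reflexive (trans (‖ofR‖ _) (nonneg⇒∣∣ (<⇒≤ (expR-pos _))))) factor≤))
                (≤-trans (exp-norm-affine _ _) (≤-reflexive (*-congˡ (*-congˡ (expR-cong (re-neg w)))))))
              (≤-trans (≤-reflexive (trans (+-congʳ (trans (solve 4
                (λ e q c t → (con 1ℚ :+ con 1ℚ) :* e :* (q :* (c :* (t :* t))) := (e :* t) :*
                ((con 1ℚ :+ con 1ℚ) :* (q :* c) :* t)) tt (expR (re w)) (expR (logq η)) C₂ (θ w))
                    (trans (*-congʳ (expR-neg (re w))) (*-identityˡ _))))
                  (solve 3 (λ a x t → (con 1ℚ :+ con 1ℚ) :* a :* t :+ (con 1ℚ :+ con 1ℚ) :* (x :* t) :=
                    ((con 1ℚ :+ con 1ℚ) :* a :+ (con 1ℚ :+ con 1ℚ) :* x) :* t) tt (expR (logq η) * C₂)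
                    (expR (logq ξ)) (θ w))))
                (≤-trans (*-monoˡ-≤ C₃≥0 (≤-trans θ≤θ₂ (≤-by (<⇒≤ (proj₁ (proj₂ md₂)))
                  (solve 1 (λ t → t :- con 0ℚ := (t :+ t) :- t) tt θ₂)))) (proj₂ (proj₂ md₂))))))
          where
          θw : R
          θw = θ w
          θ≤θ* : θw ≤ θ*
          θ≤θ* = ≤-trans (≤-reflexive (trans (expR-cong (solve 1 (λ x → x := x :* con 1ℚ) tt (- re w)))
            (sym (*-identityˡ _)))) (proj₂ (proj₂ decay) (- re w) (neg-mono-≤ T≤))
          θ≤1 : θw ≤ 1#
          θ≤1 = ≤-trans θ≤θ* (x⊓y≤x 1# _)
          θ≤rest : θw ≤ θ₀ ⊓ (θ₁ ⊓ θ₂)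
          θ≤rest = ≤-trans θ≤θ* (x⊓y≤y 1# _)
          θ≤θ₀ : θw ≤ θ₀
          θ≤θ₀ = ≤-trans θ≤rest (x⊓y≤x θ₀ _)
          θ≤θ₁ : θw ≤ θ₁
          θ≤θ₁ = ≤-trans θ≤rest (≤-trans (x⊓y≤y θ₀ _) (x⊓y≤x θ₁ θ₂))
          θ≤θ₂ : θw ≤ θ₂
          θ≤θ₂ = ≤-trans θ≤rest (≤-trans (x⊓y≤y θ₀ _) (x⊓y≤y θ₁ θ₂))
          pos : ∀ i → 0# < re (v w i)
          pos i = proj₁ (proj₂ (proj₂ near-all) i w θ≤θ₀)
          Λ : Point
          Λ i = Log (v w i)
          Λ∈ : Tube {n} Λ
          Λ∈ i = Log-argument (pos i)
          Cθ²≤δ : Cₛ * (θw * θw) ≤ δ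
          Cθ²≤δ = ≤-trans (*-monoˡ-≤ Cₛ≥0 (≤-trans (*-mono-≤ (<⇒≤ (θ>0 w)) (<⇒≤ 0<1) θ≤θ₁ θ≤1)
            (≤-trans (≤-reflexive (*-identityʳ θ₁)) (≤-by (<⇒≤ (proj₁ (proj₂ md₁)))
            (solve 1 (λ t → t :- con 0ℚ := (t :+ t) :- t) tt θ₁)))))
            (proj₂ (proj₂ md₁))
          Λ-close : ∀ i → ‖ Λ i -ᶜ ω₀ i ‖ ≤ Cₛ * (θw * θw)
          Λ-close i = ≤-trans (proj₂ (proj₂ (proj₂ near-all) i w θ≤θ₀))
            (*-monoʳ-≤ (square-nonneg θw) (term≤sum {n} Cᵢ≥0 i))
          y l : C
          y = (P Λ -ᶜ P ω₀) *ᶜ P ω₀ ⁻¹ᶜ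
          l = ofR d⁻¹ *ᶜ log1p y
          ℓΛ : ‖ y ‖ ≤ r₁ × ℓ Λ ≈ᶜ ℓ ω₀ +ᶜ log1p y
          ℓΛ = proj₂ (proj₂ local) Λ Λ∈ λ i → ≤-trans (Λ-close i) (≤-trans Cθ²≤δ (x⊓y≤y 1# _))
          y≤ : ‖ y ‖ ≤ K * (Cₛ * (θw * θw)) * I
          y≤ = ‖‖-mult-≤ (proj₂ (proj₂ lipP) Λ ω₀ _
              (λ i → ≤-trans (‖‖-reverse (Λ i) (ω₀ i)) (+-mono-≤ (≤size ω₀ i)
                (≤-trans (Λ-close i) (≤-trans Cθ²≤δ (x⊓y≤x 1# _)))))
              (λ i → ≤-trans (≤size ω₀ i) (≤-by (<⇒≤ 0<1) (solve 1 (λ s → con 1ℚ :- con 0ℚ := (s :+ con 1ℚ) :- s) tt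
                (size ω₀)))) Λ-close) ≤-refl
          l≤ : ∀ {b} → ‖ y ‖ ≤ b → ‖ l ‖ ≤ d⁻¹ * (2# * b)
          l≤ q = ≤-trans (≤-reflexive (trans (‖ofR*‖ _ _) (*-congʳ (nonneg⇒∣∣ d⁻¹≥0))))
            (*-monoˡ-≤ d⁻¹≥0 (≤-trans (log1p-bound (≤-trans (proj₁ ℓΛ) r₁≤r₀)) (*-monoˡ-≤ (<⇒≤ 0<2) q)))
          factor≤ : ‖ exp l -ᶜ 1ᶜ ‖ ≤ C₂ * (θw * θw)
          factor≤ = ≤-trans (≤-reflexive (‖‖-cong (+ᶜ-congˡ (-ᶜ-cong (csym exp-zero)))))
            (≤-trans (exp-lipschitz {l} {0ᶜ} {rd} (l≤ (proj₁ ℓΛ)) (≤-trans (≤-reflexive ‖0‖) rd≥0))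
              (≤-trans (*-monoˡ-≤ E≥0 (≤-trans (≤-reflexive (‖‖-cong (csolve 1 (λ l → l ⊖ ccon 0ℚ ⊜ l) tt l)))
                (l≤ y≤)))
                (≤-reflexive (solve 6 (λ e d k c t i → e :* (d :* ((con 1ℚ :+ con 1ℚ) :* (k :* (c :* t) :* i))) := e
                  :* (d :* ((con 1ℚ :+ con 1ℚ) :* (k :* c :* i))) :* t) tt E d⁻¹ K Cₛ (θw * θw) I))))
          Ω≈ : ∀ i → Ω w i ≈ᶜ Λ i +ᶜ w
          Ω≈ i = Ω-factor w i s (pos i)
          Λw∈ : Tube {n} (λ i → Λ i +ᶜ w)
          Λw∈ i = <-resp₂ (∣∣-cong (im-cong (Ω≈ i))) refl (Ω∈Tube s i)
          QΩ : Q (Ω w) ≈ᶜ exp w *ᶜ (ofR (expR (logq η)) *ᶜ exp l)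
          QΩ = ctrans (Q-cong (Ω∈Tube s) Λw∈ Ω≈) (ctrans (Q-shift w Λ∈ Λw∈) (*ᶜ-congˡ
            (ctrans (exp-cong (ctrans (*ᶜ-congˡ (proj₂ ℓΛ)) (csolve 3 (λ d a b → d ⊗ (a ⊕ b) ⊜ d ⊗ a ⊕ d ⊗ b) tt
              (ofR d⁻¹) (ℓ ω₀) (log1p y))))
              (ctrans (exp-+ _ _) (*ᶜ-congʳ (Q-real η))))))
          Ψ-eq : Ψ w ≈ᶜ exp w *ᶜ (ofR (expR (logq η)) *ᶜ (exp l -ᶜ 1ᶜ)) -ᶜ exp (ofR (logq ξ) +ᶜ -ᶜ w)
          Ψ-eq = ctrans (+ᶜ-cong QΩ (+ᶜ-congˡ (*ᶜ-congˡ (ctrans (exp-+ _ _) (*ᶜ-congʳ (exp-ofR _))))))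
            (csolve 4 (λ e q x z → e ⊗ (q ⊗ x) ⊕ ((⊝ ccon 1ℚ) ⊗ z ⊕ (⊝ ccon 1ℚ) ⊗ (q ⊗ e)) ⊜ e ⊗
              (q ⊗ (x ⊖ ccon 1ℚ)) ⊖ z) tt (exp w) (ofR (expR (logq η))) (exp l) (exp (ofR (logq ξ) +ᶜ -ᶜ w)))

    -- Exchanging X and Y amounts to replacing w by -w, which reduces the left end of the strip to
    -- the right end.
    Ψ-swap : ∀ ξ η w → InStrip w → Sum.Ψ ξ η w ≈ᶜ Sum.Ψ η ξ (-ᶜ w)
    Ψ-swap ξ η w s = +ᶜ-cong (Q-cong (Sum.Ω∈Tube ξ η s) (Sum.Ω∈Tube η ξ (strip-neg s)) λ i → Log-cong
      (Sum.Z>0 ξ η s i)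
        (ctrans (+ᶜ-comm _ _) (+ᶜ-congʳ (exp-cong (+ᶜ-congˡ neg-neg)))))
      (ctrans (+ᶜ-comm _ _) (+ᶜ-congʳ (*ᶜ-congˡ (exp-cong (+ᶜ-congˡ neg-neg)))))
      where
      neg-neg : w ≈ᶜ -ᶜ (-ᶜ w)
      neg-neg = csolve 1 (λ w → w ⊜ ⊝ (⊝ w)) tt w

    -- Superadditivity is V 0 ≥ 0. The minimum principle gives V 0 ≥ -ε on a rectangle around 0
    -- whose vertical edges lie where `right-end` makes V small and whose horizontal edges are close
    -- to |Im w| = π/2.
    superadditive : ∀ ξ η → expR (logq ξ) + expR (logq η) ≤ expR (logq (λ i → ln (expR (ξ i) + expR (η i))))
    superadditive ξ η = ≤-from-ε bound
      where
      open Sum ξ η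
      bound : ∀ ε → 0# < ε → expR (logq ξ) + expR (logq η) ≤ expR (logq (λ i → ln (expR (ξ i) + expR (η i)))) + ε
      bound ε ε>0 = ≤-by at-origin (trans (+-congʳ origin-value)
        (solve 3 (λ q a e → (q :- a) :- :- e := (q :+ e) :- a) tt (expR (logq (λ i → ln (expR (ξ i) + expR (η i)))))
        (expR (logq ξ) + expR (logq η)) ε))
        where
        right : ∃ λ T → 0# ≤ T × (∀ w → InStrip w → T ≤ re w → ‖ Ψ w ‖ ≤ ε)
        right = RightEnd.right-end ξ η ε>0
        left : ∃ λ T → 0# ≤ T × (∀ w → InStrip w → T ≤ re w → ‖ Sum.Ψ η ξ w ‖ ≤ ε)
        left = RightEnd.right-end η ξ ε>0
        T M : R
        T = proj₁ right + proj₁ left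
        M = expR (logq ξ + T) + expR (logq η + T)
        T≥0 : 0# ≤ T
        T≥0 = +-nonneg (proj₁ (proj₂ right)) (proj₁ (proj₂ left))
        M>0 : 0# < M
        M>0 = +-pos (expR-pos _) (<⇒≤ (expR-pos _))
        -- The angle is chosen last: the width T determines the size M of the subtracted terms on
        -- the horizontal edges, and cos ψ ≤ ε / M then compensates for it.
        angle : ∃ λ ψ → 0# < ψ × ψ < π/2 × cos ψ ≤ ε / M
        angle = cos-small (/-pos ε>0 M>0)
        ψ : R
        ψ = proj₁ angle
        ψ≥0 : 0# ≤ ψ
        ψ≥0 = <⇒≤ (proj₁ (proj₂ angle))
        M*≤ε : M * (ε / M) ≤ ε
        M*≤ε = ≤-reflexive (*-/-cancel (pos⇒≉0 M>0))
        in-strip : ∀ {x y} → Between (- ψ) (- ψ + (ψ + ψ)) y → InStrip (mkC x y)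
        in-strip {x} {y} (q , q′) = ≤-<-trans (∣∣-lub (≤-trans q′ (≤-reflexive (solve 1 (λ p → :- p :+ (p :+ p) := p) tt ψ))) (≤-by q (solve 2 (λ p y → y :- :- p := p :- :- y) tt ψ y))) (proj₁ (proj₂ (proj₂ angle)))
        ∣x∣≤T : ∀ {x} → Between (- T) (- T + (T + T)) x → ∣ x ∣ ≤ T
        ∣x∣≤T {x} (q , q′) = ∣∣-lub (≤-trans q′ (≤-reflexive (solve 1 (λ p → :- p :+ (p :+ p) := p) tt T)))
          (≤-by q (solve 2 (λ p y → y :- :- p := p :- :- y) tt T x))
        first : - ψ ≤ - ψ + (ψ + ψ)
        first = ≤-by (+-nonneg ψ≥0 ψ≥0) (solve 1 (λ p → (p :+ p) :- con 0ℚ := (:- p :+ (p :+ p)) :- :- p) tt ψ)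
        small⇒ : ∀ {z} → ‖ z ‖ ≤ ε → - ε ≤ re z
        small⇒ {z} q = ≤-by (≤-trans (-x≤∣x∣ _) (≤-trans (∣re∣≤‖‖ z) q))
          (solve 2 (λ e x → e :- :- x := x :- :- e) tt ε (re z))
        origin-in : InRectangle (- T) (T + T) (- ψ) (ψ + ψ) 0# 0#
        origin-in = (≤-trans (neg-nonpos T≥0) ≤-refl , ≤-trans T≥0 (≤-reflexive (solve 1 (λ p → p := :- p :+ (p :+ p)) tt T))) ,
          (neg-nonpos ψ≥0 , ≤-trans ψ≥0 (≤-reflexive (solve 1 (λ p → p := :- p :+ (p :+ p)) tt ψ)))
        at-origin : - ε ≤ re (Ψ (mkC 0# 0#))
        at-origin = MinimumPrinciple.minimum-principle Ψ (- T) (T + T) (- ψ) (ψ + ψ) (+-nonneg T≥0 T≥0)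
          (+-nonneg ψ≥0 ψ≥0)
          (λ { {x} {y} {w} (_ , by) e → csym (Ψ-cong {mkC x y} {w} (in-strip {x} {y} by) e) })
          (λ { x y (_ , by) → At.jet-Ψ (mkC x y) (in-strip {x} {y} by) })
          ε
          (λ {y} by → let s = in-strip { - T} {y} by in small⇒ (≤-trans (≤-reflexive (‖‖-cong (Ψ-swap ξ η (mkC (- T) y) s)))
            (proj₂ (proj₂ left) (-ᶜ mkC (- T) y) (strip-neg s)
              (≤-trans (≤-by (proj₁ (proj₂ right)) (solve 2 (λ a b → a :- con 0ℚ := (a :+ b) :- b) tt (proj₁ right)
              (proj₁ left)))
              (≤-reflexive (sym (trans (re-neg _) (solve 1 (λ t → :- (:- t) := t) tt T))))))))
          (λ {y} by → small⇒ (proj₂ (proj₂ right) (mkC (- T + (T + T)) y) (in-strip { - T + (T + T)} {y} by)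
            (≤-trans (≤-by (proj₁ (proj₂ left)) (solve 2 (λ a b → b :- con 0ℚ := (a :+ b) :- a) tt (proj₁ right)
              (proj₁ left))) (≤-reflexive (solve 1 (λ p → p := :- p :+ (p :+ p)) tt T)))))
          (λ {x} bx → edge {mkC x (- ψ)} {T} {ε / M} (in-strip {x} (≤-refl , first)) (∣x∣≤T bx) (≤-trans (≤-reflexive (cos-neg ψ)) (proj₂ (proj₂ (proj₂ angle)))) M*≤ε)
          (λ {x} bx → edge {mkC x (- ψ + (ψ + ψ))} {T} {ε / M} (in-strip {x} (first , ≤-refl)) (∣x∣≤T bx)
            (≤-trans (≤-reflexive (cos-cong (solve 1 (λ p → :- p :+ (p :+ p) := p) tt ψ)))
              (proj₂ (proj₂ (proj₂ angle)))) M*≤ε)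
          0# 0# origin-in
        Z₀ : ∀ i → Z (mkC 0# 0#) i ≈ᶜ ofR (expR (ξ i) + expR (η i))
        Z₀ i = ctrans (+ᶜ-cong (ctrans (exp-cong (csolve 1 (λ x → x ⊕ ⊝ ccon 0ℚ ⊜ x) tt (ofR (ξ i)))) (exp-ofR _))
          (ctrans (exp-cong (+ᶜ-identityʳ _)) (exp-ofR _))) (csym (ofR-+ _ _))
        z>0 : ∀ i → 0# < expR (ξ i) + expR (η i)
        z>0 i = +-pos (expR-pos _) (<⇒≤ (expR-pos _))
        0∈ : InStrip (mkC 0# 0#)
        0∈ = <-resp₂ (sym (nonneg⇒∣∣ ≤-refl)) refl π/2>0
        ζ : Fin n → R
        ζ i = ln (expR (ξ i) + expR (η i))
        Q₀ : re (Q (Ω (mkC 0# 0#))) ≈ expR (logq ζ)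
        Q₀ = re-cong (ctrans (Q-cong (Ω∈Tube 0∈) (real∈Tube ζ) λ i → ctrans (Log-cong (Z>0 0∈ i) (Z₀ i))
          (Log-real (z>0 i))) (Q-real ζ))
        origin-value : re (Ψ (mkC 0# 0#)) ≈ expR (logq ζ) - (expR (logq ξ) + expR (logq η))
        origin-value = trans (re-Ψ _) (+-cong Q₀ (-‿cong (trans
          (*-cong (+-cong (expR-cong (solve 1 (λ x → x :- con 0ℚ := x) tt (logq ξ))) (expR-cong (+-identityʳ _)))
          cos-zero) (*-identityʳ _))))

  -- Convexity of the exponential; concavity of q and of log P

  T⁺≤pow : ∀ k {u} → 0# ≤ u → T⁺ k u ≤ pow u k
  T⁺≤pow zero p = ≤-refl
  T⁺≤pow (suc k) {u} p = ≤-trans (*-mono-≤ (<⇒≤ (unit-pos k)) (*-nonneg p (≤-trans (T⁺-nonneg k p) (T⁺≤pow k p)))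
    (unit≤1 k) (*-monoˡ-≤ p (T⁺≤pow k p)))
    (≤-reflexive (solve 2 (λ u q → con 1ℚ :* (u :* q) := q :* u) tt u (pow u k)))

  -- Comparison of the exponential with the geometric series, free of division; the summand u^k is
  -- the telescoping tail that carries the induction.
  S⁺-geometric : ∀ k {u} → 0# ≤ u → u ≤ 1# → S⁺ k u * (1# - u) + pow u k ≤ 1#
  S⁺-geometric zero {u} p q = ≤-reflexive (solve 1 (λ u → con 0ℚ :* (con 1ℚ :- u) :+ con 1ℚ := con 1ℚ) tt u)
  S⁺-geometric (suc k) {u} p q = ≤-trans (≤-by (*-monoʳ-≤ (≤⇒0≤ q) (T⁺≤pow k p))
    (solve 4 (λ s t u w → w :* (con 1ℚ :- u) :- t :* (con 1ℚ :- u) := (s :* (con 1ℚ :- u) :+ w) :-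
      ((s :+ t) :* (con 1ℚ :- u) :+ w :* u)) tt (S⁺ k u) (T⁺ k u) u (pow u k))) (S⁺-geometric k p q)

  pow-nonneg : ∀ {u} → 0# ≤ u → ∀ k → 0# ≤ pow u k
  pow-nonneg p zero = <⇒≤ 0<1
  pow-nonneg p (suc k) = *-nonneg (pow-nonneg p k) p

  expR*[1-u]≤1 : ∀ {u} → 0# ≤ u → u ≤ 1# → expR u * (1# - u) ≤ 1#
  expR*[1-u]≤1 {u} p q = ≤-from-ε λ ε ε>0 → let k , h = exp-limit (ofR u) ε ε>0 in
    ≤-trans (*-monoʳ-≤ (≤⇒0≤ q) (∣-∣≤⇒≤ (≤-trans (≤-reflexive
      (∣∣-cong (+-congˡ (-‿cong (re-cong (csym (S-ofR k u))))))) (≤-trans (∣re-re∣≤ _ _) (h k ℕ.≤-refl)))))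
      (≤-trans (≤-by (+-mono-≤ (S⁺-geometric k p q) (+-mono-≤ (neg-nonpos (pow-nonneg p k))
        (neg-nonpos (*-nonneg p (<⇒≤ ε>0)))))
          (solve 4 (λ s e u w → (con 1ℚ :+ (con 0ℚ :+ con 0ℚ)) :-
            ((s :* (con 1ℚ :- u) :+ w) :+ (:- w :+ :- (u :* e))) := (con 1ℚ :+ e) :- ((s :+ e) :* (con 1ℚ :- u))) tt
            (S⁺ k u) ε u (pow u k)))
        ≤-refl)

  1+x≤expR-everywhere : ∀ x → 1# + x ≤ expR x
  1+x≤expR-everywhere x with ≤-or-> 0# x
  ... | inj₁ x≥0 = 1+x≤expR x≥0
  ... | inj₂ x<0 with ≤-or-> (1# + x) 0#
  ...   | inj₁ le = ≤-trans le (<⇒≤ (expR-pos x))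
  ...   | inj₂ gt = ≤-trans (≤-reflexive (trans (sym (*-identityʳ _))
    (trans (*-congˡ (sym (expR-neg x))) (solve 3 (λ x e f → (con 1ℚ :+ x) :* (e :* f) := e :*
    (f :* (con 1ℚ :- :- x))) tt x (expR x) (expR (- x))))))
    (≤-trans (*-monoˡ-≤ (<⇒≤ (expR-pos x)) (expR*[1-u]≤1 (≤-by (<⇒≤ x<0)
      (solve 1 (λ x → con 0ℚ :- x := :- x :- con 0ℚ) tt x)) (≤-by (<⇒≤ gt)
      (solve 1 (λ x → (con 1ℚ :+ x) :- con 0ℚ := con 1ℚ :- :- x) tt x)))) (≤-reflexive (*-identityʳ _)))

  expR-convex : ∀ a b t → 0# ≤ t → t ≤ 1# → expR ((1# - t) * a + t * b) ≤ (1# - t) * expR a + t * expR b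
  expR-convex a b t t≥0 t≤1 = ≤-trans (≤-reflexive (solve 4 (λ e a b t → e := (con 1ℚ :- t) :*
    (e :* (con 1ℚ :+ (a :- ((con 1ℚ :- t) :* a :+ t :* b)))) :+ t :*
    (e :* (con 1ℚ :+ (b :- ((con 1ℚ :- t) :* a :+ t :* b))))) tt (expR m) a b t))
    (+-mono-≤ (*-monoˡ-≤ (≤⇒0≤ t≤1) (tangent a)) (*-monoˡ-≤ t≥0 (tangent b)))
    where
    m : R
    m = (1# - t) * a + t * b
    -- The tangent at the mean m lies below the graph, and the linear terms of the two tangent
    -- values cancel in the weighted sum.
    tangent : ∀ y → expR m * (1# + (y - m)) ≤ expR y
    tangent y = ≤-trans (*-monoˡ-≤ (<⇒≤ (expR-pos m)) (1+x≤expR-everywhere (y - m)))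
      (≤-reflexive (trans (sym (expR-+ _ _)) (expR-cong (solve 2 (λ m y → m :+ (y :- m) := y) tt m y))))

  mix-pos : ∀ {x y t} → 0# < x → 0# < y → 0# ≤ t → t ≤ 1# → 0# < (1# - t) * x + t * y
  mix-pos {x} {y} {t} x>0 y>0 t≥0 t≤1 = [ (λ t>0 → <-resp₂ refl (+-comm _ _)
    (+-pos (*-pos t>0 y>0) (*-nonneg (≤⇒0≤ t≤1) (<⇒≤ x>0)))) ,
    (λ e → <-resp₂ refl (trans (solve 2 (λ x y → x := (con 1ℚ :- con 0ℚ) :* x :+ con 0ℚ :* y) tt x y)
      (+-cong (*-congʳ (+-congˡ (-‿cong e))) (*-congʳ e))) x>0) ]′ (≤-split t≥0)

  module Concavity {n m : ℕ} (p : StablePosynomial n m) where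
    open Logarithm p
    open Branch p
    open Superadditive p

    logq-cong : ∀ {ρ ρ′} → (∀ i → ρ i ≈ ρ′ i) → logq ρ ≈ logq ρ′
    logq-cong h = *-congˡ (ln-cong (PR-pos _) (PR-cong h))

    logq-shift : ∀ ρ s → logq (λ i → ρ i + s) ≈ logq ρ + s
    logq-shift ρ s = trans (*-congˡ (sym (ln-unique (PR-pos _)
      (trans (expR-+ _ _) (trans (*-congʳ (expR-ln (PR-pos ρ))) (sym PR-shift))))))
      (trans (solve 4 (λ i l d s → i :* (l :+ d :* s) := i :* l :+ i :* d :* s) tt d⁻¹ (ln (PR ρ)) d s)
        (+-congˡ (trans (*-congʳ d⁻¹*d) (*-identityˡ s))))
      where
      PR-shift : PR (λ i → ρ i + s) ≈ PR ρ * expR (d * s)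
      PR-shift = re-cong (ctrans (csym (P-real _)) (ctrans (P-cong λ i → ofR-+ _ _)
        (ctrans (P-shift (ofR ∘ ρ) (ofR s)) (ctrans (*ᶜ-cong (P-real _)
          (ctrans (exp-cong (csym (ofR-* _ _))) (exp-ofR _))) (csym (ofR-* _ _))))))

    q-scale : ∀ ρ {r} → 0# < r → expR (logq (λ i → ρ i + ln r)) ≈ r * expR (logq ρ)
    q-scale ρ {r} r>0 = trans (expR-cong (logq-shift ρ (ln r)))
      (trans (expR-+ _ _) (trans (*-comm _ _) (*-congʳ (expR-ln r>0))))

    -- Superadditivity for (1 - t) X and t Y, the weights being pulled out by homogeneity. In
    -- logarithmic coordinates they appear as ln (1 - t) and ln t, so the endpoints t = 0 and t = 1
    -- are treated apart.
    q-concave : ∀ ξ η ζ t → 0# ≤ t → t ≤ 1# → (∀ i → expR (ζ i) ≈ (1# - t) * expR (ξ i) + t * expR (η i)) →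
      (1# - t) * expR (logq ξ) + t * expR (logq η) ≤ expR (logq ζ)
    q-concave ξ η ζ t t≥0 t≤1 mix = [ (λ t>0 → [ interior t>0 , at-one ]′ (≤-split t≤1)) , at-zero ]′ (≤-split t≥0)
      where
      interior : 0# < t → t < 1# → (1# - t) * expR (logq ξ) + t * expR (logq η) ≤ expR (logq ζ)
      interior t>0 t<1 = ≤-trans (≤-reflexive (sym (+-cong (q-scale ξ (<⇒0< t<1)) (q-scale η t>0))))
        (≤-trans (superadditive _ _) (≤-reflexive (expR-cong (logq-cong λ i → sym
          (ln-unique (+-pos (expR-pos _) (<⇒≤ (expR-pos _)))
          (trans (mix i) (sym (+-cong (trans (expR-+ _ _) (trans (*-comm _ _) (*-congʳ (expR-ln (<⇒0< t<1)))))
            (trans (expR-+ _ _) (trans (*-comm _ _) (*-congʳ (expR-ln t>0))))))))))))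
      at-zero : 0# ≈ t → (1# - t) * expR (logq ξ) + t * expR (logq η) ≤ expR (logq ζ)
      at-zero e = ≤-reflexive (trans (weights (expR (logq ξ)) (expR (logq η)))
        (expR-cong (logq-cong λ i → expR-injective (sym (trans (mix i) (weights (expR (ξ i)) (expR (η i))))))))
        where
        weights : ∀ x y → (1# - t) * x + t * y ≈ x
        weights x y = trans (+-cong (*-congʳ (+-congˡ (-‿cong (sym e)))) (*-congʳ (sym e)))
          (solve 2 (λ x y → (con 1ℚ :- con 0ℚ) :* x :+ con 0ℚ :* y := x) tt x y)
      at-one : t ≈ 1# → (1# - t) * expR (logq ξ) + t * expR (logq η) ≤ expR (logq ζ)
      at-one e = ≤-reflexive (trans (weights (expR (logq ξ)) (expR (logq η)))
        (expR-cong (logq-cong λ i → expR-injective (sym (trans (mix i) (weights (expR (ξ i)) (expR (η i))))))))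
        where
        weights : ∀ x y → (1# - t) * x + t * y ≈ y
        weights x y = trans (+-cong (*-congʳ (+-congˡ (-‿cong e))) (*-congʳ e))
          (solve 2 (λ x y → (con 1ℚ :- con 1ℚ) :* x :+ con 1ℚ :* y := y) tt x y)

    ln-concave : ∀ ξ η ζ t → 0# ≤ t → t ≤ 1# → (∀ i → expR (ζ i) ≈ (1# - t) * expR (ξ i) + t * expR (η i)) →
      (1# - t) * ln (PR ξ) + t * ln (PR η) ≤ ln (PR ζ)
    ln-concave ξ η ζ t t≥0 t≤1 mix = *-cancelˡ-≤ d⁻¹>0 (≤-trans
      (≤-reflexive (solve 4 (λ i a b t → i :* ((con 1ℚ :- t) :* a :+ t :* b) := (con 1ℚ :- t) :* (i :* a) :+ t :*
        (i :* b)) tt d⁻¹ (ln (PR ξ)) (ln (PR η)) t))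
      (expR-cancel-≤ (≤-trans (expR-convex _ _ t t≥0 t≤1) (q-concave ξ η ζ t t≥0 t≤1 mix))))

  -- Transfer to the definitions of the statement

  prodᶜ-exp : ∀ {n} (a : Fin n → R) (ω : Fin n → C) (f : Fin n → C) → (∀ i → f i ≈ᶜ exp (ofR (a i) *ᶜ ω i)) →
    foldr _*ᶜ_ 1ᶜ f ≈ᶜ exp (dot a ω)
  prodᶜ-exp {zero} a ω f e = csym exp-zero
  prodᶜ-exp {suc n} a ω f e = ctrans (*ᶜ-cong (e zero) (prodᶜ-exp (a ∘ suc) (ω ∘ suc) (f ∘ suc) (e ∘ suc)))
    (csym (exp-+ _ _))

  foldr-sum : ∀ {n} (f : Fin n → R) → foldr _+_ 0# f ≈ sum f
  foldr-sum {zero} f = refl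
  foldr-sum {suc n} f = +-congˡ (foldr-sum (f ∘ suc))

  -- The complex numbers of Defs enter only through this interface, so that they are never unfolded.
  module Model (ℂ′ : Set) (mk : R → R → ℂ′) (0′ 1′ : ℂ′) (re′ im′ : ℂ′ → R) (_+′_ _*′_ : ℂ′ → ℂ′ → ℂ′) (_•′_ : R → ℂ′ → ℂ′) (exp′ : ℂ′ → ℂ′)
    (re-0′ : re′ 0′ ≈ 0#) (im-0′ : im′ 0′ ≈ 0#) (re-1′ : re′ 1′ ≈ 1#) (im-1′ : im′ 1′ ≈ 0#)
    (re-mk : ∀ x y → re′ (mk x y) ≈ x) (im-mk : ∀ x y → im′ (mk x y) ≈ y)
    (re-+′ : ∀ z w → re′ (z +′ w) ≈ re′ z + re′ w) (im-+′ : ∀ z w → im′ (z +′ w) ≈ im′ z + im′ w)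
    (re-*′ : ∀ z w → re′ (z *′ w) ≈ re′ z * re′ w - im′ z * im′ w)
      (im-*′ : ∀ z w → im′ (z *′ w) ≈ re′ z * im′ w + im′ z * re′ w)
    (re-•′ : ∀ r z → re′ (r •′ z) ≈ r * re′ z) (im-•′ : ∀ r z → im′ (r •′ z) ≈ r * im′ z)
    (re-exp′ : ∀ z → re′ (exp′ z) ≈ re (exp (mkC (re′ z) (im′ z)))) (im-exp′ : ∀ z → im′ (exp′ z) ≈ im (exp (mkC (re′ z) (im′ z)))) where

    infix 4 _≈′_
    _≈′_ : ℂ′ → ℂ′ → Set
    z ≈′ w = re′ z ≈ re′ w × im′ z ≈ im′ w

    ofR′ : R → ℂ′
    ofR′ x = mk x 0#

    IsPi′ : R → Set
    IsPi′ ϖ = 0# < ϖ × im′ (exp′ (mk 0# ϖ)) ≈ 0# × (∀ t → 0# < t → t < ϖ → ¬ (im′ (exp′ (mk 0# t)) ≈ 0#))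

    PrincipalLog′ : ℂ′ → ℂ′ → Set
    PrincipalLog′ z w = exp′ w ≈′ z × ∃ λ ϖ → IsPi′ ϖ × - ϖ < im′ w × im′ w < ϖ

    to : ℂ′ → C
    to z = mkC (re′ z) (im′ z)

    from : C → ℂ′
    from z = mk (re z) (im z)

    to-from : ∀ z → to (from z) ≈ᶜ z
    to-from z = re-mk _ _ ,ᶜ im-mk _ _

    to-exp : ∀ z → to (exp′ z) ≈ᶜ exp (to z)
    to-exp z = re-exp′ z ,ᶜ im-exp′ z

    sin′ : ∀ t → im′ (exp′ (mk 0# t)) ≈ sin t
    sin′ t = im-cong (ctrans (to-exp _) (exp-cong (to-from (imag t))))

    π-isPi′ : IsPi′ π
    π-isPi′ = π>0 , trans (sin′ π) sin-π , λ t p q e → <⇒≉ (sin-pos p q) (sym (trans (sym (sin′ t)) e))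

    principal-log′ : ∀ {z w} → exp′ w ≈′ z → - π < im′ w → im′ w < π → PrincipalLog′ z w
    principal-log′ e p q = e , π , π-isPi′ , p , q

    -- The number ϖ playing the role of π comes with the hypothesis. Its minimality already excludes
    -- a nonzero imaginary part, so it need not be identified with `π`.
    real-log : ∀ {x w} → 0# < x → PrincipalLog′ (ofR′ x) w → to w ≈ᶜ ofR (ln x)
    real-log {x} {w} x>0 (e , ϖ , (_ , _ , least) , p , q) = ln-unique x>0
      (trans (sym (re-cong (exp-ofR _))) (re-cong (ctrans (exp-cong (refl ,ᶜ sym im≈0)) exp-w))) ,ᶜ im≈0
      where
      y : R
      y = im′ w
      exp-w : exp (to w) ≈ᶜ ofR x
      exp-w = ctrans (csym (to-exp w)) (trans (proj₁ e) (re-mk _ _) ,ᶜ trans (proj₂ e) (im-mk _ _))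
      sin-y : sin y ≈ 0#
      sin-y = *-cancelˡ-≈ (pos⇒≉0 (expR-pos (re′ w))) (trans (sym (im-exp (to w)))
        (trans (im-cong exp-w) (sym (zeroʳ _))))
      im≈0 : y ≈ 0#
      im≈0 with compare y 0#
      ... | inj₂ (inj₁ eq) = eq
      ... | inj₂ (inj₂ pos) = ⊥-elim (least y pos q (trans (sin′ y) sin-y))
      ... | inj₁ neg = ⊥-elim (least (- y) (neg-pos neg) (<-by p (solve 2 (λ y p → y :- :- p := p :- :- y) tt y ϖ))
              (trans (sin′ (- y)) (trans (sin-neg y) (trans (-‿cong sin-y) (solve 0 (:- con 0ℚ := con 0ℚ) tt)))))

    real-principal-log : ∀ {x} → 0# < x → PrincipalLog′ (ofR′ x) (from (ofR (ln x)))
    real-principal-log {x} x>0 = principal-log′ (trans (re-cong e) (sym (re-mk _ _)) , trans (im-cong e)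
      (sym (im-mk _ _)))
        (<-resp₂ refl (sym (im-mk _ _)) (<-by π>0 (solve 1 (λ p → p :- con 0ℚ := con 0ℚ :- :- p) tt π)))
          (<-resp₂ (sym (im-mk _ _)) refl π>0)
      where
      e : to (exp′ (from (ofR (ln x)))) ≈ᶜ ofR x
      e = ctrans (to-exp _) (ctrans (exp-cong (to-from _)) (ctrans (exp-ofR _) (ofR-cong (expR-ln x>0))))

    module Evaluation {n m : ℕ} (a : Fin m → Fin n → R) (c : Fin m → R) (d : R)
      (a≥0 : ∀ j i → 0# ≤ a j i) (c>0 : ∀ j → 0# < c j) (d>0 : 0# < d) (homogeneous : ∀ j → foldr _+_ 0# (a j) ≈ d) where

      -- This and the following graphs copy the definitions of the statement over the abstract
      -- interface; once the interface is instantiated they agree with them by computation.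
      evalLog′ : (Fin n → ℂ′) → ℂ′
      evalLog′ w = foldr _+′_ 0′ λ j → c j •′ foldr _*′_ 1′ (λ i → exp′ (a j i •′ w i))

      Value′ : (Fin n → ℂ′) → ℂ′ → Set
      Value′ z v = ∃ λ w → (∀ i → PrincipalLog′ (z i) (w i)) × evalLog′ w ≈′ v

      PowerOf′ : R → (Fin n → R) → R → Set
      PowerOf′ s x y = ∃ λ u → Value′ (ofR′ ∘ x) (ofR′ u) × ∃ λ w → PrincipalLog′ (ofR′ u) w × exp′
        (s •′ w) ≈′ ofR′ y

      LogOf′ : (Fin n → R) → R → Set
      LogOf′ x y = ∃ λ u → Value′ (ofR′ ∘ x) (ofR′ u) × PrincipalLog′ (ofR′ u) (ofR′ y)

      ConcaveOnPositive′ : ((Fin n → R) → R → Set) → Set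
      ConcaveOnPositive′ F =
        (∀ x → (∀ i → 0# < x i) → ∃ λ v → F x v) ×
        (∀ x y t → (∀ i → 0# < x i) → (∀ i → 0# < y i) → 0# ≤ t → t ≤ 1# →
         ∀ α β γ → F x α → F y β → F (λ i → (1# - t) * x i + t * y i) γ → (1# - t) * α + t * β ≤ γ)

      to-product : ∀ {k} (f : Fin k → ℂ′) → to (foldr _*′_ 1′ f) ≈ᶜ foldr _*ᶜ_ 1ᶜ (to ∘ f)
      to-product {zero} f = re-1′ ,ᶜ im-1′
      to-product {suc k} f = ctrans (trans (re-*′ _ _) (sym (re-* _ _)) ,ᶜ trans (im-*′ _ _) (sym (im-* _ _)))
        (*ᶜ-congˡ (to-product (f ∘ suc)))

      to-• : ∀ r z → to (r •′ z) ≈ᶜ ofR r *ᶜ to z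
      to-• r z = trans (re-•′ r z) (sym (re-ofR-* r (to z))) ,ᶜ trans (im-•′ r z) (sym (im-ofR-* r (to z)))

      to-sum : ∀ {k} (f : Fin k → ℂ′) → to (foldr _+′_ 0′ f) ≈ᶜ sumᶜ (to ∘ f)
      to-sum {zero} f = re-0′ ,ᶜ im-0′
      to-sum {suc k} f = ctrans (trans (re-+′ _ _) (sym (re-+ _ _)) ,ᶜ trans (im-+′ _ _) (sym (im-+ _ _)))
        (+ᶜ-congˡ (to-sum (f ∘ suc)))

      to-evalLog : ∀ w → to (evalLog′ w) ≈ᶜ posynomial a c (to ∘ w)
      to-evalLog w = ctrans (to-sum {m} (λ j → c j •′ foldr _*′_ 1′ (factor j)))
        (sumᶜ-cong {m} λ j → ctrans (to-• (c j) _) (*ᶜ-congˡ (ctrans (to-product {n} (factor j))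
          (prodᶜ-exp {n} (a j) (to ∘ w) (to ∘ factor j) λ i → ctrans (to-exp _) (exp-cong (to-• (a j i) (w i)))))))
        where
        factor : Fin m → Fin n → ℂ′
        factor j i = exp′ (a j i •′ w i)

      module Conclusion (stable : ∀ z → (∀ i → 0# < re′ (z i)) → ¬ Value′ z 0′) where

        p : StablePosynomial n m
        p = record { a = a ; c = c ; d = d ; a≥0 = a≥0 ; c>0 = c>0 ; d>0 = d>0
          ; homogeneous = λ j → trans (sym (foldr-sum (a j))) (homogeneous j)
          -- The tube lies in the range of the principal logarithm and exp maps it into the right
          -- half-plane, so ω itself supplies the logarithms that `Value′` asks for at z = exp ω.
          ; stable = λ ω t e → stable (exp′ ∘ from ∘ ω) (λ i → right-half-plane ω t i)
              (from ∘ ω , (λ i → principal-log′ (refl , refl) (lower ω t i) (upper ω t i)) ,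
               let e′ = ctrans (to-evalLog (from ∘ ω)) (ctrans (sumᶜ-cong {m} λ j → *ᶜ-congˡ (exp-cong (dot-cong (a j) λ i → to-from (ω i)))) e) in
               trans (re-cong e′) (sym re-0′) , trans (im-cong e′) (sym im-0′)) }
          where
          right-half-plane : ∀ ω → Tube {n} ω → ∀ i → 0# < re′ (exp′ (from (ω i)))
          right-half-plane ω t i = <-resp₂ refl (sym (re-cong (ctrans (to-exp _) (exp-cong (to-from (ω i))))))
            (<-resp₂ refl (sym (re-exp (ω i))) (*-pos (expR-pos _) (strip-cos-pos {ω i} (t i))))
          upper : ∀ ω → Tube {n} ω → ∀ i → im′ (from (ω i)) < π
          upper ω t i = <-resp₂ (sym (im-mk _ _)) refl (<-trans (proj₂ (∣∣<⇒ (t i))) π/2<π)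
          lower : ∀ ω → Tube {n} ω → ∀ i → - π < im′ (from (ω i))
          lower ω t i = <-resp₂ refl (sym (im-mk _ _)) (<-trans (neg-mono-< π/2<π) (proj₁ (∣∣<⇒ (t i))))

        open Logarithm p using (PR; PR-pos; P-real; P-cong)
        open Branch p using (logq; d⁻¹)
        open Concavity p using (q-concave; ln-concave)

        value-real : ∀ (x : Fin n → R) {u} → (∀ i → 0# < x i) → Value′ (ofR′ ∘ x) (ofR′ u) → u ≈ PR (ln ∘ x)
        value-real x {u} x>0 (w , logs , e) = trans (sym (re-mk u 0#))
          (trans (sym (proj₁ e)) (re-cong (ctrans (to-evalLog w)
          (ctrans (P-cong λ i → real-log (x>0 i) (logs i)) (P-real (ln ∘ x))))))

        real-value : ∀ (x : Fin n → R) → (∀ i → 0# < x i) → Value′ (ofR′ ∘ x) (ofR′ (PR (ln ∘ x)))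
        real-value x x>0 = (λ i → from (ofR (ln (x i)))) , (λ i → real-principal-log (x>0 i)) ,
          (trans (re-cong e) (sym (re-mk _ _)) , trans (im-cong e) (sym (im-mk _ _)))
          where
          e : to (evalLog′ (λ i → from (ofR (ln (x i))))) ≈ᶜ ofR (PR (ln ∘ x))
          e = ctrans (to-evalLog _) (ctrans (P-cong λ i → to-from (ofR (ln (x i)))) (P-real (ln ∘ x)))

        log-of : ∀ (x : Fin n → R) {y} → (∀ i → 0# < x i) → LogOf′ x y → y ≈ ln (PR (ln ∘ x))
        log-of x {y} x>0 (u , v , l) = let u≈ = value-real x x>0 v ; u>0 = <-resp₂ refl (sym u≈) (PR-pos (ln ∘ x)) in
          trans (sym (re-mk y 0#)) (trans (re-cong (real-log u>0 l)) (ln-cong u>0 u≈))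

        module Power (s : R) (d*s : d * s ≈ 1#) where

          power-of : ∀ (x : Fin n → R) {y} → (∀ i → 0# < x i) → PowerOf′ s x y → y ≈ expR (logq (ln ∘ x))
          power-of x {y} x>0 (u , v , w , l , e) = let u≈ = value-real x x>0 v ; u>0 = <-resp₂ refl (sym u≈) (PR-pos (ln ∘ x)) in
            trans (sym (re-mk y 0#)) (trans (sym (proj₁ e)) (re-cong (ctrans (to-exp _) (ctrans
              (exp-cong (ctrans (to-• s w) (ctrans (*ᶜ-cong (ofR-cong (⁻¹-unique d*s (pos⇒≉0 d>0)))
                (ctrans (real-log u>0 l) (ofR-cong (ln-cong u>0 u≈)))) (csym (ofR-* _ _)))))
              (exp-ofR _)))))

          mix : (Fin n → R) → (Fin n → R) → R → Fin n → R
          mix x y t i = (1# - t) * x i + t * y i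

          mix-logs : ∀ (x y : Fin n → R) {t} → (∀ i → 0# < x i) → (∀ i → 0# < y i) → 0# ≤ t → t ≤ 1# → ∀ i →
            expR (ln ((1# - t) * x i + t * y i)) ≈ (1# - t) * expR (ln (x i)) + t * expR (ln (y i))
          mix-logs x y x>0 y>0 t≥0 t≤1 i = trans (expR-ln (mix-pos (x>0 i) (y>0 i) t≥0 t≤1))
            (sym (+-cong (*-congˡ (expR-ln (x>0 i))) (*-congˡ (expR-ln (y>0 i)))))

          power-exists : ∀ x → (∀ i → 0# < x i) → ∃ λ v → PowerOf′ s x v
          power-exists x x>0 = expR (s * ln u) , u , real-value x x>0 , from (ofR (ln u)) , real-principal-log
            (PR-pos _) ,
              (trans (re-cong e) (sym (re-mk _ _)) , trans (im-cong e) (sym (im-mk _ _)))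
            where
            u : R
            u = PR (ln ∘ x)
            e : to (exp′ (s •′ from (ofR (ln u)))) ≈ᶜ ofR (expR (s * ln u))
            e = ctrans (to-exp _) (ctrans (exp-cong (ctrans (to-• s _)
              (ctrans (*ᶜ-congˡ (to-from _)) (csym (ofR-* _ _))))) (exp-ofR _))

          concave : ConcaveOnPositive′ (PowerOf′ s) × ConcaveOnPositive′ LogOf′
          concave = (power-exists , λ x y t x>0 y>0 t≥0 t≤1 α β γ fα fβ fγ →
              ≤-resp₂ (+-cong (*-congˡ (sym (power-of x x>0 fα))) (*-congˡ (sym (power-of y y>0 fβ))))
                (sym (power-of (mix x y t) (λ i → mix-pos (x>0 i) (y>0 i) t≥0 t≤1) fγ))
                (q-concave (ln ∘ x) (ln ∘ y) (ln ∘ mix x y t) t t≥0 t≤1 (mix-logs x y x>0 y>0 t≥0 t≤1))) ,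
            ((λ x x>0 → ln (PR (ln ∘ x)) , PR (ln ∘ x) , real-value x x>0 , real-principal-log (PR-pos _)) ,
             λ x y t x>0 y>0 t≥0 t≤1 α β γ fα fβ fγ →
              ≤-resp₂ (+-cong (*-congˡ (sym (log-of x x>0 fα))) (*-congˡ (sym (log-of y y>0 fβ))))
                (sym (log-of (mix x y t) (λ i → mix-pos (x>0 i) (y>0 i) t≥0 t≤1) fγ))
                (ln-concave (ln ∘ x) (ln ∘ y) (ln ∘ mix x y t) t t≥0 t≤1 (mix-logs x y x>0 y>0 t≥0 t≤1)))

open import Defs

-- The Cauchy reals as a complete archimedean ordered field

-- The ring laws hold term by term on the sequences, as propositional equalities of rationals.
pointwise : ∀ {x y} → (∀ k → seq x k ≡ seq y k) → x ≈ y
pointwise {x} {y} h ε 0<ε = 0 , λ k _ →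
  ≡.subst (_<ℚ ε) (≡.sym (≡.trans (≡.cong (λ q → ℚ.∣ seq x k ℚ.- q ∣) (≡.sym (h k)))
    (≡.cong ℚ.∣_∣ (ℚ.+-inverseʳ (seq x k))))) 0<ε

≈-refl : ∀ {x} → x ≈ x
≈-refl {x} = pointwise {x} {x} λ _ → ≡.refl

≈-sym : ∀ {x y} → x ≈ y → y ≈ x
≈-sym {x} {y} p ε 0<ε = let N , h = p ε 0<ε in N , λ k N≤k → ≡.subst (_<ℚ ε) (∣-∣-swap (seq x k) (seq y k)) (h k N≤k)

⊔-left : ∀ {m n k} → m ℕ.⊔ n ℕ.≤ k → m ℕ.≤ k
⊔-left {m} {n} = ℕ.≤-trans (ℕ.m≤m⊔n m n)

⊔-right : ∀ {m n k} → m ℕ.⊔ n ℕ.≤ k → n ℕ.≤ k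
⊔-right {m} {n} = ℕ.≤-trans (ℕ.m≤n⊔m m n)

≈-trans : ∀ {x y z} → x ≈ y → y ≈ z → x ≈ z
≈-trans {x} {y} {z} p q ε 0<ε = let N , h = p (½ ℚ.* ε) (half-pos 0<ε) ; M , g = q (½ ℚ.* ε) (half-pos 0<ε) in
  N ℕ.⊔ M , λ k le → ℚ.≤-<-trans (triangle (seq x k) (seq y k) (seq z k))
    (≡.subst (ℚ.∣ seq x k ℚ.- seq y k ∣ ℚ.+ ℚ.∣ seq y k ℚ.- seq z k ∣ <ℚ_) (halves ε)
      (ℚ.+-mono-< (h k (⊔-left le)) (g k (⊔-right {N} le))))

+ℝ-cong : ∀ {x x′ y y′} → x ≈ x′ → y ≈ y′ → x +ℝ y ≈ x′ +ℝ y′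
+ℝ-cong {x} {x′} {y} {y′} p q ε 0<ε = let N , h = p (½ ℚ.* ε) (half-pos 0<ε) ; M , g = q (½ ℚ.* ε) (half-pos 0<ε) in
  N ℕ.⊔ M , λ k le → ≡.subst₂ _<ℚ_ ≡.refl (halves ε) (ℚ.≤-<-trans
    (≡.subst (λ u → ℚ.∣ u ∣ ≤ℚ ℚ.∣ seq x k ℚ.- seq x′ k ∣ ℚ.+ ℚ.∣ seq y k ℚ.- seq y′ k ∣)
      (identity04 (seq x k) (seq x′ k) (seq y k) (seq y′ k)) (ℚ.∣p+q∣≤∣p∣+∣q∣ (seq x k ℚ.- seq x′ k)
        (seq y k ℚ.- seq y′ k)))
    (ℚ.+-mono-< (h k (⊔-left le)) (g k (⊔-right {N} le))))

-ℝ-cong : ∀ {x y} → x ≈ y → -ℝ x ≈ -ℝ y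
-ℝ-cong {x} {y} p ε 0<ε = let N , h = p ε 0<ε in N , λ k le →
  ≡.subst (_<ℚ ε) (≡.trans (≡.sym (ℚ.∣-p∣≡∣p∣ (seq x k ℚ.- seq y k)))
    (≡.cong ℚ.∣_∣ (identity05 (seq x k) (seq y k)))) (h k le)

*ℝ-cong : ∀ {x x′ y y′} → x ≈ x′ → y ≈ y′ → x *ℝ y ≈ x′ *ℝ y′
*ℝ-cong {x} {x′} {y} {y′} p q ε 0<ε =
  let A , 0<A , N₁ , hA = tail-bound (seq x′) (cauchy x′)
      B , 0<B , N₂ , hB = tail-bound (seq y) (cauchy y)
      N₃ , h = p (inv 0<B ℚ.* (½ ℚ.* ε)) (*-pos (inv-pos 0<B) (half-pos 0<ε))
      N₄ , g = q (inv 0<A ℚ.* (½ ℚ.* ε)) (*-pos (inv-pos 0<A) (half-pos 0<ε))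
  in (N₁ ℕ.⊔ N₂) ℕ.⊔ (N₃ ℕ.⊔ N₄) , λ k le →
    let le₁ = ⊔-left {N₁ ℕ.⊔ N₂} le ; le₂ = ⊔-right {N₁ ℕ.⊔ N₂} le in
    ≡.subst (ℚ.∣ seq x k ℚ.* seq y k ℚ.- seq x′ k ℚ.* seq y′ k ∣ <ℚ_) (halves ε)
      (ℚ.≤-<-trans (split (seq x k) (seq x′ k) (seq y k) (seq y′ k))
        (ℚ.+-mono-<
          (scaled (seq x k ℚ.- seq x′ k) (seq y k) 0<B (hB k (⊔-right {N₁} le₁)) (h k (⊔-left le₂)))
          (scaled (seq y k ℚ.- seq y′ k) (seq x′ k) 0<A (hA k (⊔-left le₁)) (g k (⊔-right {N₃} le₂)))))

ℝ-isCommutativeRing : IsCommutativeRing _≈_ _+ℝ_ _*ℝ_ -ℝ_ 0ℝ 1ℝ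
ℝ-isCommutativeRing = record
  { isRing = record
    { +-isAbelianGroup = record
      { isGroup = record
        { isMonoid = record
          { isSemigroup = record
            { isMagma = record
              { isEquivalence = record
                { refl = λ {x} → ≈-refl {x} ; sym = λ {x} {y} → ≈-sym {x} {y} ; trans = λ {x} {y} {z} → ≈-trans {x}
                  {y} {z} }
              ; ∙-cong = λ {x} {x′} {y} {y′} → +ℝ-cong {x} {x′} {y} {y′} }
            ; assoc = λ x y z → pointwise {(x +ℝ y) +ℝ z} {x +ℝ (y +ℝ z)} λ k → ℚ.+-assoc (seq x k) (seq y k)
              (seq z k) }
          ; identity = (λ x → pointwise {0ℝ +ℝ x} {x} λ k → ℚ.+-identityˡ (seq x k)) ,
            (λ x → pointwise {x +ℝ 0ℝ} {x} λ k → ℚ.+-identityʳ (seq x k)) }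
        ; inverse = (λ x → pointwise { -ℝ x +ℝ x} {0ℝ} λ k → ℚ.+-inverseˡ (seq x k)) ,
          (λ x → pointwise {x +ℝ -ℝ x} {0ℝ} λ k → ℚ.+-inverseʳ (seq x k))
        ; ⁻¹-cong = λ {x} {y} → -ℝ-cong {x} {y} }
      ; comm = λ x y → pointwise {x +ℝ y} {y +ℝ x} λ k → ℚ.+-comm (seq x k) (seq y k) }
    ; *-cong = λ {x} {x′} {y} {y′} → *ℝ-cong {x} {x′} {y} {y′}
    ; *-assoc = λ x y z → pointwise {(x *ℝ y) *ℝ z} {x *ℝ (y *ℝ z)} λ k → ℚ.*-assoc (seq x k) (seq y k) (seq z k)
    ; *-identity = (λ x → pointwise {1ℝ *ℝ x} {x} λ k → ℚ.*-identityˡ (seq x k)) ,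
      (λ x → pointwise {x *ℝ 1ℝ} {x} λ k → ℚ.*-identityʳ (seq x k))
    ; distrib = (λ x y z → pointwise {x *ℝ (y +ℝ z)} {x *ℝ y +ℝ x *ℝ z} λ k → ℚ.*-distribˡ-+ (seq x k) (seq y k)
      (seq z k)) ,
                (λ x y z → pointwise {(y +ℝ z) *ℝ x} {y *ℝ x +ℝ z *ℝ x} λ k → ℚ.*-distribʳ-+ (seq x k) (seq y k)
                  (seq z k)) }
  ; *-comm = λ x y → pointwise {x *ℝ y} {y *ℝ x} λ k → ℚ.*-comm (seq x k) (seq y k) }

∣∣<⇒ : ∀ {a b ε} → ℚ.∣ a ℚ.- b ∣ <ℚ ε → a ℚ.- b <ℚ ε
∣∣<⇒ {a} {b} lt = ℚ.≤-<-trans (p≤∣p∣ (a ℚ.- b)) lt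
  where
  p≤∣p∣ : ∀ p → p ≤ℚ ℚ.∣ p ∣
  p≤∣p∣ p with ℚ.≤-total 0ℚ p
  ... | inj₁ le = ℚ.≤-reflexive (≡.sym (ℚ.0≤p⇒∣p∣≡p le))
  ... | inj₂ le = ℚ.≤-trans le (ℚ.0≤∣p∣ p)

∣∣<⇒′ : ∀ {a b ε} → ℚ.∣ a ℚ.- b ∣ <ℚ ε → b ℚ.- a <ℚ ε
∣∣<⇒′ {a} {b} {ε} lt = ∣∣<⇒ {b} {a} (≡.subst (_<ℚ ε) (∣-∣-swap a b) lt)

module _ where
  open import Data.Rational.Base using () renaming (_+_ to _⊞_; _-_ to _⊟_; _*_ to _⊠_)
  open +-*-Solver

  shift-by : ∀ {p q r s} → p ≤ℚ q → q ⊟ p ≡ s ⊟ r → r ≤ℚ s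
  shift-by {p} {q} {r} {s} p≤q e = ≡.subst₂ _≤ℚ_ (solve 2 (λ p r → p :+ (r :- p) := r) ≡.refl p r)
    (≡.trans (solve 3 (λ p q r → q :+ (r :- p) := (q :- p) :+ r) ≡.refl p q r)
      (≡.trans (≡.cong (_⊞ r) e) (solve 2 (λ r s → (s :- r) :+ r := s) ≡.refl r s)))
    (ℚ.+-monoˡ-≤ (r ⊟ p) p≤q)

  <-resp₂ℝ : ∀ {x x′ y y′} → x ≈ x′ → y ≈ y′ → x < y → x′ < y′
  <-resp₂ℝ {x} {x′} {y} {y′} p q (ε , 0<ε , N , h) =
    let M , g = p (⅓ ⊠ ε) (third-pos 0<ε) ; L , f = q (⅓ ⊠ ε) (third-pos 0<ε) in
    ⅓ ⊠ ε , third-pos 0<ε , N ℕ.⊔ (M ℕ.⊔ L) , λ k le →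
      let le′ = ⊔-right {N} le
          a = ∣∣<⇒′ {seq x k} {seq x′ k} (g k (⊔-left le′))
          b = ∣∣<⇒ {seq y k} {seq y′ k} (f k (⊔-right {M} le′))
      in shift-by (ℚ.+-mono-≤ (ℚ.+-mono-≤ (ℚ.<⇒≤ a) (ℚ.<⇒≤ b)) (h k (⊔-left le)))
        (solve 5 (λ e u u' v v' → ((con ⅓ :* e :+ con ⅓ :* e) :+ (v :- u)) :- (((u' :- u) :+ (v :- v')) :+ e) :=
          (v' :- u') :- con ⅓ :* e)
          ≡.refl ε (seq x k) (seq x′ k) (seq y k) (seq y′ k))

  <-irreflℝ : ∀ {x} → ¬ (x < x)
  <-irreflℝ {x} (ε , 0<ε , N , h) = ℚ.<-irrefl ≡.refl (ℚ.<-≤-trans 0<ε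
    (≡.subst (ε ≤ℚ_) (ℚ.+-inverseʳ (seq x N)) (h N ℕ.≤-refl)))

  <-transℝ : ∀ {x y z} → x < y → y < z → x < z
  <-transℝ {x} {y} {z} (ε , 0<ε , N , h) (δ , 0<δ , M , g) = ε , 0<ε , N ℕ.⊔ M , λ k le →
    shift-by (ℚ.+-mono-≤ (ℚ.+-mono-≤ (h k (⊔-left le)) (g k (⊔-right {N} le))) (ℚ.<⇒≤ 0<δ))
      (solve 5 (λ e d u v w → (((v :- u) :+ (w :- v)) :+ d) :- ((e :+ d) :+ con 0ℚ) := (w :- u) :- e) ≡.refl ε δ
        (seq x k) (seq y k) (seq z k))

  -- a gap of ε at one late index persists as a gap of ε/3
  late-gap : ∀ x y ε → 0ℚ <ℚ ε → ∀ N → (∀ m n → N ℕ.≤ m → N ℕ.≤ n → ℚ.∣ seq x m ⊟ seq x n ∣ <ℚ ⅓ ⊠ ε) →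
    (∀ m n → N ℕ.≤ m → N ℕ.≤ n → ℚ.∣ seq y m ⊟ seq y n ∣ <ℚ ⅓ ⊠ ε) → ∀ k → N ℕ.≤ k → ε ≤ℚ seq y k ⊟ seq x k → x < y
  late-gap x y ε 0<ε N hx hy k N≤k gap = ⅓ ⊠ ε , third-pos 0<ε , N , λ j N≤j →
    shift-by (ℚ.+-mono-≤ (ℚ.+-mono-≤ gap (ℚ.<⇒≤ (∣∣<⇒′ {seq x k} {seq x j} (hx k j N≤k N≤j))))
      (ℚ.<⇒≤ (∣∣<⇒ {seq y k} {seq y j} (hy k j N≤k N≤j))))
      (solve 5 (λ e u u' v v' → (((v :- u) :+ con ⅓ :* e) :+ con ⅓ :* e) :- ((e :+ (u' :- u)) :+ (v :- v')) :=
        (v' :- u') :- con ⅓ :* e)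
        ≡.refl ε (seq x k) (seq x j) (seq y k) (seq y j))

  -- If neither number is below the other, then by `late-gap` no late index can separate the two
  -- sequences by ε, which is their equality.
  compareℝ : (∀ {P : Set} → Dec P) → ∀ x y → x < y ⊎ x ≈ y ⊎ y < x
  compareℝ lem x y with lem {x < y} | lem {y < x}
  ... | yes p | _ = inj₁ p
  ... | no _ | yes q = inj₂ (inj₂ q)
  ... | no ¬p | no ¬q = inj₂ (inj₁ close)
    where
    close : x ≈ y
    close ε 0<ε = N , near
      where
      cx : ∃ λ N → ∀ m n → N ℕ.≤ m → N ℕ.≤ n → ℚ.∣ seq x m ⊟ seq x n ∣ <ℚ ⅓ ⊠ ε
      cx = cauchy x (⅓ ⊠ ε) (third-pos 0<ε)
      cy : ∃ λ N → ∀ m n → N ℕ.≤ m → N ℕ.≤ n → ℚ.∣ seq y m ⊟ seq y n ∣ <ℚ ⅓ ⊠ ε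
      cy = cauchy y (⅓ ⊠ ε) (third-pos 0<ε)
      N : ℕ
      N = proj₁ cx ℕ.⊔ proj₁ cy
      hx : ∀ m n → N ℕ.≤ m → N ℕ.≤ n → ℚ.∣ seq x m ⊟ seq x n ∣ <ℚ ⅓ ⊠ ε
      hx m n p q = proj₂ cx m n (⊔-left p) (⊔-left q)
      hy : ∀ m n → N ℕ.≤ m → N ℕ.≤ n → ℚ.∣ seq y m ⊟ seq y n ∣ <ℚ ⅓ ⊠ ε
      hy m n p q = proj₂ cy m n (⊔-right {proj₁ cx} p) (⊔-right {proj₁ cx} q)
      near : ∀ k → N ℕ.≤ k → ℚ.∣ seq x k ⊟ seq y k ∣ <ℚ ε
      near k le with ℚ._<?_ (ℚ.∣ seq x k ⊟ seq y k ∣) ε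
      ... | yes lt = lt
      ... | no ¬lt = ⊥-elim (cases (ℚ.≤-total 0ℚ (seq x k ⊟ seq y k)))
        where
        far : ε ≤ℚ ℚ.∣ seq x k ⊟ seq y k ∣
        far = ℚ.≮⇒≥ ¬lt
        cases : 0ℚ ≤ℚ seq x k ⊟ seq y k ⊎ seq x k ⊟ seq y k ≤ℚ 0ℚ → ⊥
        cases (inj₁ pos) = ¬q (late-gap y x ε 0<ε N hy hx k le (≡.subst (ε ≤ℚ_) (ℚ.0≤p⇒∣p∣≡p pos) far))
        cases (inj₂ neg) = ¬p (late-gap x y ε 0<ε N hx hy k le (≡.subst (ε ≤ℚ_)
          (≡.trans (∣-∣-swap (seq x k) (seq y k)) (ℚ.0≤p⇒∣p∣≡p
            (shift-by neg (solve 2 (λ u v → con 0ℚ :- (u :- v) := (v :- u) :- con 0ℚ) ≡.refl (seq x k) (seq y k)))))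
            far))

  +-monoˡ-<ℝ : ∀ z {x y} → x < y → x +ℝ z < y +ℝ z
  +-monoˡ-<ℝ z {x} {y} (ε , 0<ε , N , h) = ε , 0<ε , N , λ k le →
    ≡.subst (ε ≤ℚ_) (solve 3 (λ u v w → v :- u := (v :+ w) :- (u :+ w)) ≡.refl (seq x k) (seq y k) (seq z k))
      (h k le)

  *-posℝ : ∀ {x y} → 0ℝ < x → 0ℝ < y → 0ℝ < x *ℝ y
  *-posℝ {x} {y} (ε , 0<ε , N , h) (δ , 0<δ , M , g) = ε ⊠ δ , *-pos 0<ε 0<δ , N ℕ.⊔ M , λ k le →
    let a = ≡.subst (ε ≤ℚ_) (ℚ.+-identityʳ (seq x k)) (h k (⊔-left le))
        b = ≡.subst (δ ≤ℚ_) (ℚ.+-identityʳ (seq y k)) (g k (⊔-right {N} le))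
    in ≡.subst (ε ⊠ δ ≤ℚ_) (≡.sym (ℚ.+-identityʳ (seq x k ⊠ seq y k)))
      (*-mono-≤ (ℚ.<⇒≤ 0<ε) (ℚ.≤-trans (ℚ.<⇒≤ 0<δ) b) a b)

  fromℚ-posℝ : ∀ q → 0ℚ <ℚ q → 0ℝ < fromℚ q
  fromℚ-posℝ q 0<q = q , 0<q , 0 , λ k _ → ℚ.≤-reflexive (≡.sym (ℚ.+-identityʳ q))

  recip-cancel : ∀ x (p : 0ℝ < x) → x *ℝ recip x p ≈ 1ℝ
  recip-cancel x p@(ε , 0<ε , N , h) δ 0<δ = N , λ k le → ≡.subst (_<ℚ δ) (≡.sym (≡.trans
    (≡.cong (λ q → ℚ.∣ q ⊟ 1ℚ ∣) (≡.trans (≡.cong (_⊠ recipSeq x ε 0<ε k) (≡.sym (tail k le)))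
      (≡.trans (ℚ.*-comm (seq x k ℚ.⊔ ε) (recipSeq x ε 0<ε k)) (inv-cancel (⊔-pos x ε 0<ε k))))) ≡.refl)) 0<δ
    where
    tail : ∀ k → N ℕ.≤ k → seq x k ℚ.⊔ ε ≡ seq x k
    tail k le = ℚ.p≥q⇒p⊔q≡p (≡.subst (ε ≤ℚ_) (ℚ.+-identityʳ (seq x k)) (h k le))

  archimedeanℝ : ∀ x → ∃ λ k → x < fromℚ (ι k)
  archimedeanℝ x =
    let B , _ , N , h = tail-bound (seq x) (cauchy x) ; K , le = archimedean (B ⊞ 1ℚ) in
    K , 1ℚ , ℚ.positive⁻¹ 1ℚ , N , λ k N≤k →
      shift-by (ℚ.+-mono-≤ le (ℚ.≤-trans (p≤∣p∣ (seq x k)) (h k N≤k)))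
        (solve 3 (λ b i u → (i :+ b) :- ((b :+ con 1ℚ) :+ u) := (i :- u) :- con 1ℚ) ≡.refl B (ι K) (seq x k))
    where
    p≤∣p∣ : ∀ p → p ≤ℚ ℚ.∣ p ∣
    p≤∣p∣ p with ℚ.≤-total 0ℚ p
    ... | inj₁ le = ℚ.≤-reflexive (≡.sym (ℚ.0≤p⇒∣p∣≡p le))
    ... | inj₂ le = ℚ.≤-trans le (ℚ.0≤∣p∣ p)

  1/suc-pos : ∀ n → 0ℚ <ℚ 1/suc n
  1/suc-pos n = ℚ.positive⁻¹ (1/suc n) {{ℚ.normalize-pos 1 (suc n)}}

  1/suc-small : ∀ ε → 0ℚ <ℚ ε → ∃ λ N → ∀ n → N ℕ.≤ n → 1/suc n <ℚ ε
  1/suc-small ε 0<ε = let J , le = archimedean (inv 0<ε) in J , λ n J≤n →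
    ℚ.*-cancelˡ-<-nonNeg (ι (suc n)) {{ℚ.nonNegative (ι-nonNeg (suc n))}} (≡.subst₂ _<ℚ_
      (≡.trans (≡.sym (1/suc-cancel n)) (ℚ.*-comm (1/suc n) (ι (suc n)))) ≡.refl
      (≡.subst (_<ℚ ι (suc n) ⊠ ε) (inv-cancel 0<ε) (ℚ.*-monoˡ-<-pos ε {{ℚ.positive 0<ε}}
        (ℚ.≤-<-trans le (ℚ.≤-<-trans (ι-mono J≤n) (≡.subst (_<ℚ ι (suc n)) (ℚ.+-identityˡ (ι n))
          (ℚ.+-monoˡ-< (ι n) (ℚ.positive⁻¹ 1ℚ))))))))

  -- The limit takes from `s n` its term at an index after which `s n` varies by less than 1/(n +
  -- 1). That rational is within 1/(n + 1) of the late terms of `s n`, so the Cauchy property passes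
  -- from s to the sequence r.
  module Complete (s : ℕ → ℝ)
    (h : ∀ ε → 0ℝ < ε → ∃ λ N → ∀ m n → N ℕ.≤ m → N ℕ.≤ n → s m < s n +ℝ ε) where

    index : ℕ → ℕ
    index n = proj₁ (cauchy (s n) (1/suc n) (1/suc-pos n))

    settled : ∀ n j k → index n ℕ.≤ j → index n ℕ.≤ k → ℚ.∣ seq (s n) j ⊟ seq (s n) k ∣ <ℚ 1/suc n
    settled n = proj₂ (cauchy (s n) (1/suc n) (1/suc-pos n))

    r : ℕ → ℚ
    r n = seq (s n) (index n)

    r-upper : ∀ ε → 0ℚ <ℚ ε → ∃ λ N → ∀ m n → N ℕ.≤ m → N ℕ.≤ n → r m ⊟ r n <ℚ ε
    r-upper ε 0<ε =
      let N , f = h (fromℚ (⅓ ⊠ ε)) (fromℚ-posℝ _ (third-pos 0<ε)) ; M , g = 1/suc-small (⅓ ⊠ ε) (third-pos 0<ε) in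
      N ℕ.⊔ M , λ m n p q →
        let δ , 0<δ , L , gap = f m n (⊔-left p) (⊔-left q)
            k = L ℕ.⊔ (index m ℕ.⊔ index n)
            im≤k = ℕ.≤-trans (ℕ.m≤m⊔n (index m) (index n)) (ℕ.m≤n⊔m L _)
            in≤k = ℕ.≤-trans (ℕ.m≤n⊔m (index m) (index n)) (ℕ.m≤n⊔m L _)
            a = ℚ.<-trans (∣∣<⇒ {r m} {seq (s m) k} (settled m (index m) k ℕ.≤-refl im≤k)) (g m (⊔-right {N} p))
            b = ℚ.<-trans (∣∣<⇒′ {r n} {seq (s n) k} (settled n (index n) k ℕ.≤-refl in≤k)) (g n (⊔-right {N} q))
            c = ℚ.≤-trans (ℚ.<⇒≤ 0<δ) (gap k (ℕ.m≤m⊔n L _))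
        in ℚ.≤-<-trans (shift-by c (solve 5 (λ e u v u' v' → ((v' :+ con ⅓ :* e) :- u') :- con 0ℚ := (((u :- u') :+ (v' :- v)) :+ con ⅓ :* e) :- (u :- v)) ≡.refl ε (r m) (r n) (seq (s m) k) (seq (s n) k)))
             (≡.subst (((r m ⊟ seq (s m) k) ⊞ (seq (s n) k ⊟ r n)) ⊞ ⅓ ⊠ ε <ℚ_) (thirds ε)
               (ℚ.+-monoˡ-< (⅓ ⊠ ε) (ℚ.+-mono-< a b)))

    ∣∣-lub : ∀ {p q} → p <ℚ q → ℚ.- p <ℚ q → ℚ.∣ p ∣ <ℚ q
    ∣∣-lub {p} {q} lt lt′ with ℚ.≤-total 0ℚ p
    ... | inj₁ le = ≡.subst (_<ℚ q) (≡.sym (ℚ.0≤p⇒∣p∣≡p le)) lt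
    ... | inj₂ le = ≡.subst (_<ℚ q) (≡.trans (≡.sym (ℚ.0≤p⇒∣p∣≡p (ℚ.neg-antimono-≤ le))) (ℚ.∣-p∣≡∣p∣ p)) lt′

    r-cauchy : Cauchy r
    r-cauchy ε 0<ε = let N , f = r-upper ε 0<ε in N , λ m n p q →
      ∣∣-lub (f m n p q) (≡.subst (_<ℚ ε) (identity03 (r n) (r m)) (f n m q p))

    limit : ℝ
    limit = mkℝ r r-cauchy

    limit-spec : ∀ ε → 0ℝ < ε → ∃ λ N → ∀ n → N ℕ.≤ n → s n < limit +ℝ ε × limit < s n +ℝ ε
    limit-spec x (ε , 0<ε , M , f) =
      let N , g = r-upper (⅓ ⊠ ε) (third-pos 0<ε) ; L , q = 1/suc-small (⅓ ⊠ ε) (third-pos 0<ε) in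
      N ℕ.⊔ L , λ n p →
        let K = (M ℕ.⊔ N) ℕ.⊔ index n
            tail : ∀ {k} → K ℕ.≤ k → ε ≤ℚ seq x k ⊟ 0ℚ
            tail le = f _ (⊔-left (⊔-left {M ℕ.⊔ N} le))
            N≤ : ∀ {k} → K ℕ.≤ k → N ℕ.≤ k
            N≤ le = ⊔-right {M} (⊔-left {M ℕ.⊔ N} le)
            near = λ {k} (le : K ℕ.≤ k) → settled n (index n) k ℕ.≤-refl (⊔-right {M ℕ.⊔ N} le)
        in (⅓ ⊠ ε , third-pos 0<ε , K , λ k le →
              shift-by (ℚ.+-mono-≤ (ℚ.+-mono-≤ (tail le) (ℚ.<⇒≤ (g n k (⊔-left p) (N≤ le))))
                (ℚ.<⇒≤ (ℚ.<-trans (∣∣<⇒′ {r n} {seq (s n) k} (near le)) (q n (⊔-right {N} p)))))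
                (solve 5 (λ e y u v w → (((y :- con 0ℚ) :+ con ⅓ :* e) :+ con ⅓ :* e) :-
                  ((e :+ (u :- v)) :+ (w :- u)) := ((v :+ y) :- w) :- con ⅓ :* e) ≡.refl ε (seq x k) (r n) (r k)
                  (seq (s n) k))) ,
           (⅓ ⊠ ε , third-pos 0<ε , K , λ k le →
              shift-by (ℚ.+-mono-≤ (ℚ.+-mono-≤ (tail le) (ℚ.<⇒≤ (g k n (N≤ le) (⊔-left p))))
                (ℚ.<⇒≤ (ℚ.<-trans (∣∣<⇒ {r n} {seq (s n) k} (near le)) (q n (⊔-right {N} p)))))
                (solve 5 (λ e y u v w → (((y :- con 0ℚ) :+ con ⅓ :* e) :+ con ⅓ :* e) :-
                  ((e :+ (v :- u)) :+ (u :- w)) := ((w :+ y) :- v) :- con ⅓ :* e) ≡.refl ε (seq x k) (r n) (r k)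
                  (seq (s n) k)))

ℝ-reals : ExcludedMiddle 0ℓ → Reals
ℝ-reals lem = record
  { R = ℝ ; _≈_ = _≈_ ; _<_ = _<_ ; _+_ = _+ℝ_ ; _*_ = _*ℝ_ ; -_ = -ℝ_ ; fromℚ = fromℚ
  ; isCommutativeRing = ℝ-isCommutativeRing
  ; fromℚ-+ = λ p q → ≈-refl {fromℚ (p ℚ.+ q)}
  ; fromℚ-* = λ p q → ≈-refl {fromℚ (p ℚ.* q)}
  ; fromℚ-neg = λ p → ≈-refl {fromℚ (ℚ.- p)}
  ; fromℚ-pos = fromℚ-posℝ
  ; <-resp₂ = λ {x} {x′} {y} {y′} → <-resp₂ℝ {x} {x′} {y} {y′}
  ; <-irrefl = λ {x} → <-irreflℝ {x}
  ; <-trans = λ {x} {y} {z} → <-transℝ {x} {y} {z}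
  ; compare = compareℝ (lem)
  ; +-monoˡ-< = λ z {x} {y} → +-monoˡ-<ℝ z {x} {y}
  ; *-pos = λ {x} {y} → *-posℝ {x} {y}
  ; reciprocal = λ x p → recip x p , recip-cancel x p
  ; archimedean = archimedeanℝ
  ; complete = λ s h → Complete.limit s h , Complete.limit-spec s h
  ; lem = lem }

-- The exponential of the statement as an instance

eventually-≤ : ∀ {x y} N → (∀ k → N ℕ.≤ k → seq x k ≤ℚ seq y k) → x ≤ y
eventually-≤ {x} {y} N h (δ , 0<δ , M , g) = ℚ.<-irrefl ≡.refl (ℚ.<-≤-trans 0<δ
  (ℚ.≤-trans (g (N ℕ.⊔ M) (ℕ.m≤n⊔m N M))
    (≡.subst (seq x (N ℕ.⊔ M) ℚ.- seq y (N ℕ.⊔ M) ≤ℚ_) (ℚ.+-inverseʳ (seq y (N ℕ.⊔ M)))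
      (ℚ.+-monoˡ-≤ (ℚ.- seq y (N ℕ.⊔ M)) (h (N ℕ.⊔ M) (ℕ.m≤m⊔n N M))))))

-- The exponential was defined as the diagonal of its partial sums. A tail estimate uniform in the
-- index of approximation puts the diagonal close to every late partial sum as real numbers.
diagonal-close : (X : ℕ → ℝ) (c : Cauchy (λ k → seq (X k) k)) →
  (∀ ε → 0ℚ <ℚ ε → ∃ λ m → ∃ λ N → ∀ n i → m ℕ.≤ n → N ℕ.≤ i → ℚ.∣ seq (X n) i ℚ.- seq (X m) i ∣ <ℚ ε) →
  ∀ ε → 0ℝ < ε → ∃ λ m → ∀ n → m ℕ.≤ n → mkℝ (λ k → seq (X k) k) c ≤ X n +ℝ ε × X n ≤ mkℝ (λ k → seq (X k) k) c +ℝ ε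
diagonal-close X c h x (ε , 0<ε , M , f) =
  let m , N , near = h (½ ℚ.* ε) (half-pos 0<ε) ; L = (m ℕ.⊔ N) ℕ.⊔ M in
  m , λ n m≤n →
    let close : ∀ i → L ℕ.≤ i → ℚ.∣ seq (X i) i ℚ.- seq (X n) i ∣ <ℚ ε
        close i le = ≡.subst (ℚ.∣ seq (X i) i ℚ.- seq (X n) i ∣ <ℚ_) (halves ε)
          (ℚ.≤-<-trans (triangle (seq (X i) i) (seq (X m) i) (seq (X n) i))
          (ℚ.+-mono-< (near i i (⊔-left (⊔-left {m ℕ.⊔ N} le)) (⊔-right {m} (⊔-left {m ℕ.⊔ N} le)))
            (≡.subst (_<ℚ ½ ℚ.* ε) (∣-∣-swap (seq (X n) i) (seq (X m) i))
              (near n i m≤n (⊔-right {m} (⊔-left {m ℕ.⊔ N} le))))))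
        ε≤ : ∀ i → L ℕ.≤ i → ε ≤ℚ seq x i ℚ.- 0ℚ
        ε≤ i le = f i (⊔-right {m ℕ.⊔ N} le)
    in eventually-≤ {mkℝ (λ k → seq (X k) k) c} {X n +ℝ x} L
         (λ i le → shift-by (ℚ.+-mono-≤ (ℚ.<⇒≤ (∣∣<⇒ {seq (X i) i} {seq (X n) i} (close i le))) (ε≤ i le))
           (solve 4 (λ u v y e → (e :+ (y :- con 0ℚ)) :- ((u :- v) :+ e) := (v :+ y) :- u) ≡.refl (seq (X i) i)
             (seq (X n) i) (seq x i) ε)) ,
       eventually-≤ {X n} {mkℝ (λ k → seq (X k) k) c +ℝ x} L
         (λ i le → shift-by (ℚ.+-mono-≤ (ℚ.<⇒≤ (∣∣<⇒′ {seq (X i) i} {seq (X n) i} (close i le))) (ε≤ i le))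
           (solve 4 (λ u v y e → (e :+ (y :- con 0ℚ)) :- ((v :- u) :+ e) := (u :+ y) :- v) ≡.refl (seq (X i) i)
             (seq (X n) i) (seq x i) ε))
  where open +-*-Solver

exp-re-close : ∀ z ε → 0ℝ < ε → ∃ λ m → ∀ n → m ℕ.≤ n → re (exp z) ≤ re (expSum n z) +ℝ ε × re (expSum n z) ≤ re
  (exp z) +ℝ ε
exp-re-close z = diagonal-close (λ k → re (expSum k z)) (exp-re-cauchy z) λ ε 0<ε →
  let m , N , h = uniform-tail z ε 0<ε in m , N , λ n i hn hi → ℚ.≤-<-trans (∣re∣≤‖‖ _ _) (h n i hn hi)

exp-im-close : ∀ z ε → 0ℝ < ε → ∃ λ m → ∀ n → m ℕ.≤ n → im (exp z) ≤ im (expSum n z) +ℝ ε × im (expSum n z) ≤ im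
  (exp z) +ℝ ε
exp-im-close z = diagonal-close (λ k → im (expSum k z)) (exp-im-cauchy z) λ ε 0<ε →
  let m , N , h = uniform-tail z ε 0<ε in m , N , λ n i hn hi →
    ℚ.≤-<-trans (∣im∣≤‖‖ (seq (re (expSum n z)) i ℚ.- seq (re (expSum m z)) i) _) (h n i hn hi)

module _ (lem : ExcludedMiddle 0ℓ) where

  toℂ : Analysis.C (ℝ-reals lem) → ℂ
  toℂ z = Analysis.C.re z +i Analysis.C.im z

  ℝ-exponential : Analysis.Exponential (ℝ-reals lem)
  ℝ-exponential = Analysis.Series.exponential (ℝ-reals lem) (λ z → Analysis.mkC (re (exp (toℂ z)))
    (im (exp (toℂ z))))
    (λ z k → re (expTerm k (toℂ z))) (λ z k → im (expTerm k (toℂ z)))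
    (λ z k → re (expSum k (toℂ z))) (λ z k → im (expSum k (toℂ z)))
    (λ z → ≈-refl {1ℝ}) (λ z → ≈-refl {0ℝ})
    (λ z k → ≈-refl {re (expTerm (suc k) (toℂ z))}) (λ z k → ≈-refl {im (expTerm (suc k) (toℂ z))})
    (λ z → ≈-refl {0ℝ}) (λ z → ≈-refl {0ℝ})
    (λ z k → ≈-refl {re (expSum (suc k) (toℂ z))}) (λ z k → ≈-refl {im (expSum (suc k) (toℂ z))})
    (λ z → exp-re-close (toℂ z)) (λ z → exp-im-close (toℂ z))

theorem1 : ExcludedMiddle 0ℓ →
    (n : ℕ) → 1 ℕ.≤ n →
    (p : Posynomial n) (d : ℝ) (d>0 : 0ℝ < d) →
    Homogeneous p d →
    Γ₁-Stable p →
    ConcaveOnPositive (PowerOf p (recip d d>0)) × ConcaveOnPositive (LogOf p)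
theorem1 lem n _ p d d>0 homogeneous stable =
  Theory.Model.Evaluation.Conclusion.Power.concave (ℝ-reals lem) (ℝ-exponential lem) ℂ _+i_ 0ℂ 1ℂ re im _+ℂ_ _*ℂ_
    _•_ exp
    (≈-refl {0ℝ}) (≈-refl {0ℝ}) (≈-refl {1ℝ}) (≈-refl {0ℝ})
    (λ x y → ≈-refl {x}) (λ x y → ≈-refl {y})
    (λ z w → ≈-refl {re (z +ℂ w)}) (λ z w → ≈-refl {im (z +ℂ w)})
    (λ z w → ≈-refl {re (z *ℂ w)}) (λ z w → ≈-refl {im (z *ℂ w)})
    (λ r z → ≈-refl {re (r • z)}) (λ r z → ≈-refl {im (r • z)})
    (λ z → ≈-refl {re (exp z)}) (λ z → ≈-refl {im (exp z)})
    (exponent p) (coeff p) d (exponent≥0 p) (coeff>0 p) d>0 homogeneous stable (recip d d>0) (recip-cancel d d>0)
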